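{- Let $N$ be a positive integer and let $\mathcal{B}_N$ be the set of non-square quadratic polynomials $f(x)=ax^2+bx+c\in\mathbb{Z}[x]$ such that, for some $r\in\mathbb{Z}$, $f$ takes square values (squares of integers) at the $N$ consecutive integers $x=r,r+1,\dots,r+N-1$ and $f(r)=f(r+N-1)$. Then $$\#\mathcal{B}_N=\begin{cases}\infty & \text{if } N\le 6 \text{ or } N=8,\\ 0 & \text{if } N=7 \text{ or } N\ge 9.\end{cases}$$
   Context: "Non-square" means that $f$ is not the square of a polynomial in $\mathbb{Z}[x]$. Polynomials differing by multiplication by a nonzero square are regarded as equivalent. -}

module Defs where

open import Data.Nat using (ℕ)
open import Data.Integer using (ℤ; _+_; _*_; +_; 0ℤ)
open import Data.List using (List; []; _∷_)
open import Data.Product using (Σ; ∃; _×_; _,_)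
open import Relation.Nullary using (¬_)
open import Relation.Binary.PropositionalEquality using (_≡_; _≢_)

record Quad : Set where
  constructor quad
  field
    a b c : ℤ

open Quad public

evalQ : Quad → ℤ → ℤ
evalQ (quad a b c) x = a * x * x + b * x + c

Poly : Set
Poly = List ℤ

evalP : Poly → ℤ → ℤ
evalP []       x = 0ℤ
evalP (k ∷ ks) x = k + x * evalP ks x

-- f is the square of a polynomial g ∈ ℤ[x].  Since ℤ is infinite, equality of
-- polynomials in ℤ[x] is the same as equality of the polynomial functions on ℤ.
IsSquarePoly : Quad → Set
IsSquarePoly f = ∃ λ (g : Poly) → ∀ (x : ℤ) → evalQ f x ≡ evalP g x * evalP g x

IsSquare : ℤ → Set
IsSquare n = ∃ λ (y : ℤ) → n ≡ y * y

InB : ℕ → Quad → Set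
InB N f =
  (a f ≢ 0ℤ) × (¬ IsSquarePoly f) ×
  ∃ λ (r : ℤ) →
    (∀ (i : ℕ) → i Data.Nat.< N → IsSquare (evalQ f (r + + i))) ×
    (evalQ f r ≡ evalQ f (r + + (N Data.Nat.∸ 1)))

-- Polynomials differing by multiplication by a nonzero square are equivalent:
-- f ~ g iff u^2 f = v^2 g for some nonzero integers u, v.
_∼_ : Quad → Quad → Set
f ∼ g = ∃ λ (u : ℤ) → ∃ λ (v : ℤ) → (u ≢ 0ℤ) × (v ≢ 0ℤ) ×
  ((u * u * a f ≡ v * v * a g) × (u * u * b f ≡ v * v * b g) × (u * u * c f ≡ v * v * c g))

-- #B_N = ∞ (counting up to equivalence): an infinite sequence of members of
-- B_N that are pairwise inequivalent.
BInfinite : ℕ → Set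
BInfinite N = Σ (ℕ → Quad) λ F → (∀ i → InB N (F i)) × (∀ i j → i ≢ j → ¬ (F i ∼ F j))

BEmpty : ℕ → Set
BEmpty N = ∀ (f : Quad) → ¬ InB N f

{-# OPTIONS --safe #-}
module Submission where

-- Equal values at the two ends make f symmetric about the midpoint of the interval. For odd N the
-- values, read outwards from the centre, are c, c + a, c + 4a, c + 9a, ...; for even N, four times
-- the values are c + a, c + 9a, c + 25a, .... Here a ≠ 0, and c = 0 together with a square c + a
-- makes f the square of a polynomial. So everything depends on how many terms of these sequences
-- can be squares with ac ≠ 0.
--
-- Existence. Three squares c, c + a, c + 4a come from a polynomial family (`symmetric-5`), which
-- serves N = 1, 3, 5. Four squares c + a, c + 9a, c + 25a, c + 49a define a curve of genus one, on
-- which an explicit point is doubled again and again. Each doubling multiplies β, an eighth of the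
-- leading coefficient, by an even number, while c stays odd; hence the polynomials are pairwise
-- inequivalent. They serve N = 2, 4, 6, 8. None of these polynomials is a square, since a square
-- would continue the sequence by one more square value, which the two results below forbid.
--
-- Four squares (`four-squares`). Eliminating c and a from c = x₀², ..., c + 9a = x₃² leaves 4x₁² =
-- 3x₀² + x₂² and 9x₁² = 8x₀² + x₃². Factoring both differences of squares gives two representations
-- by binary forms, with UV = PQ. The four-number decomposition of this equality returns the same
-- system with a smaller first entry: a Fermat descent over ℤ.
--
-- Five squares (`five-squares`). The squares c + a, ..., c + 81a define a curve of genus five, and
-- the argument passes to ℤ[i]. From (3r₇ - 2r₃)(3r₇ + 2r₃) = 5r₉² one parametrizes r₃, r₇, r₉ by
-- coprime u, v; the other two conditions become 2Y² = 5u⁴ - 58u²v² + 125v⁴ and 2Z² = Y² + (u² +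
-- 5v²)². Let X be (u² + 5v²)/2 or a third of it. After rescaling, the first equation is 2Y² = 5X² -
-- 18kXv² + 15k²v⁴ with k = 3 or k = 1, and the second says, for one sign of Y, that X - ιY = (1 -
-- ι)w² with w in ℤ[i]. Now the first equation is quadratic in X and solved by 7X = 2(1 - ι)w² +
-- 9kv² - 2R, where R² = 5ιw⁴ + 9k(1 - ι)w²v² - 6k²v⁴.
--
-- This genus-one curve has a known point. The difference between any other relevant point and the
-- known one is a point of the elliptic curve `Quartic` which is close to the origin at π = 1 + ι. A
-- descent through a 2-isogeny and its dual (`descent₁`, `descent₂`) shows that the denominator of
-- such a point has even valuation at π. On the other hand X is rational, so the integer ζ that
-- measures its distance from the value at the known point has even valuation as well. The equation
-- of the curve forces the two valuations to differ by one, a contradiction; only the known point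
-- survives (`core`), and it gives a = 0 or c = 0.

-- Euclidean domains: coprimality, gcd, splitting of powers into coprime factors.

module Euclid where

  open import Algebra.Structures using (IsCommutativeRing)
  open import Algebra.Bundles using (CommutativeRing)
  import Algebra.Properties.AbelianGroup as AbelianGroupProperties
  import Algebra.Properties.Ring as RingProperties
  import Algebra.Properties.CommutativeSemigroup as CommutativeSemigroupProperties
  open import Data.Nat as ℕ using (ℕ; zero; suc; s≤s; z≤n)
  import Data.Nat.Properties as ℕ
  open import Data.Nat.Induction using (<-wellFounded)
  open import Induction.WellFounded using (Acc; acc)
  open import Data.Product using (∃; _×_; _,_; proj₁; proj₂)
  open import Data.Sum using (inj₁; inj₂)
  open import Data.Empty using (⊥-elim)
  open import Relation.Nullary using (Dec; yes; no)
  open import Relation.Binary.PropositionalEquality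

  -- Both ℤ and ℤ[i] are instances. Multiplicativity of the norm gives the absence of zero divisors
  -- and lets descents run on the norm of a factor.
  record EuclideanDomain : Set₁ where
    infixl 6 _+_
    infixl 7 _*_
    infix 8 -_
    infix 4 _≟_
    field
      Carrier : Set
      _+_ _*_ : Carrier → Carrier → Carrier
      -_ : Carrier → Carrier
      0# 1# : Carrier
      isCommutativeRing : IsCommutativeRing _≡_ _+_ _*_ -_ 0# 1#
      _≟_ : (x y : Carrier) → Dec (x ≡ y)
      norm : Carrier → ℕ
      norm-* : ∀ x y → norm (x * y) ≡ norm x ℕ.* norm y
      norm-0# : norm 0# ≡ 0
      norm-1# : norm 1# ≡ 1
      norm≡0 : ∀ x → norm x ≡ 0 → x ≡ 0#
      divide : ∀ x y → y ≢ 0# → ∃ λ q → ∃ λ r → (x ≡ r + q * y) × (norm r ℕ.< norm y)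

  module Properties (E : EuclideanDomain) where
    open EuclideanDomain E

    private
      R : CommutativeRing _ _
      R = record { isCommutativeRing = isCommutativeRing }
      module R = CommutativeRing R
      module P = RingProperties R.ring
      module * = CommutativeSemigroupProperties R.*-commutativeSemigroup
      module + = CommutativeSemigroupProperties R.+-commutativeSemigroup
      open ≡-Reasoning

    *-≢0 : ∀ {x y} → x ≢ 0# → y ≢ 0# → x * y ≢ 0#
    *-≢0 {x} {y} x≢0 y≢0 xy≡0
      with ℕ.m*n≡0⇒m≡0∨n≡0 (norm x) (trans (sym (norm-* x y)) (trans (cong norm xy≡0) norm-0#))
    ... | inj₁ nx≡0 = x≢0 (norm≡0 x nx≡0)
    ... | inj₂ ny≡0 = y≢0 (norm≡0 y ny≡0)

    *-cancelˡ : ∀ {x y z} → x ≢ 0# → x * y ≡ x * z → y ≡ z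
    *-cancelˡ {x} {y} {z} x≢0 eq with y + - z ≟ 0#
    ... | yes y-z≡0 = trans (P.+-inverseˡ-unique y (- z) y-z≡0) (AbelianGroupProperties.⁻¹-involutive R.+-abelianGroup z)
    ... | no y-z≢0 = ⊥-elim (*-≢0 x≢0 y-z≢0 (begin
      x * (y + - z)      ≡⟨ R.distribˡ x y (- z) ⟩
      x * y + x * - z    ≡⟨ cong (x * y +_) (sym (P.-‿distribʳ-* x z)) ⟩
      x * y + - (x * z)  ≡⟨ cong (λ t → t + - (x * z)) eq ⟩
      x * z + - (x * z)  ≡⟨ R.-‿inverseʳ (x * z) ⟩
      0#                 ∎))

    *≢0ˡ : ∀ {x y} → x * y ≢ 0# → x ≢ 0#
    *≢0ˡ {y = y} xy≢0 refl = xy≢0 (R.zeroˡ y)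

    *≢0ʳ : ∀ {x y} → x * y ≢ 0# → y ≢ 0#
    *≢0ʳ {x} xy≢0 refl = xy≢0 (R.zeroʳ x)

    infix 4 _∣_
    _∣_ : Carrier → Carrier → Set
    x ∣ y = ∃ λ z → y ≡ x * z

    -- Coprimality is a Bézout certificate, so that its closure properties are ring identities.
    Coprime : Carrier → Carrier → Set
    Coprime x y = ∃ λ s → ∃ λ t → s * x + t * y ≡ 1#

    coprime-sym : ∀ {x y} → Coprime x y → Coprime y x
    coprime-sym (s , t , eq) = t , s , trans (R.+-comm _ _) eq

    coprime-1 : ∀ {x} → Coprime 1# x
    coprime-1 {x} = 1# , 0# , trans (cong₂ _+_ (R.*-identityˡ 1#) (R.zeroˡ x)) (R.+-identityʳ 1#)

    coprime-* : ∀ {x y z} → Coprime x z → Coprime y z → Coprime (x * y) z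
    coprime-* {x} {y} {z} (s , t , eq) (s′ , t′ , eq′) = s * s′ , (s * x * t′ + t) , (begin
      s * s′ * (x * y) + (s * x * t′ + t) * z
        ≡⟨ cong₂ _+_ (*.interchange s s′ x y) (R.distribʳ z (s * x * t′) t) ⟩
      s * x * (s′ * y) + (s * x * t′ * z + t * z)
        ≡⟨ sym (R.+-assoc _ _ _) ⟩
      s * x * (s′ * y) + s * x * t′ * z + t * z
        ≡⟨ cong (λ u → s * x * (s′ * y) + u + t * z) (R.*-assoc (s * x) t′ z) ⟩
      s * x * (s′ * y) + s * x * (t′ * z) + t * z
        ≡⟨ cong (_+ t * z) (sym (R.distribˡ (s * x) _ _)) ⟩
      s * x * (s′ * y + t′ * z) + t * z
        ≡⟨ cong (λ u → s * x * u + t * z) eq′ ⟩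
      s * x * 1# + t * z
        ≡⟨ cong (_+ t * z) (R.*-identityʳ (s * x)) ⟩
      s * x + t * z
        ≡⟨ eq ⟩
      1# ∎)

    coprime-∣ : ∀ {x y d} → Coprime x y → d ∣ x → Coprime d y
    coprime-∣ {x} {y} {d} (s , t , eq) (z , refl) =
      s * z , t , trans (cong (_+ t * y) (*.xy∙z≈x∙zy s z d)) eq

    coprime-∣-∣ : ∀ {x y d e} → Coprime x y → d ∣ x → e ∣ y → Coprime d e
    coprime-∣-∣ c d∣x e∣y = coprime-sym (coprime-∣ (coprime-sym (coprime-∣ c d∣x)) e∣y)

    coprime⇒∣ : ∀ {x y z} → Coprime x y → x ∣ y * z → x ∣ z
    coprime⇒∣ {x} {y} {z} (s , t , eq) (w , yz≡xw) = s * z + t * w , (begin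
      z                          ≡⟨ sym (R.*-identityˡ z) ⟩
      1# * z                     ≡⟨ cong (_* z) (sym eq) ⟩
      (s * x + t * y) * z        ≡⟨ R.distribʳ z _ _ ⟩
      s * x * z + t * y * z      ≡⟨ cong₂ _+_ (*.xy∙z≈y∙xz s x z) (R.*-assoc t y z) ⟩
      x * (s * z) + t * (y * z)  ≡⟨ cong (λ u → x * (s * z) + t * u) yz≡xw ⟩
      x * (s * z) + t * (x * w)  ≡⟨ cong (x * (s * z) +_) (*.x∙yz≈y∙xz t x w) ⟩
      x * (s * z) + x * (t * w)  ≡⟨ sym (R.distribˡ x _ _) ⟩
      x * (s * z + t * w)        ∎)

    IsUnit : Carrier → Set
    IsUnit x = ∃ λ y → x * y ≡ 1#

    norm1⇒unit : ∀ {x} → norm x ≡ 1 → IsUnit x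
    norm1⇒unit {x} nx≡1 = helper (divide 1# x x≢0)
      where
      x≢0 : x ≢ 0#
      x≢0 refl with trans (sym nx≡1) norm-0#
      ... | ()
      helper : (∃ λ q → ∃ λ r → (1# ≡ r + q * x) × (norm r ℕ.< norm x)) → IsUnit x
      helper (q , r , eq , r<x) = q , (begin
        x * q       ≡⟨ R.*-comm x q ⟩
        q * x       ≡⟨ sym (R.+-identityˡ _) ⟩
        0# + q * x  ≡⟨ cong (_+ q * x) (sym r≡0) ⟩
        r + q * x   ≡⟨ sym eq ⟩
        1#          ∎)
        where
        r≡0 : r ≡ 0#
        r≡0 = norm≡0 r (ℕ.n<1⇒n≡0 (subst (norm r ℕ.<_) nx≡1 r<x))

    unit⇒coprime : ∀ {x y} → IsUnit x → Coprime x y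
    unit⇒coprime {x} {y} (u , xu≡1) = u , 0# , (begin
      u * x + 0# * y  ≡⟨ cong₂ _+_ (R.*-comm u x) (R.zeroˡ y) ⟩
      x * u + 0#      ≡⟨ R.+-identityʳ _ ⟩
      x * u           ≡⟨ xu≡1 ⟩
      1#              ∎)

    record Bezout (x y : Carrier) : Set where
      constructor bezout
      field
        g x′ y′ s t : Carrier
        x≡ : x ≡ g * x′
        y≡ : y ≡ g * y′
        g≡ : g ≡ s * x + t * y

    bezout-rec : ∀ x y → Acc ℕ._<_ (norm y) → Bezout x y
    bezout-rec x y (acc rec) with y ≟ 0#
    ... | yes refl = bezout x 1# 0# 1# 0# (sym (R.*-identityʳ x)) (sym (R.zeroʳ x))
      (sym (trans (cong₂ _+_ (R.*-identityˡ x) (R.zeroˡ 0#)) (R.+-identityʳ x)))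
    ... | no y≢0 = step (divide x y y≢0)
      where
      step : (∃ λ q → ∃ λ r → (x ≡ r + q * y) × (norm r ℕ.< norm y)) → Bezout x y
      step (q , r , x≡ , r<y) = extend (bezout-rec y r (rec r<y))
        where
        extend : Bezout y r → Bezout x y
        extend (bezout g y′ r′ s t y≡gy′ r≡ g≡) =
          bezout g (r′ + q * y′) y′ t (s + - (t * q)) x≡gx′ y≡gy′ g≡′
          where
          x≡gx′ : x ≡ g * (r′ + q * y′)
          x≡gx′ = begin
            x                     ≡⟨ x≡ ⟩
            r + q * y             ≡⟨ cong₂ (λ a b → a + q * b) r≡ y≡gy′ ⟩
            g * r′ + q * (g * y′) ≡⟨ cong (g * r′ +_) (*.x∙yz≈y∙xz q g y′) ⟩
            g * r′ + g * (q * y′) ≡⟨ sym (R.distribˡ g _ _) ⟩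
            g * (r′ + q * y′)     ∎
          g≡′ : g ≡ t * x + (s + - (t * q)) * y
          g≡′ = sym (begin
            t * x + (s + - (t * q)) * y
              ≡⟨ cong₂ (λ a b → t * a + b) x≡ (R.distribʳ y s _) ⟩
            t * (r + q * y) + (s * y + - (t * q) * y)
              ≡⟨ cong₂ (λ a b → a + (s * y + b)) (R.distribˡ t r _) (sym (P.-‿distribˡ-* (t * q) y)) ⟩
            t * r + t * (q * y) + (s * y + - (t * q * y))
              ≡⟨ cong (λ a → t * r + a + (s * y + - (t * q * y))) (sym (R.*-assoc t q y)) ⟩
            t * r + t * q * y + (s * y + - (t * q * y))
              ≡⟨ +.interchange (t * r) (t * q * y) (s * y) _ ⟩
            t * r + s * y + (t * q * y + - (t * q * y))
              ≡⟨ cong (t * r + s * y +_) (R.-‿inverseʳ _) ⟩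
            t * r + s * y + 0#
              ≡⟨ R.+-identityʳ _ ⟩
            t * r + s * y
              ≡⟨ R.+-comm _ _ ⟩
            s * y + t * r
              ≡⟨ sym g≡ ⟩
            g ∎)

    record GCD (x y : Carrier) : Set where
      constructor gcd
      field
        g x′ y′ : Carrier
        x≡ : x ≡ g * x′
        y≡ : y ≡ g * y′
        g≢0 : g ≢ 0#
        coprime : Coprime x′ y′

    gcd-of : ∀ x y → x ≢ 0# → GCD x y
    gcd-of x y x≢0 = reduce (bezout-rec x y (<-wellFounded _))
      where
      reduce : Bezout x y → GCD x y
      reduce (bezout g x′ y′ s t x≡ y≡ g≡) = gcd g x′ y′ x≡ y≡ g≢0 (s , t , *-cancelˡ g≢0 (begin
        g * (s * x′ + t * y′)        ≡⟨ R.distribˡ g _ _ ⟩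
        g * (s * x′) + g * (t * y′)  ≡⟨ cong₂ _+_ (*.x∙yz≈y∙xz g s x′) (*.x∙yz≈y∙xz g t y′) ⟩
        s * (g * x′) + t * (g * y′)  ≡⟨ cong₂ (λ a b → s * a + t * b) (sym x≡) (sym y≡) ⟩
        s * x + t * y                ≡⟨ sym g≡ ⟩
        g                            ≡⟨ sym (R.*-identityʳ g) ⟩
        g * 1#                       ∎))
        where
        g≢0 : g ≢ 0#
        g≢0 = *≢0ˡ (λ eq → x≢0 (trans x≡ eq))

    -- Take a = gcd(u, p), with u = ac and p = ab. Cancelling a leaves cv = bq, and since b and c
    -- are coprime, c divides q.
    four-numbers : ∀ {u v p q} → u ≢ 0# → u * v ≡ p * q →
      ∃ λ a → ∃ λ b → ∃ λ c → ∃ λ d →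
        (u ≡ a * c) × (v ≡ b * d) × (p ≡ a * b) × (q ≡ c * d) × Coprime b c
    four-numbers {u} {v} {p} {q} u≢0 uv≡pq = split (gcd-of u p u≢0)
      where
      split : GCD u p → _
      split (gcd a c b u≡ p≡ a≢0 cop) with coprime⇒∣ cop c∣bq
        where
        cv≡bq : c * v ≡ b * q
        cv≡bq = *-cancelˡ a≢0 (begin
          a * (c * v)  ≡⟨ sym (R.*-assoc a c v) ⟩
          a * c * v    ≡⟨ cong (_* v) (sym u≡) ⟩
          u * v        ≡⟨ uv≡pq ⟩
          p * q        ≡⟨ cong (_* q) p≡ ⟩
          a * b * q    ≡⟨ R.*-assoc a b q ⟩
          a * (b * q)  ∎)
        c∣bq : c ∣ b * q
        c∣bq = v , sym cv≡bq
      ... | d , q≡cd = a , b , c , d , u≡ , v≡bd , p≡ , q≡cd , coprime-sym cop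
        where
        c≢0 : c ≢ 0#
        c≢0 = *≢0ʳ (λ eq → u≢0 (trans u≡ eq))
        v≡bd : v ≡ b * d
        v≡bd = *-cancelˡ (*-≢0 a≢0 c≢0) (begin
          a * c * v        ≡⟨ cong (_* v) (sym u≡) ⟩
          u * v            ≡⟨ uv≡pq ⟩
          p * q            ≡⟨ cong₂ _*_ p≡ q≡cd ⟩
          a * b * (c * d)  ≡⟨ *.interchange a b c d ⟩
          a * c * (b * d)  ∎)

    -- What the splitting of a product of coprime factors uses about x² and x⁴, abstracted so that
    -- one proof serves both. The cofactors satisfy d₁d₂ = D exactly, with units absorbed into them.
    module PowerLike
      (pow : Carrier → Carrier)
      (pow-* : ∀ x y → pow (x * y) ≡ pow x * pow y)
      (pow-1 : pow 1# ≡ 1#)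
      (pow-≢0 : ∀ {x} → x ≢ 0# → pow x ≢ 0#)
      (coprime-pow : ∀ {x y} → Coprime x y → Coprime (pow x) y)
      where

      Split : Carrier → Carrier → Carrier → Carrier → Set
      Split f₁ f₂ D e = ∃ λ d₁ → ∃ λ d₂ → ∃ λ p → ∃ λ q →
        (f₁ ≡ d₁ * pow p) × (f₂ ≡ d₂ * pow q) × (d₁ * d₂ ≡ D) × (e ≡ p * q)

      -- Descent on e: a common factor g of f₁ and e is prime to f₂, so pow g divides f₁.
      split-rec : ∀ f₁ f₂ D e → e ≢ 0# → f₁ * f₂ ≡ D * pow e → Coprime f₁ f₂ →
        Acc ℕ._<_ (norm e) → Split f₁ f₂ D e
      split-rec f₁ f₂ D e e≢0 prod cop (acc rec) = go (gcd-of e f₁ e≢0)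
        where
        go : GCD e f₁ → Split f₁ f₂ D e
        go (gcd g e′ f₁′ e≡ f₁≡ g≢0 (s , t , se′+tf₁′≡1)) = cases (norm g ℕ.≟ 1) (coprime⇒∣ cop-pow pow∣)
          where
          cop-pow : Coprime (pow g) f₂
          cop-pow = coprime-pow (coprime-∣ cop (f₁′ , f₁≡))
          pow≡ : f₁ * f₂ ≡ pow g * (D * pow e′)
          pow≡ = begin
            f₁ * f₂               ≡⟨ prod ⟩
            D * pow e             ≡⟨ cong (λ x → D * pow x) e≡ ⟩
            D * pow (g * e′)      ≡⟨ cong (D *_) (pow-* g e′) ⟩
            D * (pow g * pow e′)  ≡⟨ *.x∙yz≈y∙xz D _ _ ⟩
            pow g * (D * pow e′)  ∎
          pow∣ : pow g ∣ f₂ * f₁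
          pow∣ = D * pow e′ , trans (R.*-comm f₂ f₁) pow≡
          e′≢0 : e′ ≢ 0#
          e′≢0 = *≢0ʳ (λ eq → e≢0 (trans e≡ eq))
          smaller : norm g ≢ 1 → norm e′ ℕ.< norm e
          smaller ng≢1 = subst (norm e′ ℕ.<_) (sym (trans (trans (cong norm e≡) (norm-* g e′)) (ℕ.*-comm (norm g) (norm e′))))
            (ℕ.m<m*n (norm e′) (norm g) {{ℕ.≢-nonZero λ z → e′≢0 (norm≡0 e′ z)}}
              (ℕ.≤∧≢⇒< (ℕ.n≢0⇒n>0 λ z → g≢0 (norm≡0 g z)) (λ eq → ng≢1 (sym eq))))
          cases : Dec (norm g ≡ 1) → pow g ∣ f₁ → Split f₁ f₂ D e
          cases (no ng≢1) (h , f₁≡gh) = extend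
            (split-rec h f₂ D e′ e′≢0 hf₂≡ (coprime-∣ cop (pow g , trans f₁≡gh (R.*-comm _ _))) (rec (smaller ng≢1)))
            where
            hf₂≡ : h * f₂ ≡ D * pow e′
            hf₂≡ = *-cancelˡ (pow-≢0 g≢0) (trans (sym (R.*-assoc _ _ _)) (trans (cong (_* f₂) (sym f₁≡gh)) pow≡))
            extend : Split h f₂ D e′ → Split f₁ f₂ D e
            extend (d₁ , d₂ , p , q , h≡ , f₂≡ , d≡ , e′≡) =
              d₁ , d₂ , g * p , q ,
              trans f₁≡gh (trans (cong (pow g *_) h≡) (trans (*.x∙yz≈y∙xz _ _ _) (cong (d₁ *_) (sym (pow-* g p))))) ,
              f₂≡ , d≡ , trans e≡ (trans (cong (g *_) e′≡) (sym (R.*-assoc g p q)))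
          -- Now e is prime to f₁, hence so is `pow e`, which therefore divides f₂ as a whole.
          cases (yes ng≡1) _ = unit (norm1⇒unit ng≡1)
            where
            unit : IsUnit g → Split f₁ f₂ D e
            unit (u , gu≡1) = finish (coprime⇒∣ (coprime-pow cop-e-f₁) (D , trans prod (R.*-comm _ _)))
              where
              cop-e-f₁ : Coprime e f₁
              cop-e-f₁ = u * s , u * t , (begin
                u * s * e + u * t * f₁                ≡⟨ cong₂ _+_ (R.*-assoc _ _ _) (R.*-assoc _ _ _) ⟩
                u * (s * e) + u * (t * f₁)            ≡⟨ sym (R.distribˡ u _ _) ⟩
                u * (s * e + t * f₁)                  ≡⟨ cong₂ (λ a b → u * (s * a + t * b)) e≡ f₁≡ ⟩
                u * (s * (g * e′) + t * (g * f₁′))    ≡⟨ cong (u *_) (cong₂ _+_ (*.x∙yz≈y∙xz _ _ _) (*.x∙yz≈y∙xz _ _ _)) ⟩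
                u * (g * (s * e′) + g * (t * f₁′))    ≡⟨ cong (u *_) (sym (R.distribˡ g _ _)) ⟩
                u * (g * (s * e′ + t * f₁′))          ≡⟨ cong (λ a → u * (g * a)) se′+tf₁′≡1 ⟩
                u * (g * 1#)                          ≡⟨ cong (u *_) (R.*-identityʳ g) ⟩
                u * g                                 ≡⟨ R.*-comm u g ⟩
                g * u                                 ≡⟨ gu≡1 ⟩
                1#                                    ∎)
              finish : pow e ∣ f₂ → Split f₁ f₂ D e
              finish (d₂ , f₂≡) =
                f₁ , d₂ , 1# , e ,
                trans (sym (R.*-identityʳ f₁)) (cong (f₁ *_) (sym pow-1)) ,
                trans f₂≡ (R.*-comm _ _) ,
                *-cancelˡ (pow-≢0 e≢0) (begin
                  pow e * (f₁ * d₂)  ≡⟨ *.x∙yz≈y∙xz _ _ _ ⟩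
                  f₁ * (pow e * d₂)  ≡⟨ cong (f₁ *_) (sym f₂≡) ⟩
                  f₁ * f₂            ≡⟨ prod ⟩
                  D * pow e          ≡⟨ R.*-comm _ _ ⟩
                  pow e * D          ∎) ,
                sym (R.*-identityˡ e)

      coprime-split : ∀ {f₁ f₂ D e} → e ≢ 0# → f₁ * f₂ ≡ D * pow e → Coprime f₁ f₂ → Split f₁ f₂ D e
      coprime-split e≢0 prod cop = split-rec _ _ _ _ e≢0 prod cop (<-wellFounded _)

    sq : Carrier → Carrier
    sq x = x * x

    coprime-sq : ∀ {x y} → Coprime x y → Coprime (sq x) y
    coprime-sq c = coprime-* c c

    module Square = PowerLike sq (λ x y → *.interchange x y x y) (R.*-identityˡ 1#) (λ n → *-≢0 n n) coprime-sq

    module Fourth = PowerLike (λ x → sq (sq x))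
      (λ x y → trans (cong sq (*.interchange x y x y)) (*.interchange (sq x) (sq y) (sq x) (sq y)))
      (trans (cong sq (R.*-identityˡ 1#)) (R.*-identityˡ 1#))
      (λ n → *-≢0 (*-≢0 n n) (*-≢0 n n)) (λ c → coprime-sq (coprime-sq c))

-- The Gaussian integers as a Euclidean domain.

module Gauss where

  open Euclid
  open import Algebra.Structures using (IsCommutativeRing)
  open import Data.Integer as ℤ using (ℤ; +_; -[1+_]; ∣_∣)
  import Data.Integer.Properties as ℤ
  import Data.Integer.DivMod as ℤ
  import Data.Integer.Tactic.RingSolver as ℤSolver
  open import Data.Nat as ℕ using (ℕ; zero; suc)
  import Data.Nat.Properties as ℕ
  import Data.Nat.Tactic.RingSolver as ℕSolver
  open import Data.Maybe using (Maybe; just; nothing)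
  open import Data.Product using (∃; _×_; _,_)
  open import Data.Sum using (inj₁; inj₂)
  open import Level using (0ℓ)
  open import Relation.Nullary using (Dec; yes; no; contradiction)
  open import Relation.Binary.PropositionalEquality
  open import Tactic.RingSolver using (solve; solve-∀) public
  open import Tactic.RingSolver.Core.AlmostCommutativeRing using (AlmostCommutativeRing; fromCommutativeRing)

  ℤᴱ : EuclideanDomain
  ℤᴱ = record
    { Carrier = ℤ ; _+_ = ℤ._+_ ; _*_ = ℤ._*_ ; -_ = ℤ.-_ ; 0# = ℤ.0ℤ ; 1# = ℤ.1ℤ
    ; isCommutativeRing = ℤ.+-*-isCommutativeRing ; _≟_ = ℤ._≟_
    ; norm = ∣_∣ ; norm-* = ℤ.abs-* ; norm-0# = refl ; norm-1# = refl
    ; norm≡0 = λ _ → ℤ.∣i∣≡0⇒i≡0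
    ; divide = λ x y y≢0 →
        let instance _ = ℤ.≢-nonZero y≢0 in
        x ℤ./ y , + (x ℤ.% y) , ℤ.a≡a%n+[a/n]*n x y , ℤ.n%d<d x y
    }

  infix 9 _+i_
  data 𝔾 : Set where
    _+i_ : ℤ → ℤ → 𝔾

  infixl 6 _+_ _-_
  infixl 7 _*_
  infix 8 -_

  _+_ : 𝔾 → 𝔾 → 𝔾
  (a +i b) + (c +i d) = (a ℤ.+ c) +i (b ℤ.+ d)

  _*_ : 𝔾 → 𝔾 → 𝔾
  (a +i b) * (c +i d) = (a ℤ.* c ℤ.- b ℤ.* d) +i (a ℤ.* d ℤ.+ b ℤ.* c)

  -_ : 𝔾 → 𝔾
  -_ (a +i b) = (ℤ.- a) +i (ℤ.- b)

  _-_ : 𝔾 → 𝔾 → 𝔾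
  _-_ x y = x + - y

  0# 1# ι : 𝔾
  0# = ℤ.0ℤ +i ℤ.0ℤ
  1# = ℤ.1ℤ +i ℤ.0ℤ
  ι = ℤ.0ℤ +i ℤ.1ℤ

  -- Numerals: # n is meant for literals, which the ring solver evaluates; ⟦ n ⟧ embeds variables.
  #_ : ℕ → 𝔾
  # n = (+ n) +i ℤ.0ℤ

  isCommutativeRing : IsCommutativeRing _≡_ _+_ _*_ (λ x → - x) 0# 1#
  isCommutativeRing = record
    { isRing = record
      { +-isAbelianGroup = record
        { isGroup = record
          { isMonoid = record
            { isSemigroup = record
              { isMagma = record { isEquivalence = isEquivalence ; ∙-cong = cong₂ _+_ }
              ; assoc = λ { (a +i b) (c +i d) (e +i f) → cong₂ _+i_ (ℤ.+-assoc a c e) (ℤ.+-assoc b d f) } }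
            ; identity = (λ { (a +i b) → cong₂ _+i_ (ℤ.+-identityˡ a) (ℤ.+-identityˡ b) })
                       , (λ { (a +i b) → cong₂ _+i_ (ℤ.+-identityʳ a) (ℤ.+-identityʳ b) }) }
          ; inverse = (λ { (a +i b) → cong₂ _+i_ (ℤ.+-inverseˡ a) (ℤ.+-inverseˡ b) })
                    , (λ { (a +i b) → cong₂ _+i_ (ℤ.+-inverseʳ a) (ℤ.+-inverseʳ b) })
          ; ⁻¹-cong = λ { refl → refl } }
        ; comm = λ { (a +i b) (c +i d) → cong₂ _+i_ (ℤ.+-comm a c) (ℤ.+-comm b d) } }
      ; *-cong = cong₂ _*_
      ; *-assoc = λ { (a +i b) (c +i d) (e +i f) → cong₂ _+i_ (assoc-re a b c d e f) (assoc-im a b c d e f) }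
      ; *-identity = (λ { (a +i b) → cong₂ _+i_ (idˡ-re a b) (idˡ-im a b) })
                   , (λ { (a +i b) → cong₂ _+i_ (idʳ-re a b) (idʳ-im a b) })
      ; distrib = (λ { (a +i b) (c +i d) (e +i f) → cong₂ _+i_ (distˡ-re a b c d e f) (distˡ-im a b c d e f) })
                , (λ { (a +i b) (c +i d) (e +i f) → cong₂ _+i_ (distʳ-re a b c d e f) (distʳ-im a b c d e f) }) }
    ; *-comm = λ { (a +i b) (c +i d) → cong₂ _+i_ (comm-re a b c d) (comm-im a b c d) } }
    where
    open import Data.Integer using () renaming (_+_ to _⊞_; _*_ to _⊠_; _-_ to _⊟_)
    assoc-re : ∀ a b c d e f → (a ⊠ c ⊟ b ⊠ d) ⊠ e ⊟ (a ⊠ d ⊞ b ⊠ c) ⊠ f ≡ a ⊠ (c ⊠ e ⊟ d ⊠ f) ⊟ b ⊠ (c ⊠ f ⊞ d ⊠ e)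
    assoc-re = ℤSolver.solve-∀
    assoc-im : ∀ a b c d e f → (a ⊠ c ⊟ b ⊠ d) ⊠ f ⊞ (a ⊠ d ⊞ b ⊠ c) ⊠ e ≡ a ⊠ (c ⊠ f ⊞ d ⊠ e) ⊞ b ⊠ (c ⊠ e ⊟ d ⊠ f)
    assoc-im = ℤSolver.solve-∀
    idˡ-re : ∀ a b → ℤ.1ℤ ⊠ a ⊟ ℤ.0ℤ ⊠ b ≡ a
    idˡ-re = ℤSolver.solve-∀
    idˡ-im : ∀ a b → ℤ.1ℤ ⊠ b ⊞ ℤ.0ℤ ⊠ a ≡ b
    idˡ-im = ℤSolver.solve-∀
    idʳ-re : ∀ a b → a ⊠ ℤ.1ℤ ⊟ b ⊠ ℤ.0ℤ ≡ a
    idʳ-re = ℤSolver.solve-∀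
    idʳ-im : ∀ a b → a ⊠ ℤ.0ℤ ⊞ b ⊠ ℤ.1ℤ ≡ b
    idʳ-im = ℤSolver.solve-∀
    distˡ-re : ∀ a b c d e f → a ⊠ (c ⊞ e) ⊟ b ⊠ (d ⊞ f) ≡ (a ⊠ c ⊟ b ⊠ d) ⊞ (a ⊠ e ⊟ b ⊠ f)
    distˡ-re = ℤSolver.solve-∀
    distˡ-im : ∀ a b c d e f → a ⊠ (d ⊞ f) ⊞ b ⊠ (c ⊞ e) ≡ (a ⊠ d ⊞ b ⊠ c) ⊞ (a ⊠ f ⊞ b ⊠ e)
    distˡ-im = ℤSolver.solve-∀
    distʳ-re : ∀ a b c d e f → (c ⊞ e) ⊠ a ⊟ (d ⊞ f) ⊠ b ≡ (c ⊠ a ⊟ d ⊠ b) ⊞ (e ⊠ a ⊟ f ⊠ b)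
    distʳ-re = ℤSolver.solve-∀
    distʳ-im : ∀ a b c d e f → (c ⊞ e) ⊠ b ⊞ (d ⊞ f) ⊠ a ≡ (c ⊠ b ⊞ d ⊠ a) ⊞ (e ⊠ b ⊞ f ⊠ a)
    distʳ-im = ℤSolver.solve-∀
    comm-re : ∀ a b c d → a ⊠ c ⊟ b ⊠ d ≡ c ⊠ a ⊟ d ⊠ b
    comm-re = ℤSolver.solve-∀
    comm-im : ∀ a b c d → a ⊠ d ⊞ b ⊠ c ≡ c ⊠ b ⊞ d ⊠ a
    comm-im = ℤSolver.solve-∀

  𝔾-ring : AlmostCommutativeRing 0ℓ 0ℓ
  𝔾-ring = fromCommutativeRing (record { isCommutativeRing = isCommutativeRing })
    λ { ((+ 0) +i (+ 0)) → just refl ; _ → nothing }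

  conj : 𝔾 → 𝔾
  conj (a +i b) = a +i (ℤ.- b)

  norm : 𝔾 → ℕ
  norm (a +i b) = ∣ a ∣ ℕ.* ∣ a ∣ ℕ.+ ∣ b ∣ ℕ.* ∣ b ∣

  ∣∣-sq : ∀ a → + (∣ a ∣ ℕ.* ∣ a ∣) ≡ a ℤ.* a
  ∣∣-sq (+ zero)    = refl
  ∣∣-sq (+ (suc n)) = refl
  ∣∣-sq -[1+ n ]    = refl

  norm-ℤ : ∀ a b → + norm (a +i b) ≡ a ℤ.* a ℤ.+ b ℤ.* b
  norm-ℤ a b = cong₂ ℤ._+_ (∣∣-sq a) (∣∣-sq b)

  norm-* : ∀ x y → norm (x * y) ≡ norm x ℕ.* norm y
  norm-* (a +i b) (c +i d) = ℤ.+-injective (begin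
    + norm ((a +i b) * (c +i d))
      ≡⟨ norm-ℤ (a ℤ.* c ℤ.- b ℤ.* d) (a ℤ.* d ℤ.+ b ℤ.* c) ⟩
    (a ℤ.* c ℤ.- b ℤ.* d) ℤ.* (a ℤ.* c ℤ.- b ℤ.* d) ℤ.+ (a ℤ.* d ℤ.+ b ℤ.* c) ℤ.* (a ℤ.* d ℤ.+ b ℤ.* c)
      ≡⟨ brahmagupta a b c d ⟩
    (a ℤ.* a ℤ.+ b ℤ.* b) ℤ.* (c ℤ.* c ℤ.+ d ℤ.* d)
      ≡⟨ sym (cong₂ ℤ._*_ (norm-ℤ a b) (norm-ℤ c d)) ⟩
    + norm (a +i b) ℤ.* + norm (c +i d)
      ≡⟨ sym (ℤ.pos-* (norm (a +i b)) (norm (c +i d))) ⟩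
    + (norm (a +i b) ℕ.* norm (c +i d)) ∎)
    where
    open ≡-Reasoning
    brahmagupta : ∀ a b c d → (a ℤ.* c ℤ.- b ℤ.* d) ℤ.* (a ℤ.* c ℤ.- b ℤ.* d) ℤ.+ (a ℤ.* d ℤ.+ b ℤ.* c) ℤ.* (a ℤ.* d ℤ.+ b ℤ.* c)
      ≡ (a ℤ.* a ℤ.+ b ℤ.* b) ℤ.* (c ℤ.* c ℤ.+ d ℤ.* d)
    brahmagupta = ℤSolver.solve-∀

  norm≡0 : ∀ x → norm x ≡ 0 → x ≡ 0#
  norm≡0 (a +i b) eq = cong₂ _+i_
    (ℤ.∣i∣≡0⇒i≡0 (sq≡0 ∣ a ∣ (ℕ.m+n≡0⇒m≡0 _ eq)))
    (ℤ.∣i∣≡0⇒i≡0 (sq≡0 ∣ b ∣ (ℕ.m+n≡0⇒n≡0 (∣ a ∣ ℕ.* ∣ a ∣) eq)))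
    where
    sq≡0 : ∀ n → n ℕ.* n ≡ 0 → n ≡ 0
    sq≡0 zero _ = refl

  -- Rounding to the nearest integer is the floor of A/n + 1/2, that is, of (2A + n)/(2n).
  round : ∀ A n → .{{_ : ℕ.NonZero n}} → ∃ λ q → ∃ λ r → (A ≡ r ℤ.+ q ℤ.* + n) × (∣ r ∣ ℕ.+ ∣ r ∣ ℕ.≤ n)
  round A n = q , r , eq , bound
    where
    instance
      2n≢0 : ℕ.NonZero (n ℕ.+ n)
      2n≢0 = ℕ.≢-nonZero λ z → ℕ.≢-nonZero⁻¹ n (ℕ.m+n≡0⇒m≡0 n z)
    B = A ℤ.+ A ℤ.+ + n
    q = B ℤ./ℕ (n ℕ.+ n)
    s = B ℤ.%ℕ (n ℕ.+ n)
    r = A ℤ.- q ℤ.* + n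
    eq : A ≡ r ℤ.+ q ℤ.* + n
    eq = lemma A (q ℤ.* + n)
      where
      lemma : ∀ a b → a ≡ a ℤ.- b ℤ.+ b
      lemma = ℤSolver.solve-∀
    2r≡ : r ℤ.+ r ≡ + s ℤ.- + n
    2r≡ = begin
      r ℤ.+ r                                            ≡⟨ l₁ A q (+ n) ⟩
      B ℤ.- q ℤ.* (+ n ℤ.+ + n) ℤ.- + n                  ≡⟨ cong (λ t → t ℤ.- q ℤ.* (+ n ℤ.+ + n) ℤ.- + n) (ℤ.a≡a%ℕn+[a/ℕn]*n B (n ℕ.+ n)) ⟩
      + s ℤ.+ q ℤ.* + (n ℕ.+ n) ℤ.- q ℤ.* (+ n ℤ.+ + n) ℤ.- + n  ≡⟨ l₂ (+ s) (q ℤ.* + (n ℕ.+ n)) (+ n) ⟩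
      + s ℤ.- + n                                        ∎
      where
      open ≡-Reasoning
      l₁ : ∀ A q n → A ℤ.- q ℤ.* n ℤ.+ (A ℤ.- q ℤ.* n) ≡ A ℤ.+ A ℤ.+ n ℤ.- q ℤ.* (n ℤ.+ n) ℤ.- n
      l₁ = ℤSolver.solve-∀
      l₂ : ∀ s t n → s ℤ.+ t ℤ.- t ℤ.- n ≡ s ℤ.- n
      l₂ = ℤSolver.solve-∀
    bound : ∣ r ∣ ℕ.+ ∣ r ∣ ℕ.≤ n
    bound = subst (ℕ._≤ n) (trans (cong ∣_∣ (trans (sym (ℤ.m-n≡m⊖n s n)) (sym 2r≡))) (∣x+x∣ r)) dist≤
      where
      ∣x+x∣ : ∀ x → ∣ x ℤ.+ x ∣ ≡ ∣ x ∣ ℕ.+ ∣ x ∣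
      ∣x+x∣ (+ m)    = refl
      ∣x+x∣ -[1+ m ] = cong suc (sym (ℕ.+-suc m m))
      dist≤ : ∣ s ℤ.⊖ n ∣ ℕ.≤ n
      dist≤ with ℕ.≤-total s n
      ... | inj₁ s≤n = subst (ℕ._≤ n) (sym (ℤ.∣⊖∣-≤ s≤n)) (ℕ.m∸n≤m n s)
      ... | inj₂ n≤s = subst (ℕ._≤ n) (sym (trans (ℤ.∣m⊖n∣≡∣n⊖m∣ s n) (ℤ.∣⊖∣-≤ n≤s)))
        (ℕ.m≤n+o⇒m∸n≤o s n (ℕ.<⇒≤ (ℤ.n%ℕd<d B (n ℕ.+ n))))

  -- Coordinates of size at most n/2 give a norm of at most n²/2.
  quotient-bound : ∀ r s n → r ℕ.+ r ℕ.≤ n → s ℕ.+ s ℕ.≤ n → 0 ℕ.< n → r ℕ.* r ℕ.+ s ℕ.* s ℕ.< n ℕ.* n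
  quotient-bound r s n 2r≤n 2s≤n 0<n = ℕ.*-cancelˡ-< 4 _ _ (begin-strict
    4 ℕ.* (r ℕ.* r ℕ.+ s ℕ.* s)                                 ≡⟨ quadruple r s ⟩
    (r ℕ.+ r) ℕ.* (r ℕ.+ r) ℕ.+ (s ℕ.+ s) ℕ.* (s ℕ.+ s)         ≤⟨ ℕ.+-mono-≤ (ℕ.*-mono-≤ 2r≤n 2r≤n) (ℕ.*-mono-≤ 2s≤n 2s≤n) ⟩
    n ℕ.* n ℕ.+ n ℕ.* n                                         <⟨ ℕ.+-monoʳ-< (n ℕ.* n) (ℕ.m<m+n (n ℕ.* n) (ℕ.<-≤-trans (ℕ.*-mono-< 0<n 0<n) (ℕ.m≤m+n _ _))) ⟩
    n ℕ.* n ℕ.+ (n ℕ.* n ℕ.+ (n ℕ.* n ℕ.+ n ℕ.* n))             ≡⟨ four n ⟩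
    4 ℕ.* (n ℕ.* n)                                             ∎)
    where
    open ℕ.≤-Reasoning
    quadruple : ∀ r s → 4 ℕ.* (r ℕ.* r ℕ.+ s ℕ.* s) ≡ (r ℕ.+ r) ℕ.* (r ℕ.+ r) ℕ.+ (s ℕ.+ s) ℕ.* (s ℕ.+ s)
    quadruple = ℕSolver.solve-∀
    four : ∀ n → n ℕ.* n ℕ.+ (n ℕ.* n ℕ.+ (n ℕ.* n ℕ.+ n ℕ.* n)) ≡ 4 ℕ.* (n ℕ.* n)
    four = ℕSolver.solve-∀

  norm-conj : ∀ x → norm (conj x) ≡ norm x
  norm-conj (a +i b) = cong (λ t → ∣ a ∣ ℕ.* ∣ a ∣ ℕ.+ t ℕ.* t) (ℤ.∣-i∣≡∣i∣ b)

  conj-* : ∀ x → conj x * x ≡ (+ norm x) +i ℤ.0ℤ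
  conj-* (a +i b) = cong₂ _+i_ (trans (l₁ a b) (sym (norm-ℤ a b))) (l₂ a b)
    where
    l₁ : ∀ a b → a ℤ.* a ℤ.- (ℤ.- b) ℤ.* b ≡ a ℤ.* a ℤ.+ b ℤ.* b
    l₁ = ℤSolver.solve-∀
    l₂ : ∀ a b → a ℤ.* b ℤ.+ (ℤ.- b) ℤ.* a ≡ ℤ.0ℤ
    l₂ = ℤSolver.solve-∀

  norm-0<  : ∀ {x} → x ≢ 0# → 0 ℕ.< norm x
  norm-0< x≢0 = ℕ.n≢0⇒n>0 λ z → x≢0 (norm≡0 _ z)

  -- The quotient x/y equals x · `conj y` divided by the norm n of y, and both coordinates are
  -- rounded. Multiplying the remainder by `conj y` gives r₁ + r₂ι, so the norm of the remainder
  -- times n is r₁² + r₂² < n².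
  divide : ∀ x y → y ≢ 0# → ∃ λ q → ∃ λ r → (x ≡ r + q * y) × (norm r ℕ.< norm y)
  divide x y y≢0 = go (x * conj y) refl
    where
    n = norm y
    instance
      n≢0 : ℕ.NonZero n
      n≢0 = ℕ.>-nonZero (norm-0< y≢0)
    go : ∀ z → x * conj y ≡ z → ∃ λ q → ∃ λ r → (x ≡ r + q * y) × (norm r ℕ.< norm y)
    go (A +i B) eq = with-rounding (round A n) (round B n)
      where
      with-rounding : (∃ λ q → ∃ λ r → (A ≡ r ℤ.+ q ℤ.* + n) × (∣ r ∣ ℕ.+ ∣ r ∣ ℕ.≤ n)) →
        (∃ λ q → ∃ λ r → (B ≡ r ℤ.+ q ℤ.* + n) × (∣ r ∣ ℕ.+ ∣ r ∣ ℕ.≤ n)) → _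
      with-rounding (q₁ , r₁ , A≡ , b₁) (q₂ , r₂ , B≡ , b₂) =
        q , x - q * y , cancel x (q * y) , ℕ.*-cancelʳ-< n (norm (x - q * y)) n (subst₂ ℕ._<_ (sym norm≡) refl
          (quotient-bound ∣ r₁ ∣ ∣ r₂ ∣ n b₁ b₂ (norm-0< y≢0)))
        where
        q = q₁ +i q₂
        cancel : ∀ x y → x ≡ x - y + y
        cancel = solve-∀ 𝔾-ring
        expand : ∀ x y q y′ → (x - q * y) * y′ ≡ x * y′ - q * (y′ * y)
        expand = solve-∀ 𝔾-ring
        rem : (x - q * y) * conj y ≡ r₁ +i r₂
        rem = begin
          (x - q * y) * conj y             ≡⟨ expand x y q (conj y) ⟩
          x * conj y - q * (conj y * y)    ≡⟨ cong₂ (λ s t → s - q * t) eq (conj-* y) ⟩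
          A +i B - q * ((+ n) +i ℤ.0ℤ)     ≡⟨ cong₂ (λ s t → s +i t - q * ((+ n) +i ℤ.0ℤ)) A≡ B≡ ⟩
          (r₁ ℤ.+ q₁ ℤ.* + n) +i (r₂ ℤ.+ q₂ ℤ.* + n) - q * ((+ n) +i ℤ.0ℤ)
            ≡⟨ cong₂ _+i_ (l₁ r₁ q₁ q₂ (+ n)) (l₂ r₂ q₁ q₂ (+ n)) ⟩
          r₁ +i r₂                         ∎
          where
          open ≡-Reasoning
          l₁ : ∀ r q q′ n → r ℤ.+ q ℤ.* n ℤ.- (q ℤ.* n ℤ.- q′ ℤ.* ℤ.0ℤ) ≡ r
          l₁ = ℤSolver.solve-∀
          l₂ : ∀ r q q′ n → r ℤ.+ q′ ℤ.* n ℤ.- (q ℤ.* ℤ.0ℤ ℤ.+ q′ ℤ.* n) ≡ r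
          l₂ = ℤSolver.solve-∀
        norm≡ : norm (x - q * y) ℕ.* n ≡ ∣ r₁ ∣ ℕ.* ∣ r₁ ∣ ℕ.+ ∣ r₂ ∣ ℕ.* ∣ r₂ ∣
        norm≡ = trans (cong (norm (x - q * y) ℕ.*_) (sym (norm-conj y)))
          (trans (sym (norm-* (x - q * y) (conj y))) (cong norm rem))

  _≟_ : (x y : 𝔾) → Dec (x ≡ y)
  (a +i b) ≟ (c +i d) with a ℤ.≟ c | b ℤ.≟ d
  ... | yes refl | yes refl = yes refl
  ... | no a≢c | _ = no λ { refl → a≢c refl }
  ... | _ | no b≢d = no λ { refl → b≢d refl }

  𝔾ᴱ : EuclideanDomain
  𝔾ᴱ = record
    { Carrier = 𝔾 ; _+_ = _+_ ; _*_ = _*_ ; -_ = λ x → - x ; 0# = 0# ; 1# = 1#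
    ; isCommutativeRing = isCommutativeRing ; _≟_ = _≟_
    ; norm = norm ; norm-* = norm-* ; norm-0# = refl ; norm-1# = refl
    ; norm≡0 = norm≡0 ; divide = divide }

-- Parity at π = 1 + ι and congruences of squares in ℤ[i].

module GaussTools where

  open Euclid
  open Gauss
  open import Data.Integer as ℤ using (ℤ; +_; -[1+_]; ∣_∣)
  import Data.Integer.Properties as ℤ
  import Data.Integer.DivMod as ℤ
  open import Data.Nat as ℕ using (ℕ; zero; suc)
  import Data.Nat.Properties as ℕ
  import Data.Nat.Divisibility as ℕ
  open import Data.Product using (∃; _×_; _,_)
  open import Data.Sum using (_⊎_; inj₁; inj₂)
  open import Data.List using (List; _∷_; []; _++_; map; upTo)
  open import Data.List.Membership.Propositional using (_∈_)
  open import Data.List.Membership.Propositional.Properties using (∈-++⁺ˡ; ∈-++⁺ʳ; ∈-map⁺; ∈-upTo⁺)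
  open import Data.List.Membership.DecPropositional _≟_ using (_∈?_)
  open import Data.List.Relation.Unary.All using (All; all?; lookup)
  open import Data.List.Relation.Unary.Any using (here; there)
  open import Relation.Nullary using (¬_; Dec; yes; no; contradiction)
  open import Relation.Nullary.Decidable using (True; toWitness; _→-dec_)
  open import Relation.Binary.PropositionalEquality

  private module E = Properties 𝔾ᴱ

  infix 4 _∣_
  _∣_ Coprime : 𝔾 → 𝔾 → Set
  x ∣ y = ∃ λ z → y ≡ x * z
  Coprime x y = ∃ λ s → ∃ λ t → s * x + t * y ≡ 1#

  IsUnit : 𝔾 → Set
  IsUnit x = ∃ λ y → x * y ≡ 1#

  private
    variable
      x y z d : 𝔾

  *-≢0 : x ≢ 0# → y ≢ 0# → x * y ≢ 0#
  *-≢0 = E.*-≢0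

  *≢0ˡ : x * y ≢ 0# → x ≢ 0#
  *≢0ˡ {x} {y} = E.*≢0ˡ {x} {y}

  *≢0ʳ : x * y ≢ 0# → y ≢ 0#
  *≢0ʳ {x} {y} = E.*≢0ʳ {x} {y}

  *-cancelˡ : x ≢ 0# → x * y ≡ x * z → y ≡ z
  *-cancelˡ = E.*-cancelˡ

  coprime-sym : Coprime x y → Coprime y x
  coprime-sym {x} {y} = E.coprime-sym {x} {y}

  coprime-* : Coprime x z → Coprime y z → Coprime (x * y) z
  coprime-* {x} {z} {y} = E.coprime-* {x} {y} {z}

  coprime-∣ : Coprime x y → d ∣ x → Coprime d y
  coprime-∣ {x} {y} {d} = E.coprime-∣ {x} {y} {d}

  coprime⇒∣ : Coprime x y → x ∣ y * z → x ∣ z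
  coprime⇒∣ {x} {y} {z} = E.coprime⇒∣ {x} {y} {z}

  norm1⇒unit : norm x ≡ 1 → IsUnit x
  norm1⇒unit {x} = E.norm1⇒unit {x}

  unit⇒coprime : IsUnit x → Coprime x y
  unit⇒coprime {x} {y} = E.unit⇒coprime {x} {y}

  gcd : ∀ x y → x ≢ 0# → ∃ λ g → ∃ λ x′ → ∃ λ y′ → (x ≡ g * x′) × (y ≡ g * y′) × (g ≢ 0#) × Coprime x′ y′
  gcd x y x≢0 with E.gcd-of x y x≢0
  ... | E.gcd g x′ y′ x≡ y≡ g≢0 c = g , x′ , y′ , x≡ , y≡ , g≢0 , c

  square-split : ∀ {f₁ f₂ D e} → e ≢ 0# → f₁ * f₂ ≡ D * (e * e) → Coprime f₁ f₂ →
    ∃ λ d₁ → ∃ λ d₂ → ∃ λ p → ∃ λ q → (f₁ ≡ d₁ * (p * p)) × (f₂ ≡ d₂ * (q * q)) × (d₁ * d₂ ≡ D) × (e ≡ p * q)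
  square-split = E.Square.coprime-split

  fourth-split : ∀ {f₁ f₂ D e} → e ≢ 0# → f₁ * f₂ ≡ D * (e * e * (e * e)) → Coprime f₁ f₂ →
    ∃ λ d₁ → ∃ λ d₂ → ∃ λ p → ∃ λ q →
      (f₁ ≡ d₁ * (p * p * (p * p))) × (f₂ ≡ d₂ * (q * q * (q * q))) × (d₁ * d₂ ≡ D) × (e ≡ p * q)
  fourth-split = E.Fourth.coprime-split

  π : 𝔾
  π = 1# + ι

  diff-0 : ∀ {x y} → x - y ≡ 0# → x ≡ y
  diff-0 {x} {y} h = trans (l x y) (trans (cong (_+ y) h) (l′ y))
    where
    l : ∀ x y → x ≡ x - y + y
    l = solve-∀ 𝔾-ring
    l′ : ∀ y → 0# + y ≡ y
    l′ = solve-∀ 𝔾-ring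

  -- Linear combinations of equations: x ≡ y follows when x - y is an
  -- explicit combination of the differences of the two sides of the hypotheses.
  lin₁ : ∀ c {a b x y} → a ≡ b → x - y ≡ c * (a - b) → x ≡ y
  lin₁ c {a} refl h = diff-0 (trans h (l c a))
    where
    l : ∀ c a → c * (a - a) ≡ 0#
    l = solve-∀ 𝔾-ring

  lin₂ : ∀ c {a b} d {a′ b′ x y} → a ≡ b → a′ ≡ b′ → x - y ≡ c * (a - b) + d * (a′ - b′) → x ≡ y
  lin₂ c {a} d {a′} refl refl h = diff-0 (trans h (l c a d a′))
    where
    l : ∀ c a d a′ → c * (a - a) + d * (a′ - a′) ≡ 0#
    l = solve-∀ 𝔾-ring

  lin₃ : ∀ c {a b} d {a′ b′} e {a″ b″ x y} → a ≡ b → a′ ≡ b′ → a″ ≡ b″ →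
    x - y ≡ c * (a - b) + d * (a′ - b′) + e * (a″ - b″) → x ≡ y
  lin₃ c {a} d {a′} e {a″} refl refl refl h = diff-0 (trans h (l c a d a′ e a″))
    where
    l : ∀ c a d a′ e a″ → c * (a - a) + d * (a′ - a′) + e * (a″ - a″) ≡ 0#
    l = solve-∀ 𝔾-ring

  ∣-refl : x ∣ x
  ∣-refl {x} = 1# , sym (l x)
    where
    l : ∀ x → x * 1# ≡ x
    l = solve-∀ 𝔾-ring

  ∣-trans : x ∣ y → y ∣ z → x ∣ z
  ∣-trans {x} (u , refl) (v , refl) = u * v , l x u v
    where
    l : ∀ x u v → x * u * v ≡ x * (u * v)
    l = solve-∀ 𝔾-ring

  x∣x*y : ∀ x y → x ∣ x * y
  x∣x*y x y = y , refl

  x∣y*x : ∀ x y → x ∣ y * x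
  x∣y*x x y = y , l x y
    where
    l : ∀ x y → y * x ≡ x * y
    l = solve-∀ 𝔾-ring

  coprime-*ʳ : Coprime x y → Coprime x z → Coprime x (y * z)
  coprime-*ʳ c d = coprime-sym (coprime-* (coprime-sym c) (coprime-sym d))

  coprime-+* : ∀ x y z → Coprime x z → Coprime (x + y * z) z
  coprime-+* x y z (s , t , h) = s , t - s * y , lin₁ 1# h (solve (x ∷ y ∷ z ∷ s ∷ t ∷ []) 𝔾-ring)

  coprime-resp : x ≡ y → Coprime x z → Coprime y z
  coprime-resp refl c = c

  coprime-unit : Coprime x y → x ∣ y → IsUnit x
  coprime-unit {x} (s , t , h) (u , refl) = s + t * u , lin₁ 1# h (solve (x ∷ s ∷ t ∷ u ∷ []) 𝔾-ring)

  unit-norm : IsUnit x → norm x ≡ 1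
  unit-norm {x} (y , h) = ℕ.m*n≡1⇒m≡1 (norm x) (norm y) (trans (sym (norm-* x y)) (cong norm h))

  -- Parity is taken modulo the prime π above 2.

  Even Odd : 𝔾 → Set
  Even x = π ∣ x
  Odd x = ∃ λ z → x ≡ 1# + π * z

  range : ℕ → List ℤ
  range n = map +_ (upTo (suc n)) ++ map -[1+_] (upTo n)

  ∈range : ∀ n a → ∣ a ∣ ℕ.≤ n → a ∈ range n
  ∈range n (+ m)    m≤n = ∈-++⁺ˡ (∈-map⁺ +_ (∈-upTo⁺ (ℕ.s≤s m≤n)))
  ∈range n -[1+ m ] m<n = ∈-++⁺ʳ (map +_ (upTo (suc n))) (∈-map⁺ -[1+_] (∈-upTo⁺ m<n))

  m≤m² : ∀ m → m ℕ.≤ m ℕ.* m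
  m≤m² zero    = ℕ.z≤n
  m≤m² (suc m) = ℕ.m≤m*n (suc m) (suc m)

  search? : ∀ n {P : 𝔾 → Set} → (∀ x → Dec (P x)) → Dec (All (λ a → All (λ b → norm (a +i b) ≡ n → P (a +i b)) (range n)) (range n))
  search? n P? = all? (λ a → all? (λ b → (norm (a +i b) ℕ.≟ n) →-dec P? (a +i b)) (range n)) (range n)

  -- By |a| ≤ a² ≤ n, and the same for b, the elements of norm n lie in a finite box, so that the
  -- check is an evaluation.
  norm-search : ∀ n {P : 𝔾 → Set} (P? : ∀ x → Dec (P x)) → {True (search? n P?)} → ∀ x → norm x ≡ n → P x
  norm-search n P? {found} (a +i b) eq = lookup (lookup (toWitness found)
    (∈range n a (ℕ.≤-trans (m≤m² ∣ a ∣) (subst (∣ a ∣ ℕ.* ∣ a ∣ ℕ.≤_) eq (ℕ.m≤m+n _ _)))))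
    (∈range n b (ℕ.≤-trans (m≤m² ∣ b ∣) (subst (∣ b ∣ ℕ.* ∣ b ∣ ℕ.≤_) eq (ℕ.m≤n+m _ _)))) eq

  units : List 𝔾
  units = 1# ∷ - 1# ∷ ι ∷ - ι ∷ []

  norm1⇒∈units : ∀ x → norm x ≡ 1 → x ∈ units
  norm1⇒∈units = norm-search 1 (_∈? units)

  -- This and `norm≢7` are what keeps 3 and 7 prime in ℤ[i].
  norm≢3 : ∀ x → norm x ≢ 3
  norm≢3 = norm-search 3 (λ _ → no λ ())

  norm≢7 : ∀ x → norm x ≢ 7
  norm≢7 = norm-search 7 (λ _ → no λ ())

  -- Division by π leaves a remainder of norm 0 or 1, and all four units are congruent to 1 modulo
  -- π: the residue field has two elements.
  even-or-odd : ∀ x → Even x ⊎ Odd x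
  even-or-odd x = go (divide x π λ ())
    where
    go : (∃ λ q → ∃ λ r → (x ≡ r + q * π) × (norm r ℕ.< 2)) → Even x ⊎ Odd x
    go (q , r , h , r<2) = cases (norm r) refl r<2
      where
      odd : ∀ z → r ≡ 1# + π * z → Odd x
      odd z eq = q + z , lin₂ 1# 1# h eq (solve (x ∷ q ∷ r ∷ z ∷ []) 𝔾-ring)
      unit-odd : r ∈ units → Odd x
      unit-odd (here refl) = odd 0# refl
      unit-odd (there (here refl)) = odd (- 1# + ι) refl
      unit-odd (there (there (here refl))) = odd ι refl
      unit-odd (there (there (there (here refl)))) = odd (- 1#) refl
      cases : ∀ n → norm r ≡ n → n ℕ.< 2 → Even x ⊎ Odd x
      cases 0 nr≡0 _ = inj₁ (q , lin₂ 1# 1# h (norm≡0 r nr≡0) (solve (x ∷ q ∷ r ∷ []) 𝔾-ring))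
      cases 1 nr≡1 _ = inj₂ (unit-odd (norm1⇒∈units r nr≡1))
      cases (suc (suc _)) _ (ℕ.s≤s (ℕ.s≤s ()))

  odd-not-even : Odd x → ¬ Even x
  odd-not-even {x} (z , h) (w , h′) = π-not-unit (w - z , lin₂ 1# (- 1#) h h′ (solve (x ∷ z ∷ w ∷ []) 𝔾-ring))
    where
    π-not-unit : ¬ IsUnit π
    π-not-unit u with unit-norm u
    ... | ()

  odd-* : Odd x → Odd y → Odd (x * y)
  odd-* {x} {y} (z , h) (w , h′) = z + w + π * z * w , lin₂ y (1# + π * z) h h′ (solve (x ∷ y ∷ z ∷ w ∷ []) 𝔾-ring)

  even-*ˡ : Even x → Even (x * y)
  even-*ˡ {x} {y} (z , h) = z * y , lin₁ y h (solve (x ∷ y ∷ z ∷ []) 𝔾-ring)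

  even-*ʳ : Even y → Even (x * y)
  even-*ʳ {y} {x} (z , h) = x * z , lin₁ x h (solve (x ∷ y ∷ z ∷ []) 𝔾-ring)

  even-+ : Even x → Even y → Even (x + y)
  even-+ {x} {y} (z , h) (w , h′) = z + w , lin₂ 1# 1# h h′ (solve (x ∷ y ∷ z ∷ w ∷ []) 𝔾-ring)

  odd-+ : Odd x → Even y → Odd (x + y)
  odd-+ {x} {y} (z , h) (w , h′) = z + w , lin₂ 1# 1# h h′ (solve (x ∷ y ∷ z ∷ w ∷ []) 𝔾-ring)

  odd-+-odd : Odd x → Odd y → Even (x + y)
  odd-+-odd {x} {y} (z , h) (w , h′) = # 1 - ι + z + w , lin₂ 1# 1# h h′ (solve (x ∷ y ∷ z ∷ w ∷ []) 𝔾-ring)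

  odd-*ˡ : Odd (x * y) → Odd x
  odd-*ˡ {x} {y} o with even-or-odd x
  ... | inj₂ odd = odd
  ... | inj₁ even = contradiction (even-*ˡ even) (odd-not-even o)

  odd-*ʳ : Odd (x * y) → Odd y
  odd-*ʳ {x} {y} o with even-or-odd y
  ... | inj₂ odd = odd
  ... | inj₁ even = contradiction (even-*ʳ {x = x} even) (odd-not-even o)

  z*[z+1]-even : ∀ z → Even (z * (z + 1#))
  z*[z+1]-even z with even-or-odd z
  ... | inj₁ e = even-*ˡ e
  ... | inj₂ o = even-*ʳ {x = z} (odd-+-odd o (0# , refl))

  -- The unit group of ℤ[i]/2 consists of 1 and ι.
  odd-mod-2 : Odd x → (∃ λ z → x ≡ 1# + # 2 * z) ⊎ (∃ λ z → x ≡ ι + # 2 * z)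
  odd-mod-2 {x} (z , h) with even-or-odd z
  ... | inj₁ (w , h′) = inj₁ (ι * w , lin₂ 1# π h h′ (solve (x ∷ z ∷ w ∷ []) 𝔾-ring))
  ... | inj₂ (w , h′) = inj₂ (1# + ι * w , lin₂ 1# π h h′ (solve (x ∷ z ∷ w ∷ []) 𝔾-ring))

  PlusMinusOne : 𝔾 → Set
  PlusMinusOne x = (∃ λ z → x ≡ 1# + # 4 * π * z) ⊎ (∃ λ z → x ≡ - 1# + # 4 * π * z)

  -- (1 + 2z)² = 1 + 4z(z + 1), and z(z + 1) is even. For ι + 2z = ι(1 + 2(-ιz)) the same applies to
  -- -ιz, with the opposite sign.
  odd-sq : Odd x → PlusMinusOne (x * x)
  odd-sq {x} o with odd-mod-2 o
  ... | inj₁ (z , h) = case₁ (z*[z+1]-even z)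
    where
    case₁ : Even (z * (z + 1#)) → PlusMinusOne (x * x)
    case₁ (w , e) = inj₁ (w , lin₂ (x + 1# + # 2 * z) (# 4) h e (solve (x ∷ z ∷ w ∷ []) 𝔾-ring))
  ... | inj₂ (z , h) = case₂ (z*[z+1]-even (- ι * z))
    where
    case₂ : Even (- ι * z * (- ι * z + 1#)) → PlusMinusOne (x * x)
    case₂ (w , e) = inj₂ (- w , lin₂ (x + ι + # 2 * z) (- (# 4)) h e (solve (x ∷ z ∷ w ∷ []) 𝔾-ring))

  -- Squaring ±1 + 4πz gains a factor 2. The moduli 4π and 8π are those of the sieves at π.
  odd-fourth : Odd x → ∃ λ z → x * x * (x * x) ≡ 1# + # 8 * π * z
  odd-fourth {x} o with odd-sq o
  ... | inj₁ (z , h) = z + # 2 * π * z * z , lin₁ (x * x + 1# + # 4 * π * z) h (solve (x ∷ z ∷ []) 𝔾-ring)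
  ... | inj₂ (z , h) = - z + # 2 * π * z * z , lin₁ (x * x - 1# + # 4 * π * z) h (solve (x ∷ z ∷ []) 𝔾-ring)

  odd-coprime-2 : Odd x → Coprime (# 2) x
  odd-coprime-2 {x} o with odd-mod-2 o
  ... | inj₁ (z , h) = - z , 1# , lin₁ 1# h (solve (x ∷ z ∷ []) 𝔾-ring)
  ... | inj₂ (z , h) = ι * z , - ι , lin₁ (- ι) h (solve (x ∷ z ∷ []) 𝔾-ring)

  Prime : 𝔾 → Set
  Prime p = (norm p ≢ 1) × (∀ x → p ∣ x ⊎ Coprime p x)

  -- In p = gp′ with g the gcd of p and x, either g is a unit, and p and x are coprime, or p′ is a
  -- unit, and p divides g and hence x.
  prime-by-norm : ∀ p → p ≢ 0# → norm p ≢ 1 → (∀ g h → p ≡ g * h → norm g ≡ 1 ⊎ norm h ≡ 1) → Prime p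
  prime-by-norm p p≢0 np≢1 irreducible = np≢1 , λ x → go x (gcd p x p≢0)
    where
    go : ∀ x → (∃ λ g → ∃ λ p′ → ∃ λ x′ → (p ≡ g * p′) × (x ≡ g * x′) × (g ≢ 0#) × Coprime p′ x′) → p ∣ x ⊎ Coprime p x
    go x (g , h , x′ , p≡ , x≡ , _ , s , t , sh+tx′≡1) with irreducible g h p≡
    ... | inj₁ ng≡1 = inj₂ (scale (norm1⇒unit ng≡1))
      where
      scale : IsUnit g → Coprime p x
      scale (u , gu≡1) = u * s , u * t , lin₃ (u * s) (u * t) 1# p≡ x≡ gu≡1 (lin₁ (g * u) sh+tx′≡1 (solve (g ∷ h ∷ x′ ∷ s ∷ t ∷ u ∷ p ∷ x ∷ []) 𝔾-ring))
    ... | inj₂ nh≡1 = inj₁ (scale (norm1⇒unit nh≡1))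
      where
      scale : IsUnit h → p ∣ x
      scale (u , hu≡1) = u * x′ , lin₃ 1# (- u * x′) (- g * x′) x≡ p≡ hu≡1 (solve (g ∷ h ∷ x′ ∷ u ∷ p ∷ x ∷ []) 𝔾-ring)

-- Primes 3, 7 and the factors of 5 in ℤ[i]; candidates for descent coefficients.

module Divisors where

  open Euclid
  open Gauss
  open GaussTools
  open import Data.Integer as ℤ using (ℤ; +_; -[1+_])
  open import Data.Nat as ℕ using (ℕ; zero; suc)
  import Data.Nat.Properties as ℕ
  import Data.Nat.Divisibility as ℕ
  open import Data.Product using (∃; _×_; _,_; proj₁; proj₂)
  open import Data.Sum using (_⊎_; inj₁; inj₂)
  open import Data.List using (List; _∷_; [])
  open import Data.List.Membership.Propositional using (_∈_)
  open import Data.List.Relation.Unary.Any using (here; there)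
  open import Data.List.Relation.Unary.All using (All; all?; lookup)
  open import Relation.Nullary using (¬_; Dec; yes; no; contradiction)
  open import Relation.Nullary.Decidable using (True; toWitness; False; toWitnessFalse; _→-dec_; _⊎-dec_)
  open import Relation.Binary.PropositionalEquality

  private
    variable
      x y z p g : 𝔾

  -- The remainder decides: a nonzero one has norm below that of x, too small for a multiple of x.
  -- Congruence sieves thereby become computations.
  ∣-dec : ∀ x y → x ≢ 0# → Dec (x ∣ y)
  ∣-dec x y x≢0 = go (divide y x x≢0)
    where
    go : (∃ λ q → ∃ λ r → (y ≡ r + q * x) × (norm r ℕ.< norm x)) → Dec (x ∣ y)
    go (q , r , h , r<x) = cases (r ≟ 0#)
      where
      cases : Dec (r ≡ 0#) → Dec (x ∣ y)
      cases (yes r≡0) = yes (q , lin₂ 1# 1# h r≡0 (solve (x ∷ y ∷ q ∷ r ∷ []) 𝔾-ring))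
      cases (no r≢0) = no λ x∣y → ℕ.<⇒≱ r<x (bound x∣y)
        where
        bound : x ∣ y → norm x ℕ.≤ norm r
        bound (w , h′) = subst (norm x ℕ.≤_) (trans (sym (norm-* x (w - q))) (cong norm (sym r≡)))
          (ℕ.m≤m*n (norm x) (norm (w - q)) {{ℕ.>-nonZero (norm-0< w≢q)}})
          where
          r≡ : r ≡ x * (w - q)
          r≡ = lin₂ (- 1#) 1# h h′ (solve (x ∷ y ∷ q ∷ r ∷ w ∷ []) 𝔾-ring)
          w≢q : w - q ≢ 0#
          w≢q = *≢0ʳ {x = x} (λ e → r≢0 (trans r≡ e))

  factors? : ∀ n {P : ℕ → Set} → (∀ m → Dec (P m)) → Dec (∀ {m} → m ℕ.< suc n → m ℕ.∣ n → P m)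
  factors? n P? = ℕ.allUpTo? (λ m → (m ℕ.∣? n) →-dec P? m) (suc n)

  factor-of : ∀ n .{{_ : ℕ.NonZero n}} {P : ℕ → Set} (P? : ∀ m → Dec (P m)) → {True (factors? n P?)} → ∀ a b → a ℕ.* b ≡ n → P a
  factor-of n P? {w} a b eq = toWitness w (ℕ.s≤s (ℕ.∣⇒≤ a∣n)) a∣n
    where
    a∣n : a ℕ.∣ n
    a∣n = ℕ.divides b (trans (sym eq) (ℕ.*-comm a b))

  norm-factor : ∀ n .{{_ : ℕ.NonZero n}} {P : ℕ → Set} (P? : ∀ m → Dec (P m)) → {True (factors? n P?)} →
    norm x ≡ n → ∀ g h → x ≡ g * h → P (norm g)
  norm-factor n P? {w} nx≡n g h eq = factor-of n P? {w} (norm g) (norm h) (trans (sym (norm-* g h)) (trans (cong norm (sym eq)) nx≡n))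

  cofactor-norm : x ≢ 0# → ∀ g h → x ≡ g * h → norm g ≡ norm x → norm h ≡ 1
  cofactor-norm {x} x≢0 g h eq ng≡ = ℕ.*-cancelˡ-≡ (norm h) 1 (norm x) {{ℕ.>-nonZero (norm-0< x≢0)}}
    (trans (cong (ℕ._* norm h) (sym ng≡)) (trans (sym (norm-* g h)) (trans (cong norm (sym eq)) (sym (ℕ.*-identityʳ _)))))

  θ θ̄ : 𝔾
  θ = # 2 + ι
  θ̄ = # 2 - ι

  prime-of-norm-5 : ∀ p → norm p ≡ 5 → Prime p
  prime-of-norm-5 p np≡5 = prime-by-norm p p≢0 np≢1 irreducible
    where
    p≢0 : p ≢ 0#
    p≢0 eq = contradiction (trans (sym np≡5) (cong norm eq)) λ ()
    np≢1 : norm p ≢ 1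
    np≢1 e = contradiction (trans (sym e) np≡5) λ ()
    irreducible : ∀ g h → p ≡ g * h → norm g ≡ 1 ⊎ norm h ≡ 1
    irreducible g h eq with norm-factor 5 (λ m → (m ℕ.≟ 1) ⊎-dec (m ℕ.≟ 5)) np≡5 g h eq
    ... | inj₁ e = inj₁ e
    ... | inj₂ e = inj₂ (cofactor-norm p≢0 g h eq (trans e (sym np≡5)))

  -- A proper factor would have norm m, a value that no element takes.
  inert : ∀ p n → .{{_ : ℕ.NonZero n}} → p ≢ 0# → norm p ≢ 1 → norm p ≡ n → ∀ m → (∀ x → norm x ≢ m) →
    {True (factors? n (λ j → (j ℕ.≟ 1) ⊎-dec ((j ℕ.≟ m) ⊎-dec (j ℕ.≟ n))))} → Prime p
  inert p n p≢0 np≢1 np≡n m norm≢m {w} = prime-by-norm p p≢0 np≢1 irreducible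
    where
    irreducible : ∀ g h → p ≡ g * h → norm g ≡ 1 ⊎ norm h ≡ 1
    irreducible g h eq with norm-factor n (λ j → (j ℕ.≟ 1) ⊎-dec ((j ℕ.≟ m) ⊎-dec (j ℕ.≟ n))) {w} np≡n g h eq
    ... | inj₁ e = inj₁ e
    ... | inj₂ (inj₁ e) = contradiction e (norm≢m g)
    ... | inj₂ (inj₂ e) = inj₂ (cofactor-norm p≢0 g h eq (trans e (sym np≡n)))

  prime-3 : Prime (# 3)
  prime-3 = inert (# 3) 9 (λ ()) (λ ()) refl 3 norm≢3

  prime-7 : Prime (# 7)
  prime-7 = inert (# 7) 49 (λ ()) (λ ()) refl 7 norm≢7

  prime-θ : Prime θ
  prime-θ = prime-of-norm-5 θ refl

  prime-θ̄ : Prime θ̄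
  prime-θ̄ = prime-of-norm-5 θ̄ refl

  prime-not-unit : Prime p → ¬ IsUnit p
  prime-not-unit (np≢1 , _) u = np≢1 (unit-norm u)

  prime-∣* : Prime p → p ∣ x * y → p ∣ x ⊎ p ∣ y
  prime-∣* {p} {x} {y} P p∣xy with proj₂ P x
  ... | inj₁ p∣x = inj₁ p∣x
  ... | inj₂ c = inj₂ (coprime⇒∣ {x = p} {y = x} {z = y} c p∣xy)

  prime-∣sq : Prime p → p ∣ x * x → p ∣ x
  prime-∣sq {p} {x} P p∣xx with prime-∣* {p} {x} {x} P p∣xx
  ... | inj₁ h = h
  ... | inj₂ h = h

  prime-common : Prime p → Coprime x y → p ∣ x → ¬ (p ∣ y)
  prime-common {p} {x} {y} P c p∣x p∣y = prime-not-unit P (coprime-unit (coprime-∣ {x} {y} {p} c p∣x) p∣y)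

  SquareFree : 𝔾 → Set
  SquareFree D = ∀ g → g * g ∣ D → IsUnit g

  unit-sqrt : IsUnit (g * g) → IsUnit g
  unit-sqrt {g} (u , h) = g * u , lin₁ 1# h (solve (g ∷ u ∷ []) 𝔾-ring)

  coprime-square-free : ∀ D g → Coprime g D → g * g ∣ D → IsUnit g
  coprime-square-free D g c gg∣D = unit-sqrt (coprime-unit (coprime-* {g} {D} {g} c c) gg∣D)

  prime-square-free : Prime p → p ≢ 0# → SquareFree p
  prime-square-free {p} P p≢0 g gg∣p with proj₂ P g
  ... | inj₂ c = coprime-square-free p g (coprime-sym {p} {g} c) gg∣p
  ... | inj₁ (h , g≡) = contradiction (p-unit gg∣p) (prime-not-unit P)
    where
    p-unit : g * g ∣ p → IsUnit p
    p-unit (w , p≡) = h * h * w , *-cancelˡ p≢0 (lin₂ (- 1#) (- (p * h * w + g * w)) p≡ g≡ (solve (p ∷ g ∷ h ∷ w ∷ []) 𝔾-ring))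

  coprime-θ-θ̄ : Coprime θ θ̄
  coprime-θ-θ̄ = θ̄ - 1# , - 1# , refl

  -- If θ divides g then θ² divides 5 = θθ̄, so θ divides θ̄, against coprimality; likewise for θ̄.
  -- Otherwise g is prime to 5.
  square-free-5 : SquareFree (# 5)
  square-free-5 g gg∣5 with proj₂ prime-θ g | proj₂ prime-θ̄ g
  ... | inj₁ θ∣g | _ = contradiction (θ∣θ̄ θ∣g gg∣5) (prime-common {θ} {θ} {θ̄} prime-θ coprime-θ-θ̄ (∣-refl {θ}))
    where
    θ∣θ̄ : θ ∣ g → g * g ∣ # 5 → θ ∣ θ̄
    θ∣θ̄ (h , g≡) (w , 5≡) = h * h * w , *-cancelˡ {θ} {θ̄} {θ * (h * h * w)} (λ ()) (lin₂ 1# (θ * h * w + g * w) 5≡ g≡ (solve (g ∷ h ∷ w ∷ []) 𝔾-ring))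
  ... | _ | inj₁ θ̄∣g = contradiction (θ̄∣θ θ̄∣g gg∣5) (prime-common {θ̄} {θ̄} {θ} prime-θ̄ (coprime-sym {θ} {θ̄} coprime-θ-θ̄) (∣-refl {θ̄}))
    where
    θ̄∣θ : θ̄ ∣ g → g * g ∣ # 5 → θ̄ ∣ θ
    θ̄∣θ (h , g≡) (w , 5≡) = h * h * w , *-cancelˡ {θ̄} {θ} {θ̄ * (h * h * w)} (λ ()) (lin₂ 1# (θ̄ * h * w + g * w) 5≡ g≡ (solve (g ∷ h ∷ w ∷ []) 𝔾-ring))
  ... | inj₂ c | inj₂ c̄ = coprime-square-free (# 5) g (coprime-sym {θ * θ̄} {g} (coprime-* {θ} {g} {θ̄} c c̄)) gg∣5

  -- A common factor g of f₁ and f₂ divides s, so it is prime to C, and then g² ∣ D.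
  coprime-factors : ∀ {f₁ f₂} C D s a b → f₁ ≢ 0# → SquareFree D → Coprime s C →
    f₁ * f₂ ≡ C * D → s ≡ a * f₁ + b * f₂ → Coprime f₁ f₂
  coprime-factors {f₁} {f₂} C D s a b f₁≢0 free cop prod s≡ = go (gcd f₁ f₂ f₁≢0)
    where
    go : (∃ λ g → ∃ λ x → ∃ λ y → (f₁ ≡ g * x) × (f₂ ≡ g * y) × (g ≢ 0#) × Coprime x y) → Coprime f₁ f₂
    go (g , x , y , f₁≡ , f₂≡ , g≢0 , v , w , vx+wy≡1) = finish (free g (coprime⇒∣ {g * g} {C} {D} gg-C gg∣CD))
      where
      g∣s : g ∣ s
      g∣s = a * x + b * y , lin₃ 1# a b s≡ f₁≡ f₂≡ (solve (s ∷ a ∷ b ∷ f₁ ∷ f₂ ∷ g ∷ x ∷ y ∷ []) 𝔾-ring)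
      g-C : Coprime g C
      g-C = coprime-∣ {s} {C} {g} cop g∣s
      gg-C : Coprime (g * g) C
      gg-C = coprime-* {g} {C} {g} g-C g-C
      gg∣CD : g * g ∣ C * D
      gg∣CD = x * y , lin₃ (- 1#) f₂ (g * x) prod f₁≡ f₂≡ (solve (f₁ ∷ f₂ ∷ C ∷ D ∷ g ∷ x ∷ y ∷ []) 𝔾-ring)
      finish : IsUnit g → Coprime f₁ f₂
      finish (u , gu≡1) = v * u , w * u ,
        lin₃ (v * u) (w * u) 1# f₁≡ f₂≡ gu≡1 (lin₁ (g * u) vx+wy≡1 (solve (v ∷ w ∷ u ∷ f₁ ∷ f₂ ∷ g ∷ x ∷ y ∷ []) 𝔾-ring))

  -- T stands for a power of the prime p, recorded through `power`. As p cannot divide both of the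
  -- coprime factors, T is prime to one of them and so divides the other.
  prime-power-split : ∀ {p d₁ d₂} T E → Prime p → T ≢ 0# → (∀ {x} → Coprime p x → Coprime T x) →
    Coprime d₁ d₂ → d₁ * d₂ ≡ T * E →
    (∃ λ d → (d₁ ≡ T * d) × (d * d₂ ≡ E)) ⊎ (∃ λ d → (d₂ ≡ T * d) × (d₁ * d ≡ E))
  prime-power-split {p} {d₁} {d₂} T E P T≢0 power cop prod with proj₂ P d₁
  ... | inj₂ c = inj₂ (divides (coprime⇒∣ {T} {d₁} {d₂} (power c) (E , prod)))
    where
    divides : T ∣ d₂ → ∃ λ d → (d₂ ≡ T * d) × (d₁ * d ≡ E)
    divides (d , d₂≡) = d , d₂≡ , *-cancelˡ T≢0 (lin₂ 1# (- d₁) prod d₂≡ (solve (d ∷ d₁ ∷ d₂ ∷ T ∷ E ∷ []) 𝔾-ring))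
  ... | inj₁ p∣d₁ = inj₁ (divides (coprime⇒∣ {T} {d₂} {d₁} (power (coprime-∣ {d₁} {d₂} {p} cop p∣d₁)) (E , lin₁ 1# prod (solve (d₁ ∷ d₂ ∷ T ∷ E ∷ []) 𝔾-ring))))
    where
    divides : T ∣ d₁ → ∃ λ d → (d₁ ≡ T * d) × (d * d₂ ≡ E)
    divides (d , d₁≡) = d , d₁≡ , *-cancelˡ T≢0 (lin₂ 1# (- d₂) prod d₁≡ (solve (d ∷ d₁ ∷ d₂ ∷ T ∷ E ∷ []) 𝔾-ring))

  unit∈units : IsUnit x → x ∈ units
  unit∈units {x} u = norm1⇒∈units x (unit-norm u)

  -- A value of k for which the descent below works, and the corresponding 3k².
  data Twist : 𝔾 → 𝔾 → Set where
    one   : Twist (# 1) (# 3)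
    three : Twist (# 3) (# 27)

  private
    variable
      k t : 𝔾

  twist-prime-power : Twist k t → (t ≢ 0#) × (∀ {x} → Coprime (# 3) x → Coprime t x)
  twist-prime-power one = (λ ()) , λ c → c
  twist-prime-power three = (λ ()) , λ {x} c → coprime-* {# 9} {x} {# 3} (coprime-* {# 3} {x} {# 3} c c) c

  t≡3k² : Twist k t → t ≡ # 3 * (k * k)
  t≡3k² one = refl
  t≡3k² three = refl

  -- The finitely many candidates for the leading coefficient in a descent, up to units; each is
  -- later tested by evaluation. Here t = 3k², and ρ is 7 or 5 according to the isogeny.
  record Class (ρ t d : 𝔾) : Set where
    constructor class
    field
      {c ε} : 𝔾
      c∈ : c ∈ (1# ∷ ρ ∷ t ∷ t * ρ ∷ [])
      ε∈ : ε ∈ units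
      d≡ : d ≡ c * ε

  Splitting : 𝔾 → 𝔾 → 𝔾 → Set
  Splitting ρ d₁ d₂ = (∃ λ d → (d₁ ≡ ρ * d) × IsUnit d) ⊎ IsUnit d₁

  -- The power t of 3 goes entirely to d₁ or to d₂. What remains is a factorization of ρη, handled
  -- by `split`; the argument c tells `split` whether t was removed, so that it can still use
  -- equations for d₁ itself.
  class-of : ∀ {ρ η d₁ d₂} → Twist k t →
    (∀ {c d d′} → c ∈ (1# ∷ t ∷ []) → d₁ ≡ c * d → d * d′ ≡ ρ * η → Coprime d d′ → Splitting ρ d d′) →
    d₁ * d₂ ≡ t * (ρ * η) → Coprime d₁ d₂ → Class ρ t d₁
  class-of {t = t} {ρ} {η} {d₁} {d₂} K split prod cop with prime-power-split {# 3} {d₁} {d₂} t (ρ * η) prime-3 (proj₁ (twist-prime-power K)) (proj₂ (twist-prime-power K)) cop prod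
  ... | inj₁ (d , d₁≡ , dd₂≡) = with-t (split (there (here refl)) d₁≡ dd₂≡ (coprime-∣ {d₁} {d₂} {d} cop (t , lin₁ 1# d₁≡ (solve (d ∷ d₁ ∷ t ∷ []) 𝔾-ring))))
    where
    with-t : Splitting ρ d d₂ → Class ρ t d₁
    with-t (inj₁ (e , d≡ , u)) = class (there (there (there (here refl)))) (unit∈units u) (lin₂ 1# t d₁≡ d≡ (solve (d ∷ d₁ ∷ t ∷ ρ ∷ e ∷ []) 𝔾-ring))
    with-t (inj₂ u) = class (there (there (here refl))) (unit∈units u) d₁≡
  ... | inj₂ (d , d₂≡ , d₁d≡) = without-t (split (here refl) (l d₁) d₁d≡ (coprime-sym {d} {d₁} (coprime-∣ {d₂} {d₁} {d} (coprime-sym {d₁} {d₂} cop) (t , lin₁ 1# d₂≡ (solve (d ∷ d₂ ∷ t ∷ []) 𝔾-ring)))))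
    where
    l : ∀ d → d ≡ 1# * d
    l = solve-∀ 𝔾-ring
    without-t : Splitting ρ d₁ d → Class ρ t d₁
    without-t (inj₁ (e , d≡ , u)) = class (there (here refl)) (unit∈units u) d≡
    without-t (inj₂ u) = class (here refl) (unit∈units u) (l d₁)

  split-7 : ∀ {η d₁ d₂} → IsUnit η → d₁ * d₂ ≡ # 7 * η → Coprime d₁ d₂ → Splitting (# 7) d₁ d₂
  split-7 {η} {d₁} {d₂} (u , ηu≡1) prod cop with prime-power-split {# 7} {d₁} {d₂} (# 7) η prime-7 (λ ()) (λ c → c) cop prod
  ... | inj₁ (d , d₁≡ , dd₂≡η) = inj₁ (d , d₁≡ , d₂ * u , lin₂ u 1# dd₂≡η ηu≡1 (solve (d ∷ d₂ ∷ u ∷ η ∷ []) 𝔾-ring))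
  ... | inj₂ (d , _ , d₁d≡η) = inj₂ (d * u , lin₂ u 1# d₁d≡η ηu≡1 (solve (d ∷ d₁ ∷ u ∷ η ∷ []) 𝔾-ring))

-- The two isogenous quartics over ℤ[i].

module Quartic where

  open Euclid
  open Gauss
  open GaussTools
  open Divisors
  open import Data.Nat as ℕ using (ℕ; zero; suc)
  open import Data.Product using (∃; _×_; _,_; proj₁; proj₂)
  open import Data.Sum using (_⊎_; inj₁; inj₂)
  open import Data.List using (List; _∷_; [])
  open import Data.List.Membership.Propositional using (_∈_)
  open import Data.List.Relation.Unary.Any using (here; there)
  open import Data.List.Relation.Unary.All using (All; all?; lookup)
  open import Relation.Nullary using (¬_; Dec; yes; no; contradiction)
  open import Relation.Nullary.Decidable using (True; toWitness; False; toWitnessFalse; _→-dec_; _⊎-dec_; ¬?)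
  open import Relation.Binary.PropositionalEquality

  private
    variable
      k t : 𝔾

  -- Write the first as m⁴ + bm²e² + ce⁴ = n² with b = 9k(1 - ι) and c = -30ιk². The second has the
  -- coefficients -2b and b² - 4c. The two are elliptic curves, with origin at e = 0 and at q = 0
  -- respectively, joined by a 2-isogeny.
  Quartic Quartic′ : 𝔾 → 𝔾 → 𝔾 → 𝔾 → Set
  Quartic k m e n = m * m * (m * m) + # 9 * k * (1# - ι) * (m * m) * (e * e) - # 30 * ι * (k * k) * (e * e * (e * e)) ≡ n * n
  Quartic′ k p q n = p * p * (p * p) - # 18 * k * (1# - ι) * (p * p) * (q * q) - # 42 * ι * (k * k) * (q * q * (q * q)) ≡ n * n

  parity-clash : ∀ x {W : Set} → Even x → Odd x → W
  parity-clash x e o = contradiction e (odd-not-even o)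

  coprime-even-odd-ring₁ : ∀ s z t w x y →
    1# - π * (s * z + t * w)
    ≡ - 1# * (s * x + t * y - 1#) + s * (x - π * z) + t * (y - π * w)
  coprime-even-odd-ring₁ = solve-∀ 𝔾-ring

  coprime-even-odd : ∀ {x y} → Coprime x y → Even y → Odd x
  coprime-even-odd {x} {y} (s , t , h) (w , h′) with even-or-odd x
  ... | inj₂ o = o
  ... | inj₁ (z , h″) = parity-clash 1# (s * z + t * w , lin₃ (- 1#) s t h h″ h′ (coprime-even-odd-ring₁ s z t w x y)) (0# , refl)

  cancel-2 : ∀ {x y} → # 2 * x ≡ # 2 * y → x ≡ y
  cancel-2 = *-cancelˡ λ ()

  even-π² : ∀ {x} → Even x → ∃ λ w → x * x ≡ # 2 * ι * (w * w)
  even-π² {x} (w , h) = w , lin₁ (x + π * w) h (solve (x ∷ w ∷ []) 𝔾-ring)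

  even-fourth : ∀ {x} → Even x → ∃ λ w → x * x * (x * x) ≡ # 4 * w
  even-fourth {x} (w , h) = - (w * w * (w * w)) , lin₁ ((x + π * w) * (x * x + π * π * (w * w))) h (solve (x ∷ w ∷ []) 𝔾-ring)

  -- A + n = πx and A - n = πy, where xy and x + y are both even, so x and y are even. This leaves A
  -- = a + b with ab = 2w. As A is odd, one of a, b is odd, hence prime to 2, and the other is
  -- divisible by 2.
  halves : ∀ {A n w} → Odd A → A * A - n * n ≡ # 8 * w → ∃ λ f₁ → ∃ λ f₂ → Odd f₁ × (A ≡ f₁ + # 2 * f₂) × (f₁ * f₂ ≡ w)
  halves {A} {n} {w} o h = go even-sum even-diff
    where
    n-odd : Odd n
    n-odd with even-or-odd n
    ... | inj₂ odd = odd
    ... | inj₁ (z , h′) = parity-clash (A * A) (π * z * z + # 4 * (1# - ι) * w , lin₂ 1# (n + π * z) h h′ (solve (A ∷ n ∷ w ∷ z ∷ []) 𝔾-ring)) (odd-* o o)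
    even-sum : Even (A + n)
    even-sum = odd-+-odd o n-odd
    even-diff : Even (A - n)
    even-diff = subst Even (l A n) (even-+ even-sum (- (1# - ι) * n , l′ n))
      where
      l : ∀ A n → A + n + - # 2 * n ≡ A - n
      l = solve-∀ 𝔾-ring
      l′ : ∀ n → - # 2 * n ≡ π * (- (1# - ι) * n)
      l′ = solve-∀ 𝔾-ring
    go : Even (A + n) → Even (A - n) → ∃ λ f₁ → ∃ λ f₂ → Odd f₁ × (A ≡ f₁ + # 2 * f₂) × (f₁ * f₂ ≡ w)
    go (x , hx) (y , hy) = with-x (even-or-odd x) (even-or-odd y)
      where
      xy≡ : x * y ≡ - # 4 * ι * w
      xy≡ = *-cancelˡ {# 2 * ι} (λ ()) (lin₃ 1# (- (A - n)) (- π * x) h hx hy (solve (A ∷ n ∷ w ∷ x ∷ y ∷ []) 𝔾-ring))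
      x+y≡ : x + y ≡ (1# - ι) * A
      x+y≡ = *-cancelˡ {π} (λ ()) (lin₂ (- 1#) (- 1#) hx hy (solve (A ∷ n ∷ x ∷ y ∷ []) 𝔾-ring))
      sum-even : Even (x + y)
      sum-even = - ι * A , lin₁ 1# x+y≡ (solve (A ∷ x ∷ y ∷ []) 𝔾-ring)
      finish : ∀ {x y} → Even x → Even y → x * y ≡ - # 4 * ι * w → x + y ≡ (1# - ι) * A →
        ∃ λ f₁ → ∃ λ f₂ → Odd f₁ × (A ≡ f₁ + # 2 * f₂) × (f₁ * f₂ ≡ w)
      finish {x} {y} (x′ , hx′) (y′ , hy′) xy≡ x+y≡ = cases (even-or-odd (ι * x′)) (even-or-odd (ι * y′))
        where
        a b : 𝔾
        a = ι * x′
        b = ι * y′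
        a+b≡A : ι * x′ + ι * y′ ≡ A
        a+b≡A = *-cancelˡ {1# - ι} (λ ()) (lin₃ 1# (- 1#) (- 1#) x+y≡ hx′ hy′ (solve (A ∷ x ∷ y ∷ x′ ∷ y′ ∷ []) 𝔾-ring))
        ab≡2w : (ι * x′) * (ι * y′) ≡ # 2 * w
        ab≡2w = cancel-2 (lin₃ ι (- ι * y) (- ι * (π * x′)) xy≡ hx′ hy′ (solve (w ∷ x ∷ y ∷ x′ ∷ y′ ∷ []) 𝔾-ring))
        result : ∀ {a b} → a + b ≡ A → a * b ≡ # 2 * w → Odd a → ∃ λ f₁ → ∃ λ f₂ → Odd f₁ × (A ≡ f₁ + # 2 * f₂) × (f₁ * f₂ ≡ w)
        result {a} {b} s p oa = half (coprime⇒∣ {# 2} {a} {b} (odd-coprime-2 oa) (w , p))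
          where
          half : # 2 ∣ b → ∃ λ f₁ → ∃ λ f₂ → Odd f₁ × (A ≡ f₁ + # 2 * f₂) × (f₁ * f₂ ≡ w)
          half (f , hb) = a , f , oa , lin₂ (- 1#) 1# s hb (solve (A ∷ a ∷ b ∷ f ∷ []) 𝔾-ring) ,
            cancel-2 (lin₂ 1# (- a) p hb (solve (w ∷ a ∷ b ∷ f ∷ []) 𝔾-ring))
        comm₊ : ∀ a b → b + a ≡ a + b
        comm₊ = solve-∀ 𝔾-ring
        comm* : ∀ a b → b * a ≡ a * b
        comm* = solve-∀ 𝔾-ring
        cases : Even a ⊎ Odd a → Even b ⊎ Odd b → ∃ λ f₁ → ∃ λ f₂ → Odd f₁ × (A ≡ f₁ + # 2 * f₂) × (f₁ * f₂ ≡ w)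
        cases (inj₂ oa) _ = result a+b≡A ab≡2w oa
        cases _ (inj₂ ob) = result (trans (comm₊ a b) a+b≡A) (trans (comm* a b) ab≡2w) ob
        cases (inj₁ ea) (inj₁ eb) = contradiction (subst Even a+b≡A (even-+ ea eb)) (odd-not-even o)
      with-x : Even x ⊎ Odd x → Even y ⊎ Odd y → ∃ λ f₁ → ∃ λ f₂ → Odd f₁ × (A ≡ f₁ + # 2 * f₂) × (f₁ * f₂ ≡ w)
      with-x (inj₁ ex) (inj₁ ey) = finish ex ey xy≡ x+y≡
      with-x (inj₁ ex) (inj₂ oy) = contradiction (subst Even (l x y) sum-even) (odd-not-even (odd-+ oy ex))
        where
        l : ∀ x y → x + y ≡ y + x
        l = solve-∀ 𝔾-ring
      with-x (inj₂ ox) (inj₁ ey) = contradiction sum-even (odd-not-even (odd-+ ox ey))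
      with-x (inj₂ ox) (inj₂ oy) = contradiction (- # 2 * ι * (1# - ι) * w , trans xy≡ (l w)) (odd-not-even (odd-* ox oy))
        where
        l : ∀ w → - # 4 * ι * w ≡ π * (- # 2 * ι * (1# - ι) * w)
        l = solve-∀ 𝔾-ring

  three-step : ∀ {e z} → # 30 * ι * (e * e * (e * e)) ≡ # 9 * z → # 3 ∣ e
  three-step {e} {z} h = prime-∣sq {# 3} {e} prime-3 (prime-∣sq {# 3} {e * e} prime-3 (- ι * z - # 3 * (e * e * (e * e)) ,
    *-cancelˡ {# 3} (λ ()) (lin₁ (- ι) h (solve (e ∷ z ∷ []) 𝔾-ring))))

  three-step′ : ∀ {e z} → # 42 * ι * (e * e * (e * e)) ≡ # 9 * z → # 3 ∣ e
  three-step′ {e} {z} h = prime-∣sq {# 3} {e} prime-3 (prime-∣sq {# 3} {e * e} prime-3 (ι * z + # 5 * (e * e * (e * e)) ,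
    *-cancelˡ {# 3} (λ ()) (lin₁ ι h (solve (e ∷ z ∷ []) 𝔾-ring))))

  three-∣ : ∀ {x y} → # 3 ∣ x → x ≡ y → # 3 ∣ y
  three-∣ h refl = h

  -- 3 ∣ m makes the 3-adic valuation of the left-hand side odd unless 3 ∣ e.
  three-free-ring₁ : ∀ e m′ w v →
    # 30 * ι * (e * e * (e * e)) - # 9 * (m′ * m′ * (m′ * m′) + # 3 * (1# - ι) * (m′ * m′) * (e * e) -
      w * w)
    ≡ 1# * (v * v - # 3 * (# 3 * (m′ * m′ * (m′ * m′)) + # 9 * (1# - ι) * (m′ * m′) * (e * e) - # 10 *
      ι * (e * e * (e * e)))) + - (v + # 3 * w) * (v - # 3 * w)
  three-free-ring₁ = solve-∀ 𝔾-ring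

  three-free : ∀ {m e n} → Twist k t → Coprime m e → Quartic k m e n → Coprime m (# 3)
  three-free {m = m} {e} {n} K cop h with proj₂ prime-3 m
  ... | inj₂ c = coprime-sym {# 3} {m} c
  ... | inj₁ (m′ , hm) = contradiction (divides K h) (prime-common {# 3} {m} {e} prime-3 cop (m′ , hm))
    where
    divides : Twist k t → Quartic k m e n → # 3 ∣ e
    divides one h = first (prime-∣sq {# 3} {n} prime-3
      (# 27 * (m′ * m′ * (m′ * m′)) + # 27 * (1# - ι) * (m′ * m′) * (e * e) - # 10 * ι * (e * e * (e * e)) ,
        lin₂ (- 1#) ((m + # 3 * m′) * (m * m + # 9 * (m′ * m′) + # 9 * (1# - ι) * (e * e))) h hm (solve (m ∷ e ∷ n ∷ m′ ∷ []) 𝔾-ring)))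
      where
      first : # 3 ∣ n → # 3 ∣ e
      first (v , hn) = three-step {e} {# 9 * (m′ * m′ * (m′ * m′)) + # 9 * (1# - ι) * (m′ * m′) * (e * e) - v * v}
        (lin₃ (- 1#) ((m + # 3 * m′) * (m * m + # 9 * (m′ * m′) + # 9 * (1# - ι) * (e * e))) (- (n + # 3 * v)) h hm hn (solve (m ∷ e ∷ n ∷ m′ ∷ v ∷ []) 𝔾-ring))
    -- For k = 3 the coefficients carry further powers of 3, so n has to be divided by 3 twice.
    divides three h = first (prime-∣sq {# 3} {n} prime-3
      (# 27 * (m′ * m′ * (m′ * m′)) + # 81 * (1# - ι) * (m′ * m′) * (e * e) - # 90 * ι * (e * e * (e * e)) ,
        lin₂ (- 1#) ((m + # 3 * m′) * (m * m + # 9 * (m′ * m′) + # 27 * (1# - ι) * (e * e))) h hm (solve (m ∷ e ∷ n ∷ m′ ∷ []) 𝔾-ring)))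
      where
      first : # 3 ∣ n → # 3 ∣ e
      first (v , hn) = second (prime-∣sq {# 3} {v} prime-3 (# 3 * (m′ * m′ * (m′ * m′)) + # 9 * (1# - ι) * (m′ * m′) * (e * e) - # 10 * ι * (e * e * (e * e)) , hv))
        where
        hv : v * v ≡ # 3 * (# 3 * (m′ * m′ * (m′ * m′)) + # 9 * (1# - ι) * (m′ * m′) * (e * e) - # 10 * ι * (e * e * (e * e)))
        hv = *-cancelˡ {# 9} (λ ()) (lin₃ (- 1#) ((m + # 3 * m′) * (m * m + # 9 * (m′ * m′) + # 27 * (1# - ι) * (e * e))) (- (n + # 3 * v)) h hm hn (solve (m ∷ e ∷ n ∷ m′ ∷ v ∷ []) 𝔾-ring))
        second : # 3 ∣ v → # 3 ∣ e
        second (w , hw) = three-step {e} {m′ * m′ * (m′ * m′) + # 3 * (1# - ι) * (m′ * m′) * (e * e) - w * w}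
          (lin₂ 1# (- (v + # 3 * w)) hv hw (three-free-ring₁ e m′ w v))

  three-free′-ring₁ : ∀ q p′ w v →
    # 42 * ι * (q * q * (q * q)) - # 9 * (p′ * p′ * (p′ * p′) - # 6 * (1# - ι) * (p′ * p′) * (q * q) -
      w * w)
    ≡ 1# * (v * v - # 3 * (# 3 * (p′ * p′ * (p′ * p′)) - # 18 * (1# - ι) * (p′ * p′) * (q * q) - # 14
      * ι * (q * q * (q * q)))) + - (v + # 3 * w) * (v - # 3 * w)
  three-free′-ring₁ = solve-∀ 𝔾-ring

  three-free′ : ∀ {p q n} → Twist k t → Coprime p q → Quartic′ k p q n → Coprime p (# 3)
  three-free′ {p = p} {q} {n} K cop h with proj₂ prime-3 p
  ... | inj₂ c = coprime-sym {# 3} {p} c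
  ... | inj₁ (p′ , hp) = contradiction (divides K h) (prime-common {# 3} {p} {q} prime-3 cop (p′ , hp))
    where
    divides : Twist k t → Quartic′ k p q n → # 3 ∣ q
    divides one h = first (prime-∣sq {# 3} {n} prime-3
      (# 27 * (p′ * p′ * (p′ * p′)) - # 54 * (1# - ι) * (p′ * p′) * (q * q) - # 14 * ι * (q * q * (q * q)) ,
        lin₂ (- 1#) ((p + # 3 * p′) * (p * p + # 9 * (p′ * p′) - # 18 * (1# - ι) * (q * q))) h hp (solve (p ∷ q ∷ n ∷ p′ ∷ []) 𝔾-ring)))
      where
      first : # 3 ∣ n → # 3 ∣ q
      first (v , hn) = three-step′ {q} {# 9 * (p′ * p′ * (p′ * p′)) - # 18 * (1# - ι) * (p′ * p′) * (q * q) - v * v}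
        (lin₃ (- 1#) ((p + # 3 * p′) * (p * p + # 9 * (p′ * p′) - # 18 * (1# - ι) * (q * q))) (- (n + # 3 * v)) h hp hn (solve (p ∷ q ∷ n ∷ p′ ∷ v ∷ []) 𝔾-ring))
    divides three h = first (prime-∣sq {# 3} {n} prime-3
      (# 27 * (p′ * p′ * (p′ * p′)) - # 162 * (1# - ι) * (p′ * p′) * (q * q) - # 126 * ι * (q * q * (q * q)) ,
        lin₂ (- 1#) ((p + # 3 * p′) * (p * p + # 9 * (p′ * p′) - # 54 * (1# - ι) * (q * q))) h hp (solve (p ∷ q ∷ n ∷ p′ ∷ []) 𝔾-ring)))
      where
      first : # 3 ∣ n → # 3 ∣ q
      first (v , hn) = second (prime-∣sq {# 3} {v} prime-3 (# 3 * (p′ * p′ * (p′ * p′)) - # 18 * (1# - ι) * (p′ * p′) * (q * q) - # 14 * ι * (q * q * (q * q)) , hv))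
        where
        hv : v * v ≡ # 3 * (# 3 * (p′ * p′ * (p′ * p′)) - # 18 * (1# - ι) * (p′ * p′) * (q * q) - # 14 * ι * (q * q * (q * q)))
        hv = *-cancelˡ {# 9} (λ ()) (lin₃ (- 1#) ((p + # 3 * p′) * (p * p + # 9 * (p′ * p′) - # 54 * (1# - ι) * (q * q))) (- (n + # 3 * v)) h hp hn (solve (p ∷ q ∷ n ∷ p′ ∷ v ∷ []) 𝔾-ring))
        second : # 3 ∣ v → # 3 ∣ q
        second (w , hw) = three-step′ {q} {p′ * p′ * (p′ * p′) - # 6 * (1# - ι) * (p′ * p′) * (q * q) - w * w}
          (lin₂ 1# (- (v + # 3 * w)) hv hw (three-free′-ring₁ q p′ w v))

-- Descent through the first isogeny.

module DescentA where

  open Euclid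
  open Gauss
  open GaussTools
  open Divisors
  open Quartic
  open import Data.Nat as ℕ using (ℕ; zero; suc)
  import Data.Nat.Properties as ℕ
  open import Data.Product using (∃; _×_; _,_; proj₁; proj₂)
  open import Data.Sum using (_⊎_; inj₁; inj₂)
  open import Data.List using (List; _∷_; [])
  open import Data.List.Membership.Propositional using (_∈_)
  open import Data.List.Membership.DecPropositional _≟_ using (_∈?_)
  open import Data.List.Relation.Unary.Any using (here; there)
  open import Data.List.Relation.Unary.All using (All; all?; lookup)
  open import Relation.Nullary using (¬_; Dec; yes; no; contradiction)
  open import Relation.Nullary.Decidable using (True; toWitness; False; toWitnessFalse; from-yes; _→-dec_; _⊎-dec_; ¬?)
  open import Relation.Binary.PropositionalEquality

  private
    variable
      k t : 𝔾

  twist-coprime : ∀ {s} → Twist k t → Coprime s (# 3) → Coprime s k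
  twist-coprime {s = s} one _ = coprime-sym {# 1} {s} (unit⇒coprime {# 1} {s} (1# , refl))
  twist-coprime three c = c

  coprime-cofactor : ∀ {s e} u → IsUnit u → Twist k t → Coprime s (# 3) → Coprime s e → Coprime s (u * # 3 * (k * k) * (e * e * (e * e)))
  coprime-cofactor {k = k} {s = s} {e} u unit K s-3 s-e =
    coprime-*ʳ {s} {u * # 3 * (k * k)} {e * e * (e * e)}
      (coprime-*ʳ {s} {u * # 3} {k * k} (coprime-*ʳ {s} {u} {# 3} (coprime-sym {u} {s} (unit⇒coprime {u} {s} unit)) s-3)
        (coprime-*ʳ {s} {k} {k} s-k s-k))
      (coprime-*ʳ {s} {e * e} {e * e} s-ee s-ee)
    where
    s-k : Coprime s k
    s-k = twist-coprime K s-3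
    s-ee : Coprime s (e * e)
    s-ee = coprime-*ʳ {s} {e} {e} s-e s-e

  PlusMinusMod : 𝔾 → 𝔾 → 𝔾 → Set
  PlusMinusMod M a d = (M ∣ d - a) ⊎ (M ∣ d + a)

  plusMinusMod? : ∀ M a d → M ≢ 0# → Dec (PlusMinusMod M a d)
  plusMinusMod? M a d M≢0 = ∣-dec M (d - a) M≢0 ⊎-dec ∣-dec M (d + a) M≢0

  plusMinusOne⇒mod : ∀ {d} → PlusMinusOne d → PlusMinusMod (# 4 * π) 1# d
  plusMinusOne⇒mod {d} (inj₁ (z , h)) = inj₁ (z , lin₁ 1# h (solve (d ∷ z ∷ []) 𝔾-ring))
  plusMinusOne⇒mod {d} (inj₂ (z , h)) = inj₂ (z , lin₁ 1# h (solve (d ∷ z ∷ []) 𝔾-ring))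

  class-search? : ∀ {P : 𝔾 → Set} → (∀ d → Dec (P d)) → (cs : List 𝔾) → Dec (All (λ c → All (λ ε → P (c * ε)) units) cs)
  class-search? P? = all? (λ c → all? (λ ε → P? (c * ε)) units)

  class-search : ∀ {P : 𝔾 → 𝔾 → 𝔾 → Set} (P? : ∀ k t d → Dec (P k t d)) ρ {d} → Twist k t →
    {True (class-search? (P? (# 1) (# 3)) (1# ∷ ρ ∷ # 3 ∷ # 3 * ρ ∷ []))} →
    {True (class-search? (P? (# 3) (# 27)) (1# ∷ ρ ∷ # 27 ∷ # 27 * ρ ∷ []))} →
    Class ρ t d → P k t d
  class-search {P = P} P? ρ one {w} (class c∈ ε∈ d≡) = subst (P _ _) (sym d≡) (lookup (lookup (toWitness w) c∈) ε∈)
  class-search {P = P} P? ρ three {_} {w} (class c∈ ε∈ d≡) = subst (P _ _) (sym d≡) (lookup (lookup (toWitness w) c∈) ε∈)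

  -- A sieve through the sixteen candidates: for either twist only these can be ±1 modulo 4π.
  signs-7 : ∀ {d} → Twist k t → Class (# 7) t d → PlusMinusMod (# 4 * π) 1# d → d ∈ (1# ∷ - 1# ∷ # 7 ∷ - # 7 ∷ [])
  signs-7 K = class-search (λ _ _ d → plusMinusMod? (# 4 * π) 1# d (λ ()) →-dec (d ∈? (1# ∷ - 1# ∷ # 7 ∷ - # 7 ∷ []))) (# 7) K

  signs : List 𝔾
  signs = 1# ∷ - 1# ∷ []

  SquareModθ : 𝔾 → Set
  SquareModθ x = θ ∣ x ⊎ (θ ∣ x * x - 1# ⊎ θ ∣ x * x - - 1#)

  -- ℤ[i]/θ is the field with five elements, whose nonzero squares are ±1; the remainders of norm
  -- below 5 are searched.
  square-mod-θ : ∀ x → SquareModθ x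
  square-mod-θ x = go (divide x θ (λ ()))
    where
    P? : ∀ r → Dec (SquareModθ r)
    P? r = ∣-dec θ r (λ ()) ⊎-dec (∣-dec θ (r * r - 1#) (λ ()) ⊎-dec ∣-dec θ (r * r - - 1#) (λ ()))
    small : ∀ n r → norm r ≡ n → n ℕ.< 5 → SquareModθ r
    small 0 r e _ = norm-search 0 P? r e
    small 1 r e _ = norm-search 1 P? r e
    small 2 r e _ = norm-search 2 P? r e
    small 3 r e _ = norm-search 3 P? r e
    small 4 r e _ = norm-search 4 P? r e
    small (suc (suc (suc (suc (suc _))))) _ _ (ℕ.s≤s (ℕ.s≤s (ℕ.s≤s (ℕ.s≤s (ℕ.s≤s ())))))
    go : (∃ λ q → ∃ λ r → (x ≡ r + q * θ) × (norm r ℕ.< norm θ)) → SquareModθ x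
    go (q , r , h , r<) = transfer (small (norm r) r refl r<)
      where
      transfer : SquareModθ r → SquareModθ x
      transfer (inj₁ (w , e)) = inj₁ (w + q , lin₂ 1# 1# h e (solve (x ∷ q ∷ r ∷ w ∷ []) 𝔾-ring))
      transfer (inj₂ (inj₁ (w , e))) = inj₂ (inj₁ (w + # 2 * q * r + θ * q * q , lin₂ (x + r + q * θ) 1# h e (solve (x ∷ q ∷ r ∷ w ∷ []) 𝔾-ring)))
      transfer (inj₂ (inj₂ (w , e))) = inj₂ (inj₂ (w + # 2 * q * r + θ * q * q , lin₂ (x + r + q * θ) 1# h e (solve (x ∷ q ∷ r ∷ w ∷ []) 𝔾-ring)))

  non-residue-table : All (λ c → All (λ σ → All (λ τ → ¬ (θ ∣ c * σ - τ)) (0# ∷ signs)) signs) (# 7 ∷ - # 7 ∷ [])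
  non-residue-table = from-yes (all? (λ c → all? (λ σ → all? (λ τ → ¬? (∣-dec θ (c * σ - τ) (λ ()))) (0# ∷ signs)) signs) (# 7 ∷ - # 7 ∷ []))

  -- ±7 is ±2 modulo θ, a non-residue in the field with five elements.
  non-residue : ∀ {c m X w} → c ∈ (# 7 ∷ - # 7 ∷ []) → c * (m * m) ≡ X * X + θ * w → θ ∣ m
  non-residue {c} {m} {X} {w} c∈ h = with-m (square-mod-θ m)
    where
    clash : ∀ {σ τ} → σ ∈ signs → τ ∈ (0# ∷ signs) → θ ∣ m * m - σ → θ ∣ X * X - τ → θ ∣ m
    clash {σ} {τ} σ∈ τ∈ (a , ha) (b , hb) = contradiction divides (lookup (lookup (lookup non-residue-table c∈) σ∈) τ∈)
      where
      divides : θ ∣ c * σ - τ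
      divides = b + w - c * a , lin₃ (- c) 1# 1# ha hb h (solve (c ∷ m ∷ X ∷ w ∷ σ ∷ τ ∷ a ∷ b ∷ []) 𝔾-ring)
    with-X : ∀ {σ} → σ ∈ signs → θ ∣ m * m - σ → SquareModθ X → θ ∣ m
    with-X σ∈ hσ (inj₁ (a , ha)) = clash σ∈ (here refl) hσ (X * a , lin₁ X ha (solve (X ∷ a ∷ []) 𝔾-ring))
    with-X σ∈ hσ (inj₂ (inj₁ hX)) = clash σ∈ (there (here refl)) hσ hX
    with-X σ∈ hσ (inj₂ (inj₂ hX)) = clash σ∈ (there (there (here refl))) hσ hX
    with-m : SquareModθ m → θ ∣ m
    with-m (inj₁ h) = h
    with-m (inj₂ (inj₁ h)) = with-X (here refl) h (square-mod-θ X)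
    with-m (inj₂ (inj₂ h)) = with-X (there (here refl)) h (square-mod-θ X)

  θ∤-twist : Twist k t → ¬ (θ ∣ # 24 * θ̄ * ι * (k * k))
  θ∤-twist one = toWitnessFalse {a? = ∣-dec θ _ λ ()} _
  θ∤-twist three = toWitnessFalse {a? = ∣-dec θ _ λ ()} _

  no-seven-ring₁ : ∀ k q c a b m X →
    θ * (# 24 * θ̄ * ι * (k * k) * (q * q * (q * q))) - θ * (θ * (c * a * a - b * b))
    ≡ - 1# * (c * (m * m) - (X * X + θ * (# 24 * θ̄ * ι * (k * k) * (q * q * (q * q))))) + c * (m + θ
      * a) * (m - θ * a) + - (X + θ * b) * (X - θ * b)
  no-seven-ring₁ = solve-∀ 𝔾-ring

  -- θ divides 120 exactly once. It divides m by `non-residue`, then X, so θ² divides 120ιk²q⁴.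
  -- Hence θ divides q, and with it e, which is prime to m.
  no-seven : ∀ {m e c X q} → Twist k t → Coprime m e → q ∣ e → c ∈ (# 7 ∷ - # 7 ∷ []) →
    ¬ (c * (m * m) ≡ X * X + # 120 * ι * (k * k) * (q * q * (q * q)))
  no-seven {k = k} {m = m} {e} {c} {X} {q} K cop q∣e c∈ h = go (non-residue {c} {m} {X} {# 24 * θ̄ * ι * (k * k) * (q * q * (q * q))} c∈ h′)
    where
    h′ : c * (m * m) ≡ X * X + θ * (# 24 * θ̄ * ι * (k * k) * (q * q * (q * q)))
    h′ = lin₁ 1# h (solve (c ∷ m ∷ X ∷ k ∷ q ∷ []) 𝔾-ring)
    go : ¬ (θ ∣ m)
    go (a , ha) = θ∣X⇒ (prime-∣sq {θ} {X} prime-θ (c * a * m - # 24 * θ̄ * ι * (k * k) * (q * q * (q * q)) , lin₂ (- 1#) (c * m) h′ ha (solve (c ∷ m ∷ a ∷ X ∷ k ∷ q ∷ []) 𝔾-ring)))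
      where
      θ∣X⇒ : ¬ (θ ∣ X)
      θ∣X⇒ (b , hb) = θ∣q⇒ (prime-∣* {θ} {# 24 * θ̄ * ι * (k * k)} {q * q * (q * q)} prime-θ (c * a * a - b * b ,
        *-cancelˡ {θ} (λ ()) (lin₃ (- 1#) (c * (m + θ * a)) (- (X + θ * b)) h′ ha hb (no-seven-ring₁ k q c a b m X))))
        where
        θ∣q⇒ : ¬ (θ ∣ # 24 * θ̄ * ι * (k * k) ⊎ θ ∣ q * q * (q * q))
        θ∣q⇒ (inj₁ d) = θ∤-twist K d
        θ∣q⇒ (inj₂ d) = prime-common {θ} {m} {e} prime-θ cop (a , ha)
          (∣-trans {θ} {q} {e} (prime-∣sq {θ} {q} prime-θ (prime-∣sq {θ} {q * q} prime-θ d)) q∣e)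

  descent₁-ring₁ : ∀ A n k e₀ m e →
    A * A - n * n - # 8 * (- ι * # 21 * (k * k) * (e₀ * e₀ * (e₀ * e₀)))
    ≡ (A + m * m + # 18 * k * (1# - ι) * e₀ * e₀) * (A - (m * m + # 18 * k * (1# - ι) * e₀ * e₀)) + 1#
      * (m * m * (m * m) + # 9 * k * (1# - ι) * (m * m) * (e * e) - # 30 * ι * (k * k) * (e * e * (e *
      e)) - n * n) + - (# 9 * k * (1# - ι) * (m * m) * (e + # 2 * e₀) - # 30 * ι * (k * k) * (e + # 2
      * e₀) * (e * e + # 4 * (e₀ * e₀))) * (e - # 2 * e₀)
  descent₁-ring₁ = solve-∀ 𝔾-ring

  descent₁-ring₂ : ∀ k e₀ t →
    - ι * # 21 * (k * k) * (e₀ * e₀ * (e₀ * e₀)) - t * (# 7 * - ι) * (e₀ * e₀ * (e₀ * e₀))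
    ≡ - (# 7 * - ι * (e₀ * e₀ * (e₀ * e₀))) * (t - # 3 * (k * k))
  descent₁-ring₂ = solve-∀ 𝔾-ring

  descent₁-ring₃ : ∀ m d₁ p k q d₂ A f₁ f₂ e₀ →
    m * m - (d₁ * (p * p * (p * p)) - # 18 * k * (1# - ι) * (p * p) * (q * q) + # 2 * d₂ * (q * q * (q
      * q))) - (1# * (A - (f₁ + # 2 * f₂)) + 1# * (f₁ - d₁ * (p * p * (p * p))) + # 2 * (f₂ - d₂ * (q
      * q * (q * q))))
    ≡ - 1# * (A - (m * m + # 18 * k * (1# - ι) * e₀ * e₀)) + - (# 18 * k * (1# - ι)) * (e₀ + p * q) *
      (e₀ - p * q)
  descent₁-ring₃ = solve-∀ 𝔾-ring

  descent₁-ring₄ : ∀ d₁ d₂ k t →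
    d₁ * d₂ - - ι * # 21 * (k * k)
    ≡ 1# * (d₁ * d₂ - t * (# 7 * - ι)) + # 7 * - ι * (t - # 3 * (k * k))
  descent₁-ring₄ = solve-∀ 𝔾-ring

  descent₁-ring₅ : ∀ d₁ a k p w d₂ z m q →
    d₁ - (1# + # 4 * π * (a + # 9 * k * (p * p * (w * w)) + (1# - ι) * d₂ * (w * w * (w * w)) - # 2 *
      d₁ * z)) - (- 1# * (m * m - (d₁ * (p * p * (p * p)) - # 18 * k * (1# - ι) * (p * p) * (q * q) +
      # 2 * d₂ * (q * q * (q * q)))) + 1# * (m * m - (1# + # 4 * π * a)) + - d₁ * (p * p * (p * p) -
      (1# + # 8 * π * z)))
    ≡ (# 18 * k * (1# - ι) * (p * p) * (q + π * w) - # 2 * d₂ * (q + π * w) * (q * q + π * π * (w *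
      w))) * (q - π * w)
  descent₁-ring₅ = solve-∀ 𝔾-ring

  descent₁-ring₆ : ∀ d₁ a k p w d₂ z m q →
    d₁ - (- 1# + # 4 * π * (a + # 9 * k * (p * p * (w * w)) + (1# - ι) * d₂ * (w * w * (w * w)) - # 2
      * d₁ * z)) - (- 1# * (m * m - (d₁ * (p * p * (p * p)) - # 18 * k * (1# - ι) * (p * p) * (q * q)
      + # 2 * d₂ * (q * q * (q * q)))) + 1# * (m * m - (- 1# + # 4 * π * a)) + - d₁ * (p * p * (p * p)
      - (1# + # 8 * π * z)))
    ≡ (# 18 * k * (1# - ι) * (p * p) * (q + π * w) - # 2 * d₂ * (q + π * w) * (q * q + π * π * (w *
      w))) * (q - π * w)
  descent₁-ring₆ = solve-∀ 𝔾-ring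

  descent₁-ring₇ : ∀ d₁ m p k q d₂ →
    d₁ * (m * m) - ((d₁ * (p * p) - # 9 * k * (1# - ι) * (q * q)) * (d₁ * (p * p) - # 9 * k * (1# - ι)
      * (q * q)) + # 120 * ι * (k * k) * (q * q * (q * q)))
    ≡ d₁ * (m * m - (d₁ * (p * p * (p * p)) - # 18 * k * (1# - ι) * (p * p) * (q * q) + # 2 * d₂ * (q
      * q * (q * q)))) + # 2 * (q * q * (q * q)) * (d₁ * d₂ - - ι * # 21 * (k * k))
  descent₁-ring₇ = solve-∀ 𝔾-ring

  descent₁-ring₈ : ∀ p k q m d₁ d₂ →
    p * p * (p * p) - # 18 * k * (1# - ι) * (p * p) * (q * q) - # 42 * ι * (k * k) * (q * q * (q * q))
      - m * m
    ≡ - 1# * (m * m - (d₁ * (p * p * (p * p)) - # 18 * k * (1# - ι) * (p * p) * (q * q) + # 2 * d₂ *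
      (q * q * (q * q)))) + - (# 2 * (q * q * (q * q))) * (d₁ * d₂ - - ι * # 21 * (k * k)) + (- (p * p
      * (p * p)) + # 2 * (q * q * (q * q)) * d₂) * (d₁ - 1#)
  descent₁-ring₈ = solve-∀ 𝔾-ring

  descent₁-ring₉ : ∀ p k q m d₁ d₂ →
    p * p * (p * p) - # 18 * k * (1# - ι) * (p * p) * (ι * q * (ι * q)) - # 42 * ι * (k * k) * (ι * q
      * (ι * q) * (ι * q * (ι * q))) - ι * m * (ι * m)
    ≡ 1# * (m * m - (d₁ * (p * p * (p * p)) - # 18 * k * (1# - ι) * (p * p) * (q * q) + # 2 * d₂ * (q
      * q * (q * q)))) + - (# 2 * (q * q * (q * q))) * (d₁ * d₂ - - ι * # 21 * (k * k)) + (p * p * (p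
      * p) + # 2 * (q * q * (q * q)) * d₂) * (d₁ - - 1#)
  descent₁-ring₉ = solve-∀ 𝔾-ring

  -- A preimage, under the isogeny, of a point near the origin. Completing the square with A = m² +
  -- 18k(1 - ι)e₀² turns the quartic into A² - n² = -168ιk²e₀⁴. By `halves`, A = f₁ + 2f₂ with f₁f₂
  -- = -21ιk²e₀⁴, and coprimality gives f₁ = d₁p⁴ and f₂ = d₂q⁴. All d₁ except ±1 are excluded
  -- locally, at π or at θ; for d₁ = ±1 the resulting formula for m² is the quartic of the isogenous
  -- curve.
  descent₁ : ∀ {m e n e₀} → Twist k t → Quartic k m e n → Coprime m e → e ≡ # 2 * e₀ → Even e₀ → e₀ ≢ 0# →
    ∃ λ p → ∃ λ q → ∃ λ M → ∃ λ o → Quartic′ k p q M × Coprime p q × Odd o × (e₀ ≡ q * o)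
  descent₁ {k} {t} {m} {e} {n} {e₀} K h cop e≡ even e₀≢0 = complete-square _ refl
    where
    Goal : Set
    Goal = ∃ λ p → ∃ λ q → ∃ λ M → ∃ λ o → Quartic′ k p q M × Coprime p q × Odd o × (e₀ ≡ q * o)
    complete-square : ∀ A → A ≡ m * m + # 18 * k * (1# - ι) * e₀ * e₀ → Goal
    complete-square A A-def = go (halves {A} {n} {(- ι) * # 21 * (k * k) * (e₀ * e₀ * (e₀ * e₀))} A-odd A²-n²)
      where
      e₀∣e : e₀ ∣ e
      e₀∣e = # 2 , lin₁ 1# e≡ (solve (e ∷ e₀ ∷ []) 𝔾-ring)
      m-e₀ : Coprime m e₀
      m-e₀ = coprime-sym {e₀} {m} (coprime-∣ {e} {m} {e₀} (coprime-sym {m} {e} cop) e₀∣e)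
      A-e₀ : Coprime A e₀
      A-e₀ = coprime-resp {_} {A} {e₀} (sym A-def) (coprime-+* (m * m) (# 18 * k * (1# - ι) * e₀) e₀ (coprime-* {m} {e₀} {m} m-e₀ m-e₀))
      m-3 : Coprime m (# 3)
      m-3 = three-free {m = m} {e} {n} K cop h
      A-3 : Coprime A (# 3)
      A-3 = coprime-resp {m * m + # 6 * k * (1# - ι) * e₀ * e₀ * # 3} {A} {# 3} (lin₁ (- 1#) A-def (solve (A ∷ m ∷ k ∷ e₀ ∷ []) 𝔾-ring))
        (coprime-+* (m * m) (# 6 * k * (1# - ι) * e₀ * e₀) (# 3) (coprime-* {m} {# 3} {m} m-3 m-3))
      m-odd : Odd m
      m-odd = coprime-even-odd m-e₀ even
      A-odd : Odd A
      A-odd = subst Odd (sym A-def) (odd-+ (odd-* m-odd m-odd) (even-*ʳ {e₀} {# 18 * k * (1# - ι) * e₀} even))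
      A²-n² : A * A - n * n ≡ # 8 * ((- ι) * # 21 * (k * k) * (e₀ * e₀ * (e₀ * e₀)))
      A²-n² = lin₃ (A + m * m + # 18 * k * (1# - ι) * e₀ * e₀) 1# (- (# 9 * k * (1# - ι) * (m * m) * (e + # 2 * e₀) - # 30 * ι * (k * k) * (e + # 2 * e₀) * (e * e + # 4 * (e₀ * e₀)))) A-def h e≡ (descent₁-ring₁ A n k e₀ m e)
      go : (∃ λ f₁ → ∃ λ f₂ → Odd f₁ × (A ≡ f₁ + # 2 * f₂) × (f₁ * f₂ ≡ (- ι) * # 21 * (k * k) * (e₀ * e₀ * (e₀ * e₀)))) → Goal
      go (f₁ , f₂ , f₁-odd , A≡ , prod) = split (fourth-split {f₁} {f₂} {t * (# 7 * - ι)} {e₀} e₀≢0 (trans prod (lin₁ (- (# 7 * - ι * (e₀ * e₀ * (e₀ * e₀)))) (t≡3k² K) (descent₁-ring₂ k e₀ t))) f₁-f₂)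
        where
        f₁≢0 : f₁ ≢ 0#
        f₁≢0 refl = odd-not-even f₁-odd (0# , refl)
        f₁-f₂ : Coprime f₁ f₂
        f₁-f₂ = coprime-factors {f₁} {f₂} ((- ι) * # 3 * (k * k) * (e₀ * e₀ * (e₀ * e₀))) (# 7) A 1# (# 2) f₁≢0
          (prime-square-free {# 7} prime-7 (λ ())) (coprime-cofactor {s = A} {e₀} (- ι) (ι , refl) K A-3 A-e₀)
          (lin₁ 1# prod (solve (f₁ ∷ f₂ ∷ k ∷ e₀ ∷ []) 𝔾-ring)) (lin₁ 1# A≡ (solve (A ∷ f₁ ∷ f₂ ∷ []) 𝔾-ring))
        split : (∃ λ d₁ → ∃ λ d₂ → ∃ λ p → ∃ λ q →
          (f₁ ≡ d₁ * (p * p * (p * p))) × (f₂ ≡ d₂ * (q * q * (q * q))) × (d₁ * d₂ ≡ t * (# 7 * - ι)) × (e₀ ≡ p * q)) → Goal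
        split (d₁ , d₂ , p , q , f₁≡ , f₂≡ , d₁d₂≡ , e₀≡) = choose (signs-7 K cls (plusMinusOne⇒mod pm)) refl
          where
          m²≡ : m * m ≡ d₁ * (p * p * (p * p)) - # 18 * k * (1# - ι) * (p * p) * (q * q) + # 2 * d₂ * (q * q * (q * q))
          m²≡ = lin₃ 1# 1# (# 2) A≡ f₁≡ f₂≡ (lin₂ (- 1#) (- (# 18 * k * (1# - ι)) * (e₀ + p * q)) A-def e₀≡ (descent₁-ring₃ m d₁ p k q d₂ A f₁ f₂ e₀))
          dd≡ : d₁ * d₂ ≡ (- ι) * # 21 * (k * k)
          dd≡ = lin₂ 1# (# 7 * - ι) d₁d₂≡ (t≡3k² K) (descent₁-ring₄ d₁ d₂ k t)
          p-odd : Odd p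
          p-odd = odd-*ˡ {p} {p} (odd-*ˡ {p * p} {p * p} (odd-*ʳ {d₁} {p * p * (p * p)} (subst Odd f₁≡ f₁-odd)))
          q-even : Even q
          q-even with even-or-odd q
          ... | inj₁ ev = ev
          ... | inj₂ od = contradiction (subst Even e₀≡ even) (odd-not-even (odd-* p-odd od))
          p-q : Coprime p q
          p-q = coprime-sym {q} {p} (coprime-∣ {f₂} {p} {q} (coprime-sym {p} {f₂} (coprime-∣ {f₁} {f₂} {p} f₁-f₂
            (d₁ * (p * p * p) , lin₁ 1# f₁≡ (solve (f₁ ∷ d₁ ∷ p ∷ []) 𝔾-ring)))) (d₂ * (q * q * q) , lin₁ 1# f₂≡ (solve (f₂ ∷ d₂ ∷ q ∷ []) 𝔾-ring)))
          d₁-d₂ : Coprime d₁ d₂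
          d₁-d₂ = coprime-sym {d₂} {d₁} (coprime-∣ {f₂} {d₁} {d₂} (coprime-sym {d₁} {f₂} (coprime-∣ {f₁} {f₂} {d₁} f₁-f₂ (_ , f₁≡))) (_ , f₂≡))
          cls : Class (# 7) t d₁
          cls = class-of {ρ = # 7} {(- ι)} {d₁} {d₂} K (λ {_} {a} {b} _ _ → split-7 {(- ι)} {a} {b} (ι , refl)) d₁d₂≡ d₁-d₂
          -- Modulo 4π the terms in q² and q⁴ vanish since q is even, and p⁴ ≡ 1, so that d₁ ≡ m² ≡
          -- ±1.
          pm : PlusMinusOne d₁
          pm = combine (odd-sq m-odd) (odd-fourth p-odd) q-even
            where
            combine : PlusMinusOne (m * m) → (∃ λ z → p * p * (p * p) ≡ 1# + # 8 * π * z) → Even q → PlusMinusOne d₁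
            combine (inj₁ (a , ha)) (z , hz) (w , hw) = inj₁
              (a + # 9 * k * (p * p * (w * w)) + (1# - ι) * d₂ * (w * w * (w * w)) - # 2 * d₁ * z ,
                lin₃ (- 1#) 1# (- d₁) m²≡ ha hz (lin₁ (# 18 * k * (1# - ι) * (p * p) * (q + π * w) - # 2 * d₂ * (q + π * w) * (q * q + π * π * (w * w))) hw (descent₁-ring₅ d₁ a k p w d₂ z m q)))
            combine (inj₂ (a , ha)) (z , hz) (w , hw) = inj₂
              (a + # 9 * k * (p * p * (w * w)) + (1# - ι) * d₂ * (w * w * (w * w)) - # 2 * d₁ * z ,
                lin₃ (- 1#) 1# (- d₁) m²≡ ha hz (lin₁ (# 18 * k * (1# - ι) * (p * p) * (q + π * w) - # 2 * d₂ * (q + π * w) * (q * q + π * π * (w * w))) hw (descent₁-ring₆ d₁ a k p w d₂ z m q)))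
          q∣e : q ∣ e
          q∣e = # 2 * p , lin₂ 1# (# 2) e≡ e₀≡ (solve (e ∷ e₀ ∷ p ∷ q ∷ []) 𝔾-ring)
          -- Multiplying by d₁ and completing the square in p² gives the equation of `no-seven`.
          not-seven : d₁ ∈ (# 7 ∷ - # 7 ∷ []) → Goal
          not-seven d∈ = contradiction completed
            (no-seven {m = m} {e} {d₁} {d₁ * (p * p) - # 9 * k * (1# - ι) * (q * q)} {q} K cop q∣e d∈)
            where
            completed : d₁ * (m * m) ≡ (d₁ * (p * p) - # 9 * k * (1# - ι) * (q * q)) * (d₁ * (p * p) - # 9 * k * (1# - ι) * (q * q)) + # 120 * ι * (k * k) * (q * q * (q * q))
            completed = lin₂ d₁ (# 2 * (q * q * (q * q))) m²≡ dd≡ (descent₁-ring₇ d₁ m p k q d₂)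
          choose : ∀ {d} → d ∈ (1# ∷ - 1# ∷ # 7 ∷ - # 7 ∷ []) → d₁ ≡ d → Goal
          choose (here refl) d≡ = p , q , m , p ,
            lin₃ (- 1#) (- (# 2 * (q * q * (q * q)))) (- (p * p * (p * p)) + # 2 * (q * q * (q * q)) * d₂) m²≡ dd≡ d≡ (descent₁-ring₈ p k q m d₁ d₂) ,
            p-q , p-odd , lin₁ 1# e₀≡ (solve (e₀ ∷ p ∷ q ∷ []) 𝔾-ring)
          -- For d₁ = -1, multiply by -1 = ι² and replace q by ιq, which changes the sign of q² and
          -- keeps q⁴.
          choose (there (here refl)) d≡ = p , ι * q , ι * m , - ι * p ,
            lin₃ 1# (- (# 2 * (q * q * (q * q)))) (p * p * (p * p) + # 2 * (q * q * (q * q)) * d₂) m²≡ dd≡ d≡ (descent₁-ring₉ p k q m d₁ d₂) ,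
            coprime-*ʳ {p} {ι} {q} (coprime-sym {ι} {p} (unit⇒coprime {ι} {p} (- ι , refl))) p-q ,
            odd-* {(- ι)} {p} (- 1# , refl) p-odd , lin₁ 1# e₀≡ (solve (e₀ ∷ p ∷ q ∷ []) 𝔾-ring)
          choose (there (there (here refl))) d≡ = not-seven (here d≡)
          choose (there (there (there (here refl)))) d≡ = not-seven (there (here d≡))

-- Divisibility in ℤ and squares modulo 7.

module IntTools where

  open Euclid
  open Gauss using (ℤᴱ)
  open import Data.Integer using (ℤ; +_; -[1+_]; _+_; _*_; -_; _-_; ∣_∣; 0ℤ; 1ℤ)
  import Data.Integer as ℤ
  import Data.Integer.Properties as ℤ
  import Data.Integer.DivMod as ℤ
  open import Data.Integer.Tactic.RingSolver using (solve; solve-∀)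
  open import Data.Nat as ℕ using (ℕ; zero; suc)
  import Data.Nat.Properties as ℕ
  import Data.Nat.Divisibility as ℕ
  open import Data.Product using (∃; _×_; _,_)
  open import Data.Sum using (_⊎_; inj₁; inj₂)
  open import Data.List using (_∷_; [])
  open import Relation.Nullary using (¬_; Dec; yes; no; contradiction)
  open import Relation.Nullary.Decidable using (True; toWitness; False; toWitnessFalse)
  open import Relation.Binary.PropositionalEquality

  private module E = Properties ℤᴱ

  infix 4 _∣_
  _∣_ Coprime : ℤ → ℤ → Set
  x ∣ y = ∃ λ z → y ≡ x * z
  Coprime x y = ∃ λ s → ∃ λ t → s * x + t * y ≡ 1ℤ

  private
    variable
      x y z d : ℤ

  diff-0 : x - y ≡ 0ℤ → x ≡ y
  diff-0 {x} {y} h = ℤ.i-j≡0⇒i≡j x y h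

  lin₁ : ∀ c {a b x y} → a ≡ b → x - y ≡ c * (a - b) → x ≡ y
  lin₁ c {a} refl h = diff-0 (trans h (l c a))
    where
    l : ∀ c a → c * (a - a) ≡ 0ℤ
    l = solve-∀

  lin₂ : ∀ c {a b} d {a′ b′ x y} → a ≡ b → a′ ≡ b′ → x - y ≡ c * (a - b) + d * (a′ - b′) → x ≡ y
  lin₂ c {a} d {a′} refl refl h = diff-0 (trans h (l c a d a′))
    where
    l : ∀ c a d a′ → c * (a - a) + d * (a′ - a′) ≡ 0ℤ
    l = solve-∀

  lin₃ : ∀ c {a b} d {a′ b′} e {a″ b″ x y} → a ≡ b → a′ ≡ b′ → a″ ≡ b″ →
    x - y ≡ c * (a - b) + d * (a′ - b′) + e * (a″ - b″) → x ≡ y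
  lin₃ c {a} d {a′} e {a″} refl refl refl h = diff-0 (trans h (l c a d a′ e a″))
    where
    l : ∀ c a d a′ e a″ → c * (a - a) + d * (a′ - a′) + e * (a″ - a″) ≡ 0ℤ
    l = solve-∀

  *-≢0 : x ≢ 0ℤ → y ≢ 0ℤ → x * y ≢ 0ℤ
  *-≢0 = E.*-≢0

  *≢0ˡ : x * y ≢ 0ℤ → x ≢ 0ℤ
  *≢0ˡ {x} {y} = E.*≢0ˡ {x} {y}

  *≢0ʳ : x * y ≢ 0ℤ → y ≢ 0ℤ
  *≢0ʳ {x} {y} = E.*≢0ʳ {x} {y}

  *-cancelˡ : x ≢ 0ℤ → x * y ≡ x * z → y ≡ z
  *-cancelˡ = E.*-cancelˡ

  coprime-sym : Coprime x y → Coprime y x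
  coprime-sym {x} {y} = E.coprime-sym {x} {y}

  coprime-* : Coprime x z → Coprime y z → Coprime (x * y) z
  coprime-* {x} {z} {y} = E.coprime-* {x} {y} {z}

  coprime-*ʳ : Coprime x y → Coprime x z → Coprime x (y * z)
  coprime-*ʳ {x} {y} {z} c d = coprime-sym {y * z} {x} (coprime-* {y} {x} {z} (coprime-sym {x} {y} c) (coprime-sym {x} {z} d))

  coprime-∣ : Coprime x y → d ∣ x → Coprime d y
  coprime-∣ {x} {y} {d} = E.coprime-∣ {x} {y} {d}

  coprime-∣ʳ : Coprime x y → d ∣ y → Coprime x d
  coprime-∣ʳ {x} {y} {d} c h = coprime-sym {d} {x} (coprime-∣ {y} {x} {d} (coprime-sym {x} {y} c) h)

  coprime⇒∣ : Coprime x y → x ∣ y * z → x ∣ z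
  coprime⇒∣ {x} {y} {z} = E.coprime⇒∣ {x} {y} {z}

  coprime-+* : ∀ x y z → Coprime x z → Coprime (x + y * z) z
  coprime-+* x y z (s , t , h) = s , t - s * y , lin₁ 1ℤ h (solve (x ∷ y ∷ z ∷ s ∷ t ∷ []))

  coprime-resp : x ≡ y → Coprime x z → Coprime y z
  coprime-resp refl c = c

  gcd : ∀ x y → x ≢ 0ℤ → ∃ λ g → ∃ λ x′ → ∃ λ y′ → (x ≡ g * x′) × (y ≡ g * y′) × (g ≢ 0ℤ) × Coprime x′ y′
  gcd x y x≢0 with E.gcd-of x y x≢0
  ... | E.gcd g x′ y′ x≡ y≡ g≢0 c = g , x′ , y′ , x≡ , y≡ , g≢0 , c

  four-numbers : ∀ {u v p q} → u ≢ 0ℤ → u * v ≡ p * q →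
    ∃ λ a → ∃ λ b → ∃ λ c → ∃ λ d →
      (u ≡ a * c) × (v ≡ b * d) × (p ≡ a * b) × (q ≡ c * d) × Coprime b c
  four-numbers {u} {v} {p} {q} = E.four-numbers {u} {v} {p} {q}

  square-split : ∀ {f₁ f₂ D e} → e ≢ 0ℤ → f₁ * f₂ ≡ D * (e * e) → Coprime f₁ f₂ →
    ∃ λ d₁ → ∃ λ d₂ → ∃ λ p → ∃ λ q → (f₁ ≡ d₁ * (p * p)) × (f₂ ≡ d₂ * (q * q)) × (d₁ * d₂ ≡ D) × (e ≡ p * q)
  square-split = E.Square.coprime-split

  residue : ∀ n → .{{_ : ℕ.NonZero n}} → ∀ x → ∃ λ r → ∃ λ q → (r ℕ.< n) × (x ≡ + r + q * + n)
  residue n x = x ℤ.%ℕ n , x ℤ./ℕ n , ℤ.n%ℕd<d x n , ℤ.a≡a%ℕn+[a/ℕn]*n x n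

  sixth-powers : ∀ {x} r q → x ≡ r + q * + 7 →
    ∃ λ w → x * x * x * (x * x * x) ≡ r * r * r * (r * r * r) + + 7 * w
  sixth-powers {x} r q h = q * (x * x * x * x * x + x * x * x * x * r + x * x * x * r * r + x * x * r * r * r + x * r * r * r * r + r * r * r * r * r) ,
    lin₁ (x * x * x * x * x + x * x * x * x * r + x * x * x * r * r + x * x * r * r * r + x * r * r * r * r + r * r * r * r * r) h (solve (x ∷ r ∷ q ∷ []))

  fermat-7 : ∀ x → + 7 ∣ x ⊎ (∃ λ w → x * x * x * (x * x * x) ≡ 1ℤ + + 7 * w)
  fermat-7 x with residue 7 x
  ... | 0 , q , _ , h = inj₁ (q , trans h (l q))
    where
    l : ∀ q → + 0 + q * + 7 ≡ + 7 * q
    l = solve-∀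
  ... | 1 , q , _ , h = inj₂ (sixth-powers (+ 1) q h)
  ... | 2 , q , _ , h = inj₂ (shift (sixth-powers (+ 2) q h))
    where
    shift : (∃ λ w → x * x * x * (x * x * x) ≡ + 64 + + 7 * w) → ∃ λ w → x * x * x * (x * x * x) ≡ 1ℤ + + 7 * w
    shift (w , e) = + 9 + w , lin₁ 1ℤ e (solve (x ∷ w ∷ []))
  ... | 3 , q , _ , h = inj₂ (shift (sixth-powers (+ 3) q h))
    where
    shift : (∃ λ w → x * x * x * (x * x * x) ≡ + 729 + + 7 * w) → ∃ λ w → x * x * x * (x * x * x) ≡ 1ℤ + + 7 * w
    shift (w , e) = + 104 + w , lin₁ 1ℤ e (solve (x ∷ w ∷ []))
  ... | 4 , q , _ , h = inj₂ (shift (sixth-powers (+ 4) q h))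
    where
    shift : (∃ λ w → x * x * x * (x * x * x) ≡ + 4096 + + 7 * w) → ∃ λ w → x * x * x * (x * x * x) ≡ 1ℤ + + 7 * w
    shift (w , e) = + 585 + w , lin₁ 1ℤ e (solve (x ∷ w ∷ []))
  ... | 5 , q , _ , h = inj₂ (shift (sixth-powers (+ 5) q h))
    where
    shift : (∃ λ w → x * x * x * (x * x * x) ≡ + 15625 + + 7 * w) → ∃ λ w → x * x * x * (x * x * x) ≡ 1ℤ + + 7 * w
    shift (w , e) = + 2232 + w , lin₁ 1ℤ e (solve (x ∷ w ∷ []))
  ... | 6 , q , _ , h = inj₂ (shift (sixth-powers (+ 6) q h))
    where
    shift : (∃ λ w → x * x * x * (x * x * x) ≡ + 46656 + + 7 * w) → ∃ λ w → x * x * x * (x * x * x) ≡ 1ℤ + + 7 * w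
    shift (w , e) = + 6665 + w , lin₁ 1ℤ e (solve (x ∷ w ∷ []))
  ... | suc (suc (suc (suc (suc (suc (suc _)))))) , _ , ℕ.s≤s (ℕ.s≤s (ℕ.s≤s (ℕ.s≤s (ℕ.s≤s (ℕ.s≤s (ℕ.s≤s ())))))) , _

  ∤-literal : ∀ d c → {False (∣ d ∣ ℕ.∣? ∣ c ∣)} → ¬ (d ∣ c)
  ∤-literal d c {no-∣} (w , c≡) = toWitnessFalse no-∣ (ℕ.divides ∣ w ∣ (trans (cong ∣_∣ c≡) (trans (ℤ.abs-* d w) (ℕ.*-comm ∣ d ∣ ∣ w ∣))))

  absurd-∣ : ∀ d c {W : Set} → {False (∣ d ∣ ℕ.∣? ∣ c ∣)} → d ∣ c → W
  absurd-∣ d c {_} {no-∣} h = contradiction h (∤-literal d c {no-∣})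

  -- By Fermat, γ is not a square modulo 7 when γ³ ≡ -1.
  non-residue-7 : ∀ {γ δ y x w} → γ * γ * γ ≡ - 1ℤ + + 7 * δ → y * y ≡ γ * (x * x) + + 7 * w → + 7 ∣ x
  non-residue-7 {γ} {δ} {y} {x} {w} hγ h = cases (fermat-7 x) (fermat-7 y)
    where
    W : ℤ → ℤ
    W a = δ + + 7 * δ * a - a + w * (+ 3 * (γ * γ) * (x * x * (x * x)) + + 21 * γ * (x * x) * w + + 49 * w * w)
    y⁶ : ∀ a → x * x * x * (x * x * x) ≡ 1ℤ + + 7 * a →
      y * y * y * (y * y * y) ≡ - 1ℤ + + 7 * (δ + + 7 * δ * a - a + w * (+ 3 * (γ * γ) * (x * x * (x * x)) + + 21 * γ * (x * x) * w + + 49 * w * w))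
    y⁶ a ha = lin₃ (y * y * (y * y) + y * y * (γ * (x * x) + + 7 * w) + (γ * (x * x) + + 7 * w) * (γ * (x * x) + + 7 * w))
      (x * x * x * (x * x * x)) (- 1ℤ + + 7 * δ) h hγ ha (solve (γ ∷ δ ∷ y ∷ x ∷ w ∷ a ∷ []))
    cases : + 7 ∣ x ⊎ (∃ λ a → x * x * x * (x * x * x) ≡ 1ℤ + + 7 * a) →
            + 7 ∣ y ⊎ (∃ λ b → y * y * y * (y * y * y) ≡ 1ℤ + + 7 * b) → + 7 ∣ x
    cases (inj₁ d) _ = d
    cases (inj₂ (a , ha)) (inj₁ (z , hz)) = contradiction (one (W a) (y⁶ a ha)) (∤-literal (+ 7) 1ℤ)
      where
      one : ∀ W → y * y * y * (y * y * y) ≡ - 1ℤ + + 7 * W → + 7 ∣ 1ℤ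
      one W e = W - z * (y * y * y * y * y) , lin₂ 1ℤ (- (y * y * y * y * y)) e hz (solve (y ∷ z ∷ W ∷ []))
    cases (inj₂ (a , ha)) (inj₂ (b , hb)) = contradiction (two (W a) (y⁶ a ha)) (∤-literal (+ 7) (+ 2))
      where
      two : ∀ W → y * y * y * (y * y * y) ≡ - 1ℤ + + 7 * W → + 7 ∣ + 2
      two W e = W - b , lin₂ 1ℤ (- 1ℤ) e hb (solve (y ∷ b ∷ W ∷ []))

-- Obstructions for the second isogeny: modulo 7 and modulo 8π.

module DescentB where

  open Euclid
  open Gauss
  open GaussTools
  open Divisors
  open Quartic
  open DescentA
  module ℤT = IntTools
  open import Data.Integer as ℤ using (ℤ; +_; -[1+_])
  import Data.Integer.Properties as ℤ
  import Data.Integer.Tactic.RingSolver as ℤSolver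
  open import Data.Nat as ℕ using (ℕ; zero; suc)
  import Data.Nat.Properties as ℕ
  open import Data.Product using (∃; _×_; _,_; proj₁; proj₂)
  open import Data.Sum using (_⊎_; inj₁; inj₂)
  open import Data.Empty using (⊥)
  open import Data.List using (List; _∷_; [])
  open import Data.List.Membership.Propositional using (_∈_)
  open import Data.List.Membership.DecPropositional _≟_ using (_∈?_)
  open import Data.List.Relation.Unary.Any using (here; there)
  open import Data.List.Relation.Unary.All using (All; all?; lookup)
  open import Relation.Nullary using (¬_; Dec; yes; no; contradiction)
  open import Relation.Nullary.Decidable using (True; toWitness; False; toWitnessFalse; from-yes; _→-dec_; _⊎-dec_; ¬?)
  open import Relation.Binary.PropositionalEquality

  private
    variable
      k t : 𝔾

  conj-hom-* : ∀ x y → conj (x * y) ≡ conj x * conj y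
  conj-hom-* (a +i b) (c +i d) = cong₂ _+i_ (l₁ a b c d) (l₂ a b c d)
    where
    l₁ : ∀ a b c d → a ℤ.* c ℤ.- b ℤ.* d ≡ a ℤ.* c ℤ.- (ℤ.- b) ℤ.* (ℤ.- d)
    l₁ = ℤSolver.solve-∀
    l₂ : ∀ a b c d → ℤ.- (a ℤ.* d ℤ.+ b ℤ.* c) ≡ a ℤ.* (ℤ.- d) ℤ.+ (ℤ.- b) ℤ.* c
    l₂ = ℤSolver.solve-∀

  conj-hom-+ : ∀ x y → conj (x + y) ≡ conj x + conj y
  conj-hom-+ (a +i b) (c +i d) = cong ((a ℤ.+ c) +i_) (ℤ.neg-distrib-+ b d)

  conj-conj : ∀ x → conj (conj x) ≡ x
  conj-conj (a +i b) = cong (a +i_) (ℤ.neg-involutive b)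

  re : 𝔾 → ℤ
  re (a +i _) = a

  ⟨_⟩ : ℕ → 𝔾
  ⟨ n ⟩ = (+ n) +i ℤ.0ℤ

  norm-congruence-ring₁ : ∀ X̄ X d̄ d p̄ p w w̄ →
    X̄ * X * (X̄ * X) - (# 16 * (d̄ * d) * (p̄ * p * (p̄ * p)) + # 7 * (# 7 * (w * w̄) - w̄ * (# 4 * d
      * (p * p)) - w * (# 4 * d̄ * (p̄ * p̄))))
    ≡ - (X̄ * X̄) * (# 4 * d * (p * p) - (X * X + # 7 * w)) + - (# 4 * d * (p * p) - # 7 * w) * (# 4 *
      d̄ * (p̄ * p̄) - (X̄ * X̄ + # 7 * w̄))
  norm-congruence-ring₁ = solve-∀ 𝔾-ring

  -- Multiply the equation by its complex conjugate. Modulo 7 this is a congruence between norms,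
  -- which are rational, so its real part is a congruence in ℤ.
  norm-congruence : ∀ {d p X w} → # 4 * d * (p * p) ≡ X * X + # 7 * w →
    ∃ λ j → + norm X ℤ.* + norm X ≡ + 16 ℤ.* + norm d ℤ.* (+ norm p ℤ.* + norm p) ℤ.+ + 7 ℤ.* j
  norm-congruence {d} {p} {X} {w} h = go (conj w) (conj d) (conj p) (conj X) (conj-* X) (conj-* d) (conj-* p) conj-h
    where
    conj-h : # 4 * conj d * (conj p * conj p) ≡ conj X * conj X + # 7 * conj w
    conj-h = begin
      # 4 * conj d * (conj p * conj p)  ≡⟨ cong₂ _*_ (sym (conj-hom-* (# 4) d)) (sym (conj-hom-* p p)) ⟩
      conj (# 4 * d) * conj (p * p)     ≡⟨ sym (conj-hom-* (# 4 * d) (p * p)) ⟩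
      conj (# 4 * d * (p * p))          ≡⟨ cong conj h ⟩
      conj (X * X + # 7 * w)            ≡⟨ conj-hom-+ (X * X) (# 7 * w) ⟩
      conj (X * X) + conj (# 7 * w)     ≡⟨ cong₂ _+_ (conj-hom-* X X) (conj-hom-* (# 7) w) ⟩
      conj X * conj X + # 7 * conj w    ∎
      where open ≡-Reasoning
    go : ∀ w̄ d̄ p̄ X̄ → X̄ * X ≡ ⟨ norm X ⟩ → d̄ * d ≡ ⟨ norm d ⟩ → p̄ * p ≡ ⟨ norm p ⟩ →
      # 4 * d̄ * (p̄ * p̄) ≡ X̄ * X̄ + # 7 * w̄ →
      ∃ λ j → + norm X ℤ.* + norm X ≡ + 16 ℤ.* + norm d ℤ.* (+ norm p ℤ.* + norm p) ℤ.+ + 7 ℤ.* j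
    go w̄ d̄ p̄ X̄ hX hd hp h̄ = real-part _ (subst₂ (λ x y → x ≡ y + # 7 * rest) (cong₂ _*_ hX hX) (cong₂ (λ a b → # 16 * a * (b * b)) hd hp) product)
      where
      rest : 𝔾
      rest = # 7 * (w * w̄) - w̄ * (# 4 * d * (p * p)) - w * (# 4 * d̄ * (p̄ * p̄))
      product : X̄ * X * (X̄ * X) ≡ # 16 * (d̄ * d) * (p̄ * p * (p̄ * p)) + # 7 * (# 7 * (w * w̄) - w̄ * (# 4 * d * (p * p)) - w * (# 4 * d̄ * (p̄ * p̄)))
      product = lin₂ (- (X̄ * X̄)) (- (# 4 * d * (p * p) - # 7 * w)) h h̄ (norm-congruence-ring₁ X̄ X d̄ d p̄ p w w̄)
      real-part : ∀ rest → ⟨ norm X ⟩ * ⟨ norm X ⟩ ≡ # 16 * ⟨ norm d ⟩ * (⟨ norm p ⟩ * ⟨ norm p ⟩) + # 7 * rest →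
        ∃ λ j → + norm X ℤ.* + norm X ≡ + 16 ℤ.* + norm d ℤ.* (+ norm p ℤ.* + norm p) ℤ.+ + 7 ℤ.* j
      real-part (j₁ +i j₂) e = j₁ , trans (l₁ (+ norm X)) (trans (cong re e) (l₂ (+ norm d) (+ norm p) j₁ j₂))
        where
        l₁ : ∀ x → x ℤ.* x ≡ x ℤ.* x ℤ.- ℤ.0ℤ ℤ.* ℤ.0ℤ
        l₁ = ℤSolver.solve-∀
        l₂ : ∀ d p j₁ j₂ → (+ 16 ℤ.* d ℤ.- ℤ.0ℤ ℤ.* ℤ.0ℤ) ℤ.* (p ℤ.* p ℤ.- ℤ.0ℤ ℤ.* ℤ.0ℤ) ℤ.- (+ 16 ℤ.* ℤ.0ℤ ℤ.+ ℤ.0ℤ ℤ.* d) ℤ.* (p ℤ.* ℤ.0ℤ ℤ.+ ℤ.0ℤ ℤ.* p) ℤ.+ (+ 7 ℤ.* j₁ ℤ.- ℤ.0ℤ ℤ.* j₂)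
          ≡ + 16 ℤ.* d ℤ.* (p ℤ.* p) ℤ.+ + 7 ℤ.* j₁
        l₂ = ℤSolver.solve-∀

  -- Sixteen times the norm of d is a non-residue, its cube being -1 modulo 7; this forces 7 to
  -- divide the norm of p. As 7 is prime in ℤ[i], it divides p or `conj p`, and hence p.
  seven-divides : ∀ {d p X w} δ → + 16 ℤ.* + norm d ℤ.* (+ 16 ℤ.* + norm d) ℤ.* (+ 16 ℤ.* + norm d) ≡ ℤ.- ℤ.1ℤ ℤ.+ + 7 ℤ.* δ →
    # 4 * d * (p * p) ≡ X * X + # 7 * w → # 7 ∣ p
  seven-divides {d} {p} {X} {w} δ hγ h = go (norm-congruence {d} {p} {X} {w} h)
    where
    go : (∃ λ j → + norm X ℤ.* + norm X ≡ + 16 ℤ.* + norm d ℤ.* (+ norm p ℤ.* + norm p) ℤ.+ + 7 ℤ.* j) → # 7 ∣ p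
    go (j , e) = from-norm (ℤT.non-residue-7 {+ 16 ℤ.* + norm d} {δ} {+ norm X} {+ norm p} {j} hγ e)
      where
      from-norm : ℤT._∣_ (+ 7) (+ norm p) → # 7 ∣ p
      from-norm (z , n≡) = from-product (prime-∣* {# 7} {conj p} {p} prime-7 (z +i ℤ.0ℤ , trans (conj-* p) (cong₂ _+i_ (trans n≡ (l₁ z)) (l₂ z))))
        where
        l₁ : ∀ z → + 7 ℤ.* z ≡ + 7 ℤ.* z ℤ.- ℤ.0ℤ ℤ.* ℤ.0ℤ
        l₁ = ℤSolver.solve-∀
        l₂ : ∀ z → ℤ.0ℤ ≡ + 7 ℤ.* ℤ.0ℤ ℤ.+ ℤ.0ℤ ℤ.* z
        l₂ = ℤSolver.solve-∀
        from-product : # 7 ∣ conj p ⊎ # 7 ∣ p → # 7 ∣ p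
        from-product (inj₂ d) = d
        from-product (inj₁ (v , e)) = conj v , trans (sym (conj-conj p)) (trans (cong conj e) (conj-hom-* (# 7) v))

  seven∤-twist : Twist k t → ¬ (# 7 ∣ # 6 * ι * (k * k))
  seven∤-twist one = toWitnessFalse {a? = ∣-dec (# 7) _ λ ()} _
  seven∤-twist three = toWitnessFalse {a? = ∣-dec (# 7) _ λ ()} _

  norm-5-obstruction-ring₁ : ∀ X d₁ a p k s →
    X * X - # 7 * (# 4 * d₁ * a * p - # 6 * ι * (k * k) * (s * s * (s * s)))
    ≡ - 1# * (# 4 * d₁ * (p * p) - (X * X + # 7 * (# 6 * ι * (k * k) * (s * s * (s * s))))) + # 4 * d₁
      * p * (p - # 7 * a)
  norm-5-obstruction-ring₁ = solve-∀ 𝔾-ring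

  norm-5-obstruction-ring₂ : ∀ k s d₁ a b p X →
    # 7 * (# 6 * ι * (k * k) * (s * s * (s * s))) - # 7 * (# 7 * (# 4 * d₁ * a * a - b * b))
    ≡ - 1# * (# 4 * d₁ * (p * p) - (X * X + # 7 * (# 6 * ι * (k * k) * (s * s * (s * s))))) + # 4 * d₁
      * (p + # 7 * a) * (p - # 7 * a) + - (X + # 7 * b) * (X - # 7 * b)
  norm-5-obstruction-ring₂ = solve-∀ 𝔾-ring

  -- The norm of d₁ is 5 times the norm of c, the latter a square, and 5 is a non-residue modulo 7;
  -- so `seven-divides` applies to p. The equation then gives 7 ∣ X, and the second factor 7 in
  -- 42ιk²s⁴ forces 7 ∣ s.
  norm-5-obstruction : ∀ {c d d₁ p s X} → Twist k t → c ∈ (1# ∷ t ∷ []) → d₁ ≡ c * d → norm d ≡ 5 →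
    # 4 * d₁ * (p * p) ≡ X * X + # 42 * ι * (k * k) * (s * s * (s * s)) → # 7 ∣ p × # 7 ∣ s
  norm-5-obstruction {k} {t} {c} {d} {d₁} {p} {s} {X} K c∈ d₁≡ nd≡5 h = 7∣p , 7∣s 7∣p
    where
    h′ : # 4 * d₁ * (p * p) ≡ X * X + # 7 * (# 6 * ι * (k * k) * (s * s * (s * s)))
    h′ = lin₁ 1# h (solve (k ∷ d₁ ∷ p ∷ s ∷ X ∷ []) 𝔾-ring)
    cube : ∀ {k t} → Twist k t → c ∈ (1# ∷ t ∷ []) → ∃ λ δ → + 16 ℤ.* + (norm c ℕ.* 5) ℤ.* (+ 16 ℤ.* + (norm c ℕ.* 5)) ℤ.* (+ 16 ℤ.* + (norm c ℕ.* 5)) ≡ ℤ.- ℤ.1ℤ ℤ.+ + 7 ℤ.* δ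
    -- The witnesses are (γ³ + 1)/7 for γ = 80, 720 and 58320, that is, for 16 · 5 times the norm 1,
    -- 9 or 729 of c.
    cube _ (here refl) = + 73143 , refl
    cube one (there (here refl)) = + 53321143 , refl
    cube three (there (here refl)) = + 28337041481143 , refl
    norm-d₁ : norm c ℕ.* 5 ≡ norm d₁
    norm-d₁ = trans (cong (norm c ℕ.*_) (sym nd≡5)) (trans (sym (norm-* c d)) (cong norm (sym d₁≡)))
    7∣p : # 7 ∣ p
    7∣p = go (cube K c∈)
      where
      go : (∃ λ δ → + 16 ℤ.* + (norm c ℕ.* 5) ℤ.* (+ 16 ℤ.* + (norm c ℕ.* 5)) ℤ.* (+ 16 ℤ.* + (norm c ℕ.* 5)) ≡ ℤ.- ℤ.1ℤ ℤ.+ + 7 ℤ.* δ) → # 7 ∣ p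
      go (δ , e) = seven-divides {d₁} {p} {X} {# 6 * ι * (k * k) * (s * s * (s * s))} δ
        (subst (λ n → + 16 ℤ.* + n ℤ.* (+ 16 ℤ.* + n) ℤ.* (+ 16 ℤ.* + n) ≡ ℤ.- ℤ.1ℤ ℤ.+ + 7 ℤ.* δ) norm-d₁ e) h′
    7∣s : # 7 ∣ p → # 7 ∣ s
    7∣s (a , ha) = with-X (prime-∣sq {# 7} {X} prime-7 (# 4 * d₁ * a * p - # 6 * ι * (k * k) * (s * s * (s * s)) , lin₂ (- 1#) (# 4 * d₁ * p) h′ ha (norm-5-obstruction-ring₁ X d₁ a p k s)))
      where
      with-X : # 7 ∣ X → # 7 ∣ s
      with-X (b , hb) = with-s (prime-∣* {# 7} {# 6 * ι * (k * k)} {s * s * (s * s)} prime-7 (# 4 * d₁ * a * a - b * b ,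
        *-cancelˡ {# 7} (λ ()) (lin₃ (- 1#) (# 4 * d₁ * (p + # 7 * a)) (- (X + # 7 * b)) h′ ha hb (norm-5-obstruction-ring₂ k s d₁ a b p X))))
        where
        with-s : # 7 ∣ # 6 * ι * (k * k) ⊎ # 7 ∣ s * s * (s * s) → # 7 ∣ s
        with-s (inj₁ e) = contradiction e (seven∤-twist K)
        with-s (inj₂ e) = prime-∣sq {# 7} {s} prime-7 (prime-∣sq {# 7} {s * s} prime-7 e)

  split-5 : ∀ {d d′} → norm d ≢ 5 → d * d′ ≡ # 5 * - ι → Splitting (# 5) d d′
  split-5 {d} {d′} nd≢5 prod = go (norm-factor {# 5 * - ι} 25 (λ m → (m ℕ.≟ 1) ⊎-dec ((m ℕ.≟ 5) ⊎-dec (m ℕ.≟ 25))) refl d d′ (sym prod))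
    where
    go : norm d ≡ 1 ⊎ (norm d ≡ 5 ⊎ norm d ≡ 25) → Splitting (# 5) d d′
    go (inj₁ e) = inj₂ (norm1⇒unit e)
    go (inj₂ (inj₁ e)) = contradiction e nd≢5
    go (inj₂ (inj₂ e)) = inj₁ (unit-cofactor (norm1⇒unit (cofactor-norm {# 5 * - ι} (λ ()) d d′ (sym prod) e)))
      where
      unit-cofactor : IsUnit d′ → ∃ λ a → (d ≡ # 5 * a) × IsUnit a
      unit-cofactor (u , d′u≡1) = - ι * u , lin₂ u (- d) prod d′u≡1 (solve (d ∷ d′ ∷ u ∷ []) 𝔾-ring) , ι * d′ , lin₁ 1# d′u≡1 (solve (d′ ∷ u ∷ []) 𝔾-ring)

  twist-odd : Twist k t → Odd k
  twist-odd one = 0# , refl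
  twist-odd three = 1# - ι , refl

  sum-table : Twist k t → ∀ {d} → Class (# 7) t d → ¬ PlusMinusMod (# 8 * π) (# 18 * k * d) (d * d + # 7 * t)
  sum-table K = class-search (λ k t d → ¬? (plusMinusMod? (# 8 * π) (# 18 * k * d) (d * d + # 7 * t) λ ())) (# 7) K

  no-fifteen-ring₁ : ∀ f₁ f₂ k r s p →
    f₁ * f₂ - # 21 * (k * k) * (r * r * (r * r))
    ≡ f₂ * (f₁ - (# 2 * (1# - ι) * (s * s) + # 9 * k * (r * r) - # 2 * p)) + (# 2 * (1# - ι) * (s * s)
      + # 9 * k * (r * r) - # 2 * p) * (f₂ - (# 2 * (1# - ι) * (s * s) + # 9 * k * (r * r) + # 2 * p))
      + - (# 4) * (p * p - (# 15 * (k * k) * (r * r * (r * r)) + # 9 * k * (1# - ι) * (r * r) * (s *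
      s) - # 2 * ι * (s * s * (s * s))))
  no-fifteen-ring₁ = solve-∀ 𝔾-ring

  no-fifteen-ring₂ : ∀ p f₁ f₂ s k r →
    # 4 * p - (- 1# * f₁ + 1# * f₂)
    ≡ 1# * (f₁ - (# 2 * (1# - ι) * (s * s) + # 9 * k * (r * r) - # 2 * p)) + - 1# * (f₂ - (# 2 * (1# -
      ι) * (s * s) + # 9 * k * (r * r) + # 2 * p))
  no-fifteen-ring₂ = solve-∀ 𝔾-ring

  no-fifteen-ring₃ : ∀ c₁ a c₂ b s k r f₁ f₂ p →
    c₁ * (a * a * (a * a)) + c₂ * (b * b * (b * b)) - (# 4 * (1# - ι) * (s * s) + # 18 * k * (r * r))
      - (- 1# * (f₁ - c₁ * (a * a * (a * a))) + - 1# * (f₂ - c₂ * (b * b * (b * b))))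
    ≡ 1# * (f₁ - (# 2 * (1# - ι) * (s * s) + # 9 * k * (r * r) - # 2 * p)) + 1# * (f₂ - (# 2 * (1# -
      ι) * (s * s) + # 9 * k * (r * r) + # 2 * p))
  no-fifteen-ring₃ = solve-∀ 𝔾-ring

  no-fifteen-ring₄ : ∀ c₁ t k w z x y a c₂ b s r →
    c₁ * c₁ + # 7 * t - # 18 * k * c₁ - # 8 * π * (c₁ * (w * w) + # 9 * k * c₁ * z - c₁ * c₁ * x - # 7
      * t * y) - (c₁ * (c₁ * (a * a * (a * a)) + c₂ * (b * b * (b * b)) - (# 4 * (1# - ι) * (s * s) +
      # 18 * k * (r * r))) + - (c₁ * c₁) * (a * a * (a * a) - (1# + # 8 * π * x)) + - (# 7 * t) * (b *
      b * (b * b) - (1# + # 8 * π * y)))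
    ≡ # 18 * k * c₁ * (r * r - (1# + # 4 * π * z)) + - (b * b * (b * b)) * (c₁ * c₂ - t * (# 7 * 1#))
      + # 4 * (1# - ι) * c₁ * (s + π * w) * (s - π * w)
  no-fifteen-ring₄ = solve-∀ 𝔾-ring

  no-fifteen-ring₅ : ∀ c₁ t k w z x y a c₂ b s r →
    c₁ * c₁ + # 7 * t + # 18 * k * c₁ - # 8 * π * (c₁ * (w * w) + # 9 * k * c₁ * z - c₁ * c₁ * x - # 7
      * t * y) - (c₁ * (c₁ * (a * a * (a * a)) + c₂ * (b * b * (b * b)) - (# 4 * (1# - ι) * (s * s) +
      # 18 * k * (r * r))) + - (c₁ * c₁) * (a * a * (a * a) - (1# + # 8 * π * x)) + - (# 7 * t) * (b *
      b * (b * b) - (1# + # 8 * π * y)))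
    ≡ # 18 * k * c₁ * (r * r - (- 1# + # 4 * π * z)) + - (b * b * (b * b)) * (c₁ * c₂ - t * (# 7 *
      1#)) + # 4 * (1# - ι) * c₁ * (s + π * w) * (s - π * w)
  no-fifteen-ring₅ = solve-∀ 𝔾-ring

  -- A further descent for the classes d₁ = ±5t in `descent₂`, which survive modulo 4π. The equation
  -- amounts to (2(1 - ι)s² + 9kr²)² - 4p² = 21k²r⁴. So the two factors are c₁a⁴ and c₂b⁴ with c₁c₂
  -- = 7t and sum 4(1 - ι)s² + 18kr². Multiplied by c₁ and read modulo 8π, the sum says c₁² + 7t ≡
  -- ±18kc₁, which `sum-table` refutes for every candidate c₁.
  no-fifteen : ∀ {p r s} → Twist k t → Coprime p (# 3) → Coprime p r → Odd r → Even s →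
    p * p ≢ # 15 * (k * k) * (r * r * (r * r)) + # 9 * k * (1# - ι) * (r * r) * (s * s) - # 2 * ι * (s * s * (s * s))
  no-fifteen {k} {t} {p} {r} {s} K p-3 p-r r-odd s-even h = go _ _ refl refl
    where
    go : ∀ f₁ f₂ → f₁ ≡ # 2 * (1# - ι) * (s * s) + # 9 * k * (r * r) - # 2 * p → f₂ ≡ # 2 * (1# - ι) * (s * s) + # 9 * k * (r * r) + # 2 * p → ⊥
    go f₁ f₂ f₁-def f₂-def = split (fourth-split {f₁} {f₂} {t * (# 7 * 1#)} {r} r≢0 (trans prod (lin₁ (- (# 7 * (r * r * (r * r)))) (t≡3k² K) (solve (k ∷ t ∷ r ∷ []) 𝔾-ring))) f₁-f₂)
      where
      r≢0 : r ≢ 0#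
      r≢0 refl = odd-not-even r-odd (0# , refl)
      prod : f₁ * f₂ ≡ # 21 * (k * k) * (r * r * (r * r))
      prod = lin₃ f₂ (# 2 * (1# - ι) * (s * s) + # 9 * k * (r * r) - # 2 * p) (- # 4) f₁-def f₂-def h (no-fifteen-ring₁ f₁ f₂ k r s p)
      f₁≢0 : f₁ ≢ 0#
      f₁≢0 refl = odd-not-even (odd-* (odd-* {# 21} {k * k} (# 10 * (1# - ι) , refl) (odd-* (twist-odd K) (twist-odd K))) (odd-* (odd-* r-odd r-odd) (odd-* r-odd r-odd)))
        (subst Even prod (even-*ˡ {0#} {f₂} (0# , refl)))
      four-r : Coprime (# 4) r
      four-r = coprime-* {# 2} {r} {# 2} (odd-coprime-2 r-odd) (odd-coprime-2 r-odd)
      f₁-f₂ : Coprime f₁ f₂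
      f₁-f₂ = coprime-factors {f₁} {f₂} (1# * # 3 * (k * k) * (r * r * (r * r))) (# 7) (# 4 * p) (- 1#) 1# f₁≢0
        (prime-square-free {# 7} prime-7 (λ ()))
        (coprime-cofactor {s = # 4 * p} {r} 1# (1# , refl) K (coprime-* {# 4} {# 3} {p} (1# , - 1# , refl) p-3) (coprime-* {# 4} {r} {p} four-r p-r))
        (lin₁ 1# prod (solve (f₁ ∷ f₂ ∷ k ∷ r ∷ []) 𝔾-ring)) (lin₂ 1# (- 1#) f₁-def f₂-def (no-fifteen-ring₂ p f₁ f₂ s k r))
      split : (∃ λ c₁ → ∃ λ c₂ → ∃ λ a → ∃ λ b →
        (f₁ ≡ c₁ * (a * a * (a * a))) × (f₂ ≡ c₂ * (b * b * (b * b))) × (c₁ * c₂ ≡ t * (# 7 * 1#)) × (r ≡ a * b)) → ⊥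
      split (c₁ , c₂ , a , b , f₁≡ , f₂≡ , c₁c₂≡ , r≡) = contradiction
          (congruence (odd-sq r-odd) (odd-fourth (odd-*ˡ {a} {b} (subst Odd r≡ r-odd))) (odd-fourth (odd-*ʳ {a} {b} (subst Odd r≡ r-odd))) s-even)
          (sum-table K cls)
        where
        c₁-c₂ : Coprime c₁ c₂
        c₁-c₂ = coprime-sym {c₂} {c₁} (coprime-∣ {f₂} {c₁} {c₂} (coprime-sym {c₁} {f₂} (coprime-∣ {f₁} {f₂} {c₁} f₁-f₂ (_ , f₁≡))) (_ , f₂≡))
        cls : Class (# 7) t c₁
        cls = class-of {ρ = # 7} {1#} {c₁} {c₂} K (λ {_} {x} {y} _ _ → split-7 {1#} {x} {y} (1# , refl)) c₁c₂≡ c₁-c₂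
        sum : c₁ * (a * a * (a * a)) + c₂ * (b * b * (b * b)) ≡ # 4 * (1# - ι) * (s * s) + # 18 * k * (r * r)
        sum = lin₂ (- 1#) (- 1#) f₁≡ f₂≡ (lin₂ 1# 1# f₁-def f₂-def (no-fifteen-ring₃ c₁ a c₂ b s k r f₁ f₂ p))
        congruence : PlusMinusOne (r * r) → (∃ λ z → a * a * (a * a) ≡ 1# + # 8 * π * z) → (∃ λ z → b * b * (b * b) ≡ 1# + # 8 * π * z) → Even s →
          PlusMinusMod (# 8 * π) (# 18 * k * c₁) (c₁ * c₁ + # 7 * t)
        congruence (inj₁ (z , hr)) (x , ha) (y , hb) (w , hs) = inj₁ (c₁ * (w * w) + # 9 * k * c₁ * z - c₁ * c₁ * x - # 7 * t * y ,
          lin₃ c₁ (- (c₁ * c₁)) (- (# 7 * t)) sum ha hb (lin₃ (# 18 * k * c₁) (- (b * b * (b * b))) (# 4 * (1# - ι) * c₁ * (s + π * w)) hr c₁c₂≡ hs (no-fifteen-ring₄ c₁ t k w z x y a c₂ b s r)))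
        congruence (inj₂ (z , hr)) (x , ha) (y , hb) (w , hs) = inj₂ (c₁ * (w * w) + # 9 * k * c₁ * z - c₁ * c₁ * x - # 7 * t * y ,
          lin₃ c₁ (- (c₁ * c₁)) (- (# 7 * t)) sum ha hb (lin₃ (# 18 * k * c₁) (- (b * b * (b * b))) (# 4 * (1# - ι) * c₁ * (s + π * w)) hr c₁c₂≡ hs (no-fifteen-ring₅ c₁ t k w z x y a c₂ b s r)))

-- Descent through the dual isogeny, and the valuation of denominators.

module DescentC where

  open Euclid
  open Gauss
  open GaussTools
  open Divisors
  open Quartic
  open DescentA
  open DescentB
  open import Data.Nat as ℕ using (ℕ; zero; suc)
  import Data.Nat.Properties as ℕ
  open import Data.Nat.Induction using (<-wellFounded)
  open import Induction.WellFounded using (Acc; acc)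
  open import Data.Product using (∃; _×_; _,_; proj₁; proj₂)
  open import Data.Sum using (_⊎_; inj₁; inj₂)
  open import Data.Empty using (⊥; ⊥-elim)
  open import Data.List using (List; _∷_; [])
  open import Data.List.Membership.Propositional using (_∈_)
  open import Data.List.Membership.DecPropositional _≟_ using (_∈?_)
  open import Data.List.Relation.Unary.Any using (here; there)
  open import Relation.Nullary using (¬_; Dec; yes; no; contradiction)
  open import Relation.Nullary.Decidable using (_→-dec_; ¬?; toWitnessFalse)
  open import Relation.Binary.PropositionalEquality

  private
    variable
      k t : 𝔾

  odd-table : Twist k t → ∀ {d} → Class (# 5) t d → ¬ PlusMinusMod (# 4 * π) 1# (d + # 2 * π)
  odd-table K = class-search (λ k t d → ¬? (plusMinusMod? (# 4 * π) 1# (d + # 2 * π) λ ())) (# 5) K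

  even-table : Twist k t → ∀ {d} → Class (# 5) t d → PlusMinusMod (# 4 * π) 1# d → d ∈ (1# ∷ - 1# ∷ # 5 * t ∷ - (# 5 * t) ∷ [])
  even-table K = class-search (λ k t d → plusMinusMod? (# 4 * π) 1# d (λ ()) →-dec (d ∈? (1# ∷ - 1# ∷ # 5 * t ∷ - (# 5 * t) ∷ []))) (# 5) K

  eighteen-k : Twist k t → ∃ λ j → # 18 * k ≡ # 2 + # 4 * j
  eighteen-k one = # 4 , refl
  eighteen-k three = # 13 , refl

  descent₂-ring₁ : ∀ A n k q p →
    A * A - n * n - # 8 * (- ι * # 15 * (k * k) * (q * q * (q * q)))
    ≡ (A + p * p - # 9 * k * (1# - ι) * q * q) * (A - (p * p - # 9 * k * (1# - ι) * q * q)) + 1# * (p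
      * p * (p * p) - # 18 * k * (1# - ι) * (p * p) * (q * q) - # 42 * ι * (k * k) * (q * q * (q * q))
      - n * n)
  descent₂-ring₁ = solve-∀ 𝔾-ring

  descent₂-ring₂ : ∀ p d₁ r k s d₂ A f₁ f₂ q →
    p * p - (d₁ * (r * r * (r * r)) + # 9 * k * (1# - ι) * (r * r) * (s * s) + # 2 * d₂ * (s * s * (s
      * s))) - (1# * (A - (f₁ + # 2 * f₂)) + 1# * (f₁ - d₁ * (r * r * (r * r))) + # 2 * (f₂ - d₂ * (s
      * s * (s * s))))
    ≡ - 1# * (A - (p * p - # 9 * k * (1# - ι) * q * q)) + # 9 * k * (1# - ι) * (q + r * s) * (q - r *
      s)
  descent₂-ring₂ = solve-∀ 𝔾-ring

  descent₂-ring₃ : ∀ d₁ d₂ k t →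
    d₁ * d₂ - - ι * # 15 * (k * k)
    ≡ 1# * (d₁ * d₂ - t * (# 5 * - ι)) + # 5 * - ι * (t - # 3 * (k * k))
  descent₂-ring₃ = solve-∀ 𝔾-ring

  descent₂-ring₄ : ∀ d₁ p r k s d₂ →
    # 4 * d₁ * (p * p) - ((# 2 * d₁ * (r * r) + # 9 * k * (1# - ι) * (s * s)) * (# 2 * d₁ * (r * r) +
      # 9 * k * (1# - ι) * (s * s)) + # 42 * ι * (k * k) * (s * s * (s * s)))
    ≡ # 4 * d₁ * (p * p - (d₁ * (r * r * (r * r)) + # 9 * k * (1# - ι) * (r * r) * (s * s) + # 2 * d₂
      * (s * s * (s * s)))) + # 8 * (s * s * (s * s)) * (d₁ * d₂ - - ι * # 15 * (k * k))
  descent₂-ring₄ = solve-∀ 𝔾-ring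

  descent₂-ring₅ : ∀ d₁ a j k b d₂ w z p r s →
    d₁ + # 2 * π - 1# - # 4 * π * (a - j - # 18 * k * π * b + (1# - ι) * d₂ * (w * w * (w * w)) - # 2
      * z * d₁) - (- 1# * (p * p - (d₁ * (r * r * (r * r)) + # 9 * k * (1# - ι) * (r * r) * (s * s) +
      # 2 * d₂ * (s * s * (s * s)))) + 1# * (p * p - (1# + # 4 * π * a)) + - d₁ * (r * r * (r * r) -
      (1# + # 8 * π * z)))
    ≡ - (# 18 * k * π) * (w * r * (w * r) - (1# + # 4 * π * b)) + - π * (# 18 * k - (# 2 + # 4 * j)) +
      (- (# 9 * k * (1# - ι) * (r * r) * (s + π * w)) - # 2 * d₂ * (s + π * w) * (s * s + π * π * (w *
      w))) * (s - π * w)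
  descent₂-ring₅ = solve-∀ 𝔾-ring

  descent₂-ring₆ : ∀ d₁ a j k b d₂ w z p r s →
    d₁ + # 2 * π - 1# - # 4 * π * (a + 1# + j - # 18 * k * π * b + (1# - ι) * d₂ * (w * w * (w * w)) -
      # 2 * z * d₁) - (- 1# * (p * p - (d₁ * (r * r * (r * r)) + # 9 * k * (1# - ι) * (r * r) * (s *
      s) + # 2 * d₂ * (s * s * (s * s)))) + 1# * (p * p - (1# + # 4 * π * a)) + - d₁ * (r * r * (r *
      r) - (1# + # 8 * π * z)))
    ≡ - (# 18 * k * π) * (w * r * (w * r) - (- 1# + # 4 * π * b)) + π * (# 18 * k - (# 2 + # 4 * j)) +
      (- (# 9 * k * (1# - ι) * (r * r) * (s + π * w)) - # 2 * d₂ * (s + π * w) * (s * s + π * π * (w *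
      w))) * (s - π * w)
  descent₂-ring₆ = solve-∀ 𝔾-ring

  descent₂-ring₇ : ∀ d₁ a j k b d₂ w z p r s →
    d₁ + # 2 * π + 1# - # 4 * π * (a - j - # 18 * k * π * b + (1# - ι) * d₂ * (w * w * (w * w)) - # 2
      * z * d₁) - (- 1# * (p * p - (d₁ * (r * r * (r * r)) + # 9 * k * (1# - ι) * (r * r) * (s * s) +
      # 2 * d₂ * (s * s * (s * s)))) + 1# * (p * p - (- 1# + # 4 * π * a)) + - d₁ * (r * r * (r * r) -
      (1# + # 8 * π * z)))
    ≡ - (# 18 * k * π) * (w * r * (w * r) - (1# + # 4 * π * b)) + - π * (# 18 * k - (# 2 + # 4 * j)) +
      (- (# 9 * k * (1# - ι) * (r * r) * (s + π * w)) - # 2 * d₂ * (s + π * w) * (s * s + π * π * (w *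
      w))) * (s - π * w)
  descent₂-ring₇ = solve-∀ 𝔾-ring

  descent₂-ring₈ : ∀ d₁ a j k b d₂ w z p r s →
    d₁ + # 2 * π + 1# - # 4 * π * (a + 1# + j - # 18 * k * π * b + (1# - ι) * d₂ * (w * w * (w * w)) -
      # 2 * z * d₁) - (- 1# * (p * p - (d₁ * (r * r * (r * r)) + # 9 * k * (1# - ι) * (r * r) * (s *
      s) + # 2 * d₂ * (s * s * (s * s)))) + 1# * (p * p - (- 1# + # 4 * π * a)) + - d₁ * (r * r * (r *
      r) - (1# + # 8 * π * z)))
    ≡ - (# 18 * k * π) * (w * r * (w * r) - (- 1# + # 4 * π * b)) + π * (# 18 * k - (# 2 + # 4 * j)) +
      (- (# 9 * k * (1# - ι) * (r * r) * (s + π * w)) - # 2 * d₂ * (s + π * w) * (s * s + π * π * (w *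
      w))) * (s - π * w)
  descent₂-ring₈ = solve-∀ 𝔾-ring

  descent₂-ring₉ : ∀ s v w → s - # 2 * ι * v ≡ 1# * (s - π * w) + π * (w - π * v)
  descent₂-ring₉ = solve-∀ 𝔾-ring

  descent₂-ring₁₀ : ∀ d₁ a k r v d₂ z p s →
    d₁ - (1# + # 4 * π * (a - # 9 * k * ι * (r * r) * (v * v) - # 4 * (1# - ι) * d₂ * (v * v * (v *
      v)) - # 2 * z * d₁)) - (- 1# * (p * p - (d₁ * (r * r * (r * r)) + # 9 * k * (1# - ι) * (r * r) *
      (s * s) + # 2 * d₂ * (s * s * (s * s)))) + 1# * (p * p - (1# + # 4 * π * a)) + - d₁ * (r * r *
      (r * r) - (1# + # 8 * π * z)))
    ≡ (- (# 9 * k * (1# - ι) * (r * r) * (s + # 2 * ι * v)) - # 2 * d₂ * (s + # 2 * ι * v) * (s * s -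
      # 4 * (v * v))) * (s - # 2 * ι * v)
  descent₂-ring₁₀ = solve-∀ 𝔾-ring

  descent₂-ring₁₁ : ∀ d₁ a k r v d₂ z p s →
    d₁ - (- 1# + # 4 * π * (a - # 9 * k * ι * (r * r) * (v * v) - # 4 * (1# - ι) * d₂ * (v * v * (v *
      v)) - # 2 * z * d₁)) - (- 1# * (p * p - (d₁ * (r * r * (r * r)) + # 9 * k * (1# - ι) * (r * r) *
      (s * s) + # 2 * d₂ * (s * s * (s * s)))) + 1# * (p * p - (- 1# + # 4 * π * a)) + - d₁ * (r * r *
      (r * r) - (1# + # 8 * π * z)))
    ≡ (- (# 9 * k * (1# - ι) * (r * r) * (s + # 2 * ι * v)) - # 2 * d₂ * (s + # 2 * ι * v) * (s * s -
      # 4 * (v * v))) * (s - # 2 * ι * v)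
  descent₂-ring₁₁ = solve-∀ 𝔾-ring

  descent₂-ring₁₂ : ∀ r k s p d₁ d₂ →
    r * r * (r * r) + # 9 * k * (1# - ι) * (r * r) * (s * s) - # 30 * ι * (k * k) * (s * s * (s * s))
      - p * p
    ≡ - 1# * (p * p - (d₁ * (r * r * (r * r)) + # 9 * k * (1# - ι) * (r * r) * (s * s) + # 2 * d₂ * (s
      * s * (s * s)))) + - (# 2 * (s * s * (s * s))) * (d₁ * d₂ - - ι * # 15 * (k * k)) + (- (r * r *
      (r * r)) + # 2 * (s * s * (s * s)) * d₂) * (d₁ - 1#)
  descent₂-ring₁₂ = solve-∀ 𝔾-ring

  descent₂-ring₁₃ : ∀ r k s p d₁ d₂ →
    r * r * (r * r) + # 9 * k * (1# - ι) * (r * r) * (ι * s * (ι * s)) - # 30 * ι * (k * k) * (ι * s *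
      (ι * s) * (ι * s * (ι * s))) - ι * p * (ι * p)
    ≡ 1# * (p * p - (d₁ * (r * r * (r * r)) + # 9 * k * (1# - ι) * (r * r) * (s * s) + # 2 * d₂ * (s *
      s * (s * s)))) + - (# 2 * (s * s * (s * s))) * (d₁ * d₂ - - ι * # 15 * (k * k)) + (r * r * (r *
      r) + # 2 * (s * s * (s * s)) * d₂) * (d₁ - - 1#)
  descent₂-ring₁₃ = solve-∀ 𝔾-ring

  descent₂-ring₁₄ : ∀ p k r s d₁ d₂ t →
    p * p - (# 15 * (k * k) * (r * r * (r * r)) + # 9 * k * (1# - ι) * (r * r) * (s * s) - # 2 * ι *
      (s * s * (s * s))) - (1# * (p * p - (d₁ * (r * r * (r * r)) + # 9 * k * (1# - ι) * (r * r) * (s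
      * s) + # 2 * d₂ * (s * s * (s * s)))) + r * r * (r * r) * (d₁ - # 5 * t) + # 2 * (s * s * (s *
      s)) * (d₂ - - ι))
    ≡ # 5 * (r * r * (r * r)) * (t - # 3 * (k * k))
  descent₂-ring₁₄ = solve-∀ 𝔾-ring

  descent₂-ring₁₅ : ∀ t d₂ d₁ →
    # 5 * t * d₂ - # 5 * t * - ι
    ≡ 1# * (d₁ * d₂ - t * (# 5 * - ι)) + - d₂ * (d₁ - # 5 * t)
  descent₂-ring₁₅ = solve-∀ 𝔾-ring

  descent₂-ring₁₆ : ∀ p k r s d₁ d₂ t →
    ι * p * (ι * p) - (# 15 * (k * k) * (r * r * (r * r)) + # 9 * k * (1# - ι) * (r * r) * (ι * s * (ι
      * s)) - # 2 * ι * (ι * s * (ι * s) * (ι * s * (ι * s)))) - (- 1# * (p * p - (d₁ * (r * r * (r *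
      r)) + # 9 * k * (1# - ι) * (r * r) * (s * s) + # 2 * d₂ * (s * s * (s * s)))) + - (r * r * (r *
      r)) * (d₁ - - (# 5 * t)) + - (# 2 * (s * s * (s * s))) * (d₂ - ι))
    ≡ # 5 * (r * r * (r * r)) * (t - # 3 * (k * k))
  descent₂-ring₁₆ = solve-∀ 𝔾-ring

  descent₂-ring₁₇ : ∀ t d₂ d₁ →
    # 5 * t * d₂ - # 5 * t * ι
    ≡ - 1# * (d₁ * d₂ - t * (# 5 * - ι)) + d₂ * (d₁ - - (# 5 * t))
  descent₂-ring₁₇ = solve-∀ 𝔾-ring

  -- The analogue for the dual isogeny. With A = p² - 9k(1 - ι)q² one has A² - n² = -120ιk²q⁴, hence
  -- f₁f₂ = -15ιk²q⁴, f₁ = d₁r⁴, f₂ = d₂s⁴ and p² = d₁r⁴ + 9k(1 - ι)r²s² + 2d₂s⁴. Since 5 splits in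
  -- ℤ[i], the classes containing a single factor of norm 5 have to be excluded as well, which is
  -- done modulo 7.
  descent₂ : ∀ {p q n} → Twist k t → Quartic′ k p q n → Coprime p q → Even q → q ≢ 0# →
    ∃ λ r → ∃ λ s → ∃ λ n′ → ∃ λ o → Quartic k r s n′ × Coprime r s × Odd o × Even s × (q ≡ s * o)
  descent₂ {k} {t} {p} {q} {n} K h cop q-even q≢0 = complete-square _ refl
    where
    Goal : Set
    Goal = ∃ λ r → ∃ λ s → ∃ λ n′ → ∃ λ o → Quartic k r s n′ × Coprime r s × Odd o × Even s × (q ≡ s * o)
    complete-square : ∀ A → A ≡ p * p - # 9 * k * (1# - ι) * q * q → Goal
    complete-square A A-def = go (halves {A} {n} {(- ι) * # 15 * (k * k) * (q * q * (q * q))} A-odd A²-n²)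
      where
      A-q : Coprime A q
      A-q = coprime-resp {p * p + - (# 9 * k * (1# - ι) * q) * q} {A} {q} (lin₁ (- 1#) A-def (solve (A ∷ p ∷ q ∷ k ∷ []) 𝔾-ring))
        (coprime-+* (p * p) (- (# 9 * k * (1# - ι) * q)) q (coprime-* {p} {q} {p} cop cop))
      p-3 : Coprime p (# 3)
      p-3 = three-free′ {p = p} {q} {n} K cop h
      A-3 : Coprime A (# 3)
      A-3 = coprime-resp {p * p + - (# 3 * k * (1# - ι) * q * q) * # 3} {A} {# 3} (lin₁ (- 1#) A-def (solve (A ∷ p ∷ q ∷ k ∷ []) 𝔾-ring))
        (coprime-+* (p * p) (- (# 3 * k * (1# - ι) * q * q)) (# 3) (coprime-* {p} {# 3} {p} p-3 p-3))
      p-odd : Odd p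
      p-odd = coprime-even-odd cop q-even
      A-odd : Odd A
      A-odd = subst Odd sum≡A (odd-+ (odd-* p-odd p-odd) (even-*ʳ {q} {(- (# 9 * k * (1# - ι) * q))} q-even))
        where
        sum≡A : p * p + - (# 9 * k * (1# - ι) * q) * q ≡ A
        sum≡A = lin₁ (- 1#) A-def (solve (A ∷ p ∷ q ∷ k ∷ []) 𝔾-ring)
      A²-n² : A * A - n * n ≡ # 8 * ((- ι) * # 15 * (k * k) * (q * q * (q * q)))
      A²-n² = lin₂ (A + p * p - # 9 * k * (1# - ι) * q * q) 1# A-def h (descent₂-ring₁ A n k q p)
      go : (∃ λ f₁ → ∃ λ f₂ → Odd f₁ × (A ≡ f₁ + # 2 * f₂) × (f₁ * f₂ ≡ (- ι) * # 15 * (k * k) * (q * q * (q * q)))) → Goal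
      go (f₁ , f₂ , f₁-odd , A≡ , prod) = split (fourth-split {f₁} {f₂} {t * (# 5 * - ι)} {q} q≢0 (trans prod (lin₁ (- (# 5 * - ι * (q * q * (q * q)))) (t≡3k² K) (solve (k ∷ t ∷ q ∷ []) 𝔾-ring))) f₁-f₂)
        where
        f₁≢0 : f₁ ≢ 0#
        f₁≢0 refl = odd-not-even f₁-odd (0# , refl)
        f₁-f₂ : Coprime f₁ f₂
        f₁-f₂ = coprime-factors {f₁} {f₂} ((- ι) * # 3 * (k * k) * (q * q * (q * q))) (# 5) A 1# (# 2) f₁≢0
          square-free-5 (coprime-cofactor {s = A} {q} (- ι) (ι , refl) K A-3 A-q)
          (lin₁ 1# prod (solve (f₁ ∷ f₂ ∷ k ∷ q ∷ []) 𝔾-ring)) (lin₁ 1# A≡ (solve (A ∷ f₁ ∷ f₂ ∷ []) 𝔾-ring))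
        split : (∃ λ d₁ → ∃ λ d₂ → ∃ λ r → ∃ λ s →
          (f₁ ≡ d₁ * (r * r * (r * r))) × (f₂ ≡ d₂ * (s * s * (s * s))) × (d₁ * d₂ ≡ t * (# 5 * - ι)) × (q ≡ r * s)) → Goal
        split (d₁ , d₂ , r , s , f₁≡ , f₂≡ , d₁d₂≡ , q≡) = by-parity s-even
          where
          p²≡ : p * p ≡ d₁ * (r * r * (r * r)) + # 9 * k * (1# - ι) * (r * r) * (s * s) + # 2 * d₂ * (s * s * (s * s))
          p²≡ = lin₃ 1# 1# (# 2) A≡ f₁≡ f₂≡ (lin₂ (- 1#) (# 9 * k * (1# - ι) * (q + r * s)) A-def q≡ (descent₂-ring₂ p d₁ r k s d₂ A f₁ f₂ q))
          dd≡ : d₁ * d₂ ≡ (- ι) * # 15 * (k * k)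
          dd≡ = lin₂ 1# (# 5 * - ι) d₁d₂≡ (t≡3k² K) (descent₂-ring₃ d₁ d₂ k t)
          r-odd : Odd r
          r-odd = odd-*ˡ {r} {r} (odd-*ˡ {r * r} {r * r} (odd-*ʳ {d₁} {r * r * (r * r)} (subst Odd f₁≡ f₁-odd)))
          s-even : Even s
          s-even with even-or-odd s
          ... | inj₁ ev = ev
          ... | inj₂ od = contradiction (subst Even q≡ q-even) (odd-not-even (odd-* r-odd od))
          r-s : Coprime r s
          r-s = coprime-sym {s} {r} (coprime-∣ {f₂} {r} {s} (coprime-sym {r} {f₂} (coprime-∣ {f₁} {f₂} {r} f₁-f₂
            (d₁ * (r * r * r) , lin₁ 1# f₁≡ (solve (f₁ ∷ d₁ ∷ r ∷ []) 𝔾-ring)))) (d₂ * (s * s * s) , lin₁ 1# f₂≡ (solve (f₂ ∷ d₂ ∷ s ∷ []) 𝔾-ring)))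
          p-r : Coprime p r
          p-r = coprime-sym {r} {p} (coprime-∣ {q} {p} {r} (coprime-sym {p} {q} cop) (s , q≡))
          d₁-d₂ : Coprime d₁ d₂
          d₁-d₂ = coprime-sym {d₂} {d₁} (coprime-∣ {f₂} {d₁} {d₂} (coprime-sym {d₁} {f₂} (coprime-∣ {f₁} {f₂} {d₁} f₁-f₂ (_ , f₁≡))) (_ , f₂≡))
          -- The square is completed in r², in the form needed for the obstruction modulo 7.
          completed : # 4 * d₁ * (p * p) ≡ (# 2 * d₁ * (r * r) + # 9 * k * (1# - ι) * (s * s)) * (# 2 * d₁ * (r * r) + # 9 * k * (1# - ι) * (s * s)) + # 42 * ι * (k * k) * (s * s * (s * s))
          completed = lin₂ (# 4 * d₁) (# 8 * (s * s * (s * s))) p²≡ dd≡ (descent₂-ring₄ d₁ p r k s d₂)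
          norm≢5 : ∀ {c d} → c ∈ (1# ∷ t ∷ []) → d₁ ≡ c * d → norm d ≢ 5
          norm≢5 {c} {d} c∈ d₁≡ nd≡5 = impossible (norm-5-obstruction {c = c} {d} {d₁} {p} {s} {# 2 * d₁ * (r * r) + # 9 * k * (1# - ι) * (s * s)} K c∈ d₁≡ nd≡5 completed)
            where
            impossible : # 7 ∣ p × # 7 ∣ s → ⊥
            impossible (7∣p , 7∣s) = prime-common {# 7} {p} {q} prime-7 cop 7∣p (∣-trans {# 7} {s} {q} 7∣s (r , lin₁ 1# q≡ (solve (q ∷ r ∷ s ∷ []) 𝔾-ring)))
          cls : Class (# 5) t d₁
          cls = class-of {ρ = # 5} {(- ι)} {d₁} {d₂} K (λ {c} {x} {y} c∈ d₁≡ prod _ → split-5 {x} {y} (norm≢5 {c} {x} c∈ d₁≡) prod) d₁d₂≡ d₁-d₂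
          by-parity : Even s → Goal
          by-parity (w , hs) with even-or-odd w
          -- Here s = πw with w odd. The middle term is 18kπ(wr)² ≡ 2π modulo 4π, so d₁ + 2π ≡ p² ≡
          -- ±1, which no candidate satisfies.
          ... | inj₂ w-odd = contradiction (congruence (eighteen-k K) (odd-sq p-odd) (odd-fourth r-odd) (odd-sq (odd-* w-odd r-odd))) (odd-table K cls)
            where
            congruence : (∃ λ j → # 18 * k ≡ # 2 + # 4 * j) → PlusMinusOne (p * p) → (∃ λ z → r * r * (r * r) ≡ 1# + # 8 * π * z) → PlusMinusOne (w * r * (w * r)) →
              PlusMinusMod (# 4 * π) 1# (d₁ + # 2 * π)
            congruence (j , hk) (inj₁ (a , ha)) (z , hz) (inj₁ (b , hb)) = inj₁ (a - j - # 18 * k * π * b + (1# - ι) * d₂ * (w * w * (w * w)) - # 2 * z * d₁ ,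
              lin₃ (- 1#) 1# (- d₁) p²≡ ha hz (lin₃ (- (# 18 * k * π)) (- π) (- (# 9 * k * (1# - ι) * (r * r) * (s + π * w)) - # 2 * d₂ * (s + π * w) * (s * s + π * π * (w * w))) hb hk hs (descent₂-ring₅ d₁ a j k b d₂ w z p r s)))
            congruence (j , hk) (inj₁ (a , ha)) (z , hz) (inj₂ (b , hb)) = inj₁ (a + 1# + j - # 18 * k * π * b + (1# - ι) * d₂ * (w * w * (w * w)) - # 2 * z * d₁ ,
              lin₃ (- 1#) 1# (- d₁) p²≡ ha hz (lin₃ (- (# 18 * k * π)) π (- (# 9 * k * (1# - ι) * (r * r) * (s + π * w)) - # 2 * d₂ * (s + π * w) * (s * s + π * π * (w * w))) hb hk hs (descent₂-ring₆ d₁ a j k b d₂ w z p r s)))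
            congruence (j , hk) (inj₂ (a , ha)) (z , hz) (inj₁ (b , hb)) = inj₂ (a - j - # 18 * k * π * b + (1# - ι) * d₂ * (w * w * (w * w)) - # 2 * z * d₁ ,
              lin₃ (- 1#) 1# (- d₁) p²≡ ha hz (lin₃ (- (# 18 * k * π)) (- π) (- (# 9 * k * (1# - ι) * (r * r) * (s + π * w)) - # 2 * d₂ * (s + π * w) * (s * s + π * π * (w * w))) hb hk hs (descent₂-ring₇ d₁ a j k b d₂ w z p r s)))
            congruence (j , hk) (inj₂ (a , ha)) (z , hz) (inj₂ (b , hb)) = inj₂ (a + 1# + j - # 18 * k * π * b + (1# - ι) * d₂ * (w * w * (w * w)) - # 2 * z * d₁ ,
              lin₃ (- 1#) 1# (- d₁) p²≡ ha hz (lin₃ (- (# 18 * k * π)) π (- (# 9 * k * (1# - ι) * (r * r) * (s + π * w)) - # 2 * d₂ * (s + π * w) * (s * s + π * π * (w * w))) hb hk hs (descent₂-ring₈ d₁ a j k b d₂ w z p r s)))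
          -- Here 2 divides s, so the middle term vanishes modulo 4π and d₁ ≡ ±1.
          ... | inj₁ (v , hw) = choose (even-table K cls (plusMinusOne⇒mod (congruence (odd-sq p-odd) (odd-fourth r-odd)))) refl
            where
            hs′ : s ≡ # 2 * ι * v
            hs′ = lin₂ 1# π hs hw (descent₂-ring₉ s v w)
            congruence : PlusMinusOne (p * p) → (∃ λ z → r * r * (r * r) ≡ 1# + # 8 * π * z) → PlusMinusOne d₁
            congruence (inj₁ (a , ha)) (z , hz) = inj₁ (a - # 9 * k * ι * (r * r) * (v * v) - # 4 * (1# - ι) * d₂ * (v * v * (v * v)) - # 2 * z * d₁ ,
              lin₃ (- 1#) 1# (- d₁) p²≡ ha hz (lin₁ (- (# 9 * k * (1# - ι) * (r * r) * (s + # 2 * ι * v)) - # 2 * d₂ * (s + # 2 * ι * v) * (s * s - # 4 * (v * v))) hs′ (descent₂-ring₁₀ d₁ a k r v d₂ z p s)))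
            congruence (inj₂ (a , ha)) (z , hz) = inj₂ (a - # 9 * k * ι * (r * r) * (v * v) - # 4 * (1# - ι) * d₂ * (v * v * (v * v)) - # 2 * z * d₁ ,
              lin₃ (- 1#) 1# (- d₁) p²≡ ha hz (lin₁ (- (# 9 * k * (1# - ι) * (r * r) * (s + # 2 * ι * v)) - # 2 * d₂ * (s + # 2 * ι * v) * (s * s - # 4 * (v * v))) hs′ (descent₂-ring₁₁ d₁ a k r v d₂ z p s)))
            5t≢0 : Twist k t → # 5 * t ≢ 0#
            5t≢0 one ()
            5t≢0 three ()
            choose : ∀ {d} → d ∈ (1# ∷ - 1# ∷ # 5 * t ∷ - (# 5 * t) ∷ []) → d₁ ≡ d → Goal
            choose (here refl) d≡ = r , s , p , r ,
              lin₃ (- 1#) (- (# 2 * (s * s * (s * s)))) (- (r * r * (r * r)) + # 2 * (s * s * (s * s)) * d₂) p²≡ dd≡ d≡ (descent₂-ring₁₂ r k s p d₁ d₂) ,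
              r-s , r-odd , s-even , lin₁ 1# q≡ (solve (q ∷ r ∷ s ∷ []) 𝔾-ring)
            choose (there (here refl)) d≡ = r , ι * s , ι * p , - ι * r ,
              lin₃ 1# (- (# 2 * (s * s * (s * s)))) (r * r * (r * r) + # 2 * (s * s * (s * s)) * d₂) p²≡ dd≡ d≡ (descent₂-ring₁₃ r k s p d₁ d₂) ,
              coprime-*ʳ {r} {ι} {s} (coprime-sym {ι} {r} (unit⇒coprime {ι} {r} (- ι , refl))) r-s ,
              odd-* {(- ι)} {r} (- 1# , refl) r-odd , even-*ʳ {s} {ι} s-even , lin₁ 1# q≡ (solve (q ∷ r ∷ s ∷ []) 𝔾-ring)
            -- d₁ = ±5t leaves d₂ = ∓ι, which is the equation of `no-fifteen`; for the lower sign, p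
            -- and s are multiplied by ι.
            choose (there (there (here refl))) d≡ = ⊥-elim (no-fifteen {p = p} {r} {s} K p-3 p-r r-odd s-even
              (lin₃ 1# (r * r * (r * r)) (# 2 * (s * s * (s * s))) p²≡ d≡ d₂≡ (lin₁ (# 5 * (r * r * (r * r))) (t≡3k² K) (descent₂-ring₁₄ p k r s d₁ d₂ t))))
              where
              d₂≡ : d₂ ≡ - ι
              d₂≡ = *-cancelˡ (5t≢0 K) (lin₂ 1# (- d₂) d₁d₂≡ d≡ (descent₂-ring₁₅ t d₂ d₁))
            choose (there (there (there (here refl)))) d≡ = ⊥-elim (no-fifteen {p = ι * p} {r} {ι * s} K
              (coprime-* {ι} {# 3} {p} (unit⇒coprime {ι} {# 3} (- ι , refl)) p-3) (coprime-* {ι} {r} {p} (unit⇒coprime {ι} {r} (- ι , refl)) p-r) r-odd (even-*ʳ {s} {ι} s-even)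
              (lin₃ (- 1#) (- (r * r * (r * r))) (- (# 2 * (s * s * (s * s)))) p²≡ d≡ d₂≡ (lin₁ (# 5 * (r * r * (r * r))) (t≡3k² K) (descent₂-ring₁₆ p k r s d₁ d₂ t))))
              where
              d₂≡ : d₂ ≡ ι
              d₂≡ = *-cancelˡ (5t≢0 K) (lin₂ (- 1#) d₂ d₁d₂≡ d≡ (descent₂-ring₁₇ t d₂ d₁))

  -- The valuation at π is even, phrased through 2 = - ι * π².
  data EvenValuation : 𝔾 → Set where
    odd    : ∀ {x} → Odd x → EvenValuation x
    double : ∀ {x y} → y ≡ # 2 * x → EvenValuation x → EvenValuation y

  even-valuation-* : ∀ {x o} → EvenValuation x → Odd o → EvenValuation (x * o)
  even-valuation-* (odd x-odd) o-odd = odd (odd-* x-odd o-odd)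
  even-valuation-* {x} {o} (double {y} h v) o-odd = double {y * o} (lin₁ o h (solve (x ∷ y ∷ o ∷ []) 𝔾-ring)) (even-valuation-* v o-odd)

  -- The valuation of πx is odd. Factors of 2 are cancelled on both sides until x or y is odd.
  valuation-clash : ∀ {x y} → EvenValuation x → EvenValuation y → π * x ≢ y
  valuation-clash {x} _ (odd y-odd) refl = odd-not-even y-odd (x , refl)
  valuation-clash {x} {y} (odd x-odd) (double {y′} h _) e = parity-clash x (- ι * y′ , *-cancelˡ {π} (λ ()) (lin₂ 1# 1# e h (solve (x ∷ y ∷ y′ ∷ []) 𝔾-ring))) x-odd
  valuation-clash {x} {y} (double {x′} h v) (double {y′} h′ v′) e = valuation-clash v v′
    (cancel-2 (lin₃ 1# (- π) 1# e h h′ (solve (x ∷ y ∷ x′ ∷ y′ ∷ []) 𝔾-ring)))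

  quartic-valuation-1-ring₁ : ∀ n m k w e →
    n * n - (m * m * (m * m) + # 18 * k * π * (m * w * (m * w)) + # 120 * ι * (k * k) * (w * w * (w *
      w)))
    ≡ - 1# * (m * m * (m * m) + # 9 * k * (1# - ι) * (m * m) * (e * e) - # 30 * ι * (k * k) * (e * e *
      (e * e)) - n * n) + (# 9 * k * (1# - ι) * (m * m) * (e + π * w) - # 30 * ι * (k * k) * (e + π *
      w) * (e * e + π * π * (w * w))) * (e - π * w)
  quartic-valuation-1-ring₁ = solve-∀ 𝔾-ring

  quartic-valuation-1-ring₂ : ∀ m n v k w →
    m * m * (m * m) - π * (n * v - # 18 * k * (m * w * (m * w)) - # 60 * (1# - ι) * ι * (k * k) * (w *
      w * (w * w)))
    ≡ - 1# * (n * n - (m * m * (m * m) + # 18 * k * π * (m * w * (m * w)) + # 120 * ι * (k * k) * (w *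
      w * (w * w)))) + n * (n - π * v)
  quartic-valuation-1-ring₂ = solve-∀ 𝔾-ring

  quartic-valuation-1-ring₃ : ∀ a z j k b w n m →
    1# + # 2 * π - 1# - # 4 * π * (a - # 2 * z - j - # 18 * k * π * b - # 15 * (1# - ι) * ι * (k * k)
      * (w * w * (w * w))) - (- 1# * (n * n - (m * m * (m * m) + # 18 * k * π * (m * w * (m * w)) +
      # 120 * ι * (k * k) * (w * w * (w * w)))) + 1# * (n * n - (1# + # 4 * π * a)) + - 1# * (m * m *
      (m * m) - (1# + # 8 * π * z)))
    ≡ - (# 18 * k * π) * (m * w * (m * w) - (1# + # 4 * π * b)) + - π * (# 18 * k - (# 2 + # 4 * j))
  quartic-valuation-1-ring₃ = solve-∀ 𝔾-ring

  quartic-valuation-1-ring₄ : ∀ a z j k b w n m →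
    1# + # 2 * π - 1# - # 4 * π * (a - # 2 * z + 1# + j - # 18 * k * π * b - # 15 * (1# - ι) * ι * (k
      * k) * (w * w * (w * w))) - (- 1# * (n * n - (m * m * (m * m) + # 18 * k * π * (m * w * (m * w))
      + # 120 * ι * (k * k) * (w * w * (w * w)))) + 1# * (n * n - (1# + # 4 * π * a)) + - 1# * (m * m
      * (m * m) - (1# + # 8 * π * z)))
    ≡ - (# 18 * k * π) * (m * w * (m * w) - (- 1# + # 4 * π * b)) + π * (# 18 * k - (# 2 + # 4 * j))
  quartic-valuation-1-ring₄ = solve-∀ 𝔾-ring

  quartic-valuation-1-ring₅ : ∀ a z j k b w n m →
    1# + # 2 * π + 1# - # 4 * π * (a - # 2 * z - j - # 18 * k * π * b - # 15 * (1# - ι) * ι * (k * k)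
      * (w * w * (w * w))) - (- 1# * (n * n - (m * m * (m * m) + # 18 * k * π * (m * w * (m * w)) +
      # 120 * ι * (k * k) * (w * w * (w * w)))) + 1# * (n * n - (- 1# + # 4 * π * a)) + - 1# * (m * m
      * (m * m) - (1# + # 8 * π * z)))
    ≡ - (# 18 * k * π) * (m * w * (m * w) - (1# + # 4 * π * b)) + - π * (# 18 * k - (# 2 + # 4 * j))
  quartic-valuation-1-ring₅ = solve-∀ 𝔾-ring

  quartic-valuation-1-ring₆ : ∀ a z j k b w n m →
    1# + # 2 * π + 1# - # 4 * π * (a - # 2 * z + 1# + j - # 18 * k * π * b - # 15 * (1# - ι) * ι * (k
      * k) * (w * w * (w * w))) - (- 1# * (n * n - (m * m * (m * m) + # 18 * k * π * (m * w * (m * w))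
      + # 120 * ι * (k * k) * (w * w * (w * w)))) + 1# * (n * n - (- 1# + # 4 * π * a)) + - 1# * (m *
      m * (m * m) - (1# + # 8 * π * z)))
    ≡ - (# 18 * k * π) * (m * w * (m * w) - (- 1# + # 4 * π * b)) + π * (# 18 * k - (# 2 + # 4 * j))
  quartic-valuation-1-ring₆ = solve-∀ 𝔾-ring

  -- Modulo 4π, n² would be m⁴ + 18kπ(mw)² ≡ 1 + 2π, whereas an odd square is ±1.
  quartic-valuation-1 : ∀ {m e n w} → Twist k t → Quartic k m e n → Odd m → Odd w → e ≢ π * w
  quartic-valuation-1 {k} {t} {m} {e} {n} {w} K h m-odd w-odd e≡ =
    contradiction (congruence (eighteen-k K) (odd-sq n-odd) (odd-fourth m-odd) (odd-sq (odd-* m-odd w-odd)))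
      (toWitnessFalse {a? = plusMinusMod? (# 4 * π) 1# (1# + # 2 * π) λ ()} _)
    where
    n²≡ : n * n ≡ m * m * (m * m) + # 18 * k * π * (m * w * (m * w)) + # 120 * ι * (k * k) * (w * w * (w * w))
    n²≡ = lin₂ (- 1#) (# 9 * k * (1# - ι) * (m * m) * (e + π * w) - # 30 * ι * (k * k) * (e + π * w) * (e * e + π * π * (w * w))) h e≡ (quartic-valuation-1-ring₁ n m k w e)
    n-odd : Odd n
    n-odd with even-or-odd n
    ... | inj₂ o = o
    ... | inj₁ (v , hv) = parity-clash (m * m * (m * m))
      (n * v - # 18 * k * (m * w * (m * w)) - # 60 * (1# - ι) * ι * (k * k) * (w * w * (w * w)) , lin₂ (- 1#) n n²≡ hv (quartic-valuation-1-ring₂ m n v k w))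
      (odd-* (odd-* m-odd m-odd) (odd-* m-odd m-odd))
    congruence : (∃ λ j → # 18 * k ≡ # 2 + # 4 * j) → PlusMinusOne (n * n) → (∃ λ z → m * m * (m * m) ≡ 1# + # 8 * π * z) → PlusMinusOne (m * w * (m * w)) →
      PlusMinusMod (# 4 * π) 1# (1# + # 2 * π)
    congruence (j , hk) (inj₁ (a , ha)) (z , hz) (inj₁ (b , hb)) = inj₁ (a - # 2 * z - j - # 18 * k * π * b - # 15 * (1# - ι) * ι * (k * k) * (w * w * (w * w)) ,
      lin₃ (- 1#) 1# (- 1#) n²≡ ha hz (lin₂ (- (# 18 * k * π)) (- π) hb hk (quartic-valuation-1-ring₃ a z j k b w n m)))
    congruence (j , hk) (inj₁ (a , ha)) (z , hz) (inj₂ (b , hb)) = inj₁ (a - # 2 * z + 1# + j - # 18 * k * π * b - # 15 * (1# - ι) * ι * (k * k) * (w * w * (w * w)) ,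
      lin₃ (- 1#) 1# (- 1#) n²≡ ha hz (lin₂ (- (# 18 * k * π)) π hb hk (quartic-valuation-1-ring₄ a z j k b w n m)))
    congruence (j , hk) (inj₂ (a , ha)) (z , hz) (inj₁ (b , hb)) = inj₂ (a - # 2 * z - j - # 18 * k * π * b - # 15 * (1# - ι) * ι * (k * k) * (w * w * (w * w)) ,
      lin₃ (- 1#) 1# (- 1#) n²≡ ha hz (lin₂ (- (# 18 * k * π)) (- π) hb hk (quartic-valuation-1-ring₅ a z j k b w n m)))
    congruence (j , hk) (inj₂ (a , ha)) (z , hz) (inj₂ (b , hb)) = inj₂ (a - # 2 * z + 1# + j - # 18 * k * π * b - # 15 * (1# - ι) * ι * (k * k) * (w * w * (w * w)) ,
      lin₃ (- 1#) 1# (- 1#) n²≡ ha hz (lin₂ (- (# 18 * k * π)) π hb hk (quartic-valuation-1-ring₆ a z j k b w n m)))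

  valuation-rec-ring₁ : ∀ e v w → e - # 2 * (ι * v) ≡ 1# * (e - π * w) + π * (w - π * v)
  valuation-rec-ring₁ = solve-∀ 𝔾-ring

  valuation-rec-ring₂ : ∀ e₀ s o′ o q → e₀ - s * (o′ * o) ≡ 1# * (e₀ - q * o) + o * (q - s * o′)
  valuation-rec-ring₂ = solve-∀ 𝔾-ring

  valuation-rec-ring₃ : ∀ e s o′ o e₀ →
    e - s * (# 2 * (o′ * o))
    ≡ 1# * (e - # 2 * e₀) + # 2 * (e₀ - s * (o′ * o))
  valuation-rec-ring₃ = solve-∀ 𝔾-ring

  -- Valuation 1 is excluded by `quartic-valuation-1`, and valuation 2 is even. Beyond that, e = 2e₀
  -- with e₀ even. The two isogeny descents in succession, which in effect halve the point, lead to
  -- s with e equal to 2s times an odd number: the valuation drops by exactly 2.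
  valuation-rec : ∀ {m e n} → Twist k t → Quartic k m e n → Coprime m e → Even e → e ≢ 0# → Acc ℕ._<_ (norm e) → EvenValuation e
  valuation-rec {k} {t} {m} {e} {n} K h cop e-even e≢0 (acc rec) = go e-even
    where
    m-odd : Odd m
    m-odd = coprime-even-odd cop e-even
    go : Even e → EvenValuation e
    go (w , e≡) with even-or-odd w
    ... | inj₂ w-odd = contradiction e≡ (quartic-valuation-1 {m = m} {e} {n} {w} K h m-odd w-odd)
    ... | inj₁ (v , w≡) = with-half (even-or-odd (ι * v)) (lin₂ 1# π e≡ w≡ (valuation-rec-ring₁ e v w))
      where
      with-half : ∀ {e₀} → Even e₀ ⊎ Odd e₀ → e ≡ # 2 * e₀ → EvenValuation e
      with-half (inj₂ o) e≡2e₀ = double e≡2e₀ (odd o)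
      with-half {e₀} (inj₁ ev) e≡2e₀ = double e≡2e₀ (first (descent₁ {m = m} {e} {n} {e₀} K h cop e≡2e₀ ev e₀≢0))
        where
        e₀≢0 : e₀ ≢ 0#
        e₀≢0 = *≢0ʳ {# 2} {e₀} (λ z → e≢0 (trans e≡2e₀ z))
        first : (∃ λ p → ∃ λ q → ∃ λ M → ∃ λ o → Quartic′ k p q M × Coprime p q × Odd o × (e₀ ≡ q * o)) → EvenValuation e₀
        first (p , q , M , o , h′ , p-q , o-odd , e₀≡) = second (descent₂ {p = p} {q} {M} K h′ p-q q-even q≢0)
          where
          q≢0 : q ≢ 0#
          q≢0 = *≢0ˡ {q} {o} (λ z → e₀≢0 (trans e₀≡ z))
          q-even : Even q
          q-even with even-or-odd q
          ... | inj₁ x = x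
          ... | inj₂ x = contradiction (subst Even e₀≡ ev) (odd-not-even (odd-* x o-odd))
          second : (∃ λ r → ∃ λ s → ∃ λ n′ → ∃ λ o → Quartic k r s n′ × Coprime r s × Odd o × Even s × (q ≡ s * o)) → EvenValuation e₀
          second (r , s , n′ , o′ , h″ , r-s , o′-odd , s-even , q≡) = subst EvenValuation (sym e₀≡′)
            (even-valuation-* (valuation-rec {m = r} {s} {n′} K h″ r-s s-even s≢0 (rec smaller)) (odd-* o′-odd o-odd))
            where
            e₀≡′ : e₀ ≡ s * (o′ * o)
            e₀≡′ = lin₂ 1# o e₀≡ q≡ (valuation-rec-ring₂ e₀ s o′ o q)
            s≢0 : s ≢ 0#
            s≢0 = *≢0ˡ {s} {o′} (λ z → q≢0 (trans q≡ z))
            e≡′ : e ≡ s * (# 2 * (o′ * o))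
            e≡′ = lin₂ 1# (# 2) e≡2e₀ e₀≡′ (valuation-rec-ring₃ e s o′ o e₀)
            o≢0 : o′ * o ≢ 0#
            o≢0 z = odd-not-even (odd-* o′-odd o-odd) (0# , z)
            smaller : norm s ℕ.< norm e
            smaller = subst (norm s ℕ.<_) (sym (trans (cong norm e≡′) (norm-* s (# 2 * (o′ * o)))))
              (ℕ.m<m*n (norm s) (norm (# 2 * (o′ * o))) {{ℕ.>-nonZero (norm-0< s≢0)}}
                (subst (1 ℕ.<_) (sym (norm-* (# 2) (o′ * o))) (ℕ.<-≤-trans (ℕ.s≤s (ℕ.s≤s ℕ.z≤n)) (ℕ.m≤m*n 4 (norm (o′ * o)) {{ℕ.>-nonZero (norm-0< o≢0)}}))))

  even-valuation : ∀ {m e n} → Twist k t → Quartic k m e n → Coprime m e → Even e → e ≢ 0# → EvenValuation e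
  even-valuation {m = m} {e} {n} K h cop e-even e≢0 = valuation-rec {m = m} {e} {n} K h cop e-even e≢0 (<-wellFounded _)

-- The genus-one curve with a known point: comparison of valuations.

module Core where

  open Euclid
  open Gauss
  open GaussTools
  open Divisors
  open Quartic
  open DescentC
  open import Data.Product using (∃; _×_; _,_; proj₁; proj₂)
  open import Data.Sum using (_⊎_; inj₁; inj₂)
  open import Data.Empty using (⊥; ⊥-elim)
  open import Data.List using (List; _∷_; [])
  open import Relation.Nullary using (¬_; Dec; yes; no; contradiction)
  open import Relation.Binary.PropositionalEquality

  -- The known point (w₀ : 1 : R₀) of R² = 5ι w⁴ + 9k(1 - ι) w²v² - 6k² v⁴, and a sign τ.
  data Base : (k t w₀ R₀ τ : 𝔾) → Set where
    base₁ : Base (# 1) (# 3) 1# (# 2 - ι) 1#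
    base₃ : Base (# 3) (# 27) (# 2 + ι) (- # 4 + ι) (- 1#)

  private
    variable
      k t w₀ R₀ τ : 𝔾

  base-twist : Base k t w₀ R₀ τ → Twist k t
  base-twist base₁ = one
  base-twist base₃ = three

  odd-w₀ : Base k t w₀ R₀ τ → Odd w₀
  odd-w₀ base₁ = 0# , refl
  odd-w₀ base₃ = 1# , refl

  odd-R₀ : Base k t w₀ R₀ τ → Odd R₀
  odd-R₀ base₁ = - ι , refl
  odd-R₀ base₃ = - # 2 + # 3 * ι , refl

  odd-τ : Base k t w₀ R₀ τ → Odd τ
  odd-τ base₁ = 0# , refl
  odd-τ base₃ = - # 1 + ι , refl

  -- For odd ζ and v, R₀v² + 7ζ is R₀ + 7 modulo 2; that this has valuation exactly 1 excludes odd ζ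
  -- in `core-even`.
  R₀+7 : Base k t w₀ R₀ τ → ∃ λ z → Odd z × (R₀ + # 7 ≡ π * z)
  R₀+7 base₁ = # 4 - # 5 * ι , (- # 1 - # 4 * ι , refl) , refl
  R₀+7 base₃ = # 2 - ι , (- ι , refl) , refl

  OnCurve : 𝔾 → 𝔾 → 𝔾 → 𝔾 → Set
  OnCurve k R w v = R * R ≡ # 5 * ι * (w * w * (w * w)) + # 9 * k * (1# - ι) * (w * w) * (v * v) - # 6 * (k * k) * (v * v * (v * v))

  translate-ring₁ : ∀ ζ v d R w →
    # 7 * (# 4 * ζ * ((# 2 - ι) * (v * v) + # 7 * ζ + (1# - ι) * d)) - # 7 * (d * (ι * d + 1# * π * (v
      * v)))
    ≡ 1# * (R * R - (# 5 * ι * (w * w * (w * w)) + # 9 * # 1 * (1# - ι) * (w * w) * (v * v) - # 6 *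
      (# 1 * # 1) * (v * v * (v * v)))) + - (R + (# 2 - ι) * (v * v) + (1# - ι) * d + # 14 * ζ) * (R -
      ((# 2 - ι) * (v * v) + (1# - ι) * d + # 14 * ζ)) + - (# 5 * ι * (w * w + d + v * v) + # 9 * (1#
      - ι) * (v * v)) * (d - (w * w - 1# * 1# * (v * v)))
  translate-ring₁ = solve-∀ 𝔾-ring

  translate-ring₂ : ∀ ζ v d R w →
    # 7 * (# 4 * ζ * ((- (# 4) + ι) * (v * v) + # 7 * ζ + (1# - ι) * d)) - # 7 * (d * (ι * d + - 1# *
      π * (v * v)))
    ≡ 1# * (R * R - (# 5 * ι * (w * w * (w * w)) + # 9 * # 3 * (1# - ι) * (w * w) * (v * v) - # 6 *
      (# 3 * # 3) * (v * v * (v * v)))) + - (R + (- (# 4) + ι) * (v * v) + (1# - ι) * d + # 14 * ζ) *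
      (R - ((- (# 4) + ι) * (v * v) + (1# - ι) * d + # 14 * ζ)) + - (# 5 * ι * (w * w + d + (# 3 + # 4
      * ι) * (v * v)) + # 27 * (1# - ι) * (v * v)) * (d - (w * w - (# 2 + ι) * (# 2 + ι) * (v * v)))
  translate-ring₂ = solve-∀ 𝔾-ring

  -- Substitute w² = d + w₀²v² and the expression for R: the terms of the known point cancel, and
  -- the rest is divisible by 7. The shape of R comes from 7X = 2(1 - ι)w² + 9kv² - 2R, with 4ζ the
  -- amount by which X falls short of its value at the known point.
  translate : ∀ {R w v d ζ} → Base k t w₀ R₀ τ → OnCurve k R w v → d ≡ w * w - w₀ * w₀ * (v * v) →
    R ≡ R₀ * (v * v) + (1# - ι) * d + # 14 * ζ →
    # 4 * ζ * (R₀ * (v * v) + # 7 * ζ + (1# - ι) * d) ≡ d * (ι * d + τ * π * (v * v))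
  translate {R = R} {w} {v} {d} {ζ} base₁ h d≡ R≡ = *-cancelˡ {# 7} (λ ())
    (lin₃ 1# (- (R + (# 2 - ι) * (v * v) + (1# - ι) * d + # 14 * ζ)) (- (# 5 * ι * (w * w + d + v * v) + # 9 * (1# - ι) * (v * v))) h R≡ d≡ (translate-ring₁ ζ v d R w))
  translate {R = R} {w} {v} {d} {ζ} base₃ h d≡ R≡ = *-cancelˡ {# 7} (λ ())
    (lin₃ 1# (- (R + (- # 4 + ι) * (v * v) + (1# - ι) * d + # 14 * ζ)) (- (# 5 * ι * (w * w + d + (# 3 + # 4 * ι) * (v * v)) + # 27 * (1# - ι) * (v * v))) h R≡ d≡ (translate-ring₂ ζ v d R w))

  -- The difference of (w : v : R) and the known point, on the Jacobian.
  quartic-point-ring₁ : ∀ R w v →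
    (1# * R + (# 2 - ι) * w * v) * (1# * R + (# 2 - ι) * w * v) * ((1# * R + (# 2 - ι) * w * v) * (1#
      * R + (# 2 - ι) * w * v)) + # 9 * # 1 * (1# - ι) * ((1# * R + (# 2 - ι) * w * v) * (1# * R +
      (# 2 - ι) * w * v)) * ((w * w - 1# * 1# * (v * v)) * (w * w - 1# * 1# * (v * v))) - # 30 * ι *
      (# 1 * # 1) * ((w * w - 1# * 1# * (v * v)) * (w * w - 1# * 1# * (v * v)) * ((w * w - 1# * 1# *
      (v * v)) * (w * w - 1# * 1# * (v * v)))) - ((# 2 - ι) * R * v * v + (# 2 - ι) * R * w * w + (# 9
      + ι) * v * w * w * w - (# 3 + # 9 * ι) * v * v * v * w) * ((# 2 - ι) * R * v * v + (# 2 - ι) * R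
      * w * w + (# 9 + ι) * v * w * w * w - (# 3 + # 9 * ι) * v * v * v * w)
    ≡ ((# 8 - # 4 * ι) * R * v * w + R * R + (# 3 - # 7 * ι) * v * v * w * w - # 5 * ι * v * v * v * v
      + # 6 * w * w * w * w) * (R * R - (# 5 * ι * (w * w * (w * w)) + # 9 * # 1 * (1# - ι) * (w * w)
      * (v * v) - # 6 * (# 1 * # 1) * (v * v * (v * v))))
  quartic-point-ring₁ = solve-∀ 𝔾-ring

  quartic-point-ring₂ : ∀ R w v →
    ((# 2 + ι) * R + (- (# 4) + ι) * w * v) * ((# 2 + ι) * R + (- (# 4) + ι) * w * v) * (((# 2 + ι) *
      R + (- (# 4) + ι) * w * v) * ((# 2 + ι) * R + (- (# 4) + ι) * w * v)) + # 9 * # 3 * (1# - ι) *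
      (((# 2 + ι) * R + (- (# 4) + ι) * w * v) * ((# 2 + ι) * R + (- (# 4) + ι) * w * v)) * ((w * w -
      (# 2 + ι) * (# 2 + ι) * (v * v)) * (w * w - (# 2 + ι) * (# 2 + ι) * (v * v))) - # 30 * ι * (# 3
      * # 3) * ((w * w - (# 2 + ι) * (# 2 + ι) * (v * v)) * (w * w - (# 2 + ι) * (# 2 + ι) * (v * v))
      * ((w * w - (# 2 + ι) * (# 2 + ι) * (v * v)) * (w * w - (# 2 + ι) * (# 2 + ι) * (v * v)))) - ((-
      (# 16) - # 13 * ι) * R * v * v + (- (# 4) + ι) * R * w * w + (- (# 29) - # 7 * ι) * v * w * w *
      w + (# 135 + # 135 * ι) * v * v * v * w) * ((- (# 16) - # 13 * ι) * R * v * v + (- (# 4) + ι) *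
      R * w * w + (- (# 29) - # 7 * ι) * v * w * w * w + (# 135 + # 135 * ι) * v * v * v * w)
    ≡ ((- (# 76) - # 168 * ι) * R * v * w + (- (# 7) + # 24 * ι) * R * R + (- (# 151) - # 693 * ι) * v
      * v * w * w + (- (# 1680) + # 2635 * ι) * v * v * v * v + # 54 * w * w * w * w) * (R * R - (# 5
      * ι * (w * w * (w * w)) + # 9 * # 3 * (1# - ι) * (w * w) * (v * v) - # 6 * (# 3 * # 3) * (v * v
      * (v * v))))
  quartic-point-ring₂ = solve-∀ 𝔾-ring

  quartic-point : ∀ {R w v d μ} → Base k t w₀ R₀ τ → OnCurve k R w v → d ≡ w * w - w₀ * w₀ * (v * v) → μ ≡ w₀ * R + R₀ * w * v →
    ∃ λ n → Quartic k μ d n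
  quartic-point {R = R} {w} {v} {d} {μ} base₁ h refl refl =
    (# 2 - ι) * R * v * v + (# 2 - ι) * R * w * w + (# 9 + ι) * v * w * w * w - (# 3 + # 9 * ι) * v * v * v * w ,
    lin₁ ((# 8 - # 4 * ι) * R * v * w + R * R + (# 3 - # 7 * ι) * v * v * w * w - # 5 * ι * v * v * v * v + # 6 * w * w * w * w) h (quartic-point-ring₁ R w v)
  quartic-point {R = R} {w} {v} {d} {μ} base₃ h refl refl =
    (- # 16 - # 13 * ι) * R * v * v + (- # 4 + ι) * R * w * w + (- # 29 - # 7 * ι) * v * w * w * w + (# 135 + # 135 * ι) * v * v * v * w ,
    lin₁ ((- # 76 - # 168 * ι) * R * v * w + (- # 7 + # 24 * ι) * R * R + (- # 151 - # 693 * ι) * v * v * w * w + (- # 1680 + # 2635 * ι) * v * v * v * v + # 54 * w * w * w * w) h (quartic-point-ring₂ R w v)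

  square-∣ : ∀ {x y z} → x ≢ 0# → y * y ≡ x * x * z → x ∣ y
  square-∣ {x} {y} {z} x≢0 h = go (gcd x y x≢0)
    where
    go : (∃ λ g → ∃ λ x′ → ∃ λ y′ → (x ≡ g * x′) × (y ≡ g * y′) × (g ≢ 0#) × Coprime x′ y′) → x ∣ y
    go (g , x′ , y′ , x≡ , y≡ , g≢0 , c) = finish (coprime-unit (coprime-*ʳ {x′} {y′} {y′} c c) (x′ * z , y′y′≡))
      where
      y′y′≡ : y′ * y′ ≡ x′ * (x′ * z)
      y′y′≡ = *-cancelˡ (*-≢0 g≢0 g≢0) (lin₃ 1# (z * (x + g * x′)) (- (y + g * y′)) h x≡ y≡ (solve (x ∷ y ∷ z ∷ g ∷ x′ ∷ y′ ∷ []) 𝔾-ring))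
      finish : IsUnit x′ → x ∣ y
      finish (u , e) = u * y′ , lin₃ 1# (- (u * y′)) (- (g * y′)) y≡ x≡ e (solve (x ∷ y ∷ g ∷ x′ ∷ y′ ∷ u ∷ []) 𝔾-ring)

  core-even-ring₁ : ∀ d h₁ w₀ v h w →
    d - # 4 * π * (h₁ * (w₀ * v + h))
    ≡ 1# * (d - (w * w - w₀ * w₀ * (v * v))) + (w + w₀ * v + # 2 * h) * (w - (w₀ * v + # 2 * h)) + # 4
      * (w₀ * v + h) * (h - π * h₁)
  core-even-ring₁ = solve-∀ 𝔾-ring

  core-even-ring₂ : ∀ ζ R₀ v d y τ →
    # 4 * (ζ * (R₀ * (v * v) + # 7 * ζ + (1# - ι) * d)) - # 4 * (# 2 * ι * y * (# 4 * ι * y + τ * (v *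
      v)))
    ≡ 1# * (# 4 * ζ * (R₀ * (v * v) + # 7 * ζ + (1# - ι) * d) - d * (ι * d + τ * π * (v * v))) + (ι *
      d + τ * π * (v * v) + # 4 * π * y * ι) * (d - # 4 * π * y)
  core-even-ring₂ = solve-∀ 𝔾-ring

  core-even-ring₃ : ∀ ζ z R₀ a b y τ v d →
    π * (ζ * (z + (1# - ι) * (R₀ * (# 2 * a + # 2 * a * a) + # 7 * b + # 4 * y))) - π * (π * (y * (# 4
      * ι * y + τ * (v * v)))) - (1# * (ζ * (R₀ * (v * v) + # 7 * ζ + (1# - ι) * d) - # 2 * ι * y *
      (# 4 * ι * y + τ * (v * v))) + - (ζ * R₀ * (v + 1# + # 2 * a)) * (v - (1# + # 2 * a)) + - (ζ *
      # 7) * (ζ - (1# + # 2 * b)))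
    ≡ - ζ * (R₀ + # 7 - π * z) + - (ζ * (1# - ι)) * (d - # 4 * π * y)
  core-even-ring₃ = solve-∀ 𝔾-ring

  core-even-ring₄ : ∀ w₀ R R₀ w v h ζ y d →
    w₀ * R + R₀ * w * v - # 2 * (R₀ * w₀ * (v * v) + (h * (R₀ * v) + (# 7 * w₀ * ζ + # 4 * w₀ * y)))
    ≡ w₀ * (R - (R₀ * (v * v) + (1# - ι) * d + # 14 * ζ)) + R₀ * v * (w - (w₀ * v + # 2 * h)) + w₀ *
      (1# - ι) * (d - # 4 * π * y)
  core-even-ring₄ = solve-∀ 𝔾-ring

  core-even-ring₅ : ∀ n g m k e μ d →
    n * n - g * g * (g * g) * (m * m * (m * m) + # 9 * k * (1# - ι) * (m * m) * (e * e) - # 30 * ι *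
      (k * k) * (e * e * (e * e)))
    ≡ - 1# * (μ * μ * (μ * μ) + # 9 * k * (1# - ι) * (μ * μ) * (d * d) - # 30 * ι * (k * k) * (d * d *
      (d * d)) - n * n) + (μ + g * m) * (μ * μ + g * g * m * m + # 9 * k * (1# - ι) * (d * d)) * (μ -
      g * m) + (d + g * e) * (# 9 * k * (1# - ι) * (g * g * (m * m)) - # 30 * ι * (k * k) * (d * d + g
      * g * e * e)) * (d - g * e)
  core-even-ring₅ = solve-∀ 𝔾-ring

  core-even-ring₆ : ∀ g m k e n′ n →
    g * g * (g * g) * (m * m * (m * m) + # 9 * k * (1# - ι) * (m * m) * (e * e) - # 30 * ι * (k * k) *
      (e * e * (e * e))) - g * g * (g * g) * (n′ * n′)
    ≡ - 1# * (n * n - g * g * (g * g) * (m * m * (m * m) + # 9 * k * (1# - ι) * (m * m) * (e * e) -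
      # 30 * ι * (k * k) * (e * e * (e * e)))) + (n + g * g * n′) * (n - g * g * n′)
  core-even-ring₆ = solve-∀ 𝔾-ring

  core-even-ring₇ : ∀ M e y m μ g d →
    # 2 * (M * e) - # 2 * (# 2 * π * (y * m)) - (- e * (μ - # 2 * M) + e * (μ - g * m) + - m * (d - g
      * e))
    ≡ m * (d - # 4 * π * y)
  core-even-ring₇ = solve-∀ 𝔾-ring

  core-even-ring₈ : ∀ ζ m U e M V y →
    π * (ζ * (m * U)) - e * (M * (ι * V))
    ≡ π * m * (ζ * U - # 2 * ι * y * V) + - ι * V * (M * e - # 2 * π * (y * m))
  core-even-ring₈ = solve-∀ 𝔾-ring

  -- All valuations v are at π. In lowest terms the point (μ : d) of `quartic-point` is (m : e) with
  -- e even, so v(e) is even by the descent. Since d = 4πy and μ is 2 times an odd number, v(e) =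
  -- v(2πy) = v(y) + 3. For even ζ, `translate` reads ζU = 2ιyV with U and V odd, so v(ζ) = v(y) +
  -- 2. Hence v(e) = v(ζ) + 1, although v(ζ) is even by hypothesis.
  core-even : ∀ {R w v d ζ h a} → Base k t w₀ R₀ τ → OnCurve k R w v → d ≡ w * w - w₀ * w₀ * (v * v) →
    R ≡ R₀ * (v * v) + (1# - ι) * d + # 14 * ζ →
    v ≡ 1# + # 2 * a → (∃ λ b → ζ ≡ 1# + # 2 * b) ⊎ Even ζ → (ζ ≡ 0# ⊎ EvenValuation ζ) →
    w ≡ w₀ * v + # 2 * h → Even h → d ≢ 0# → ⊥
  core-even {k} {t} {w₀} {R₀} {τ} {R} {w} {v} {d} {ζ} {h} {a} B curve d≡ R≡ v≡ ζ-parity ζ-val w≡ (h₁ , h≡) d≢0 =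
    main (h₁ * (w₀ * v + h)) (lin₃ 1# (w + w₀ * v + # 2 * h) (# 4 * (w₀ * v + h)) d≡ w≡ h≡ (core-even-ring₁ d h₁ w₀ v h w))
    where
    v-odd : Odd v
    v-odd = (1# - ι) * a , lin₁ 1# v≡ (solve (v ∷ a ∷ []) 𝔾-ring)
    main : ∀ y → d ≡ # 4 * π * y → ⊥
    main y d≡4πy = with-ζ ζ-parity
      where
      U V : 𝔾
      U = R₀ * (v * v) + # 7 * ζ + (1# - ι) * d
      V = # 4 * ι * y + τ * (v * v)
      ζU≡ : ζ * (R₀ * (v * v) + # 7 * ζ + (1# - ι) * d) ≡ # 2 * ι * y * (# 4 * ι * y + τ * (v * v))
      ζU≡ = *-cancelˡ {# 4} (λ ()) (lin₂ 1# (ι * d + τ * π * (v * v) + # 4 * π * y * ι) (translate {w = w} B curve d≡ R≡) d≡4πy (core-even-ring₂ ζ R₀ v d y τ))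
      V-odd : Odd V
      V-odd = subst Odd (l (# 4 * ι * y) (τ * (v * v))) (odd-+ {τ * (v * v)} {# 4 * ι * y} (odd-* (odd-τ B) (odd-* v-odd v-odd)) (# 2 * (1# - ι) * ι * y , solve (y ∷ []) 𝔾-ring))
        where
        l : ∀ x y → y + x ≡ x + y
        l = solve-∀ 𝔾-ring
      with-ζ : (∃ λ b → ζ ≡ 1# + # 2 * b) ⊎ Even ζ → ⊥
      -- For odd ζ, U is R₀ + 7 modulo 2, so ζU has valuation 1, while the other side is divisible
      -- by 2 = -ιπ².
      with-ζ (inj₁ (b , ζ≡)) = with-R₀ (R₀+7 B)
        where
        ζ-odd : Odd ζ
        ζ-odd = (1# - ι) * b , lin₁ 1# ζ≡ (solve (ζ ∷ b ∷ []) 𝔾-ring)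
        with-R₀ : (∃ λ z → Odd z × (R₀ + # 7 ≡ π * z)) → ⊥
        with-R₀ (z , z-odd , R₀≡) = parity-clash (ζ * (z + (1# - ι) * (R₀ * (# 2 * a + # 2 * a * a) + # 7 * b + # 4 * y)))
          (y * (# 4 * ι * y + τ * (v * v)) , *-cancelˡ {π} (λ ())
            (lin₃ 1# (- (ζ * R₀ * (v + 1# + # 2 * a))) (- (ζ * # 7)) ζU≡ v≡ ζ≡ (lin₂ (- ζ) (- (ζ * (1# - ι))) R₀≡ d≡4πy (core-even-ring₃ ζ z R₀ a b y τ v d))))
          (odd-* ζ-odd (odd-+ z-odd (- ι * (R₀ * (# 2 * a + # 2 * a * a) + # 7 * b + # 4 * y) , l (R₀ * (# 2 * a + # 2 * a * a) + # 7 * b + # 4 * y))))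
          where
          l : ∀ x → (1# - ι) * x ≡ π * (- ι * x)
          l = solve-∀ 𝔾-ring
      with-ζ (inj₂ ζ-even) = with-valuation ζ-val
        where
        U-odd : Odd U
        U-odd = odd-+ {R₀ * (v * v) + # 7 * ζ} {(1# - ι) * d} (odd-+ (odd-* (odd-R₀ B) (odd-* v-odd v-odd)) (even-*ʳ {ζ} {# 7} ζ-even)) (- ι * d , solve (d ∷ []) 𝔾-ring)
        y≢0 : y ≢ 0#
        y≢0 y≡0 = d≢0 (lin₂ 1# (# 4 * π) d≡4πy y≡0 (solve (d ∷ y ∷ []) 𝔾-ring))
        odd≢0 : ∀ {x} → Odd x → x ≢ 0#
        odd≢0 o z = odd-not-even o (0# , z)
        with-valuation : ζ ≡ 0# ⊎ EvenValuation ζ → ⊥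
        with-valuation (inj₁ ζ≡0) = *-≢0 {# 2 * ι * y} {V} (*-≢0 {# 2 * ι} {y} (λ ()) y≢0) (odd≢0 V-odd) (trans (sym ζU≡) (trans (cong (_* U) ζ≡0) (l U)))
          where
          l : ∀ x → 0# * x ≡ 0#
          l = solve-∀ 𝔾-ring
        with-valuation (inj₂ ζ-val) = with-point (quartic-point {R = R} {w} {v} {d} {w₀ * R + R₀ * w * v} B curve d≡ refl)
          where
          -- Half of w₀R + R₀wv. The term R₀w₀v² is odd and the others are even.
          μ′ : 𝔾
          μ′ = R₀ * w₀ * (v * v) + (h * (R₀ * v) + (# 7 * w₀ * ζ + # 4 * w₀ * y))
          μ′-odd : Odd μ′
          μ′-odd = odd-+ {R₀ * w₀ * (v * v)} (odd-* (odd-* (odd-R₀ B) (odd-w₀ B)) (odd-* v-odd v-odd))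
            (even-+ {h * (R₀ * v)} {# 7 * w₀ * ζ + # 4 * w₀ * y} (even-*ˡ {h} {R₀ * v} (h₁ , h≡)) (even-+ {# 7 * w₀ * ζ} {# 4 * w₀ * y} (even-*ʳ {ζ} {# 7 * w₀} ζ-even) (# 2 * (1# - ι) * w₀ * y , solve (w₀ ∷ y ∷ []) 𝔾-ring)))
          μ≡ : w₀ * R + R₀ * w * v ≡ # 2 * (R₀ * w₀ * (v * v) + (h * (R₀ * v) + (# 7 * w₀ * ζ + # 4 * w₀ * y)))
          μ≡ = lin₃ w₀ (R₀ * v) (w₀ * (1# - ι)) R≡ w≡ d≡4πy (core-even-ring₄ w₀ R R₀ w v h ζ y d)
          with-point : (∃ λ n → Quartic k (w₀ * R + R₀ * w * v) d n) → ⊥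
          with-point (n , point) = with-gcd _ refl (gcd d (w₀ * R + R₀ * w * v) d≢0)
            where
            with-gcd : ∀ μ → w₀ * R + R₀ * w * v ≡ μ → (∃ λ g → ∃ λ e → ∃ λ m → (d ≡ g * e) × (w₀ * R + R₀ * w * v ≡ g * m) × (g ≢ 0#) × Coprime e m) → ⊥
            with-gcd μ μ-def (g , e , m , d≡ge , μ≡gm′ , g≢0 , e-m) = with-n (square-∣ {g * g} {n} {rest} (*-≢0 g≢0 g≢0) n²≡)
              where
              rest : 𝔾
              rest = m * m * (m * m) + # 9 * k * (1# - ι) * (m * m) * (e * e) - # 30 * ι * (k * k) * (e * e * (e * e))
              μ≡gm : μ ≡ g * m
              μ≡gm = trans (sym μ-def) μ≡gm′
              point′ : Quartic k μ d n
              point′ = subst (λ x → Quartic k x d n) μ-def point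
              n²≡ : n * n ≡ g * g * (g * g) * (m * m * (m * m) + # 9 * k * (1# - ι) * (m * m) * (e * e) - # 30 * ι * (k * k) * (e * e * (e * e)))
              n²≡ = lin₃ (- 1#) ((μ + g * m) * (μ * μ + g * g * m * m + # 9 * k * (1# - ι) * (d * d))) ((d + g * e) * (# 9 * k * (1# - ι) * (g * g * (m * m)) - # 30 * ι * (k * k) * (d * d + g * g * e * e)))
                point′ μ≡gm d≡ge (core-even-ring₅ n g m k e μ d)
              with-n : g * g ∣ n → ⊥
              with-n (n′ , n≡) = valuation-clash (even-valuation-* ζ-val (odd-* m-odd U-odd)) (even-valuation-* e-val (odd-* μ′-odd (odd-* {ι} (ι , refl) V-odd))) clash
                where
                m-e : Coprime m e
                m-e = coprime-sym {e} {m} e-m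
                quartic : Quartic k m e n′
                quartic = *-cancelˡ (*-≢0 {g * g} {g * g} (*-≢0 g≢0 g≢0) (*-≢0 g≢0 g≢0)) (lin₂ (- 1#) (n + g * g * n′) n²≡ n≡ (core-even-ring₆ g m k e n′ n))
                μ′e≡ : ∀ {M} → μ ≡ # 2 * M → M * e ≡ # 2 * π * (y * m)
                μ′e≡ {M} μ≡2M = cancel-2 (lin₃ (- e) e (- m) μ≡2M μ≡gm d≡ge (lin₁ m d≡4πy (core-even-ring₇ M e y m μ g d)))
                e-even : Even e
                e-even = from (μ′e≡ (trans (sym μ-def) μ≡))
                  where
                  from : μ′ * e ≡ # 2 * π * (y * m) → Even e
                  from eq with even-or-odd e
                  ... | inj₁ x = x
                  ... | inj₂ x = parity-clash (μ′ * e) (# 2 * (y * m) , trans eq (l (y * m))) (odd-* μ′-odd x)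
                    where
                    l : ∀ x → # 2 * π * x ≡ π * (# 2 * x)
                    l = solve-∀ 𝔾-ring
                m-odd : Odd m
                m-odd = coprime-even-odd m-e e-even
                e-val : EvenValuation e
                e-val = even-valuation {m = m} {e} {n′} (base-twist B) quartic m-e e-even (*≢0ʳ {g} {e} (λ z → d≢0 (trans d≡ge z)))
                clash : π * (ζ * (m * U)) ≡ e * (μ′ * (ι * V))
                clash = combine U V μ′ ζU≡ (μ′e≡ (trans (sym μ-def) μ≡))
                  where
                  combine : ∀ U V M → ζ * U ≡ # 2 * ι * y * V → M * e ≡ # 2 * π * (y * m) → π * (ζ * (m * U)) ≡ e * (M * (ι * V))
                  combine U V M h₁ h₂ = lin₂ (π * m) (- ι * V) h₁ h₂ (core-even-ring₈ ζ m U e M V y)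

  core-ring₁ : ∀ R w k v →
    R * R - (# 5 * ι * (- w * - w * (- w * - w)) + # 9 * k * (1# - ι) * (- w * - w) * (v * v) - # 6 *
      (k * k) * (v * v * (v * v)))
    ≡ 1# * (R * R - (# 5 * ι * (w * w * (w * w)) + # 9 * k * (1# - ι) * (w * w) * (v * v) - # 6 * (k *
      k) * (v * v * (v * v))))
  core-ring₁ = solve-∀ 𝔾-ring

  -- Replacing w by -w changes h into -(h + w₀v), which has the other parity as w₀v is odd. So one
  -- of the two signs meets the requirement of `core-even`. The conclusion d = 0 says w = ±w₀v.
  core : ∀ {R w v d ζ h a} → Base k t w₀ R₀ τ → OnCurve k R w v → d ≡ w * w - w₀ * w₀ * (v * v) →
    R ≡ R₀ * (v * v) + (1# - ι) * d + # 14 * ζ →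
    v ≡ 1# + # 2 * a → (∃ λ b → ζ ≡ 1# + # 2 * b) ⊎ Even ζ → (ζ ≡ 0# ⊎ EvenValuation ζ) →
    w ≡ w₀ * v + # 2 * h → d ≡ 0#
  core {k} {t} {w₀} {R₀} {τ} {R} {w} {v} {d} {ζ} {h} {a} B curve d≡ R≡ v≡ ζ-parity ζ-val w≡ = decide (d ≟ 0#) (even-or-odd h)
    where
    w₀v-odd : Odd (w₀ * v)
    w₀v-odd = odd-* {w₀} {v} (odd-w₀ B) ((1# - ι) * a , lin₁ 1# v≡ (solve (v ∷ a ∷ []) 𝔾-ring))
    decide : Dec (d ≡ 0#) → Even h ⊎ Odd h → d ≡ 0#
    decide (yes d≡0) _ = d≡0
    decide (no d≢0) (inj₁ h-even) = ⊥-elim (core-even {w = w} {v} {d} {ζ} {h} {a} B curve d≡ R≡ v≡ ζ-parity ζ-val w≡ h-even d≢0)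
    decide (no d≢0) (inj₂ h-odd) = ⊥-elim (core-even {R = R} {w = - w} {v} {d} {ζ} {(- # 1) * (h + w₀ * v)} {a} B
      (lin₁ 1# curve (core-ring₁ R w k v)) (lin₁ 1# d≡ (solve (d ∷ w ∷ w₀ ∷ v ∷ []) 𝔾-ring)) R≡ v≡ ζ-parity ζ-val
      (lin₁ (- 1#) w≡ (solve (w ∷ w₀ ∷ v ∷ h ∷ []) 𝔾-ring)) (even-*ʳ {h + w₀ * v} {(- # 1)} (odd-+-odd h-odd w₀v-odd)) d≢0)

-- From rational integers to the curve over ℤ[i]; Pythagorean triples.

module TenA where

  open Euclid
  open Gauss
  open GaussTools
  open Divisors
  open Quartic
  open DescentB using (conj-hom-*; conj-conj; re)
  open DescentC
  open Core
  module ℤT = IntTools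
  open import Data.Integer as ℤ using (ℤ; +_; -[1+_]; ∣_∣)
  import Data.Integer.Properties as ℤ
  import Data.Integer.Tactic.RingSolver as ℤSolver
  open import Data.Nat as ℕ using (ℕ; zero; suc)
  import Data.Nat.Properties as ℕ
  open import Data.Nat.Induction using (<-wellFounded)
  open import Induction.WellFounded using (Acc; acc)
  open import Data.Product using (∃; _×_; _,_; proj₁; proj₂)
  open import Data.Sum using (_⊎_; inj₁; inj₂)
  open import Data.Empty using (⊥; ⊥-elim)
  open import Data.List using (List; _∷_; [])
  open import Data.List.Membership.Propositional using (_∈_)
  open import Data.List.Relation.Unary.Any using (here; there)
  open import Relation.Nullary using (¬_; Dec; yes; no; contradiction)
  open import Relation.Binary.PropositionalEquality

  parity : ∀ x → (∃ λ q → x ≡ + 2 ℤ.* q) ⊎ (∃ λ q → x ≡ ℤ.1ℤ ℤ.+ + 2 ℤ.* q)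
  parity x with ℤT.residue 2 x
  ... | 0 , q , _ , h = inj₁ (q , trans h (l q))
    where
    l : ∀ q → + 0 ℤ.+ q ℤ.* + 2 ≡ + 2 ℤ.* q
    l = ℤSolver.solve-∀
  ... | 1 , q , _ , h = inj₂ (q , trans h (l q))
    where
    l : ∀ q → + 1 ℤ.+ q ℤ.* + 2 ≡ + 1 ℤ.+ + 2 ℤ.* q
    l = ℤSolver.solve-∀
  ... | suc (suc _) , _ , ℕ.s≤s (ℕ.s≤s ()) , _

  emb : ℤ → 𝔾
  emb x = x +i ℤ.0ℤ

  emb-+ : ∀ {x y X Y} → emb x ≡ X → emb y ≡ Y → emb (x ℤ.+ y) ≡ X + Y
  emb-+ refl refl = refl

  emb-* : ∀ {x y X Y} → emb x ≡ X → emb y ≡ Y → emb (x ℤ.* y) ≡ X * Y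
  emb-* {x} {y} refl refl = cong₂ _+i_ (l₁ x y) (l₂ x y)
    where
    l₁ : ∀ x y → x ℤ.* y ≡ x ℤ.* y ℤ.- ℤ.0ℤ ℤ.* ℤ.0ℤ
    l₁ = ℤSolver.solve-∀
    l₂ : ∀ x y → ℤ.0ℤ ≡ x ℤ.* ℤ.0ℤ ℤ.+ ℤ.0ℤ ℤ.* y
    l₂ = ℤSolver.solve-∀

  emb-- : ∀ {x y X Y} → emb x ≡ X → emb y ≡ Y → emb (x ℤ.- y) ≡ X - Y
  emb-- refl refl = refl

  emb-≡ : ∀ {x y X Y} → x ≡ y → emb x ≡ X → emb y ≡ Y → X ≡ Y
  emb-≡ refl refl refl = refl

  emb-odd : ∀ {x b} → x ≡ ℤ.1ℤ ℤ.+ + 2 ℤ.* b → emb x ≡ 1# + # 2 * emb b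
  emb-odd {x} {b} h = emb-≡ {x} h refl (emb-+ {ℤ.1ℤ} {+ 2 ℤ.* b} refl (emb-* {+ 2} {b} refl refl))

  emb-even : ∀ {x b} → x ≡ + 2 ℤ.* b → emb x ≡ # 2 * emb b
  emb-even {x} {b} h = emb-≡ {x} h refl (emb-* {+ 2} {b} refl refl)

  1+2*-odd : ∀ {x b} → x ≡ 1# + # 2 * b → Odd x
  1+2*-odd {x} {b} h = (1# - ι) * b , lin₁ 1# h (solve (x ∷ b ∷ []) 𝔾-ring)

  2*-even : ∀ {x b} → x ≡ # 2 * b → Even x
  2*-even {x} {b} h = (1# - ι) * b , lin₁ 1# h (solve (x ∷ b ∷ []) 𝔾-ring)

  -- An odd integer stays odd in ℤ[i], and 2 has valuation 2 at π. This is where rationality enters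
  -- the argument.
  emb-valuation : ∀ x → Acc ℕ._<_ ∣ x ∣ → emb x ≡ 0# ⊎ EvenValuation (emb x)
  emb-valuation x (acc rec) with parity x
  ... | inj₂ (b , h) = inj₂ (odd (1+2*-odd {emb x} {emb b} (emb-odd {x} {b} h)))
  ... | inj₁ (b , h) with b ℤ.≟ ℤ.0ℤ
  ... | yes refl = inj₁ (cong emb h)
  ... | no b≢0 = go (emb-valuation b (rec smaller))
    where
    smaller : ∣ b ∣ ℕ.< ∣ x ∣
    smaller = subst (∣ b ∣ ℕ.<_) (sym (trans (cong ∣_∣ h) (trans (ℤ.abs-* (+ 2) b) (ℕ.*-comm 2 ∣ b ∣))))
      (ℕ.m<m*n ∣ b ∣ 2 {{ℕ.≢-nonZero λ z → b≢0 (ℤ.∣i∣≡0⇒i≡0 z)}} (ℕ.s≤s (ℕ.s≤s ℕ.z≤n)))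
    go : emb b ≡ 0# ⊎ EvenValuation (emb b) → emb x ≡ 0# ⊎ EvenValuation (emb x)
    go (inj₁ z) = inj₁ (trans (emb-even {x} {b} h) (cong (# 2 *_) z))
    go (inj₂ v) = inj₂ (double {emb b} (emb-even {x} {b} h) v)

  emb-parity : ∀ x → (∃ λ b → emb x ≡ 1# + # 2 * b) ⊎ Even (emb x)
  emb-parity x with parity x
  ... | inj₁ (b , h) = inj₂ (2*-even {emb x} {emb b} (emb-even {x} {b} h))
  ... | inj₂ (b , h) = inj₁ (emb b , emb-odd {x} {b} h)

  im : 𝔾 → ℤ
  im (_ +i b) = b

  -- With T = (1 - ι)w² = X - ιY and R = T + c, the equation of Y becomes the quartic in w.
  on-curve : ∀ {k w₀ R₀ κ} → (k ≡ # 1 × w₀ ≡ 1# × R₀ ≡ # 2 - ι × κ ≡ # 1) ⊎ (k ≡ # 3 × w₀ ≡ # 2 + ι × R₀ ≡ - # 4 + ι × κ ≡ # 7) →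
    ∀ {X Y v ζ w} → X ≡ κ * (v * v) - # 4 * ζ → (1# - ι) * (w * w) ≡ X - ι * Y →
    # 2 * (Y * Y) ≡ # 5 * (X * X) - # 18 * k * (X * (v * v)) + # 15 * (k * k) * (v * v * (v * v)) →
    OnCurve k (R₀ * (v * v) + (1# - ι) * (w * w - w₀ * w₀ * (v * v)) + # 14 * ζ) w v
  on-curve (inj₁ (refl , refl , refl , refl)) {Y = Y} {v} {ζ} {w} refl h e = *-cancelˡ {# 4} (λ ())
    (lin₂ (# 2 * (# 7 * ((1# - ι) * (w * w) + (# 1 * (v * v) - # 4 * ζ - ι * Y)) + # 4 * (v * v + # 14 * ζ) - # 18 * (v * v))) (- # 7) h e (solve (Y ∷ v ∷ ζ ∷ w ∷ []) 𝔾-ring))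
  on-curve (inj₂ (refl , refl , refl , refl)) {Y = Y} {v} {ζ} {w} refl h e = *-cancelˡ {# 4} (λ ())
    (lin₂ (# 2 * (# 7 * ((1# - ι) * (w * w) + (# 7 * (v * v) - # 4 * ζ - ι * Y)) + # 4 * (# 14 * ζ - # 11 * (v * v)) - # 54 * (v * v))) (- # 7) h e (solve (Y ∷ v ∷ ζ ∷ w ∷ []) 𝔾-ring))

  private
    Parity : ℤ → Set
    Parity x = (∃ λ q → x ≡ + 2 ℤ.* q) ⊎ (∃ λ q → x ≡ ℤ.1ℤ ℤ.+ + 2 ℤ.* q)

  -- X = p² - q² + 2pq is odd only if p and q have opposite parity, and then X modulo 4 tells which one is odd.
  p-odd : ∀ {p q X e} → X ≡ p ℤ.* p ℤ.- q ℤ.* q ℤ.+ + 2 ℤ.* (p ℤ.* q) → X ≡ ℤ.1ℤ ℤ.+ + 4 ℤ.* e → Parity p → Parity q →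
    ∃ λ a → ∃ λ b → (p ≡ ℤ.1ℤ ℤ.+ + 2 ℤ.* a) × (q ≡ + 2 ℤ.* b)
  p-odd _ _ (inj₂ (a , p≡)) (inj₁ (b , q≡)) = a , b , p≡ , q≡
  p-odd {X = X} {e} h h′ (inj₁ (a , refl)) (inj₁ (b , refl)) = ℤT.absurd-∣ (+ 2) ℤ.1ℤ
    (+ 2 ℤ.* (a ℤ.* a) ℤ.- + 2 ℤ.* (b ℤ.* b) ℤ.+ + 4 ℤ.* (a ℤ.* b) ℤ.- + 2 ℤ.* e , ℤT.lin₂ ℤ.1ℤ (ℤ.- ℤ.1ℤ) h h′ (ℤSolver.solve (X ∷ e ∷ a ∷ b ∷ [])))
  p-odd {X = X} {e} h h′ (inj₂ (a , refl)) (inj₂ (b , refl)) = ℤT.absurd-∣ (+ 2) ℤ.1ℤ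
    (+ 2 ℤ.* a ℤ.* a ℤ.+ + 4 ℤ.* a ℤ.+ ℤ.1ℤ ℤ.- + 2 ℤ.* b ℤ.* b ℤ.+ + 4 ℤ.* a ℤ.* b ℤ.- + 2 ℤ.* e , ℤT.lin₂ ℤ.1ℤ (ℤ.- ℤ.1ℤ) h h′ (ℤSolver.solve (X ∷ e ∷ a ∷ b ∷ [])))
  p-odd {X = X} {e} h h′ (inj₁ (a , refl)) (inj₂ (b , refl)) = ℤT.absurd-∣ (+ 4) (+ 2)
    (a ℤ.* a ℤ.- b ℤ.- b ℤ.* b ℤ.+ a ℤ.+ + 2 ℤ.* a ℤ.* b ℤ.- e , ℤT.lin₂ ℤ.1ℤ (ℤ.- ℤ.1ℤ) h h′ (ℤSolver.solve (X ∷ e ∷ a ∷ b ∷ [])))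

  q-odd : ∀ {p q X e} → X ≡ p ℤ.* p ℤ.- q ℤ.* q ℤ.+ + 2 ℤ.* (p ℤ.* q) → X ≡ + 3 ℤ.+ + 4 ℤ.* e → Parity p → Parity q →
    ∃ λ a → ∃ λ b → (p ≡ + 2 ℤ.* a) × (q ≡ ℤ.1ℤ ℤ.+ + 2 ℤ.* b)
  q-odd _ _ (inj₁ (a , p≡)) (inj₂ (b , q≡)) = a , b , p≡ , q≡
  q-odd {X = X} {e} h h′ (inj₁ (a , refl)) (inj₁ (b , refl)) = ℤT.absurd-∣ (+ 2) (+ 3)
    (+ 2 ℤ.* (a ℤ.* a) ℤ.- + 2 ℤ.* (b ℤ.* b) ℤ.+ + 4 ℤ.* (a ℤ.* b) ℤ.- + 2 ℤ.* e , ℤT.lin₂ ℤ.1ℤ (ℤ.- ℤ.1ℤ) h h′ (ℤSolver.solve (X ∷ e ∷ a ∷ b ∷ [])))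
  q-odd {X = X} {e} h h′ (inj₂ (a , refl)) (inj₂ (b , refl)) = ℤT.absurd-∣ (+ 2) (+ 3)
    (+ 2 ℤ.* a ℤ.* a ℤ.+ + 4 ℤ.* a ℤ.+ ℤ.1ℤ ℤ.- + 2 ℤ.* b ℤ.* b ℤ.+ + 4 ℤ.* a ℤ.* b ℤ.- + 2 ℤ.* e , ℤT.lin₂ ℤ.1ℤ (ℤ.- ℤ.1ℤ) h h′ (ℤSolver.solve (X ∷ e ∷ a ∷ b ∷ [])))
  q-odd {X = X} {e} h h′ (inj₂ (a , refl)) (inj₁ (b , refl)) = ℤT.absurd-∣ (+ 4) (+ 2)
    (a ℤ.* a ℤ.+ a ℤ.- b ℤ.* b ℤ.+ b ℤ.+ + 2 ℤ.* a ℤ.* b ℤ.- e , ℤT.lin₂ ℤ.1ℤ (ℤ.- ℤ.1ℤ) h h′ (ℤSolver.solve (X ∷ e ∷ a ∷ b ∷ [])))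

  module _ {p q X Y v k : ℤ}
    (X≡ : X ≡ p ℤ.* p ℤ.- q ℤ.* q ℤ.+ + 2 ℤ.* (p ℤ.* q)) (Y≡ : Y ≡ p ℤ.* p ℤ.- q ℤ.* q ℤ.- + 2 ℤ.* (p ℤ.* q))
    (eq : + 2 ℤ.* (Y ℤ.* Y) ≡ + 5 ℤ.* (X ℤ.* X) ℤ.- + 18 ℤ.* k ℤ.* (X ℤ.* (v ℤ.* v)) ℤ.+ + 15 ℤ.* (k ℤ.* k) ℤ.* (v ℤ.* v ℤ.* (v ℤ.* v)))
    where

    eq𝔾 : # 2 * (emb Y * emb Y) ≡ # 5 * (emb X * emb X) - # 18 * emb k * (emb X * (emb v * emb v)) + # 15 * (emb k * emb k) * (emb v * emb v * (emb v * emb v))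
    eq𝔾 = emb-≡ eq (emb-* {+ 2} refl (emb-* {Y} {Y} refl refl))
      (emb-+ {x = + 5 ℤ.* (X ℤ.* X) ℤ.- + 18 ℤ.* k ℤ.* (X ℤ.* (v ℤ.* v))} (emb-- {x = + 5 ℤ.* (X ℤ.* X)} (emb-* {+ 5} refl (emb-* {X} {X} refl refl)) (emb-* {+ 18 ℤ.* k} (emb-* {+ 18} {k} refl refl) (emb-* {X} refl V)))
        (emb-* {+ 15 ℤ.* (k ℤ.* k)} (emb-* {+ 15} refl (emb-* {k} {k} refl refl)) (emb-* {v ℤ.* v} V V)))
      where
      V : emb (v ℤ.* v) ≡ emb v * emb v
      V = emb-* {v} {v} refl refl

    square-root : (1# - ι) * ((p +i q) * (p +i q)) ≡ emb X - ι * emb Y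
    square-root = cong₂ _+i_ (trans (l₁ p q) (l₃ X Y X≡)) (trans (l₂ p q) (l₄ X Y Y≡))
      where
      l₁ : ∀ p q → ℤ.1ℤ ℤ.* (p ℤ.* p ℤ.- q ℤ.* q) ℤ.- -[1+ 0 ] ℤ.* (p ℤ.* q ℤ.+ q ℤ.* p) ≡ p ℤ.* p ℤ.- q ℤ.* q ℤ.+ + 2 ℤ.* (p ℤ.* q)
      l₁ = ℤSolver.solve-∀
      l₂ : ∀ p q → ℤ.1ℤ ℤ.* (p ℤ.* q ℤ.+ q ℤ.* p) ℤ.+ -[1+ 0 ] ℤ.* (p ℤ.* p ℤ.- q ℤ.* q) ≡ ℤ.- (p ℤ.* p ℤ.- q ℤ.* q ℤ.- + 2 ℤ.* (p ℤ.* q))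
      l₂ = ℤSolver.solve-∀
      l₃ : ∀ X Y {S} → X ≡ S → S ≡ X ℤ.+ ℤ.- (ℤ.0ℤ ℤ.* Y ℤ.- ℤ.1ℤ ℤ.* ℤ.0ℤ)
      l₃ X Y refl = l X Y
        where
        l : ∀ X Y → X ≡ X ℤ.+ ℤ.- (ℤ.0ℤ ℤ.* Y ℤ.- ℤ.1ℤ ℤ.* ℤ.0ℤ)
        l = ℤSolver.solve-∀
      l₄ : ∀ X Y {S} → Y ≡ S → ℤ.- S ≡ ℤ.0ℤ ℤ.+ ℤ.- (ℤ.0ℤ ℤ.* ℤ.0ℤ ℤ.+ ℤ.1ℤ ℤ.* Y)
      l₄ X Y refl = l X Y
        where
        l : ∀ X Y → ℤ.- Y ≡ ℤ.0ℤ ℤ.+ ℤ.- (ℤ.0ℤ ℤ.* ℤ.0ℤ ℤ.+ ℤ.1ℤ ℤ.* Y)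
        l = ℤSolver.solve-∀


  -- X ≡ v² ≡ 1 modulo 4, so ζ = (v² - X)/4 is an integer. The same congruence makes p odd and q
  -- even, so that w = p + qι is congruent to v modulo 2. Then `core` gives w² = v², and X is the
  -- sum of the real and imaginary parts of w².
  first-twist : ∀ {p q X Y v a e} →
    X ≡ p ℤ.* p ℤ.- q ℤ.* q ℤ.+ + 2 ℤ.* (p ℤ.* q) → Y ≡ p ℤ.* p ℤ.- q ℤ.* q ℤ.- + 2 ℤ.* (p ℤ.* q) →
    + 2 ℤ.* (Y ℤ.* Y) ≡ + 5 ℤ.* (X ℤ.* X) ℤ.- + 18 ℤ.* + 1 ℤ.* (X ℤ.* (v ℤ.* v)) ℤ.+ + 15 ℤ.* (+ 1 ℤ.* + 1) ℤ.* (v ℤ.* v ℤ.* (v ℤ.* v)) →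
    v ≡ ℤ.1ℤ ℤ.+ + 2 ℤ.* a → X ≡ ℤ.1ℤ ℤ.+ + 4 ℤ.* e → X ≡ v ℤ.* v
  first-twist {p} {q} {X} {Y} {v} {a} {e} X≡ Y≡ eq v≡ X≡e = go (p-odd {p} {q} {X} {e} X≡ X≡e (parity p) (parity q))
    where
    ζ : ℤ
    ζ = a ℤ.* a ℤ.+ a ℤ.- e
    X≡ζ : X ≡ v ℤ.* v ℤ.- + 4 ℤ.* (a ℤ.* a ℤ.+ a ℤ.- e)
    X≡ζ = ℤT.lin₂ ℤ.1ℤ (ℤ.- (v ℤ.+ ℤ.1ℤ ℤ.+ + 2 ℤ.* a)) X≡e v≡ (ℤSolver.solve (X ∷ v ∷ a ∷ e ∷ []))
    X𝔾 : emb X ≡ # 1 * (emb v * emb v) - # 4 * emb ζ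
    X𝔾 = emb-≡ {X} X≡ζ refl (emb-- {v ℤ.* v} (trans (emb-* {v} {v} refl refl) (l (emb v * emb v))) (emb-* {+ 4} {ζ} refl refl))
      where
      l : ∀ x → x ≡ # 1 * x
      l = solve-∀ 𝔾-ring
    go : (∃ λ a → ∃ λ b → (p ≡ ℤ.1ℤ ℤ.+ + 2 ℤ.* a) × (q ≡ + 2 ℤ.* b)) → X ≡ v ℤ.* v
    go (a′ , b′ , p≡ , q≡) = finish (core {w = p +i q} {emb v} {_} {emb ζ} {(a′ +i b′) - emb a} {emb a} base₁
        (on-curve {κ = # 1} (inj₁ (refl , refl , refl , refl)) {Y = emb Y} {emb v} {emb ζ} {p +i q} X𝔾 (square-root {p} {q} {X} {Y} {v} {+ 1} X≡ Y≡ eq) (eq𝔾 {p} {q} {X} {Y} {v} {+ 1} X≡ Y≡ eq))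
        refl refl (emb-odd {v} {a} v≡) (emb-parity ζ) (emb-valuation ζ (<-wellFounded _)) w≡)
      where
      w≡ : p +i q ≡ 1# * emb v + # 2 * ((a′ +i b′) - emb a)
      w≡ = trans pq≡ (lin₁ (- 1#) (emb-odd {v} {a} v≡) (l (emb v) (emb a) (a′ +i b′)))
        where
        l : ∀ v a z → 1# + # 2 * z - (1# * v + # 2 * (z - a)) ≡ (- 1#) * (v - (1# + # 2 * a))
        l = solve-∀ 𝔾-ring
        pq≡ : p +i q ≡ 1# + # 2 * (a′ +i b′)
        pq≡ = cong₂ _+i_ (trans p≡ (l₁ a′ b′)) (trans q≡ (l₂ a′ b′))
          where
          l₁ : ∀ a b → ℤ.1ℤ ℤ.+ + 2 ℤ.* a ≡ ℤ.1ℤ ℤ.+ (+ 2 ℤ.* a ℤ.- ℤ.0ℤ ℤ.* b)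
          l₁ = ℤSolver.solve-∀
          l₂ : ∀ a b → + 2 ℤ.* b ≡ ℤ.0ℤ ℤ.+ (+ 2 ℤ.* b ℤ.+ ℤ.0ℤ ℤ.* a)
          l₂ = ℤSolver.solve-∀
      finish : (p +i q) * (p +i q) - 1# * 1# * (emb v * emb v) ≡ 0# → X ≡ v ℤ.* v
      finish d≡0 = trans (trans X≡ (l₁ p q)) (trans (cong₂ ℤ._+_ (cong re eq′) (cong im eq′)) (ℤ.+-identityʳ (v ℤ.* v)))
        where
        l₁ : ∀ p q → p ℤ.* p ℤ.- q ℤ.* q ℤ.+ + 2 ℤ.* (p ℤ.* q) ≡ p ℤ.* p ℤ.- q ℤ.* q ℤ.+ (p ℤ.* q ℤ.+ q ℤ.* p)
        l₁ = ℤSolver.solve-∀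
        l : ∀ w v → w - 1# * 1# * v ≡ 0# → w ≡ v
        l w v h = lin₁ 1# h (solve (w ∷ v ∷ []) 𝔾-ring)
        eq′ : (p +i q) * (p +i q) ≡ emb (v ℤ.* v)
        eq′ = trans (l _ (emb v * emb v) d≡0) (sym (emb-* {v} {v} refl refl))

  -- The known point now has w₀² = 3 + 4ι, whence X = (3 + 4)v². The congruence X ≡ 3 modulo 4 makes
  -- p even and q odd, in agreement with w₀ = 2 + ι modulo 2.
  second-twist : ∀ {p q X Y v a e} →
    X ≡ p ℤ.* p ℤ.- q ℤ.* q ℤ.+ + 2 ℤ.* (p ℤ.* q) → Y ≡ p ℤ.* p ℤ.- q ℤ.* q ℤ.- + 2 ℤ.* (p ℤ.* q) →
    + 2 ℤ.* (Y ℤ.* Y) ≡ + 5 ℤ.* (X ℤ.* X) ℤ.- + 18 ℤ.* + 3 ℤ.* (X ℤ.* (v ℤ.* v)) ℤ.+ + 15 ℤ.* (+ 3 ℤ.* + 3) ℤ.* (v ℤ.* v ℤ.* (v ℤ.* v)) →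
    v ≡ ℤ.1ℤ ℤ.+ + 2 ℤ.* a → X ≡ + 3 ℤ.+ + 4 ℤ.* e → X ≡ + 7 ℤ.* (v ℤ.* v)
  second-twist {p} {q} {X} {Y} {v} {a} {e} X≡ Y≡ eq v≡ X≡e = go (q-odd {p} {q} {X} {e} X≡ X≡e (parity p) (parity q))
    where
    ζ : ℤ
    ζ = + 7 ℤ.* a ℤ.* a ℤ.+ + 7 ℤ.* a ℤ.+ ℤ.1ℤ ℤ.- e
    X≡ζ : X ≡ + 7 ℤ.* (v ℤ.* v) ℤ.- + 4 ℤ.* (+ 7 ℤ.* a ℤ.* a ℤ.+ + 7 ℤ.* a ℤ.+ ℤ.1ℤ ℤ.- e)
    X≡ζ = ℤT.lin₂ ℤ.1ℤ (ℤ.- (+ 7 ℤ.* (v ℤ.+ ℤ.1ℤ ℤ.+ + 2 ℤ.* a))) X≡e v≡ (ℤSolver.solve (X ∷ v ∷ a ∷ e ∷ []))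
    X𝔾 : emb X ≡ # 7 * (emb v * emb v) - # 4 * emb ζ
    X𝔾 = emb-≡ {X} X≡ζ refl (emb-- {+ 7 ℤ.* (v ℤ.* v)} (emb-* {+ 7} {v ℤ.* v} refl (emb-* {v} {v} refl refl)) (emb-* {+ 4} {ζ} refl refl))
    go : (∃ λ a → ∃ λ b → (p ≡ + 2 ℤ.* a) × (q ≡ ℤ.1ℤ ℤ.+ + 2 ℤ.* b)) → X ≡ + 7 ℤ.* (v ℤ.* v)
    go (a′ , b′ , p≡ , q≡) = finish (core {w = p +i q} {emb v} {_} {emb ζ} {(a′ +i b′) - 1# - (# 2 + ι) * emb a} {emb a} base₃
        (on-curve {κ = # 7} (inj₂ (refl , refl , refl , refl)) {Y = emb Y} {emb v} {emb ζ} {p +i q} X𝔾 (square-root {p} {q} {X} {Y} {v} {+ 3} X≡ Y≡ eq) (eq𝔾 {p} {q} {X} {Y} {v} {+ 3} X≡ Y≡ eq))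
        refl refl (emb-odd {v} {a} v≡) (emb-parity ζ) (emb-valuation ζ (<-wellFounded _)) w≡)
      where
      w≡ : p +i q ≡ (# 2 + ι) * emb v + # 2 * ((a′ +i b′) - 1# - (# 2 + ι) * emb a)
      w≡ = trans pq≡ (lin₁ (- (# 2 + ι)) (emb-odd {v} {a} v≡) (l (emb v) (emb a) (a′ +i b′)))
        where
        l : ∀ v a z → ι + # 2 * z - ((# 2 + ι) * v + # 2 * (z - 1# - (# 2 + ι) * a)) ≡ (- (# 2 + ι)) * (v - (1# + # 2 * a))
        l = solve-∀ 𝔾-ring
        pq≡ : p +i q ≡ ι + # 2 * (a′ +i b′)
        pq≡ = cong₂ _+i_ (trans p≡ (l₁ a′ b′)) (trans q≡ (l₂ a′ b′))
          where
          l₁ : ∀ a b → + 2 ℤ.* a ≡ ℤ.0ℤ ℤ.+ (+ 2 ℤ.* a ℤ.- ℤ.0ℤ ℤ.* b)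
          l₁ = ℤSolver.solve-∀
          l₂ : ∀ a b → ℤ.1ℤ ℤ.+ + 2 ℤ.* b ≡ ℤ.1ℤ ℤ.+ (+ 2 ℤ.* b ℤ.+ ℤ.0ℤ ℤ.* a)
          l₂ = ℤSolver.solve-∀
      finish : (p +i q) * (p +i q) - (# 2 + ι) * (# 2 + ι) * (emb v * emb v) ≡ 0# → X ≡ + 7 ℤ.* (v ℤ.* v)
      finish d≡0 = trans (trans X≡ (l₁ p q)) (trans (cong₂ ℤ._+_ (cong re eq′) (cong im eq′)) (l₂ (v ℤ.* v)))
        where
        l₁ : ∀ p q → p ℤ.* p ℤ.- q ℤ.* q ℤ.+ + 2 ℤ.* (p ℤ.* q) ≡ p ℤ.* p ℤ.- q ℤ.* q ℤ.+ (p ℤ.* q ℤ.+ q ℤ.* p)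
        l₁ = ℤSolver.solve-∀
        l₂ : ∀ x → + 3 ℤ.* x ℤ.- + 4 ℤ.* ℤ.0ℤ ℤ.+ (+ 3 ℤ.* ℤ.0ℤ ℤ.+ + 4 ℤ.* x) ≡ + 7 ℤ.* x
        l₂ = ℤSolver.solve-∀
        l : ∀ w v → w - (# 2 + ι) * (# 2 + ι) * v ≡ 0# → w ≡ (# 2 + ι) * (# 2 + ι) * v
        l w v h = lin₁ 1# h (solve (w ∷ v ∷ []) 𝔾-ring)
        eq′ : (p +i q) * (p +i q) ≡ (# 2 + ι) * (# 2 + ι) * emb (v ℤ.* v)
        eq′ = trans (l _ (emb v * emb v) d≡0) (cong ((# 2 + ι) * (# 2 + ι) *_) (sym (emb-* {v} {v} refl refl)))

  -- s + tι and s - tι are coprime because s + t is odd and s, t are coprime; their product is a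
  -- square. So s + tι is a unit times (p + qι)², and the units ±ι interchange the roles of s and t.
  pythagoras : ∀ {s t z c} → ℤT.Coprime s t → s ℤ.+ t ≡ ℤ.1ℤ ℤ.+ + 2 ℤ.* c → s ℤ.* s ℤ.+ t ℤ.* t ≡ z ℤ.* z → z ≢ ℤ.0ℤ →
    ∃ λ p → ∃ λ q → ((s ≡ p ℤ.* p ℤ.- q ℤ.* q) × (t ≡ + 2 ℤ.* (p ℤ.* q))) ⊎ ((t ≡ p ℤ.* p ℤ.- q ℤ.* q) × (s ≡ + 2 ℤ.* (p ℤ.* q)))
  pythagoras {s} {t} {z} {c} (α , β , αs+βt≡1) s+t≡ s²+t² z≢0 = split (square-split {s +i t} {s +i (ℤ.- t)} {1#} {emb z} (λ e → z≢0 (cong re e)) product coprime)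
    where
    product : (s +i t) * (s +i (ℤ.- t)) ≡ 1# * (emb z * emb z)
    product = trans (cong₂ _+i_ (trans (l₁ s t) s²+t²) (l₂ s t)) (trans (emb-* {z} {z} refl refl) (l (emb z * emb z)))
      where
      l₁ : ∀ s t → s ℤ.* s ℤ.- t ℤ.* (ℤ.- t) ≡ s ℤ.* s ℤ.+ t ℤ.* t
      l₁ = ℤSolver.solve-∀
      l₂ : ∀ s t → s ℤ.* (ℤ.- t) ℤ.+ t ℤ.* s ≡ ℤ.0ℤ
      l₂ = ℤSolver.solve-∀
      l : ∀ x → x ≡ 1# * x
      l = solve-∀ 𝔾-ring
    bezout : emb α * emb s + emb β * emb t ≡ 1#
    bezout = emb-≡ {α ℤ.* s ℤ.+ β ℤ.* t} αs+βt≡1 (emb-+ {α ℤ.* s} (emb-* {α} {s} refl refl) (emb-* {β} {t} refl refl)) refl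
    odd-sum : emb s + emb t ≡ 1# + # 2 * emb c
    odd-sum = emb-≡ {s ℤ.+ t} s+t≡ refl (emb-+ {ℤ.1ℤ} {+ 2 ℤ.* c} refl (emb-* {+ 2} {c} refl refl))
    s+it : s +i t ≡ emb s + ι * emb t
    s+it = cong₂ _+i_ (l₁ s t) (l₂ t)
      where
      l₁ : ∀ s t → s ≡ s ℤ.+ (ℤ.0ℤ ℤ.* t ℤ.- ℤ.1ℤ ℤ.* ℤ.0ℤ)
      l₁ = ℤSolver.solve-∀
      l₂ : ∀ t → t ≡ ℤ.0ℤ ℤ.+ (ℤ.0ℤ ℤ.* ℤ.0ℤ ℤ.+ ℤ.1ℤ ℤ.* t)
      l₂ = ℤSolver.solve-∀
    s-it : s +i (ℤ.- t) ≡ emb s - ι * emb t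
    s-it = cong₂ _+i_ (l₁ s t) (l₂ t)
      where
      l₁ : ∀ s t → s ≡ s ℤ.+ ℤ.- (ℤ.0ℤ ℤ.* t ℤ.- ℤ.1ℤ ℤ.* ℤ.0ℤ)
      l₁ = ℤSolver.solve-∀
      l₂ : ∀ t → ℤ.- t ≡ ℤ.0ℤ ℤ.+ ℤ.- (ℤ.0ℤ ℤ.* ℤ.0ℤ ℤ.+ ℤ.1ℤ ℤ.* t)
      l₂ = ℤSolver.solve-∀
    conjugates-coprime : ∀ {x x̄ S T A B C} → x ≡ S + ι * T → x̄ ≡ S - ι * T → A * S + B * T ≡ 1# → S + T ≡ 1# + # 2 * C → Coprime x x̄
    conjugates-coprime {x} {x̄} {S} {T} {A} {B} {C} hx hx̄ hAB hS = go (odd-coprime-2 x-odd)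
      where
      x-odd : Odd x
      x-odd = ι - ι * S + ι * (1# - ι) * C , lin₂ 1# ι hx hS (solve (x ∷ S ∷ T ∷ C ∷ []) 𝔾-ring)
      go : Coprime (# 2) x → Coprime x x̄
      go (a , b , h) = a * (A - ι * B) + b , a * (A + ι * B) ,
        lin₃ 1# (a * (A - ι * B)) (a * (A + ι * B)) h hx hx̄ (lin₁ (# 2 * a) hAB (solve (x ∷ x̄ ∷ S ∷ T ∷ A ∷ B ∷ a ∷ b ∷ []) 𝔾-ring))
    coprime : Coprime (s +i t) (s +i (ℤ.- t))
    coprime = conjugates-coprime {s +i t} {s +i (ℤ.- t)} {emb s} {emb t} {emb α} {emb β} {emb c} s+it s-it bezout odd-sum
    Goal : Set
    Goal = ∃ λ p → ∃ λ q → ((s ≡ p ℤ.* p ℤ.- q ℤ.* q) × (t ≡ + 2 ℤ.* (p ℤ.* q))) ⊎ ((t ≡ p ℤ.* p ℤ.- q ℤ.* q) × (s ≡ + 2 ℤ.* (p ℤ.* q)))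
    split : (∃ λ d₁ → ∃ λ d₂ → ∃ λ w → ∃ λ w′ → (s +i t ≡ d₁ * (w * w)) × (s +i (ℤ.- t) ≡ d₂ * (w′ * w′)) × (d₁ * d₂ ≡ 1#) × (emb z ≡ w * w′)) → Goal
    split (d₁ , d₂ , p +i q , _ , x≡ , _ , d₁d₂≡1 , _) = by-unit (unit∈units (d₂ , d₁d₂≡1)) x≡
      where
      by-unit : ∀ {d} → d ∈ units → s +i t ≡ d * ((p +i q) * (p +i q)) → Goal
      by-unit (here refl) e = p , q , inj₁ (trans (cong re e) (l₁ p q) , trans (cong im e) (l₂ p q))
        where
        l₁ : ∀ p q → ℤ.1ℤ ℤ.* (p ℤ.* p ℤ.- q ℤ.* q) ℤ.- ℤ.0ℤ ℤ.* (p ℤ.* q ℤ.+ q ℤ.* p) ≡ p ℤ.* p ℤ.- q ℤ.* q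
        l₁ = ℤSolver.solve-∀
        l₂ : ∀ p q → ℤ.1ℤ ℤ.* (p ℤ.* q ℤ.+ q ℤ.* p) ℤ.+ ℤ.0ℤ ℤ.* (p ℤ.* p ℤ.- q ℤ.* q) ≡ + 2 ℤ.* (p ℤ.* q)
        l₂ = ℤSolver.solve-∀
      by-unit (there (here refl)) e = q , ℤ.- p , inj₁ (trans (cong re e) (l₁ p q) , trans (cong im e) (l₂ p q))
        where
        l₁ : ∀ p q → -[1+ 0 ] ℤ.* (p ℤ.* p ℤ.- q ℤ.* q) ℤ.- ℤ.0ℤ ℤ.* (p ℤ.* q ℤ.+ q ℤ.* p) ≡ q ℤ.* q ℤ.- (ℤ.- p) ℤ.* (ℤ.- p)
        l₁ = ℤSolver.solve-∀
        l₂ : ∀ p q → -[1+ 0 ] ℤ.* (p ℤ.* q ℤ.+ q ℤ.* p) ℤ.+ ℤ.0ℤ ℤ.* (p ℤ.* p ℤ.- q ℤ.* q) ≡ + 2 ℤ.* (q ℤ.* (ℤ.- p))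
        l₂ = ℤSolver.solve-∀
      by-unit (there (there (here refl))) e = p , ℤ.- q , inj₂ (trans (cong im e) (l₁ p q) , trans (cong re e) (l₂ p q))
        where
        l₁ : ∀ p q → ℤ.0ℤ ℤ.* (p ℤ.* q ℤ.+ q ℤ.* p) ℤ.+ ℤ.1ℤ ℤ.* (p ℤ.* p ℤ.- q ℤ.* q) ≡ p ℤ.* p ℤ.- (ℤ.- q) ℤ.* (ℤ.- q)
        l₁ = ℤSolver.solve-∀
        l₂ : ∀ p q → ℤ.0ℤ ℤ.* (p ℤ.* p ℤ.- q ℤ.* q) ℤ.- ℤ.1ℤ ℤ.* (p ℤ.* q ℤ.+ q ℤ.* p) ≡ + 2 ℤ.* (p ℤ.* (ℤ.- q))
        l₂ = ℤSolver.solve-∀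
      by-unit (there (there (there (here refl)))) e = q , p , inj₂ (trans (cong im e) (l₁ p q) , trans (cong re e) (l₂ p q))
        where
        l₁ : ∀ p q → ℤ.0ℤ ℤ.* (p ℤ.* q ℤ.+ q ℤ.* p) ℤ.+ -[1+ 0 ] ℤ.* (p ℤ.* p ℤ.- q ℤ.* q) ≡ q ℤ.* q ℤ.- p ℤ.* p
        l₁ = ℤSolver.solve-∀
        l₂ : ∀ p q → ℤ.0ℤ ℤ.* (p ℤ.* p ℤ.- q ℤ.* q) ℤ.- -[1+ 0 ] ℤ.* (p ℤ.* q ℤ.+ q ℤ.* p) ≡ + 2 ℤ.* (q ℤ.* p)
        l₂ = ℤSolver.solve-∀

-- The equations for u and v, and the choice of twist.

module TenB where

  open IntTools
  open TenA using (parity; first-twist; second-twist; pythagoras)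
  open import Data.Integer using (ℤ; +_; -[1+_]; _+_; _*_; -_; _-_; ∣_∣; 0ℤ; 1ℤ)
  import Data.Integer as ℤ
  open import Data.Integer.Tactic.RingSolver using (solve; solve-∀)
  open import Data.Nat as ℕ using (ℕ; zero; suc)
  open import Data.Product using (∃; _×_; _,_; proj₁; proj₂)
  open import Data.Sum using (_⊎_; inj₁; inj₂)
  open import Data.List using (_∷_; [])
  open import Relation.Nullary using (¬_; Dec; yes; no; contradiction)
  open import Relation.Binary.PropositionalEquality

  prime-2 : ∀ x → + 2 ∣ x ⊎ Coprime (+ 2) x
  prime-2 x = go (parity x)
    where
    go : (∃ λ q → x ≡ + 2 * q) ⊎ (∃ λ q → x ≡ 1ℤ + + 2 * q) → + 2 ∣ x ⊎ Coprime (+ 2) x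
    go (inj₁ h) = inj₁ h
    go (inj₂ (q , h)) = inj₂ (- q , 1ℤ , lin₁ 1ℤ h (solve (x ∷ q ∷ [])))

  prime-3 : ∀ x → + 3 ∣ x ⊎ Coprime (+ 3) x
  prime-3 x = go (residue 3 x)
    where
    go : (∃ λ r → ∃ λ q → (r ℕ.< 3) × (x ≡ + r + q * + 3)) → + 3 ∣ x ⊎ Coprime (+ 3) x
    go (0 , q , _ , h) = inj₁ (q , lin₁ 1ℤ h (solve (x ∷ q ∷ [])))
    go (1 , q , _ , h) = inj₂ (- q , 1ℤ , lin₁ 1ℤ h (solve (x ∷ q ∷ [])))
    go (2 , q , _ , h) = inj₂ (1ℤ + q , - 1ℤ , lin₁ (- 1ℤ) h (solve (x ∷ q ∷ [])))
    go (suc (suc (suc _)) , _ , ℕ.s≤s (ℕ.s≤s (ℕ.s≤s ())) , _)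

  prime-5 : ∀ x → + 5 ∣ x ⊎ Coprime (+ 5) x
  prime-5 x = go (residue 5 x)
    where
    go : (∃ λ r → ∃ λ q → (r ℕ.< 5) × (x ≡ + r + q * + 5)) → + 5 ∣ x ⊎ Coprime (+ 5) x
    go (0 , q , _ , h) = inj₁ (q , lin₁ 1ℤ h (solve (x ∷ q ∷ [])))
    go (1 , q , _ , h) = inj₂ (- q , 1ℤ , lin₁ 1ℤ h (solve (x ∷ q ∷ [])))
    go (2 , q , _ , h) = inj₂ (1ℤ + + 2 * q , - + 2 , lin₁ (- + 2) h (solve (x ∷ q ∷ [])))
    go (3 , q , _ , h) = inj₂ (- 1ℤ - + 2 * q , + 2 , lin₁ (+ 2) h (solve (x ∷ q ∷ [])))
    go (4 , q , _ , h) = inj₂ (1ℤ + q , - 1ℤ , lin₁ (- 1ℤ) h (solve (x ∷ q ∷ [])))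
    go (suc (suc (suc (suc (suc _)))) , _ , ℕ.s≤s (ℕ.s≤s (ℕ.s≤s (ℕ.s≤s (ℕ.s≤s ())))) , _)

  3∣sq : ∀ x → + 3 ∣ x * x → + 3 ∣ x
  3∣sq x h with prime-3 x
  ... | inj₁ d = d
  ... | inj₂ c = coprime⇒∣ {+ 3} {x} {x} c h

  5∣sq : ∀ x → + 5 ∣ x * x → + 5 ∣ x
  5∣sq x h with prime-5 x
  ... | inj₁ d = d
  ... | inj₂ c = coprime⇒∣ {+ 5} {x} {x} c h

  square-mod-3 : ∀ x → + 3 ∣ x ⊎ (∃ λ z → x * x ≡ 1ℤ + + 3 * z)
  square-mod-3 x = go (residue 3 x)
    where
    go : (∃ λ r → ∃ λ q → (r ℕ.< 3) × (x ≡ + r + q * + 3)) → + 3 ∣ x ⊎ (∃ λ z → x * x ≡ 1ℤ + + 3 * z)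
    go (0 , q , _ , h) = inj₁ (q , lin₁ 1ℤ h (solve (x ∷ q ∷ [])))
    go (1 , q , _ , h) = inj₂ (+ 2 * q + + 3 * q * q , lin₁ (x + 1ℤ + q * + 3) h (solve (x ∷ q ∷ [])))
    go (2 , q , _ , h) = inj₂ (1ℤ + + 4 * q + + 3 * q * q , lin₁ (x + + 2 + q * + 3) h (solve (x ∷ q ∷ [])))
    go (suc (suc (suc _)) , _ , ℕ.s≤s (ℕ.s≤s (ℕ.s≤s ())) , _)

  triangular : ∀ a → ∃ λ i → a * a + a ≡ + 2 * i
  triangular a = go (parity a)
    where
    go : (∃ λ q → a ≡ + 2 * q) ⊎ (∃ λ q → a ≡ 1ℤ + + 2 * q) → ∃ λ i → a * a + a ≡ + 2 * i
    go (inj₁ (b , h)) = b * (a + 1ℤ) , lin₁ (a + 1ℤ) h (solve (a ∷ b ∷ []))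
    go (inj₂ (b , h)) = a * (1ℤ + b) , lin₁ a h (solve (a ∷ b ∷ []))

  no-common : ∀ {x y} d {W : Set} → Coprime x y → d ∣ x → d ∣ y → (d ∣ 1ℤ → W) → W
  no-common {x} {y} d (s , t , e) (a , ha) (b , hb) k = k (s * a + t * b , lin₃ (- 1ℤ) s t e ha hb (solve (x ∷ y ∷ d ∷ s ∷ t ∷ a ∷ b ∷ [])))

  even-of-square : ∀ x z → x * x ≡ + 2 * z → ∃ λ q → x ≡ + 2 * q
  even-of-square x z h = go (parity x)
    where
    go : (∃ λ q → x ≡ + 2 * q) ⊎ (∃ λ q → x ≡ 1ℤ + + 2 * q) → ∃ λ q → x ≡ + 2 * q
    go (inj₁ e) = e
    go (inj₂ (b , e)) = absurd-∣ (+ 2) 1ℤ (z - + 2 * b - + 2 * b * b , lin₂ 1ℤ (- (x + 1ℤ + + 2 * b)) h e (solve (x ∷ z ∷ b ∷ [])))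

  -- T is (u² + 5v²)/2, and `reduce` supplies for Y and Z the halves of the original unknowns.
  -- Eliminating u² in favour of T makes `eq` quadratic in T and v².
  record Reduced (u v : ℤ) : Set where
    field
      {T Y Z m b f} : ℤ
      T≡ : T ≡ + 3 + + 4 * m
      v≡ : v ≡ 1ℤ + + 2 * b
      Y≡ : Y ≡ 1ℤ + + 2 * f
      W≡ : u * u + + 5 * (v * v) ≡ + 2 * T
      Z≡ : + 2 * (Z * Z) ≡ Y * Y + T * T
      eq : + 2 * (Y * Y) ≡ + 5 * (T * T) - + 54 * (T * (v * v)) + + 135 * (v * v * (v * v))

  Equation₁ : ℤ → ℤ → ℤ → Set
  Equation₁ u v Y = + 2 * (Y * Y) ≡ + 5 * (u * u * (u * u)) - + 58 * (u * u * (v * v)) + + 125 * (v * v * (v * v))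

  Equation₂ : ℤ → ℤ → ℤ → ℤ → Set
  Equation₂ u v Y Z = + 2 * (Z * Z) ≡ Y * Y + (u * u + + 5 * (v * v)) * (u * u + + 5 * (v * v))

  reduce-ring₁ : ∀ Y g j i k u v →
    + 2 * (Y * Y) - (+ 72 + g * (+ 192 * j - + 48 * i) + g * g * k) - (1ℤ * (+ 2 * (Y * Y) - (+ 5 * (u
      * u * (u * u)) - + 58 * (u * u * (v * v)) + + 125 * (v * v * (v * v)))) + (+ 5 * (u * u + 1ℤ + g
      * i) - + 58 * (v * v)) * (u * u - (1ℤ + g * i)) + (- (+ 58 * (1ℤ + g * i)) + + 125 * (v * v + 1ℤ
      + g * j)) * (v * v - (1ℤ + g * j)))
    ≡ - (g * g) * (k - (+ 5 * (i * i) - + 58 * (i * j) + + 125 * (j * j)))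
  reduce-ring₁ = solve-∀

  reduce-ring₂ : ∀ y j i k Y →
    + 4 * (y * y) - + 4 * (+ 9 + + 2 * (+ 96 * j - + 24 * i + + 4 * k))
    ≡ 1ℤ * (Y * Y - + 2 * (+ 18 + + 4 * (+ 96 * j - + 24 * i + + 4 * k))) + - (Y + + 2 * y) * (Y - + 2
      * y)
  reduce-ring₂ = solve-∀

  reduce-ring₃ : ∀ y f j i k →
    + 9 - + 2 * (y * f - (+ 96 * j - + 24 * i + + 4 * k))
    ≡ - 1ℤ * (y * y - (+ 9 + + 2 * (+ 96 * j - + 24 * i + + 4 * k))) + y * (y - + 2 * f)
  reduce-ring₃ = solve-∀

  reduce-ring₄ : ∀ Z y i j Y u v →
    + 2 * (Z * Z) - + 2 * (+ 2 * (y * y + (+ 3 + + 4 * (i + + 5 * j)) * (+ 3 + + 4 * (i + + 5 * j))))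
    ≡ 1ℤ * (+ 2 * (Z * Z) - (Y * Y + (u * u + + 5 * (v * v)) * (u * u + + 5 * (v * v)))) + (Y + + 2 *
      y) * (Y - + 2 * y) + (u * u + + 5 * (v * v) + + 2 * (+ 3 + + 4 * (i + + 5 * j))) * (u * u + + 5
      * (v * v) - + 2 * (+ 3 + + 4 * (i + + 5 * j)))
  reduce-ring₄ = solve-∀

  reduce-ring₅ : ∀ z y i j Z →
    + 4 * (+ 2 * (z * z)) - + 4 * (y * y + (+ 3 + + 4 * (i + + 5 * j)) * (+ 3 + + 4 * (i + + 5 * j)))
    ≡ 1ℤ * (+ 2 * (Z * Z) - + 2 * (+ 2 * (y * y + (+ 3 + + 4 * (i + + 5 * j)) * (+ 3 + + 4 * (i + + 5
      * j))))) + - (+ 2 * (Z + + 2 * z)) * (Z - + 2 * z)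
  reduce-ring₅ = solve-∀

  reduce-ring₆ : ∀ y i j v Y u →
    + 4 * (+ 2 * (y * y)) - + 4 * (+ 5 * ((+ 3 + + 4 * (i + + 5 * j)) * (+ 3 + + 4 * (i + + 5 * j))) -
      + 54 * ((+ 3 + + 4 * (i + + 5 * j)) * (v * v)) + + 135 * (v * v * (v * v)))
    ≡ 1ℤ * (+ 2 * (Y * Y) - (+ 5 * (u * u * (u * u)) - + 58 * (u * u * (v * v)) + + 125 * (v * v * (v
      * v)))) + - (+ 2 * (Y + + 2 * y)) * (Y - + 2 * y) + (+ 5 * (u * u - + 5 * (v * v) + + 2 * (+ 3 +
      + 4 * (i + + 5 * j))) - + 58 * (v * v)) * (u * u + + 5 * (v * v) - + 2 * (+ 3 + + 4 * (i + + 5 *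
      j)))
  reduce-ring₆ = solve-∀

  reduce-ring₇ : ∀ Y a u v b →
    + 125 - + 2 * (Y * Y - + 5 * (a * (u * u * u)) + + 58 * (a * (u * (v * v))) - + 125 * (b * (+ 2 +
      + 2 * b)) * (v * v + 1ℤ))
    ≡ - 1ℤ * (+ 2 * (Y * Y) - (+ 5 * (u * u * (u * u)) - + 58 * (u * u * (v * v)) + + 125 * (v * v *
      (v * v)))) + - (+ 5 * (u * u * u) - + 58 * (u * (v * v))) * (u - + 2 * a) + - (+ 125 * (v + 1ℤ +
      + 2 * b) * (v * v + 1ℤ)) * (v - (1ℤ + + 2 * b))
  reduce-ring₇ = solve-∀

  reduce-ring₈ : ∀ Y a u b v →
    + 5 - + 2 * (Y * Y - + 5 * (a * (+ 2 + + 2 * a)) * (u * u + 1ℤ) + + 58 * (b * (v * (u * u))) -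
      + 125 * (b * (v * v * v)))
    ≡ - 1ℤ * (+ 2 * (Y * Y) - (+ 5 * (u * u * (u * u)) - + 58 * (u * u * (v * v)) + + 125 * (v * v *
      (v * v)))) + - (+ 5 * (u + 1ℤ + + 2 * a) * (u * u + 1ℤ)) * (u - (1ℤ + + 2 * a)) + - (+ 125 * (v
      * v * v) - + 58 * (v * (u * u))) * (v - + 2 * b)
  reduce-ring₈ = solve-∀

  -- For u and v of different parity the right-hand side of `Equation₁` is odd. So both are odd,
  -- with squares 1 modulo 8; this gives T ≡ 3 modulo 4 and Y² ≡ 36 modulo 8, so that Y is twice an
  -- odd number.
  reduce : ∀ {u v Y Z} → Coprime u v → Equation₁ u v Y → Equation₂ u v Y Z → Reduced u v
  reduce {u} {v} {Y} {Z} cop e₁ e₂ = cases (parity u) (parity v)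
    where
    Parity : ℤ → Set
    Parity x = (∃ λ q → x ≡ + 2 * q) ⊎ (∃ λ q → x ≡ 1ℤ + + 2 * q)
    -- Writing u² = 1 + g i and v² = 1 + g j with g = 8 a variable keeps the numerals small.
    expand : ∀ g i j k → k ≡ + 5 * (i * i) - + 58 * (i * j) + + 125 * (j * j) → u * u ≡ 1ℤ + g * i → v * v ≡ 1ℤ + g * j →
      + 2 * (Y * Y) ≡ + 72 + g * (+ 192 * j - + 48 * i) + g * g * k
    expand g i j k hk uu vv = lin₃ 1ℤ (+ 5 * (u * u + 1ℤ + g * i) - + 58 * (v * v)) (- (+ 58 * (1ℤ + g * i)) + + 125 * (v * v + 1ℤ + g * j)) e₁ uu vv
      (lin₁ (- (g * g)) hk (reduce-ring₁ Y g j i k u v))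
    both-odd : ∀ a b i j → u ≡ 1ℤ + + 2 * a → v ≡ 1ℤ + + 2 * b → a * a + a ≡ + 2 * i → b * b + b ≡ + 2 * j → Reduced u v
    both-odd a b i j hu hv hi hj = with-k (+ 5 * (i * i) - + 58 * (i * j) + + 125 * (j * j)) refl
      where
      uu : u * u ≡ 1ℤ + + 8 * i
      uu = lin₂ (u + 1ℤ + + 2 * a) (+ 4) hu hi (solve (u ∷ a ∷ i ∷ []))
      vv : v * v ≡ 1ℤ + + 8 * j
      vv = lin₂ (v + 1ℤ + + 2 * b) (+ 4) hv hj (solve (v ∷ b ∷ j ∷ []))
      with-k : ∀ k → k ≡ + 5 * (i * i) - + 58 * (i * j) + + 125 * (j * j) → Reduced u v
      with-k k hk = with-Y (even-of-square Y (+ 18 + + 4 * (+ 96 * j - + 24 * i + + 4 * k)) Y²)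
       where
       Y² : Y * Y ≡ + 2 * (+ 18 + + 4 * (+ 96 * j - + 24 * i + + 4 * k))
       Y² = *-cancelˡ {+ 2} (λ ()) (lin₁ 1ℤ (expand (+ 8) i j k hk uu vv) (solve (Y ∷ i ∷ j ∷ k ∷ [])))
       with-Y : (∃ λ q → Y ≡ + 2 * q) → Reduced u v
       with-Y (y , hY) = with-y (parity y)
        where
        y² : y * y ≡ + 9 + + 2 * (+ 96 * j - + 24 * i + + 4 * k)
        y² = *-cancelˡ {+ 4} (λ ()) (lin₂ 1ℤ (- (Y + + 2 * y)) Y² hY (reduce-ring₂ y j i k Y))
        with-y : Parity y → Reduced u v
        with-y (inj₁ (f , hf)) = absurd-∣ (+ 2) (+ 9) (y * f - (+ 96 * j - + 24 * i + + 4 * k) , lin₂ (- 1ℤ) y y² hf (reduce-ring₃ y f j i k))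
        with-y (inj₂ (f , hf)) = with-Z (even-of-square Z (y * y + (+ 3 + + 4 * (i + + 5 * j)) * (+ 3 + + 4 * (i + + 5 * j))) (*-cancelˡ {+ 2} (λ ()) Z²))
          where
          W : u * u + + 5 * (v * v) ≡ + 2 * (+ 3 + + 4 * (i + + 5 * j))
          W = lin₂ 1ℤ (+ 5) uu vv (solve (u ∷ v ∷ i ∷ j ∷ []))
          Z² : + 2 * (Z * Z) ≡ + 2 * (+ 2 * (y * y + (+ 3 + + 4 * (i + + 5 * j)) * (+ 3 + + 4 * (i + + 5 * j))))
          Z² = lin₃ 1ℤ (Y + + 2 * y) (u * u + + 5 * (v * v) + + 2 * (+ 3 + + 4 * (i + + 5 * j))) e₂ hY W (reduce-ring₄ Z y i j Y u v)
          with-Z : (∃ λ q → Z ≡ + 2 * q) → Reduced u v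
          with-Z (z , hZ) = record
            { T = + 3 + + 4 * (i + + 5 * j) ; Y = y ; Z = z ; m = i + + 5 * j ; b = b ; f = f
            ; T≡ = refl ; v≡ = hv ; Y≡ = hf ; W≡ = W
            ; Z≡ = *-cancelˡ {+ 4} (λ ()) (lin₂ 1ℤ (- (+ 2 * (Z + + 2 * z))) Z² hZ (reduce-ring₅ z y i j Z))
            ; eq = *-cancelˡ {+ 4} (λ ()) (lin₃ 1ℤ (- (+ 2 * (Y + + 2 * y))) (+ 5 * (u * u - + 5 * (v * v) + + 2 * (+ 3 + + 4 * (i + + 5 * j))) - + 58 * (v * v)) e₁ hY W (reduce-ring₆ y i j v Y u)) }
    cases : Parity u → Parity v → Reduced u v
    cases (inj₁ hu) (inj₁ hv) = no-common {u} {v} (+ 2) cop hu hv (absurd-∣ (+ 2) 1ℤ)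
    cases (inj₁ (a , hu)) (inj₂ (b , hv)) = absurd-∣ (+ 2) (+ 125)
      (Y * Y - + 5 * (a * (u * u * u)) + + 58 * (a * (u * (v * v))) - + 125 * (b * (+ 2 + + 2 * b)) * (v * v + 1ℤ) ,
        lin₃ (- 1ℤ) (- (+ 5 * (u * u * u) - + 58 * (u * (v * v)))) (- (+ 125 * (v + 1ℤ + + 2 * b) * (v * v + 1ℤ))) e₁ hu hv (reduce-ring₇ Y a u v b))
    cases (inj₂ (a , hu)) (inj₁ (b , hv)) = absurd-∣ (+ 2) (+ 5)
      (Y * Y - + 5 * (a * (+ 2 + + 2 * a)) * (u * u + 1ℤ) + + 58 * (b * (v * (u * u))) - + 125 * (b * (v * v * v)) ,
        lin₃ (- 1ℤ) (- (+ 5 * (u + 1ℤ + + 2 * a) * (u * u + 1ℤ))) (- (+ 125 * (v * v * v) - + 58 * (v * (u * u)))) e₁ hu hv (reduce-ring₈ Y a u b v))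
    cases (inj₂ (a , hu)) (inj₂ (b , hv)) = with-triangular (triangular a) (triangular b)
      where
      with-triangular : (∃ λ i → a * a + a ≡ + 2 * i) → (∃ λ j → b * b + b ≡ + 2 * j) → Reduced u v
      with-triangular (i , hi) (j , hj) = both-odd a b i j hu hv hi hj

  -- ((X + Y)/2)² + ((X - Y)/2)² = Z² is a primitive Pythagorean triple. Its two forms correspond to
  -- the two signs of Y, of which only the square matters later.
  parametrize : ∀ {X Y Z e f} → Coprime X Y → X ≡ 1ℤ + + 2 * e → Y ≡ 1ℤ + + 2 * f → + 2 * (Z * Z) ≡ Y * Y + X * X →
    ∃ λ p → ∃ λ q → ∃ λ Y′ → (X ≡ p * p - q * q + + 2 * (p * q)) × (Y′ ≡ p * p - q * q - + 2 * (p * q)) × (Y′ * Y′ ≡ Y * Y)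
  parametrize {X} {Y} {Z} {e} {f} (α , β , αX+βY≡1) hX hY hZ = from (pythagoras {e + f + 1ℤ} {e - f} {Z} {e} (α + β , α - β , lin₃ 1ℤ (- α) (- β) αX+βY≡1 hX hY (solve (X ∷ Y ∷ e ∷ f ∷ α ∷ β ∷ [])))
      (solve (e ∷ f ∷ [])) sum Z≢0)
    where
    sum : (e + f + 1ℤ) * (e + f + 1ℤ) + (e - f) * (e - f) ≡ Z * Z
    sum = *-cancelˡ {+ 2} (λ ()) (lin₃ (- 1ℤ) (- (X + 1ℤ + + 2 * e)) (- (Y + 1ℤ + + 2 * f)) hZ hX hY (solve (X ∷ Y ∷ Z ∷ e ∷ f ∷ [])))
    Z≢0 : Z ≢ 0ℤ
    Z≢0 hz = absurd-∣ (+ 4) (+ 2) (- (e * e + e + f * f + f) , lin₃ (- 1ℤ) (- (X + 1ℤ + + 2 * e)) (- (Y + 1ℤ + + 2 * f)) hZ hX hY (lin₁ (+ 2 * Z) hz (solve (X ∷ Y ∷ Z ∷ e ∷ f ∷ []))))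
    from : (∃ λ p → ∃ λ q → ((e + f + 1ℤ ≡ p * p - q * q) × (e - f ≡ + 2 * (p * q))) ⊎ ((e - f ≡ p * p - q * q) × (e + f + 1ℤ ≡ + 2 * (p * q)))) →
      ∃ λ p → ∃ λ q → ∃ λ Y′ → (X ≡ p * p - q * q + + 2 * (p * q)) × (Y′ ≡ p * p - q * q - + 2 * (p * q)) × (Y′ * Y′ ≡ Y * Y)
    from (p , q , inj₁ (hs , ht)) = p , q , Y , lin₃ 1ℤ 1ℤ 1ℤ hX hs ht (solve (X ∷ e ∷ f ∷ p ∷ q ∷ [])) , lin₃ 1ℤ 1ℤ (- 1ℤ) hY hs ht (solve (Y ∷ e ∷ f ∷ p ∷ q ∷ [])) , refl
    from (p , q , inj₂ (ht , hs)) = p , q , - Y , lin₃ 1ℤ 1ℤ 1ℤ hX hs ht (solve (X ∷ e ∷ f ∷ p ∷ q ∷ [])) , lin₃ (- 1ℤ) (- 1ℤ) 1ℤ hY hs ht (solve (Y ∷ e ∷ f ∷ p ∷ q ∷ [])) , solve (Y ∷ [])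

  -- Modulo X the equation reads 2Y² ≡ 15k²v⁴, and the right-hand side is prime to X.
  coprime-XY : ∀ {X Y v k} → Coprime X v → Coprime X (+ 3) → Coprime X (+ 5) → Coprime X k →
    + 2 * (Y * Y) ≡ + 5 * (X * X) - + 18 * k * (X * (v * v)) + + 15 * (k * k) * (v * v * (v * v)) → Coprime X Y
  coprime-XY {X} {Y} {v} {k} X-v X-3 X-5 X-k h = coprime-∣ʳ {X} {+ 2 * (Y * Y)} {Y} (coprime-sym {+ 2 * (Y * Y)} {X}
      (coprime-resp {+ 3 * + 5 * (k * k) * (v * v * (v * v)) + (+ 5 * X - + 18 * k * (v * v)) * X} {+ 2 * (Y * Y)} {X} (lin₁ (- 1ℤ) h (solve (X ∷ Y ∷ v ∷ k ∷ [])))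
        (coprime-+* (+ 3 * + 5 * (k * k) * (v * v * (v * v))) (+ 5 * X - + 18 * k * (v * v)) X (coprime-sym {X} {+ 3 * + 5 * (k * k) * (v * v * (v * v))} cofactor))))
      (+ 2 * Y , solve (Y ∷ []))
    where
    X-vv : Coprime X (v * v)
    X-vv = coprime-*ʳ {X} {v} {v} X-v X-v
    cofactor : Coprime X (+ 3 * + 5 * (k * k) * (v * v * (v * v)))
    cofactor = coprime-*ʳ {X} {+ 3 * + 5 * (k * k)} {v * v * (v * v)} (coprime-*ʳ {X} {+ 3 * + 5} {k * k} (coprime-*ʳ {X} {+ 3} {+ 5} X-3 X-5) (coprime-*ʳ {X} {k} {k} X-k X-k))
      (coprime-*ʳ {X} {v * v} {v * v} X-vv X-vv)

  ten-core-ring₁ : ∀ u v T →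
    u * u - + 9 * (v * v)
    ≡ 1ℤ * (u * u + + 5 * (v * v) - + 2 * T) + + 2 * (T - + 7 * (v * v))
  ten-core-ring₁ = solve-∀

  ten-core-ring₂ : ∀ v a u c T →
    v * v - + 3 * (+ 2 * (v * v) + a * u - + 2 * c)
    ≡ - 1ℤ * (u * u + + 5 * (v * v) - + 2 * T) + u * (u - + 3 * a) + - (+ 2) * (T - + 3 * c)
  ten-core-ring₂ = solve-∀

  ten-core-ring₃ : ∀ u c a v T →
    u * u - + 3 * (+ 2 * c - + 5 * (a * v))
    ≡ 1ℤ * (u * u + + 5 * (v * v) - + 2 * T) + - (+ 5 * v) * (v - + 3 * a) + + 2 * (T - + 3 * c)
  ten-core-ring₃ = solve-∀

  ten-core-ring₄ : ∀ T x y u v →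
    T - + 3 * (T - + 2 - x - + 5 * y)
    ≡ 1ℤ * (u * u + + 5 * (v * v) - + 2 * T) + - 1ℤ * (u * u - (1ℤ + + 3 * x)) + - (+ 5) * (v * v -
      (1ℤ + + 3 * y))
  ten-core-ring₄ = solve-∀

  ten-core-ring₅ : ∀ Y X T v →
    Y * Y - + 3 * (Y * Y - + 5 * (X * T) + + 18 * (T * (v * v)) - + 45 * (v * v * (v * v)))
    ≡ - 1ℤ * (+ 2 * (Y * Y) - (+ 5 * (T * T) - + 54 * (T * (v * v)) + + 135 * (v * v * (v * v)))) + -
      (+ 5 * T) * (T - + 3 * X)
  ten-core-ring₅ = solve-∀

  ten-core-ring₆ : ∀ Z Y₁ Y X T →
    Z * Z - + 3 * (Z * Z - Y₁ * Y - X * T)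
    ≡ - 1ℤ * (+ 2 * (Z * Z) - (Y * Y + T * T)) + - Y * (Y - + 3 * Y₁) + - T * (T - + 3 * X)
  ten-core-ring₆ = solve-∀

  ten-core-ring₇ : ∀ Y₁ X v Y T →
    + 9 * (+ 2 * (Y₁ * Y₁)) - + 9 * (+ 5 * (X * X) - + 18 * + 1 * (X * (v * v)) + + 15 * (+ 1 * + 1) *
      (v * v * (v * v)))
    ≡ 1ℤ * (+ 2 * (Y * Y) - (+ 5 * (T * T) - + 54 * (T * (v * v)) + + 135 * (v * v * (v * v)))) + -
      (+ 2 * (Y + + 3 * Y₁)) * (Y - + 3 * Y₁) + (+ 5 * (T + + 3 * X) - + 54 * (v * v)) * (T - + 3 * X)
  ten-core-ring₇ = solve-∀

  ten-core-ring₈ : ∀ Y₁ c X v →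
    Y₁ * Y₁ - + 3 * (Y₁ * Y₁ - + 5 * (c * X) + + 6 * (X * (v * v)) - + 5 * (v * v * (v * v)))
    ≡ - 1ℤ * (+ 2 * (Y₁ * Y₁) - (+ 5 * (X * X) - + 18 * + 1 * (X * (v * v)) + + 15 * (+ 1 * + 1) * (v
      * v * (v * v)))) + - (+ 5 * X) * (X - + 3 * c)
  ten-core-ring₈ = solve-∀

  ten-core-ring₉ : ∀ v d c Y₁ X →
    + 3 * (v * v * (v * v)) - + 3 * (+ 3 * (+ 2 * (v * v * (v * v)) - + 2 * (d * d) + + 5 * (c * c) -
      + 6 * (c * (v * v))))
    ≡ 1ℤ * (+ 2 * (Y₁ * Y₁) - (+ 5 * (X * X) - + 18 * + 1 * (X * (v * v)) + + 15 * (+ 1 * + 1) * (v *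
      v * (v * v)))) + - (+ 2 * (Y₁ + + 3 * d)) * (Y₁ - + 3 * d) + (+ 5 * (X + + 3 * c) - + 18 * (v *
      v)) * (X - + 3 * c)
  ten-core-ring₉ = solve-∀

  ten-core-ring₁₀ : ∀ X m T →
    X - (1ℤ + + 4 * (+ 2 + + 3 * m - + 2 * X))
    ≡ + 3 * (T - (+ 3 + + 4 * m)) + - (+ 3) * (T - + 3 * X)
  ten-core-ring₁₀ = solve-∀

  ten-core-ring₁₁ : ∀ X m →
    X - (1ℤ + + 2 * (+ 2 * (+ 2 + + 3 * m - + 2 * X)))
    ≡ 1ℤ * (X - (1ℤ + + 4 * (+ 2 + + 3 * m - + 2 * X)))
  ten-core-ring₁₁ = solve-∀

  ten-core-ring₁₂ : ∀ Z₁ Y₁ X Z Y T →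
    + 9 * (+ 2 * (Z₁ * Z₁)) - + 9 * (Y₁ * Y₁ + X * X) - (1ℤ * (+ 2 * (Z * Z) - (Y * Y + T * T)) + (Y +
      + 3 * Y₁) * (Y - + 3 * Y₁) + (T + + 3 * X) * (T - + 3 * X))
    ≡ - (+ 2 * (Z + + 3 * Z₁)) * (Z - + 3 * Z₁)
  ten-core-ring₁₂ = solve-∀

  ten-core-ring₁₃ : ∀ u v T X →
    u * u - v * v
    ≡ 1ℤ * (u * u + + 5 * (v * v) - + 2 * T) + + 2 * (T - + 3 * X) + + 6 * (X - v * v)
  ten-core-ring₁₃ = solve-∀

  -- The prime 3 decides the twist. If it divides u or v, then T is prime to 3, and the case k = 3
  -- applies with X = T. Otherwise u² ≡ v² ≡ 1 modulo 3, so 3 divides T, Y and Z, and dividing it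
  -- out leaves the equation with k = 1 and X = T/3. The outcomes X = 7v² and X = v² mean u² = 9v²
  -- and u² = v² respectively.
  ten-core : ∀ {u v Y Z} → Coprime u v → Coprime u (+ 5) → Equation₁ u v Y → Equation₂ u v Y Z → (u * u ≡ v * v) ⊎ (u * u ≡ + 9 * (v * v))
  ten-core {u} {v} {Y} {Z} cop u-5 e₁ e₂ = go (reduce {u} {v} {Y} {Z} cop e₁ e₂) (square-mod-3 u) (square-mod-3 v)
    where
    go : Reduced u v → + 3 ∣ u ⊎ (∃ λ z → u * u ≡ 1ℤ + + 3 * z) → + 3 ∣ v ⊎ (∃ λ z → v * v ≡ 1ℤ + + 3 * z) → (u * u ≡ v * v) ⊎ (u * u ≡ + 9 * (v * v))
    go record { T = T ; Y = Y ; Z = Z ; m = m ; b = b ; f = f ; T≡ = T≡ ; v≡ = v≡ ; Y≡ = Y≡ ; W≡ = W≡ ; Z≡ = Z≡ ; eq = eq } = cases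
      where
      divisor-coprime : ∀ {X} → X ∣ + 2 * T → Coprime X v × Coprime X (+ 5)
      divisor-coprime {X} X∣2T =
        coprime-∣ {+ 2 * T} {v} {X} (coprime-resp {u * u + + 5 * v * v} {+ 2 * T} {v} (lin₁ 1ℤ W≡ (solve (u ∷ v ∷ T ∷ []))) (coprime-+* (u * u) (+ 5 * v) v (coprime-* {u} {v} {u} cop cop))) X∣2T ,
        coprime-∣ {+ 2 * T} {+ 5} {X} (coprime-resp {u * u + v * v * + 5} {+ 2 * T} {+ 5} (lin₁ 1ℤ W≡ (solve (u ∷ v ∷ T ∷ []))) (coprime-+* (u * u) (v * v) (+ 5) (coprime-* {u} {+ 5} {u} u-5 u-5))) X∣2T
      untwisted : Coprime T (+ 3) → (u * u ≡ v * v) ⊎ (u * u ≡ + 9 * (v * v))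
      untwisted T-3 = inj₂ (conclude (parametrize {T} {Y} {Z} {1ℤ + + 2 * m} {f} T-Y (trans T≡ (solve (m ∷ []))) Y≡ Z≡))
        where
        T∣2T : T ∣ + 2 * T
        T∣2T = + 2 , solve (T ∷ [])
        eq′ : + 2 * (Y * Y) ≡ + 5 * (T * T) - + 18 * + 3 * (T * (v * v)) + + 15 * (+ 3 * + 3) * (v * v * (v * v))
        eq′ = eq
        T-Y : Coprime T Y
        T-Y = coprime-XY {T} {Y} {v} {+ 3} (proj₁ (divisor-coprime T∣2T)) T-3 (proj₂ (divisor-coprime T∣2T)) T-3 eq′
        conclude : (∃ λ p → ∃ λ q → ∃ λ Y′ → (T ≡ p * p - q * q + + 2 * (p * q)) × (Y′ ≡ p * p - q * q - + 2 * (p * q)) × (Y′ * Y′ ≡ Y * Y)) → u * u ≡ + 9 * (v * v)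
        conclude (p , q , Y′ , hT , hY′ , sq) = lin₂ 1ℤ (+ 2) W≡ (second-twist {p} {q} {T} {Y′} {v} {b} {m} hT hY′ (trans (cong (+ 2 *_) sq) eq′) v≡ T≡) (ten-core-ring₁ u v T)
      cases : + 3 ∣ u ⊎ (∃ λ z → u * u ≡ 1ℤ + + 3 * z) → + 3 ∣ v ⊎ (∃ λ z → v * v ≡ 1ℤ + + 3 * z) → (u * u ≡ v * v) ⊎ (u * u ≡ + 9 * (v * v))
      cases (inj₁ (a , 3∣u)) _ = untwisted (from (prime-3 T))
        where
        from : + 3 ∣ T ⊎ Coprime (+ 3) T → Coprime T (+ 3)
        from (inj₂ c) = coprime-sym {+ 3} {T} c
        from (inj₁ (c , hc)) = no-common {u} {v} (+ 3) cop (a , 3∣u) (3∣sq v (+ 2 * (v * v) + a * u - + 2 * c , lin₃ (- 1ℤ) u (- + 2) W≡ 3∣u hc (ten-core-ring₂ v a u c T))) (absurd-∣ (+ 3) 1ℤ)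
      cases (inj₂ _) (inj₁ (a , 3∣v)) = untwisted (from (prime-3 T))
        where
        from : + 3 ∣ T ⊎ Coprime (+ 3) T → Coprime T (+ 3)
        from (inj₂ c) = coprime-sym {+ 3} {T} c
        from (inj₁ (c , hc)) = no-common {u} {v} (+ 3) cop (3∣sq u (+ 2 * c - + 5 * (a * v) , lin₃ 1ℤ (- (+ 5 * v)) (+ 2) W≡ 3∣v hc (ten-core-ring₃ u c a v T))) (a , 3∣v) (absurd-∣ (+ 3) 1ℤ)
      cases (inj₂ (x , hu)) (inj₂ (y , hv)) = twisted (T - + 2 - x - + 5 * y) (lin₃ 1ℤ (- 1ℤ) (- + 5) W≡ hu hv (ten-core-ring₄ T x y u v))
        where
        twisted : ∀ X → T ≡ + 3 * X → (u * u ≡ v * v) ⊎ (u * u ≡ + 9 * (v * v))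
        twisted X T≡3X = with-Y (3∣sq Y (Y * Y - + 5 * (X * T) + + 18 * (T * (v * v)) - + 45 * (v * v * (v * v)) , lin₂ (- 1ℤ) (- (+ 5 * T)) eq T≡3X (ten-core-ring₅ Y X T v)))
          where
          with-Y : + 3 ∣ Y → (u * u ≡ v * v) ⊎ (u * u ≡ + 9 * (v * v))
          with-Y (Y₁ , hY) = with-Z (3∣sq Z (Z * Z - Y₁ * Y - X * T , lin₃ (- 1ℤ) (- Y) (- T) Z≡ hY T≡3X (ten-core-ring₆ Z Y₁ Y X T)))
            where
            X∣2T : X ∣ + 2 * T
            X∣2T = + 6 , lin₁ (+ 2) T≡3X (solve (T ∷ X ∷ []))
            eq₁ : + 2 * (Y₁ * Y₁) ≡ + 5 * (X * X) - + 18 * + 1 * (X * (v * v)) + + 15 * (+ 1 * + 1) * (v * v * (v * v))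
            eq₁ = *-cancelˡ {+ 9} (λ ()) (lin₃ 1ℤ (- (+ 2 * (Y + + 3 * Y₁))) (+ 5 * (T + + 3 * X) - + 54 * (v * v)) eq hY T≡3X (ten-core-ring₇ Y₁ X v Y T))
            X-3 : Coprime X (+ 3)
            X-3 = not-3 (prime-3 X)
              where
              not-3 : + 3 ∣ X ⊎ Coprime (+ 3) X → Coprime X (+ 3)
              not-3 (inj₂ c) = coprime-sym {+ 3} {X} c
              not-3 (inj₁ (c , hc)) = from-Y₁ (3∣sq Y₁ (Y₁ * Y₁ - + 5 * (c * X) + + 6 * (X * (v * v)) - + 5 * (v * v * (v * v)) , lin₂ (- 1ℤ) (- (+ 5 * X)) eq₁ hc (ten-core-ring₈ Y₁ c X v)))
                where
                from-Y₁ : + 3 ∣ Y₁ → Coprime X (+ 3)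
                from-Y₁ (d , hd) = from-v (3∣sq v (3∣sq (v * v) (+ 2 * (v * v * (v * v)) - + 2 * (d * d) + + 5 * (c * c) - + 6 * (c * (v * v)) ,
                  *-cancelˡ {+ 3} (λ ()) (lin₃ 1ℤ (- (+ 2 * (Y₁ + + 3 * d))) (+ 5 * (X + + 3 * c) - + 18 * (v * v)) eq₁ hd hc (ten-core-ring₉ v d c Y₁ X)))))
                  where
                  from-v : + 3 ∣ v → Coprime X (+ 3)
                  from-v (g , hg) = absurd-∣ (+ 3) 1ℤ (g * v - y , lin₂ (- 1ℤ) v hv hg (solve (v ∷ y ∷ g ∷ [])))
            Y₁≡ : Y₁ ≡ 1ℤ + + 2 * (f - Y₁)
            Y₁≡ = lin₂ 1ℤ (- 1ℤ) Y≡ hY (solve (Y ∷ Y₁ ∷ f ∷ []))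
            X≡ : X ≡ 1ℤ + + 4 * (+ 2 + + 3 * m - + 2 * X)
            X≡ = lin₂ (+ 3) (- + 3) T≡ T≡3X (ten-core-ring₁₀ X m T)
            X-Y₁ : Coprime X Y₁
            X-Y₁ = coprime-XY {X} {Y₁} {v} {+ 1} (proj₁ (divisor-coprime X∣2T)) X-3 (proj₂ (divisor-coprime X∣2T)) (0ℤ , 1ℤ , solve (X ∷ [])) eq₁
            with-Z : + 3 ∣ Z → (u * u ≡ v * v) ⊎ (u * u ≡ + 9 * (v * v))
            with-Z (Z₁ , hZ) = inj₁ (conclude (parametrize {X} {Y₁} {Z₁} {+ 2 * (+ 2 + + 3 * m - + 2 * X)} {f - Y₁} X-Y₁ (lin₁ 1ℤ X≡ (ten-core-ring₁₁ X m)) Y₁≡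
              (*-cancelˡ {+ 9} (λ ()) (lin₃ 1ℤ (Y + + 3 * Y₁) (T + + 3 * X) Z≡ hY T≡3X (lin₁ (- (+ 2 * (Z + + 3 * Z₁))) hZ (ten-core-ring₁₂ Z₁ Y₁ X Z Y T))))))
              where
              conclude : (∃ λ p → ∃ λ q → ∃ λ Y′ → (X ≡ p * p - q * q + + 2 * (p * q)) × (Y′ ≡ p * p - q * q - + 2 * (p * q)) × (Y′ * Y′ ≡ Y₁ * Y₁)) → u * u ≡ v * v
              conclude (p , q , Y′ , hX , hY′ , sq) = lin₃ 1ℤ (+ 2) (+ 6) W≡ T≡3X
                (first-twist {p} {q} {X} {Y′} {v} {b} {+ 2 + + 3 * m - + 2 * X} hX hY′ (trans (cong (+ 2 *_) sq) eq₁) v≡ X≡) (ten-core-ring₁₃ u v T X)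

-- Five squares c + a, c + 9a, c + 25a, c + 49a, c + 81a.

module TenC where

  open IntTools
  open TenB
  open import Data.Integer using (ℤ; +_; -[1+_]; _+_; _*_; -_; _-_; ∣_∣; 0ℤ; 1ℤ)
  import Data.Integer as ℤ
  import Data.Integer.Properties as ℤ
  open import Data.Integer.Tactic.RingSolver using (solve; solve-∀)
  open import Data.Product using (∃; _×_; _,_; proj₁; proj₂)
  open import Data.Sum using (_⊎_; inj₁; inj₂)
  open import Data.List using (_∷_; [])
  open import Relation.Nullary using (¬_; Dec; yes; no; contradiction)
  open import Relation.Binary.PropositionalEquality

  -- With G = gG′ and x = gx′ in lowest terms, G′² is prime to x′² and hence divides 2, so G′ is a
  -- unit.
  double-square-∣ : ∀ {G x Q} → G ≢ 0ℤ → + 2 * (x * x) ≡ G * G * Q → G ∣ x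
  double-square-∣ {G} {x} {Q} G≢0 h = go (gcd G x G≢0)
    where
    go : (∃ λ g → ∃ λ G′ → ∃ λ x′ → (G ≡ g * G′) × (x ≡ g * x′) × (g ≢ 0ℤ) × Coprime G′ x′) → G ∣ x
    go (g , G′ , x′ , G≡ , x≡ , g≢0 , cop) = finish (square-∣2 (coprime⇒∣ {G′ * G′} {x′ * x′} {+ 2} (coprime-* {G′} {x′ * x′} {G′} cop′ cop′) (Q , h′)))
      where
      cop′ : Coprime G′ (x′ * x′)
      cop′ = coprime-*ʳ {G′} {x′} {x′} cop cop
      h′ : x′ * x′ * + 2 ≡ G′ * G′ * Q
      h′ = *-cancelˡ {g * g} (*-≢0 g≢0 g≢0) (lin₃ 1ℤ (Q * (G + g * G′)) (- (+ 2 * (x + g * x′))) h G≡ x≡ (solve (g ∷ G ∷ G′ ∷ x ∷ x′ ∷ Q ∷ [])))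
      square-∣2 : G′ * G′ ∣ + 2 → G′ ∣ 1ℤ
      square-∣2 (r , e) = by-parity (prime-2 G′)
        where
        by-parity : + 2 ∣ G′ ⊎ Coprime (+ 2) G′ → G′ ∣ 1ℤ
        by-parity (inj₁ (y , hy)) = absurd-∣ (+ 4) (+ 2) (y * y * r , lin₂ 1ℤ (r * (G′ + + 2 * y)) e hy (solve (G′ ∷ r ∷ y ∷ [])))
        by-parity (inj₂ (s , t , c)) = s * G′ * r + t , lin₂ (- 1ℤ) s c e (solve (G′ ∷ r ∷ s ∷ t ∷ []))
      finish : G′ ∣ 1ℤ → G ∣ x
      finish (y , e) = y * x′ , lin₃ 1ℤ (- (y * x′)) (g * x′) x≡ G≡ e (solve (g ∷ G ∷ G′ ∷ x ∷ x′ ∷ y ∷ []))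

  private
    variable
      a c r₁ r₃ r₅ r₇ r₉ : ℤ

  -- Here 3r₇ - 2r₃ and 3r₇ + 2r₃ have product 5r₉², so they are Gu²/5 and Gv².
  ten-nonzero-ring₁ : ∀ c a r₇ r₃ σ →
    + 40 * c - + 40 * 0ℤ - (- (+ 9) * (c + + 49 * a - r₇ * r₇) + + 49 * (c + + 9 * a - r₃ * r₃) + -
      (+ 3 * r₇ + + 7 * σ * r₃) * (+ 3 * r₇ - + 7 * σ * r₃))
    ≡ - (+ 49 * (r₃ * r₃)) * (σ * σ - 1ℤ)
  ten-nonzero-ring₁ = solve-∀

  ten-nonzero-ring₂ : ∀ g u r₇ r₃ v c a r₉ →
    g * (u * (+ 3 * r₇ + + 2 * r₃)) - g * (+ 5 * g * (v * v)) - (- (+ 3 * r₇ + + 2 * r₃) * (+ 3 * r₇ -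
      + 2 * r₃ - g * u) + + 9 * (r₇ * r₇ - (c + + 49 * a)) + - (+ 4) * (r₃ * r₃ - (c + + 9 * a)))
    ≡ + 5 * (c + + 81 * a - r₉ * r₉) + + 5 * (r₉ + g * v) * (r₉ - g * v)
  ten-nonzero-ring₂ = solve-∀

  ten-nonzero-ring₃ : ∀ u r₇ r₃ G v g →
    u * (+ 3 * r₇ + + 2 * r₃) - u * (G * (v * v))
    ≡ 1ℤ * (u * (+ 3 * r₇ + + 2 * r₃) - + 5 * g * (v * v)) + v * v * (+ 5 * g - u * G)
  ten-nonzero-ring₃ = solve-∀

  ten-nonzero-ring₄ : ∀ r₇ G u v r₃ g →
    + 3 * (+ 10 * r₇) - G * (u * u + + 5 * (v * v))
    ≡ + 5 * (+ 3 * r₇ - + 2 * r₃ - g * u) + u * (+ 5 * g - u * G) + + 5 * (+ 3 * r₇ + + 2 * r₃ - G *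
      (v * v))
  ten-nonzero-ring₄ = solve-∀

  ten-nonzero-ring₅ : ∀ r₃ G v u r₇ g →
    + 2 * (+ 10 * r₃) - G * (+ 5 * (v * v) - u * u)
    ≡ - (+ 5) * (+ 3 * r₇ - + 2 * r₃ - g * u) + - u * (+ 5 * g - u * G) + + 5 * (+ 3 * r₇ + + 2 * r₃ -
      G * (v * v))
  ten-nonzero-ring₅ = solve-∀

  ten-nonzero-ring₆ : ∀ k r₁ r₃ r₇ c a →
    + 5 * (k * r₁ * (k * r₁)) - (+ 6 * (k * r₃ * (k * r₃)) - k * r₇ * (k * r₇))
    ≡ - (+ 5 * (k * k)) * (c + a - r₁ * r₁) + + 6 * (k * k) * (c + + 9 * a - r₃ * r₃) + - (k * k) * (c
      + + 49 * a - r₇ * r₇)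
  ten-nonzero-ring₆ = solve-∀

  ten-nonzero-ring₇ : ∀ x G u v y z →
    + 5 * (+ 2 * (+ 3 * x * (+ 3 * x))) - + 5 * (G * G * (+ 5 * (u * u * (u * u)) - + 58 * (u * u * (v
      * v)) + + 125 * (v * v * (v * v))))
    ≡ + 18 * (+ 5 * (x * x) - (+ 6 * (y * y) - z * z)) + + 27 * (+ 2 * y + G * (+ 5 * (v * v) - u *
      u)) * (+ 2 * y - G * (+ 5 * (v * v) - u * u)) + - (+ 2 * (+ 3 * z + G * (u * u + + 5 * (v *
      v)))) * (+ 3 * z - G * (u * u + + 5 * (v * v)))
  ten-nonzero-ring₇ = solve-∀

  ten-nonzero-ring₈ : ∀ G y Q x →
    G * G * (+ 2 * (y * y)) - G * G * Q
    ≡ 1ℤ * (+ 2 * (x * x) - G * G * Q) + - (+ 2 * (x + G * y)) * (x - G * y)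
  ten-nonzero-ring₈ = solve-∀

  ten-nonzero-ring₉ : ∀ k r₅ G Y u v c a r₁ r₇ →
    + 2 * (+ 3 * (k * r₅) * (+ 3 * (k * r₅))) - G * G * (Y * Y + (u * u + + 5 * (v * v)) * (u * u +
      + 5 * (v * v))) - (- (+ 18 * (k * k)) * (c + + 25 * a - r₅ * r₅) + + 9 * (k * k) * (c + a - r₁ *
      r₁) + + 9 * (k * k) * (c + + 49 * a - r₇ * r₇))
    ≡ (+ 3 * (k * r₁) + G * Y) * (+ 3 * (k * r₁) - G * Y) + (+ 3 * (k * r₇) + G * (u * u + + 5 * (v *
      v))) * (+ 3 * (k * r₇) - G * (u * u + + 5 * (v * v)))
  ten-nonzero-ring₉ = solve-∀

  ten-nonzero-ring₁₀ : ∀ r₇ r₃ G u v →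
    + 60 * r₇ - + 60 * (1ℤ * r₃)
    ≡ + 2 * (+ 3 * (+ 10 * r₇) - G * (u * u + + 5 * (v * v))) + - (+ 3) * (+ 2 * (+ 10 * r₃) - G *
      (+ 5 * (v * v) - u * u)) + + 5 * G * (u * u - v * v)
  ten-nonzero-ring₁₀ = solve-∀

  ten-nonzero-ring₁₁ : ∀ r₇ r₃ G u v →
    + 60 * (+ 3 * r₇) - + 60 * (+ 7 * - 1ℤ * r₃)
    ≡ + 6 * (+ 3 * (+ 10 * r₇) - G * (u * u + + 5 * (v * v))) + + 21 * (+ 2 * (+ 10 * r₃) - G * (+ 5 *
      (v * v) - u * u)) + - (+ 15 * G) * (u * u - + 9 * (v * v))
  ten-nonzero-ring₁₁ = solve-∀

  ten-nonzero-ring₁₂ : ∀ Y f v w u →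
    + 2 * (Y * Y) - f * f * (f * (v * v * (v * v)) - + 58 * (v * v * (w * w)) + f * f * f * (w * w *
      (w * w)))
    ≡ 1ℤ * (+ 2 * (Y * Y) - (f * (u * u * (u * u)) - + 58 * (u * u * (v * v)) + f * f * f * (v * v *
      (v * v)))) + (f * (u + f * w) * (u * u + f * f * (w * w)) - + 58 * (u + f * w) * (v * v)) * (u -
      f * w)
  ten-nonzero-ring₁₂ = solve-∀

  ten-nonzero-ring₁₃ : ∀ Z f Y₁ v w Y u →
    + 2 * (Z * Z) - f * f * (Y₁ * Y₁ + (v * v + f * (w * w)) * (v * v + f * (w * w)))
    ≡ 1ℤ * (+ 2 * (Z * Z) - (Y * Y + (u * u + f * (v * v)) * (u * u + f * (v * v)))) + (Y + f * Y₁) *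
      (Y - f * Y₁) + (u + f * w) * (u * u + f * f * (w * w) + + 2 * f * (v * v)) * (u - f * w)
  ten-nonzero-ring₁₃ = solve-∀

  ten-nonzero-ring₁₄ : ∀ r₇ r₃ G u v w →
    + 60 * r₇ - + 60 * (- 1ℤ * r₃) - (+ 2 * (+ 3 * (+ 10 * r₇) - G * (u * u + + 5 * (v * v))) + + 3 *
      (+ 2 * (+ 10 * r₃) - G * (+ 5 * (v * v) - u * u)) + + 25 * G * (v * v - w * w))
    ≡ - (G * (u + + 5 * w)) * (u - + 5 * w)
  ten-nonzero-ring₁₄ = solve-∀

  ten-nonzero-ring₁₅ : ∀ r₇ r₃ G u v w →
    + 60 * (+ 3 * r₇) - + 60 * (+ 7 * 1ℤ * r₃) - (+ 6 * (+ 3 * (+ 10 * r₇) - G * (u * u + + 5 * (v *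
      v))) + - (+ 21) * (+ 2 * (+ 10 * r₃) - G * (+ 5 * (v * v) - u * u)) + - (+ 75 * G) * (v * v -
      + 9 * (w * w)))
    ≡ + 27 * G * (u + + 5 * w) * (u - + 5 * w)
  ten-nonzero-ring₁₅ = solve-∀

  ten-nonzero : c + a ≡ r₁ * r₁ → c + + 9 * a ≡ r₃ * r₃ → c + + 25 * a ≡ r₅ * r₅ → c + + 49 * a ≡ r₇ * r₇ → c + + 81 * a ≡ r₉ * r₉ →
    + 3 * r₇ - + 2 * r₃ ≢ 0ℤ → a ≡ 0ℤ ⊎ c ≡ 0ℤ
  ten-nonzero {c} {a} {r₁} {r₃} {r₅} {r₇} {r₉} h₁ h₃ h₅ h₇ h₉ α≢0 = from-gcd (gcd (+ 3 * r₇ - + 2 * r₃) r₉ α≢0)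
    where
    -- The two degenerate outcomes: r₇ = ±r₃ makes all five values equal, and 3r₇ = ±7r₃ makes them
    -- proportional to 1, 9, 25, 49, 81.
    a≡0 : ∀ σ → σ * σ ≡ 1ℤ → r₇ ≡ σ * r₃ → a ≡ 0ℤ
    a≡0 σ σσ h = *-cancelˡ {+ 40} (λ ()) (lin₃ 1ℤ (- 1ℤ) (r₇ + σ * r₃) h₇ h₃ h (lin₁ (r₃ * r₃) σσ (solve (a ∷ c ∷ r₃ ∷ r₇ ∷ σ ∷ []))))
    c≡0 : ∀ σ → σ * σ ≡ 1ℤ → + 3 * r₇ ≡ + 7 * σ * r₃ → c ≡ 0ℤ
    c≡0 σ σσ h = *-cancelˡ {+ 40} (λ ()) (lin₃ (- + 9) (+ 49) (- (+ 3 * r₇ + + 7 * σ * r₃)) h₇ h₃ h (lin₁ (- (+ 49 * (r₃ * r₃))) σσ (ten-nonzero-ring₁ c a r₇ r₃ σ)))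
    from-gcd : (∃ λ g → ∃ λ u → ∃ λ v → (+ 3 * r₇ - + 2 * r₃ ≡ g * u) × (r₉ ≡ g * v) × (g ≢ 0ℤ) × Coprime u v) → a ≡ 0ℤ ⊎ c ≡ 0ℤ
    from-gcd (g , u , v , α≡ , r₉≡ , g≢0 , cop) = with-G (coprime⇒∣ {u} {v * v} {+ 5 * g} (coprime-*ʳ {u} {v} {v} cop cop) (+ 3 * r₇ + + 2 * r₃ ,
        lin₁ (- 1ℤ) uβ≡ (solve (u ∷ v ∷ g ∷ r₇ ∷ r₃ ∷ []))))
      where
      uβ≡ : u * (+ 3 * r₇ + + 2 * r₃) ≡ + 5 * g * (v * v)
      uβ≡ = *-cancelˡ {g} g≢0 (lin₃ (- (+ 3 * r₇ + + 2 * r₃)) (+ 9) (- + 4) α≡ (sym h₇) (sym h₃) (lin₂ (+ 5) (+ 5 * (r₉ + g * v)) (sym (sym h₉)) r₉≡ (ten-nonzero-ring₂ g u r₇ r₃ v c a r₉)))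
      u≢0 : u ≢ 0ℤ
      u≢0 = *≢0ʳ {g} {u} (λ z → α≢0 (trans α≡ z))
      with-G : u ∣ + 5 * g → a ≡ 0ℤ ⊎ c ≡ 0ℤ
      with-G (G , 5g≡uG) = with-Y (double-square-∣ {G} {+ 3 * (+ 10 * r₁)} {+ 5 * (u * u * (u * u)) - + 58 * (u * u * (v * v)) + + 125 * (v * v * (v * v))} G≢0
          (first-root (+ 10 * r₁) (+ 10 * r₃) (+ 10 * r₇) (scaled-relation (+ 10)) e₃ e₇))
        where
        β≡ : + 3 * r₇ + + 2 * r₃ ≡ G * (v * v)
        β≡ = *-cancelˡ {u} u≢0 (lin₂ 1ℤ (v * v) uβ≡ 5g≡uG (ten-nonzero-ring₃ u r₇ r₃ G v g))
        G≢0 : G ≢ 0ℤ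
        G≢0 = *≢0ʳ {u} {G} (λ z → *-≢0 {+ 5} {g} (λ ()) g≢0 (trans 5g≡uG z))
        e₇ : + 3 * (+ 10 * r₇) ≡ G * (u * u + + 5 * (v * v))
        e₇ = lin₃ (+ 5) u (+ 5) α≡ 5g≡uG β≡ (ten-nonzero-ring₄ r₇ G u v r₃ g)
        e₃ : + 2 * (+ 10 * r₃) ≡ G * (+ 5 * (v * v) - u * u)
        e₃ = lin₃ (- + 5) (- u) (+ 5) α≡ 5g≡uG β≡ (ten-nonzero-ring₅ r₃ G v u r₇ g)
        -- 5r₁² = 6r₃² - r₇² leads to `Equation₁`, and 2r₅² = r₁² + r₇² to `Equation₂`. The
        -- multiplier k = 10 clears the denominators in 30r₇ = G(u² + 5v²) and 20r₃ = G(5v² - u²).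
        scaled-relation : ∀ k → + 5 * (k * r₁ * (k * r₁)) ≡ + 6 * (k * r₃ * (k * r₃)) - k * r₇ * (k * r₇)
        scaled-relation k = lin₃ (- (+ 5 * (k * k))) (+ 6 * (k * k)) (- (k * k)) h₁ h₃ h₇ (ten-nonzero-ring₆ k r₁ r₃ r₇ c a)
        first-root : ∀ x y z → + 5 * (x * x) ≡ + 6 * (y * y) - z * z → + 2 * y ≡ G * (+ 5 * (v * v) - u * u) → + 3 * z ≡ G * (u * u + + 5 * (v * v)) →
          + 2 * (+ 3 * x * (+ 3 * x)) ≡ G * G * (+ 5 * (u * u * (u * u)) - + 58 * (u * u * (v * v)) + + 125 * (v * v * (v * v)))
        first-root x y z h hy hz = *-cancelˡ {+ 5} (λ ())
          (lin₃ (+ 18) (+ 27 * (+ 2 * y + G * (+ 5 * (v * v) - u * u))) (- (+ 2 * (+ 3 * z + G * (u * u + + 5 * (v * v))))) h hy hz (ten-nonzero-ring₇ x G u v y z))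
        with-Y : G ∣ + 3 * (+ 10 * r₁) → a ≡ 0ℤ ⊎ c ≡ 0ℤ
        with-Y (Y , hY) = with-Z (double-square-∣ {G} {+ 3 * (+ 10 * r₅)} {Y * Y + (u * u + + 5 * (v * v)) * (u * u + + 5 * (v * v))} G≢0 (r₅² (+ 10) hY e₇))
          where
          GG≢0 : G * G ≢ 0ℤ
          GG≢0 = *-≢0 G≢0 G≢0
          cancel-root : ∀ {x y Q} → + 2 * (x * x) ≡ G * G * Q → x ≡ G * y → + 2 * (y * y) ≡ Q
          cancel-root {x} {y} {Q} h hx = *-cancelˡ {G * G} GG≢0 (lin₂ 1ℤ (- (+ 2 * (x + G * y))) h hx (ten-nonzero-ring₈ G y Q x))
          eq₁ : Equation₁ u v Y
          eq₁ = cancel-root {+ 3 * (+ 10 * r₁)} {Y} (first-root (+ 10 * r₁) (+ 10 * r₃) (+ 10 * r₇) (scaled-relation (+ 10)) e₃ e₇) hY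
          r₅² : ∀ k → + 3 * (k * r₁) ≡ G * Y → + 3 * (k * r₇) ≡ G * (u * u + + 5 * (v * v)) →
            + 2 * (+ 3 * (k * r₅) * (+ 3 * (k * r₅))) ≡ G * G * (Y * Y + (u * u + + 5 * (v * v)) * (u * u + + 5 * (v * v)))
          r₅² k hY e₇ = lin₃ (- (+ 18 * (k * k))) (+ 9 * (k * k)) (+ 9 * (k * k)) h₅ h₁ h₇ (lin₂ (+ 3 * (k * r₁) + G * Y) (+ 3 * (k * r₇) + G * (u * u + + 5 * (v * v))) hY e₇
            (ten-nonzero-ring₉ k r₅ G Y u v c a r₁ r₇))
          with-Z : G ∣ + 3 * (+ 10 * r₅) → a ≡ 0ℤ ⊎ c ≡ 0ℤ
          with-Z (Z , hZ) = by-5 (prime-5 u)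
            where
            eq₂ : Equation₂ u v Y Z
            eq₂ = cancel-root {+ 3 * (+ 10 * r₅)} {Z} (r₅² (+ 10) hY e₇) hZ
            by-5 : + 5 ∣ u ⊎ Coprime (+ 5) u → a ≡ 0ℤ ⊎ c ≡ 0ℤ
            by-5 (inj₂ 5-u) = conclude (ten-core {u} {v} {Y} {Z} cop (coprime-sym {+ 5} {u} 5-u) eq₁ eq₂)
              where
              conclude : (u * u ≡ v * v) ⊎ (u * u ≡ + 9 * (v * v)) → a ≡ 0ℤ ⊎ c ≡ 0ℤ
              conclude (inj₁ e) = inj₁ (a≡0 1ℤ refl (*-cancelˡ {+ 60} (λ ()) (lin₃ (+ 2) (- + 3) (+ 5 * G) e₇ e₃ e (ten-nonzero-ring₁₀ r₇ r₃ G u v))))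
              conclude (inj₂ e) = inj₂ (c≡0 (- 1ℤ) refl (*-cancelˡ {+ 60} (λ ()) (lin₃ (+ 6) (+ 21) (- (+ 15 * G)) e₇ e₃ e (ten-nonzero-ring₁₁ r₇ r₃ G u v))))
            -- If u = 5w, both equations keep their form for the pair (v, w) after division of Y and
            -- Z by 5, and v is prime to 5.
            by-5 (inj₁ (w , hu)) = with-Y₁ (5∣2sq Y (swap₁ (+ 5) hu eq₁))
              where
              v-w : Coprime v w
              v-w = coprime-∣ʳ {v} {u} {w} (coprime-sym {u} {v} cop) (+ 5 , lin₁ 1ℤ hu (solve (u ∷ w ∷ [])))
              v-5 : Coprime v (+ 5)
              v-5 = coprime-∣ʳ {v} {u} {+ 5} (coprime-sym {u} {v} cop) (w , hu)
              5∣2sq : ∀ x {Q} → + 2 * (x * x) ≡ + 5 * + 5 * Q → + 5 ∣ x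
              5∣2sq x {Q} h = 5∣sq x (coprime⇒∣ {+ 5} {+ 2} {x * x} (1ℤ , - + 2 , refl) (+ 5 * Q , trans h (ℤ.*-assoc (+ 5) (+ 5) Q)))
              swap₁ : ∀ f → u ≡ f * w → + 2 * (Y * Y) ≡ f * (u * u * (u * u)) - + 58 * (u * u * (v * v)) + f * f * f * (v * v * (v * v)) →
                + 2 * (Y * Y) ≡ f * f * (f * (v * v * (v * v)) - + 58 * (v * v * (w * w)) + f * f * f * (w * w * (w * w)))
              swap₁ f hu h = lin₂ 1ℤ (f * (u + f * w) * (u * u + f * f * (w * w)) - + 58 * (u + f * w) * (v * v)) h hu (ten-nonzero-ring₁₂ Y f v w u)
              swap₂ : ∀ f {Y₁} → u ≡ f * w → Y ≡ f * Y₁ → + 2 * (Z * Z) ≡ Y * Y + (u * u + f * (v * v)) * (u * u + f * (v * v)) →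
                + 2 * (Z * Z) ≡ f * f * (Y₁ * Y₁ + (v * v + f * (w * w)) * (v * v + f * (w * w)))
              swap₂ f {Y₁} hu hY h = lin₃ 1ℤ (Y + f * Y₁) ((u + f * w) * (u * u + f * f * (w * w) + + 2 * f * (v * v))) h hY hu (ten-nonzero-ring₁₃ Z f Y₁ v w Y u)
              cancel-5 : ∀ {x y Q} f → f ≢ 0ℤ → + 2 * (x * x) ≡ f * f * Q → x ≡ f * y → + 2 * (y * y) ≡ Q
              cancel-5 {x} {y} {Q} f f≢0 h hx = *-cancelˡ {f * f} (*-≢0 f≢0 f≢0) (lin₂ 1ℤ (- (+ 2 * (x + f * y))) h hx (ten-nonzero-ring₈ f y Q x))
              with-Y₁ : + 5 ∣ Y → a ≡ 0ℤ ⊎ c ≡ 0ℤ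
              with-Y₁ (Y₁ , hY₁) = with-Z₁ (5∣2sq Z (swap₂ (+ 5) hu hY₁ eq₂))
                where
                with-Z₁ : + 5 ∣ Z → a ≡ 0ℤ ⊎ c ≡ 0ℤ
                with-Z₁ (Z₁ , hZ₁) = conclude (ten-core {v} {w} {Y₁} {Z₁} v-w v-5 (cancel-5 {Y} {Y₁} (+ 5) (λ ()) (swap₁ (+ 5) hu eq₁) hY₁)
                    (cancel-5 {Z} {Z₁} (+ 5) (λ ()) (swap₂ (+ 5) hu hY₁ eq₂) hZ₁))
                  where
                  conclude : (v * v ≡ w * w) ⊎ (v * v ≡ + 9 * (w * w)) → a ≡ 0ℤ ⊎ c ≡ 0ℤ
                  conclude (inj₁ e) = inj₁ (a≡0 (- 1ℤ) refl (*-cancelˡ {+ 60} (λ ()) (lin₃ (+ 2) (+ 3) (+ 25 * G) e₇ e₃ e (lin₁ (- (G * (u + + 5 * w))) hu (ten-nonzero-ring₁₄ r₇ r₃ G u v w)))))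
                  conclude (inj₂ e) = inj₂ (c≡0 1ℤ refl (*-cancelˡ {+ 60} (λ ()) (lin₃ (+ 6) (- + 21) (- (+ 75 * G)) e₇ e₃ e (lin₁ (+ 27 * G * (u + + 5 * w)) hu (ten-nonzero-ring₁₅ r₇ r₃ G u v w)))))

  five-squares-ring₁ : ∀ a c r₇ r₃ →
    + 1440 * a - + 1440 * 0ℤ - (+ 36 * (c + + 49 * a - r₇ * r₇) + - (+ 36) * (c + + 9 * a - r₃ * r₃))
    ≡ (+ 6 * r₇ + + 9 * r₃) * (+ 3 * r₇ - + 2 * r₃ - 0ℤ) + (+ 6 * r₇ - + 9 * r₃) * (+ 3 * r₇ - + 2 * -
      r₃ - 0ℤ)
  five-squares-ring₁ = solve-∀

  -- Changing the sign of r₃ if necessary achieves 3r₇ ≠ 2r₃, unless r₃ = r₇ = 0, when a = 0.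
  five-squares : c + a ≡ r₁ * r₁ → c + + 9 * a ≡ r₃ * r₃ → c + + 25 * a ≡ r₅ * r₅ → c + + 49 * a ≡ r₇ * r₇ → c + + 81 * a ≡ r₉ * r₉ →
    a ≡ 0ℤ ⊎ c ≡ 0ℤ
  five-squares {c} {a} {r₁} {r₃} {r₅} {r₇} {r₉} h₁ h₃ h₅ h₇ h₉ = go (+ 3 * r₇ - + 2 * r₃ ℤ.≟ 0ℤ) (+ 3 * r₇ - + 2 * - r₃ ℤ.≟ 0ℤ)
    where
    go : Dec (+ 3 * r₇ - + 2 * r₃ ≡ 0ℤ) → Dec (+ 3 * r₇ - + 2 * - r₃ ≡ 0ℤ) → a ≡ 0ℤ ⊎ c ≡ 0ℤ
    go (no α≢0) _ = ten-nonzero {c} {a} {r₁} {r₃} {r₅} {r₇} {r₉} h₁ h₃ h₅ h₇ h₉ α≢0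
    go _ (no β≢0) = ten-nonzero {c} {a} {r₁} { - r₃} {r₅} {r₇} {r₉} h₁ (lin₁ 1ℤ h₃ (solve (a ∷ c ∷ r₃ ∷ []))) h₅ h₇ h₉ β≢0
    go (yes α≡0) (yes β≡0) = inj₁ (*-cancelˡ {+ 1440} (λ ()) (lin₂ (+ 36) (- + 36) h₇ h₃
      (lin₂ (+ 6 * r₇ + + 9 * r₃) (+ 6 * r₇ - + 9 * r₃) α≡0 β≡0 (five-squares-ring₁ a c r₇ r₃))))

-- Coprime factorizations over ℤ for the descent on four squares.

module Seven where

  open Gauss using (∣∣-sq)
  open IntTools
  open TenA using (parity)
  open TenB
  open import Data.Integer using (ℤ; +_; -[1+_]; _+_; _*_; -_; _-_; ∣_∣; 0ℤ; 1ℤ)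
  import Data.Integer as ℤ
  import Data.Integer.Properties as ℤ
  open import Data.Integer.Tactic.RingSolver using (solve; solve-∀)
  open import Data.Nat as ℕ using (ℕ; zero; suc)
  import Data.Nat.Properties as ℕ
  import Data.Nat.Divisibility as ℕ
  open import Data.Nat.Induction using (<-wellFounded)
  open import Induction.WellFounded using (Acc; acc)
  open import Data.Product using (∃; _×_; _,_; proj₁; proj₂)
  open import Data.Sum using (_⊎_; inj₁; inj₂)
  open import Data.Empty using (⊥; ⊥-elim)
  open import Data.List using (_∷_; [])
  open import Relation.Nullary using (¬_; Dec; yes; no; contradiction)
  open import Relation.Binary.PropositionalEquality

  Parity : ℤ → Set
  Parity x = (∃ λ q → x ≡ + 2 * q) ⊎ (∃ λ q → x ≡ 1ℤ + + 2 * q)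

  Oddᶻ : ℤ → Set
  Oddᶻ x = ∃ λ q → x ≡ 1ℤ + + 2 * q

  PrimeOr : ℤ → Set
  PrimeOr p = ∀ x → p ∣ x ⊎ Coprime p x

  odd-square : ∀ {x} → Oddᶻ x → ∃ λ z → x * x ≡ 1ℤ + + 8 * z
  odd-square {x} (a , h) = go (triangular a)
    where
    go : (∃ λ i → a * a + a ≡ + 2 * i) → ∃ λ z → x * x ≡ 1ℤ + + 8 * z
    go (i , hi) = i , lin₂ (x + 1ℤ + + 2 * a) (+ 4) h hi (solve (x ∷ a ∷ i ∷ []))

  odd-factors : ∀ {x y n} → x * y ≡ 1ℤ + + 2 * n → Oddᶻ x × Oddᶻ y
  odd-factors {x} {y} {n} h = left (parity x) , right (parity y)
    where
    left : Parity x → Oddᶻ x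
    left (inj₂ o) = o
    left (inj₁ (q , e)) = absurd-∣ (+ 2) 1ℤ (q * y - n , lin₂ (- 1ℤ) y h e (solve (x ∷ y ∷ n ∷ q ∷ [])))
    right : Parity y → Oddᶻ y
    right (inj₂ o) = o
    right (inj₁ (q , e)) = absurd-∣ (+ 2) 1ℤ (x * q - n , lin₂ (- 1ℤ) x h e (solve (x ∷ y ∷ n ∷ q ∷ [])))

  square-∣ : ∀ {g x z} → g ≢ 0ℤ → x * x ≡ g * g * z → g ∣ x
  square-∣ {g} {x} {z} g≢0 h = go (gcd g x g≢0)
    where
    go : (∃ λ k → ∃ λ g′ → ∃ λ x′ → (g ≡ k * g′) × (x ≡ k * x′) × (k ≢ 0ℤ) × Coprime g′ x′) → g ∣ x
    go (k , g′ , x′ , g≡ , x≡ , k≢0 , cop) = finish (coprime⇒∣ {g′} {x′} {1ℤ} cop (from (coprime⇒∣ {g′} {x′} {x′} cop (g′ * z , x′x′≡))))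
      where
      x′x′≡ : x′ * x′ ≡ g′ * (g′ * z)
      x′x′≡ = *-cancelˡ {k * k} (*-≢0 k≢0 k≢0) (lin₃ 1ℤ (z * (g + k * g′)) (- (x + k * x′)) h g≡ x≡ (solve (g ∷ x ∷ z ∷ k ∷ g′ ∷ x′ ∷ [])))
      from : g′ ∣ x′ → g′ ∣ x′ * 1ℤ
      from (r , e) = r , lin₁ 1ℤ e (solve (g′ ∷ x′ ∷ r ∷ []))
      finish : g′ ∣ 1ℤ → g ∣ x
      finish (u , e) = u * x′ , lin₃ 1ℤ (- (u * x′)) (k * x′) x≡ g≡ e (solve (g ∷ x ∷ k ∷ g′ ∷ x′ ∷ u ∷ []))

  -- Positivity, transferred to natural numbers; it excludes opposite signs in `same-sign`.
  sum-of-squares-zero : ∀ n b c d {U V P Q} → + suc n * (U * U) + + b * (V * V) + + c * (P * P) + + d * (Q * Q) ≡ 0ℤ → U ≡ 0ℤ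
  sum-of-squares-zero n b c d {U} {V} {P} {Q} h = ℤ.∣i∣≡0⇒i≡0 (zero-of-product (ℕ.m*n≡0⇒m≡0∨n≡0 ∣ U ∣ (zero-of-multiple (ℕ.m+n≡0⇒m≡0 _ (ℕ.m+n≡0⇒m≡0 _ (ℕ.m+n≡0⇒m≡0 _ (ℤ.+-injective total)))))))
    where
    term : ∀ m x → + (m ℕ.* (∣ x ∣ ℕ.* ∣ x ∣)) ≡ + m * (x * x)
    term m x = trans (ℤ.pos-* m (∣ x ∣ ℕ.* ∣ x ∣)) (cong (+ m *_) (∣∣-sq x))
    total : + (suc n ℕ.* (∣ U ∣ ℕ.* ∣ U ∣) ℕ.+ b ℕ.* (∣ V ∣ ℕ.* ∣ V ∣) ℕ.+ c ℕ.* (∣ P ∣ ℕ.* ∣ P ∣) ℕ.+ d ℕ.* (∣ Q ∣ ℕ.* ∣ Q ∣)) ≡ 0ℤ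
    total = trans (cong₂ _+_ (cong₂ _+_ (cong₂ _+_ (term (suc n) U) (term b V)) (term c P)) (term d Q)) h
    zero-of-multiple : suc n ℕ.* (∣ U ∣ ℕ.* ∣ U ∣) ≡ 0 → ∣ U ∣ ℕ.* ∣ U ∣ ≡ 0
    zero-of-multiple e = ℕ.m+n≡0⇒m≡0 (∣ U ∣ ℕ.* ∣ U ∣) e
    zero-of-product : ∣ U ∣ ≡ 0 ⊎ ∣ U ∣ ≡ 0 → ∣ U ∣ ≡ 0
    zero-of-product (inj₁ e) = e
    zero-of-product (inj₂ e) = e

  unit-square : ∀ {x y m} → x * y ≡ m → ∣ m ∣ ≡ 1 → x * x ≡ 1ℤ
  unit-square {x} {y} {m} h e = trans (sym (∣∣-sq x)) (cong (λ n → + (n ℕ.* n)) (ℕ.m*n≡1⇒m≡1 ∣ x ∣ ∣ y ∣ (trans (sym (ℤ.abs-* x y)) (trans (cong ∣_∣ h) e))))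

  coprime-factors-ring₁ : ∀ v u f₁ w f₂ g x y →
    v * u * f₁ + w * u * f₂ - 1ℤ - (v * u * (f₁ - g * x) + w * u * (f₂ - g * y) + 1ℤ * (g * u - 1ℤ))
    ≡ g * u * (v * x + w * y - 1ℤ)
  coprime-factors-ring₁ = solve-∀

  -- A common divisor g of f₁ and f₂ divides s, so it is prime to C, and g² divides the prime p;
  -- hence g is a unit.
  coprime-factors : ∀ {p f₁ f₂ C s} → PrimeOr p → p ≢ 0ℤ → ¬ (p ∣ 1ℤ) → f₁ ≢ 0ℤ → f₁ * f₂ ≡ C * p → Coprime s C → s ≡ f₁ + f₂ → Coprime f₁ f₂
  coprime-factors {p} {f₁} {f₂} {C} {s} prime p≢0 p∤1 f₁≢0 prod s-C s≡ = go (gcd f₁ f₂ f₁≢0)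
    where
    go : (∃ λ g → ∃ λ x → ∃ λ y → (f₁ ≡ g * x) × (f₂ ≡ g * y) × (g ≢ 0ℤ) × Coprime x y) → Coprime f₁ f₂
    go (g , x , y , f₁≡ , f₂≡ , g≢0 , v , w , vx+wy≡1) = by-prime (coprime⇒∣ {g * g} {C} {p} (coprime-* {g} {C} {g} g-C g-C) (x * y , lin₃ (- 1ℤ) f₂ (g * x) prod f₁≡ f₂≡ (solve (p ∷ f₁ ∷ f₂ ∷ C ∷ g ∷ x ∷ y ∷ [])))) (prime g)
      where
      g-C : Coprime g C
      g-C = coprime-∣ {s} {C} {g} s-C (x + y , lin₃ 1ℤ 1ℤ 1ℤ s≡ f₁≡ f₂≡ (solve (s ∷ f₁ ∷ f₂ ∷ g ∷ x ∷ y ∷ [])))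
      by-prime : g * g ∣ p → p ∣ g ⊎ Coprime p g → Coprime f₁ f₂
      by-prime (r , p≡) (inj₁ (d , g≡)) = ⊥-elim (p∤1 (d * d * r , *-cancelˡ {p} p≢0 (lin₂ 1ℤ (r * (g + p * d)) p≡ g≡ (solve (p ∷ g ∷ r ∷ d ∷ [])))))
      by-prime (r , p≡) (inj₂ (i , j , e)) = scale (i * g * r + j) (lin₂ 1ℤ (- i) e p≡ (solve (p ∷ g ∷ i ∷ j ∷ r ∷ [])))
        where
        scale : ∀ u → g * u ≡ 1ℤ → Coprime f₁ f₂
        scale u gu≡1 = v * u , w * u , lin₃ (v * u) (w * u) 1ℤ f₁≡ f₂≡ gu≡1 (lin₁ (g * u) vx+wy≡1 (coprime-factors-ring₁ v u f₁ w f₂ g x y))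

  -- The outcome of factoring De² into coprime factors with sum s: up to a common sign they are U²
  -- and DV². The coprimality statements are kept for the next stage of the descent.
  SumForm : ℤ → ℤ → ℤ → Set
  SumForm D e s = ∃ λ U → ∃ λ V → (e ≡ U * V) × Coprime U V × Coprime U D × ((s ≡ U * U + D * (V * V)) ⊎ (- s ≡ U * U + D * (V * V)))

  unit-sign : ∀ {x y} → x * y ≡ 1ℤ → (x ≡ 1ℤ × y ≡ 1ℤ) ⊎ (x ≡ - 1ℤ × y ≡ - 1ℤ)
  unit-sign {x} {y} h = go x refl (ℕ.m*n≡1⇒m≡1 ∣ x ∣ ∣ y ∣ (trans (sym (ℤ.abs-* x y)) (cong ∣_∣ h)))
    where
    go : ∀ z → x ≡ z → ∣ z ∣ ≡ 1 → (x ≡ 1ℤ × y ≡ 1ℤ) ⊎ (x ≡ - 1ℤ × y ≡ - 1ℤ)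
    go (+ 1) x≡ _ = inj₁ (x≡ , lin₂ 1ℤ (- y) h x≡ (solve (x ∷ y ∷ [])))
    go -[1+ 0 ] x≡ _ = inj₂ (x≡ , lin₂ (- 1ℤ) y h x≡ (solve (x ∷ y ∷ [])))

  sum-form-ring₁ : ∀ s U D V f₁ f₂ d₁ d →
    s - (U * U + D * (V * V)) - (1ℤ * (s - (f₁ + f₂)) + 1ℤ * (f₁ - d₁ * (U * U)) + 1ℤ * (f₂ - D * d *
      (V * V)))
    ≡ U * U * (d₁ - 1ℤ) + D * (V * V) * (d - 1ℤ)
  sum-form-ring₁ = solve-∀

  sum-form-ring₂ : ∀ s U D V f₁ f₂ d₁ d →
    - s - (U * U + D * (V * V)) - (- 1ℤ * (s - (f₁ + f₂)) + - 1ℤ * (f₁ - d₁ * (U * U)) + - 1ℤ * (f₂ -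
      D * d * (V * V)))
    ≡ - (U * U) * (d₁ - - 1ℤ) + - (D * (V * V)) * (d - - 1ℤ)
  sum-form-ring₂ = solve-∀

  -- D is a power of the prime p, so it goes entirely to one of the coprime factors. The remaining
  -- coefficients have product 1 and are therefore equal signs.
  sum-form : ∀ {p f₁ f₂ D e s} → PrimeOr p → (∀ {x} → Coprime p x → Coprime D x) → D ≢ 0ℤ → e ≢ 0ℤ →
    f₁ * f₂ ≡ D * (e * e) → Coprime f₁ f₂ → s ≡ f₁ + f₂ → SumForm D e s
  sum-form {p} {f₁} {f₂} {D} {e} {s} prime power D≢0 e≢0 prod cop s≡ = split (square-split {f₁} {f₂} {D} {e} e≢0 prod cop)
    where
    finish : ∀ {f₁ f₂ d₁ d U V} → Coprime f₁ f₂ → e ≡ U * V → s ≡ f₁ + f₂ → f₁ ≡ d₁ * (U * U) → f₂ ≡ D * d * (V * V) → d₁ * d ≡ 1ℤ → SumForm D e s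
    finish {f₁} {f₂} {d₁} {d} {U} {V} cop e≡ s≡ f₁≡ f₂≡ unit = U , V , e≡ ,
      coprime-∣ʳ {U} {f₂} {V} U-f₂ (D * d * V , lin₁ 1ℤ f₂≡ (solve (f₂ ∷ D ∷ d ∷ V ∷ []))) ,
      coprime-∣ʳ {U} {f₂} {D} U-f₂ (d * (V * V) , lin₁ 1ℤ f₂≡ (solve (f₂ ∷ D ∷ d ∷ V ∷ []))) ,
      sign (unit-sign {d₁} {d} unit)
      where
      U-f₂ : Coprime U f₂
      U-f₂ = coprime-∣ {f₁} {f₂} {U} cop (d₁ * U , lin₁ 1ℤ f₁≡ (solve (f₁ ∷ d₁ ∷ U ∷ [])))
      sign : (d₁ ≡ 1ℤ × d ≡ 1ℤ) ⊎ (d₁ ≡ - 1ℤ × d ≡ - 1ℤ) → (s ≡ U * U + D * (V * V)) ⊎ (- s ≡ U * U + D * (V * V))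
      sign (inj₁ (a , b)) = inj₁ (lin₃ 1ℤ 1ℤ 1ℤ s≡ f₁≡ f₂≡ (lin₂ (U * U) (D * (V * V)) a b (sum-form-ring₁ s U D V f₁ f₂ d₁ d)))
      sign (inj₂ (a , b)) = inj₂ (lin₃ (- 1ℤ) (- 1ℤ) (- 1ℤ) s≡ f₁≡ f₂≡ (lin₂ (- (U * U)) (- (D * (V * V))) a b (sum-form-ring₂ s U D V f₁ f₂ d₁ d)))
    split : (∃ λ d₁ → ∃ λ d₂ → ∃ λ U → ∃ λ V → (f₁ ≡ d₁ * (U * U)) × (f₂ ≡ d₂ * (V * V)) × (d₁ * d₂ ≡ D) × (e ≡ U * V)) → SumForm D e s
    split (d₁ , d₂ , U , V , f₁≡ , f₂≡ , d₁d₂≡ , e≡) = by-prime (prime d₁)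
      where
      d₁-d₂ : Coprime d₁ d₂
      d₁-d₂ = coprime-∣ʳ {d₁} {f₂} {d₂} (coprime-∣ {f₁} {f₂} {d₁} cop (U * U , f₁≡)) (V * V , f₂≡)
      by-prime : p ∣ d₁ ⊎ Coprime p d₁ → SumForm D e s
      by-prime (inj₂ c) = from (coprime⇒∣ {D} {d₁} {d₂} (power c) (1ℤ , lin₁ 1ℤ d₁d₂≡ (solve (d₁ ∷ d₂ ∷ D ∷ []))))
        where
        from : D ∣ d₂ → SumForm D e s
        from (d , d₂≡) = finish {f₁} {f₂} {d₁} {d} {U} {V} cop e≡ s≡ f₁≡ (lin₂ 1ℤ (V * V) f₂≡ d₂≡ (solve (f₂ ∷ d₂ ∷ d ∷ D ∷ V ∷ [])))
          (*-cancelˡ {D} D≢0 (lin₂ 1ℤ (- d₁) d₁d₂≡ d₂≡ (solve (d₁ ∷ d₂ ∷ d ∷ D ∷ []))))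
      by-prime (inj₁ p∣d₁) = from (coprime⇒∣ {D} {d₂} {d₁} (power (coprime-∣ {d₁} {d₂} {p} d₁-d₂ p∣d₁)) (1ℤ , lin₁ 1ℤ d₁d₂≡ (solve (d₁ ∷ d₂ ∷ D ∷ []))))
        where
        from : D ∣ d₁ → SumForm D e s
        from (d , d₁≡) = finish {f₂} {f₁} {d₂} {d} {V} {U} (coprime-sym {f₁} {f₂} cop) (lin₁ 1ℤ e≡ (solve (e ∷ U ∷ V ∷ []))) (lin₁ 1ℤ s≡ (solve (s ∷ f₁ ∷ f₂ ∷ []))) f₂≡ (lin₂ 1ℤ (U * U) f₁≡ d₁≡ (solve (f₁ ∷ d₁ ∷ d ∷ D ∷ U ∷ [])))
          (*-cancelˡ {D} D≢0 (lin₂ 1ℤ (- d₂) d₁d₂≡ d₁≡ (solve (d₁ ∷ d₂ ∷ d ∷ D ∷ []))))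

  -- Among the divisors ±1, ±5 of 5 only 1 is congruent to 1 modulo 8.
  one-mod-8 : ∀ {k l w} → k * l ≡ + 5 → k ≡ 1ℤ + + 8 * w → k ≡ 1ℤ
  one-mod-8 {k} {l} {w} kl≡5 k≡ = go k refl (ℕ.∣⇒≤ (ℕ.divides ∣ l ∣ (trans (cong ∣_∣ (sym kl≡5)) (trans (ℤ.abs-* k l) (ℕ.*-comm ∣ k ∣ ∣ l ∣)))))
    where
    w∣ : ∀ c → k ≡ c → + 8 ∣ c - 1ℤ
    w∣ c e = w , lin₂ 1ℤ (- 1ℤ) k≡ e (solve (k ∷ c ∷ w ∷ []))
    go : ∀ z → k ≡ z → ∣ z ∣ ℕ.≤ 5 → k ≡ 1ℤ
    go (+ 0) e _ = absurd-∣ (+ 8) (+ 0 - 1ℤ) (w∣ (+ 0) e)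
    go (+ 1) e _ = e
    go (+ 2) e _ = absurd-∣ (+ 8) (+ 2 - 1ℤ) (w∣ (+ 2) e)
    go (+ 3) e _ = absurd-∣ (+ 8) (+ 3 - 1ℤ) (w∣ (+ 3) e)
    go (+ 4) e _ = absurd-∣ (+ 8) (+ 4 - 1ℤ) (w∣ (+ 4) e)
    go (+ 5) e _ = absurd-∣ (+ 8) (+ 5 - 1ℤ) (w∣ (+ 5) e)
    go (+ suc (suc (suc (suc (suc (suc _)))))) _ (ℕ.s≤s (ℕ.s≤s (ℕ.s≤s (ℕ.s≤s (ℕ.s≤s ())))))
    go -[1+ 0 ] e _ = absurd-∣ (+ 8) (-[1+ 0 ] - 1ℤ) (w∣ -[1+ 0 ] e)
    go -[1+ 1 ] e _ = absurd-∣ (+ 8) (-[1+ 1 ] - 1ℤ) (w∣ -[1+ 1 ] e)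
    go -[1+ 2 ] e _ = absurd-∣ (+ 8) (-[1+ 2 ] - 1ℤ) (w∣ -[1+ 2 ] e)
    go -[1+ 3 ] e _ = absurd-∣ (+ 8) (-[1+ 3 ] - 1ℤ) (w∣ -[1+ 3 ] e)
    go -[1+ 4 ] e _ = absurd-∣ (+ 8) (-[1+ 4 ] - 1ℤ) (w∣ -[1+ 4 ] e)
    go -[1+ suc (suc (suc (suc (suc _)))) ] _ (ℕ.s≤s (ℕ.s≤s (ℕ.s≤s (ℕ.s≤s (ℕ.s≤s ())))))

-- The descent step through the four-number decomposition.

module SevenB where

  open Gauss using (∣∣-sq)
  open IntTools
  open TenA using (parity)
  open TenB
  open Seven
  open import Data.Integer using (ℤ; +_; -[1+_]; _+_; _*_; -_; _-_; ∣_∣; 0ℤ; 1ℤ)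
  import Data.Integer as ℤ
  import Data.Integer.Properties as ℤ
  open import Data.Integer.Tactic.RingSolver using (solve; solve-∀)
  open import Data.Nat as ℕ using (ℕ; zero; suc)
  import Data.Nat.Properties as ℕ
  open import Data.Nat.Induction using (<-wellFounded)
  open import Induction.WellFounded using (Acc; acc)
  open import Data.Product using (∃; _×_; _,_; proj₁; proj₂)
  open import Data.Sum using (_⊎_; inj₁; inj₂)
  open import Data.Empty using (⊥; ⊥-elim)
  open import Data.List using (_∷_; [])
  open import Relation.Nullary using (¬_; Dec; yes; no; contradiction)
  open import Relation.Binary.PropositionalEquality

  FourNumbers : ℤ → ℤ → ℤ → ℤ → Set
  FourNumbers u v p q = ∃ λ a → ∃ λ b → ∃ λ c → ∃ λ d →
    (u ≡ a * c) × (v ≡ b * d) × (p ≡ a * b) × (q ≡ c * d) × Coprime b c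

  -- The decomposition of UV = PQ together with a new pair of equations, which amount to `System`
  -- for (C, B, D, A) and for (2C, B, 2D, A) respectively.
  OddStep EvenStep : ℤ → ℤ → ℤ → ℤ → Set
  OddStep U V P Q = ∃ λ A → ∃ λ B → ∃ λ C → ∃ λ D → (U ≡ A * C) × (V ≡ B * D) × (P ≡ A * B) × (Q ≡ C * D) × Coprime C B ×
    (+ 4 * (B * B) ≡ + 3 * (C * C) + D * D) × (+ 9 * (B * B) ≡ + 8 * (C * C) + A * A)
  EvenStep U V P Q = ∃ λ A → ∃ λ B → ∃ λ C → ∃ λ D → (U ≡ A * C) × (V ≡ B * D) × (P ≡ A * B) × (Q ≡ C * D) × Coprime C B ×
    (B * B ≡ + 3 * (C * C) + D * D) × (+ 9 * (B * B) ≡ + 32 * (C * C) + A * A) × Oddᶻ B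

  factor-coprime : ∀ {U V A B C D} → Coprime U V → U ≡ A * C → V ≡ B * D → Coprime (D * D) (A * A)
  factor-coprime {U} {V} {A} {B} {C} {D} cop hU hV = coprime-* {D} {A * A} {D} D-AA D-AA
    where
    D-A : Coprime D A
    D-A = coprime-sym {A} {D} (coprime-∣ʳ {A} {V} {D} (coprime-∣ {U} {V} {A} cop (C , hU)) (B , lin₁ 1ℤ hV (solve (V ∷ B ∷ D ∷ []))))
    D-AA : Coprime D (A * A)
    D-AA = coprime-*ʳ {D} {A} {A} D-A D-A

  coprime-squares : ∀ {B C} → Coprime B C → Coprime (C * C) (B * B)
  coprime-squares {B} {C} c = coprime-* {C} {B * B} {C} C-BB C-BB
    where
    C-BB : Coprime C (B * B)
    C-BB = coprime-*ʳ {C} {B} {B} (coprime-sym {B} {C} c) (coprime-sym {B} {C} c)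

  odd-descent-ring₁ : ∀ A B C D U V P Q →
    A * A * (+ 4 * (B * B) - + 3 * (C * C)) - D * D * (+ 9 * (B * B) - + 8 * (C * C)) - (- 1ℤ * (+ 3 *
      (U * U + + 3 * (V * V)) - + 4 * (P * P + + 2 * (Q * Q))) + + 3 * (U + A * C) * (U - A * C) + + 9
      * (V + B * D) * (V - B * D))
    ≡ - (+ 4 * (P + A * B)) * (P - A * B) + - (+ 8 * (Q + C * D)) * (Q - C * D)
  odd-descent-ring₁ = solve-∀

  odd-descent-ring₂ : ∀ D B C A k →
    D * D * (+ 9 * (B * B) - + 8 * (C * C)) - D * D * (A * A * k)
    ≡ - 1ℤ * (A * A * (+ 4 * (B * B) - + 3 * (C * C)) - D * D * (+ 9 * (B * B) - + 8 * (C * C))) + A *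
      A * (+ 4 * (B * B) - + 3 * (C * C) - D * D * k)
  odd-descent-ring₂ = solve-∀

  odd-descent-ring₃ : ∀ k s D A t C B →
    k * (s * (+ 9 * (D * D) - + 4 * (A * A)) + t * (+ 8 * (D * D) - + 3 * (A * A))) - + 5
    ≡ + 5 * (s * (C * C) + t * (B * B) - 1ℤ) + - (+ 9 * s + + 8 * t) * (+ 4 * (B * B) - + 3 * (C * C)
      - D * D * k) + (+ 4 * s + + 3 * t) * (+ 9 * (B * B) - + 8 * (C * C) - A * A * k)
  odd-descent-ring₃ = solve-∀

  odd-descent-ring₄ : ∀ k y z x B C D →
    k - (1ℤ + + 8 * (+ 4 * y - + 3 * z - k * x)) - (- 1ℤ * (+ 4 * (B * B) - + 3 * (C * C) - D * D * k)
      + + 4 * (B * B - (1ℤ + + 8 * y)) + - (+ 3) * (C * C - (1ℤ + + 8 * z)))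
    ≡ - k * (D * D - (1ℤ + + 8 * x))
  odd-descent-ring₄ = solve-∀

  odd-descent-ring₅ : ∀ B C D k →
    + 4 * (B * B) - (+ 3 * (C * C) + D * D)
    ≡ 1ℤ * (+ 4 * (B * B) - + 3 * (C * C) - D * D * k) + D * D * (k - 1ℤ)
  odd-descent-ring₅ = solve-∀

  odd-descent-ring₆ : ∀ B C A k →
    + 9 * (B * B) - (+ 8 * (C * C) + A * A)
    ≡ 1ℤ * (+ 9 * (B * B) - + 8 * (C * C) - A * A * k) + A * A * (k - 1ℤ)
  odd-descent-ring₆ = solve-∀

  -- With U = AC, V = BD, P = AB, Q = CD the relation reads A²(4B² - 3C²) = D²(9B² - 8C²). As A and
  -- D are coprime, 4B² - 3C² = kD² and 9B² - 8C² = kA². The determinant 4 · 8 - 3 · 9 = 5 and the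
  -- coprimality of B and C give k ∣ 5, and all squares being 1 modulo 8, k ≡ 4 - 3 = 1.
  odd-descent : ∀ {U V P Q n} → U * V ≡ P * Q → U * V ≡ 1ℤ + + 2 * n → Coprime U V → + 3 * (U * U + + 3 * (V * V)) ≡ + 4 * (P * P + + 2 * (Q * Q)) → OddStep U V P Q
  odd-descent {U} {V} {P} {Q} {n} UV≡PQ UV-odd cop rel = go (four-numbers {U} {V} {P} {Q} U≢0 UV≡PQ)
    where
    U≢0 : U ≢ 0ℤ
    U≢0 z = absurd-∣ (+ 2) 1ℤ (- n , lin₂ (- 1ℤ) V UV-odd z (solve (U ∷ V ∷ n ∷ [])))
    go : FourNumbers U V P Q → OddStep U V P Q
    go (A , B , C , D , hU , hV , hP , hQ , B-C) = with-odd (odd-factors {A * C} {B * D} {n} (lin₃ 1ℤ (- V) (- (A * C)) UV-odd hU hV (solve (U ∷ V ∷ A ∷ B ∷ C ∷ D ∷ n ∷ []))))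
      where
      rel′ : A * A * (+ 4 * (B * B) - + 3 * (C * C)) ≡ D * D * (+ 9 * (B * B) - + 8 * (C * C))
      rel′ = lin₃ (- 1ℤ) (+ 3 * (U + A * C)) (+ 9 * (V + B * D)) rel hU hV (lin₂ (- (+ 4 * (P + A * B))) (- (+ 8 * (Q + C * D))) hP hQ (odd-descent-ring₁ A B C D U V P Q))
      with-odd : Oddᶻ (A * C) × Oddᶻ (B * D) → OddStep U V P Q
      with-odd ((n₁ , AC-odd) , (n₂ , BD-odd)) = with-squares (odd-square (proj₁ (odd-factors {B} {D} {n₂} BD-odd))) (odd-square (proj₂ (odd-factors {A} {C} {n₁} AC-odd))) (odd-square (proj₂ (odd-factors {B} {D} {n₂} BD-odd)))
          (coprime⇒∣ {D * D} {A * A} {+ 4 * (B * B) - + 3 * (C * C)} (factor-coprime {U} {V} {A} {B} {C} {D} cop hU hV) (+ 9 * (B * B) - + 8 * (C * C) , rel′))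
        where
        D≢0 : D ≢ 0ℤ
        D≢0 z = absurd-∣ (+ 2) 1ℤ (- n₂ , lin₂ (- 1ℤ) B BD-odd z (solve (B ∷ D ∷ n₂ ∷ [])))
        with-squares : (∃ λ y → B * B ≡ 1ℤ + + 8 * y) → (∃ λ z → C * C ≡ 1ℤ + + 8 * z) → (∃ λ x → D * D ≡ 1ℤ + + 8 * x) → D * D ∣ + 4 * (B * B) - + 3 * (C * C) → OddStep U V P Q
        with-squares (y , hB) (z , hC) (x , hD) (k , e) = with-bezout (coprime-squares {B} {C} B-C)
          where
          e′ : + 9 * (B * B) - + 8 * (C * C) ≡ A * A * k
          e′ = *-cancelˡ {D * D} (*-≢0 D≢0 D≢0) (lin₂ (- 1ℤ) (A * A) rel′ e (odd-descent-ring₂ D B C A k))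
          with-bezout : Coprime (C * C) (B * B) → OddStep U V P Q
          with-bezout (s , t , bz) = finish (one-mod-8 {k} {s * (+ 9 * (D * D) - + 4 * (A * A)) + t * (+ 8 * (D * D) - + 3 * (A * A))} {+ 4 * y - + 3 * z - k * x}
              (lin₃ (+ 5) (- (+ 9 * s + + 8 * t)) (+ 4 * s + + 3 * t) bz e e′ (odd-descent-ring₃ k s D A t C B))
              (lin₃ (- 1ℤ) (+ 4) (- + 3) e hB hC (lin₁ (- k) hD (odd-descent-ring₄ k y z x B C D))))
            where
            finish : k ≡ 1ℤ → OddStep U V P Q
            finish k≡1 = A , B , C , D , hU , hV , hP , hQ , coprime-sym {B} {C} B-C ,
              lin₂ 1ℤ (D * D) e k≡1 (odd-descent-ring₅ B C D k) , lin₂ 1ℤ (A * A) e′ k≡1 (odd-descent-ring₆ B C A k)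

  even-descent-ring₁ : ∀ A B C D U V P Q →
    A * A * (B * B - + 3 * (C * C)) - D * D * (+ 9 * (B * B) - + 32 * (C * C)) - (- 1ℤ * (+ 3 * (U * U
      + + 3 * (V * V)) - (P * P + + 32 * (Q * Q))) + + 3 * (U + A * C) * (U - A * C) + + 9 * (V + B *
      D) * (V - B * D))
    ≡ - (P + A * B) * (P - A * B) + - (+ 32 * (Q + C * D)) * (Q - C * D)
  even-descent-ring₁ = solve-∀

  even-descent-ring₂ : ∀ D B C A k →
    D * D * (+ 9 * (B * B) - + 32 * (C * C)) - D * D * (A * A * k)
    ≡ - 1ℤ * (A * A * (B * B - + 3 * (C * C)) - D * D * (+ 9 * (B * B) - + 32 * (C * C))) + A * A * (B
      * B - + 3 * (C * C) - D * D * k)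
  even-descent-ring₂ = solve-∀

  even-descent-ring₃ : ∀ k s D A t C B →
    k * (s * (+ 9 * (D * D) - A * A) + t * (+ 32 * (D * D) - + 3 * (A * A))) - + 5
    ≡ + 5 * (s * (C * C) + t * (B * B) - 1ℤ) + - (+ 9 * s + + 32 * t) * (B * B - + 3 * (C * C) - D * D
      * k) + (s + + 3 * t) * (+ 9 * (B * B) - + 32 * (C * C) - A * A * k)
  even-descent-ring₃ = solve-∀

  even-descent-ring₄ : ∀ k y C x B A →
    k - (1ℤ + + 8 * (1ℤ + + 9 * y - + 4 * (C * C) - k * x))
    ≡ - 1ℤ * (+ 9 * (B * B) - + 32 * (C * C) - A * A * k) + + 9 * (B * B - (1ℤ + + 8 * y)) + - k * (A
      * A - (1ℤ + + 8 * x))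
  even-descent-ring₄ = solve-∀

  even-descent-ring₅ : ∀ B C D k →
    B * B - (+ 3 * (C * C) + D * D)
    ≡ 1ℤ * (B * B - + 3 * (C * C) - D * D * k) + D * D * (k - 1ℤ)
  even-descent-ring₅ = solve-∀

  even-descent-ring₆ : ∀ B C A k →
    + 9 * (B * B) - (+ 32 * (C * C) + A * A)
    ≡ 1ℤ * (+ 9 * (B * B) - + 32 * (C * C) - A * A * k) + A * A * (k - 1ℤ)
  even-descent-ring₆ = solve-∀

  -- Now A²(B² - 3C²) = D²(9B² - 32C²). The determinant 32 - 27 is again 5, and the second equation
  -- gives k ≡ 9 ≡ 1 modulo 8 because A and B are odd.
  even-descent : ∀ {U V P Q n} → U ≢ 0ℤ → V ≢ 0ℤ → U * V ≡ P * Q → P * P + + 32 * (Q * Q) ≡ 1ℤ + + 2 * n → Coprime U V → + 3 * (U * U + + 3 * (V * V)) ≡ P * P + + 32 * (Q * Q) → EvenStep U V P Q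
  even-descent {U} {V} {P} {Q} {n} U≢0 V≢0 UV≡PQ odd cop rel = go (four-numbers {U} {V} {P} {Q} U≢0 UV≡PQ)
    where
    PP-odd : P * P ≡ 1ℤ + + 2 * (n - + 16 * (Q * Q))
    PP-odd = lin₁ 1ℤ odd (solve (P ∷ Q ∷ n ∷ []))
    go : FourNumbers U V P Q → EvenStep U V P Q
    go (A , B , C , D , hU , hV , hP , hQ , B-C) = with-odd (proj₁ (odd-factors {P} {P} {n - + 16 * (Q * Q)} PP-odd))
      where
      rel′ : A * A * (B * B - + 3 * (C * C)) ≡ D * D * (+ 9 * (B * B) - + 32 * (C * C))
      rel′ = lin₃ (- 1ℤ) (+ 3 * (U + A * C)) (+ 9 * (V + B * D)) rel hU hV (lin₂ (- (P + A * B)) (- (+ 32 * (Q + C * D))) hP hQ (even-descent-ring₁ A B C D U V P Q))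
      D≢0 : D ≢ 0ℤ
      D≢0 = *≢0ʳ {B} {D} (λ z → V≢0 (trans hV z))
      with-odd : Oddᶻ P → EvenStep U V P Q
      with-odd (n₁ , P-odd) = with-factors (odd-factors {A} {B} {n₁} (lin₂ 1ℤ (- 1ℤ) P-odd hP (solve (P ∷ A ∷ B ∷ n₁ ∷ []))))
        where
        with-factors : Oddᶻ A × Oddᶻ B → EvenStep U V P Q
        with-factors (A-odd , B-odd) = with-squares (odd-square A-odd) (odd-square B-odd)
            (coprime⇒∣ {D * D} {A * A} {B * B - + 3 * (C * C)} (factor-coprime {U} {V} {A} {B} {C} {D} cop hU hV) (+ 9 * (B * B) - + 32 * (C * C) , rel′))
          where
          with-squares : (∃ λ x → A * A ≡ 1ℤ + + 8 * x) → (∃ λ y → B * B ≡ 1ℤ + + 8 * y) → D * D ∣ B * B - + 3 * (C * C) → EvenStep U V P Q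
          with-squares (x , hA) (y , hB) (k , e) = with-bezout (coprime-squares {B} {C} B-C)
            where
            e′ : + 9 * (B * B) - + 32 * (C * C) ≡ A * A * k
            e′ = *-cancelˡ {D * D} (*-≢0 D≢0 D≢0) (lin₂ (- 1ℤ) (A * A) rel′ e (even-descent-ring₂ D B C A k))
            with-bezout : Coprime (C * C) (B * B) → EvenStep U V P Q
            with-bezout (s , t , bz) = finish (one-mod-8 {k} {s * (+ 9 * (D * D) - A * A) + t * (+ 32 * (D * D) - + 3 * (A * A))} {1ℤ + + 9 * y - + 4 * (C * C) - k * x}
                (lin₃ (+ 5) (- (+ 9 * s + + 32 * t)) (s + + 3 * t) bz e e′ (even-descent-ring₃ k s D A t C B))
                (lin₃ (- 1ℤ) (+ 9) (- k) e′ hB hA (even-descent-ring₄ k y C x B A)))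
              where
              finish : k ≡ 1ℤ → EvenStep U V P Q
              finish k≡1 = A , B , C , D , hU , hV , hP , hQ , coprime-sym {B} {C} B-C ,
                lin₂ 1ℤ (D * D) e k≡1 (even-descent-ring₅ B C D k) , lin₂ 1ℤ (A * A) e′ k≡1 (even-descent-ring₆ B C A k) , B-odd

  -- What remains of c = x₀², c + a = x₁², c + 4a = x₂², c + 9a = x₃² when c and a are eliminated.
  System : ℤ → ℤ → ℤ → ℤ → Set
  System x₀ x₁ x₂ x₃ = Coprime x₀ x₁ × (+ 4 * (x₁ * x₁) ≡ + 3 * (x₀ * x₀) + x₂ * x₂) × (+ 9 * (x₁ * x₁) ≡ + 8 * (x₀ * x₀) + x₃ * x₃)

  3∤1 : ¬ (+ 3 ∣ 1ℤ)
  3∤1 = ∤-literal (+ 3) 1ℤ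

  2∤1 : ¬ (+ 2 ∣ 1ℤ)
  2∤1 = ∤-literal (+ 2) 1ℤ

  -- Neither form takes negative values, so opposite signs would make a sum of nonnegative terms
  -- vanish, against U ≠ 0.
  same-sign : ∀ a b c d {s U V P Q} → (s ≡ U * U + + a * (V * V)) ⊎ (- s ≡ U * U + + a * (V * V)) → (+ suc d * s ≡ + c * (P * P + + b * (Q * Q))) ⊎ (- (+ suc d * s) ≡ + c * (P * P + + b * (Q * Q))) → U ≢ 0ℤ →
    + suc d * (U * U + + a * (V * V)) ≡ + c * (P * P + + b * (Q * Q))
  same-sign a b c d (inj₁ h) (inj₁ h′) _ = trans (cong (+ suc d *_) (sym h)) h′
  same-sign a b c d {s} (inj₂ h) (inj₂ h′) _ = trans (cong (+ suc d *_) (sym h)) (trans (l (+ suc d) s) h′)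
    where
    l : ∀ d s → d * - s ≡ - (d * s)
    l = solve-∀
  same-sign a b c d {s} {U} {V} {P} {Q} (inj₁ h) (inj₂ h′) U≢0 = ⊥-elim (U≢0 (sum-of-squares-zero d (suc d ℕ.* a) c (c ℕ.* b) {U} {V} {P} {Q} total))
    where
    total : + suc d * (U * U) + + (suc d ℕ.* a) * (V * V) + + c * (P * P) + + (c ℕ.* b) * (Q * Q) ≡ 0ℤ
    total = trans (cong₂ (λ x y → + suc d * (U * U) + x * (V * V) + + c * (P * P) + y * (Q * Q)) (ℤ.pos-* (suc d) a) (ℤ.pos-* c b)) (l (+ suc d) (+ a) (+ c) (+ b) h h′)
      where
      l : ∀ d a c b → s ≡ U * U + a * (V * V) → - (d * s) ≡ c * (P * P + b * (Q * Q)) → d * (U * U) + d * a * (V * V) + c * (P * P) + c * b * (Q * Q) ≡ 0ℤ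
      l d a c b h h′ = lin₂ (- d) (- 1ℤ) h h′ (solve (d ∷ a ∷ c ∷ b ∷ s ∷ U ∷ V ∷ P ∷ Q ∷ []))
  same-sign a b c d {s} {U} {V} {P} {Q} (inj₂ h) (inj₁ h′) U≢0 = ⊥-elim (U≢0 (sum-of-squares-zero d (suc d ℕ.* a) c (c ℕ.* b) {U} {V} {P} {Q} total))
    where
    total : + suc d * (U * U) + + (suc d ℕ.* a) * (V * V) + + c * (P * P) + + (c ℕ.* b) * (Q * Q) ≡ 0ℤ
    total = trans (cong₂ (λ x y → + suc d * (U * U) + x * (V * V) + + c * (P * P) + y * (Q * Q)) (ℤ.pos-* (suc d) a) (ℤ.pos-* c b)) (l (+ suc d) (+ a) (+ c) (+ b) h h′)
      where
      l : ∀ d a c b → - s ≡ U * U + a * (V * V) → d * s ≡ c * (P * P + b * (Q * Q)) → d * (U * U) + d * a * (V * V) + c * (P * P) + c * b * (Q * Q) ≡ 0ℤ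
      l d a c b h h′ = lin₂ (- d) (- 1ℤ) h h′ (solve (d ∷ a ∷ c ∷ b ∷ s ∷ U ∷ V ∷ P ∷ Q ∷ []))

-- Fermat descent for four squares c, c + a, c + 4a, c + 9a.

module SevenC where

  open IntTools
  open TenA using (parity)
  open TenB
  open Seven
  open SevenB
  open import Data.Integer using (ℤ; +_; -[1+_]; _+_; _*_; -_; _-_; ∣_∣; 0ℤ; 1ℤ)
  import Data.Integer as ℤ
  import Data.Integer.Properties as ℤ
  open import Data.Integer.Tactic.RingSolver using (solve; solve-∀)
  open import Data.Nat as ℕ using (ℕ; zero; suc)
  import Data.Nat.Properties as ℕ
  open import Data.Nat.Induction using (<-wellFounded)
  open import Induction.WellFounded using (Acc; acc)
  open import Data.Product using (∃; _×_; _,_; proj₁; proj₂)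
  open import Data.Sum using (_⊎_; inj₁; inj₂)
  open import Data.Empty using (⊥; ⊥-elim)
  open import Data.List using (_∷_; [])
  open import Relation.Nullary using (¬_; Dec; yes; no; contradiction)
  open import Relation.Binary.PropositionalEquality

  proper-factor : ∀ {y C m} → y ≡ C * m → y ≢ 0ℤ → ∣ m ∣ ≢ 1 → ∣ C ∣ ℕ.< ∣ y ∣
  proper-factor {y} {C} {m} h y≢0 m≢1 = subst (∣ C ∣ ℕ.<_) (sym (trans (cong ∣_∣ h) (ℤ.abs-* C m)))
    (ℕ.m<m*n ∣ C ∣ ∣ m ∣ {{ℕ.≢-nonZero λ z → *≢0ˡ {C} {m} (λ e → y≢0 (trans h e)) (ℤ.∣i∣≡0⇒i≡0 z)}}
      (ℕ.≤∧≢⇒< (ℕ.n≢0⇒n>0 λ z → *≢0ʳ {C} {m} (λ e → y≢0 (trans h e)) (ℤ.∣i∣≡0⇒i≡0 z)) (λ e → m≢1 (sym e))))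

  coprime-equal-squares : ∀ {C B} → Coprime C B → C * C ≡ B * B → C * C ≡ 1ℤ
  coprime-equal-squares {C} {B} cop h = go (coprime⇒∣ {C} {B} {B} cop (C , sym h))
    where
    go : C ∣ B → C * C ≡ 1ℤ
    go (r , e) = from cop
      where
      from : Coprime C B → C * C ≡ 1ℤ
      from (s , t , bz) = unit-square {C} {s + t * r} {1ℤ} (lin₂ 1ℤ (- t) bz e (solve (C ∷ B ∷ r ∷ s ∷ t ∷ []))) refl

  -- The induction hypothesis of the descent on the absolute value of the first entry.
  Conclusion : ℤ → Set
  Conclusion y = ∀ x₀ x₁ x₂ x₃ → System x₀ x₁ x₂ x₃ → x₀ ≢ 0ℤ → ∣ x₀ ∣ ℕ.< ∣ y ∣ → x₀ * x₀ ≡ x₁ * x₁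

  -- Either C is smaller than y, and the induction hypothesis together with coprimality gives B² =
  -- C² = 1; or the cofactor is a unit, so that B and D are units too, and the first equation gives
  -- C² = 1.
  endgame : ∀ {y X A B C D} → y ≢ 0ℤ → Conclusion y → y ≡ C * (X * B * D) → Coprime C B →
    + 4 * (B * B) ≡ + 3 * (C * C) + D * D → + 9 * (B * B) ≡ + 8 * (C * C) + A * A → (A * A ≡ 1ℤ) × (B * B ≡ 1ℤ) × (C * C ≡ 1ℤ) × (D * D ≡ 1ℤ)
  endgame {y} {X} {A} {B} {C} {D} y≢0 rec y≡ cop h₄ h₉ = go (∣ X * B * D ∣ ℕ.≟ 1)
    where
    finish : B * B ≡ 1ℤ → C * C ≡ 1ℤ → (A * A ≡ 1ℤ) × (B * B ≡ 1ℤ) × (C * C ≡ 1ℤ) × (D * D ≡ 1ℤ)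
    finish hB hC = lin₃ (- 1ℤ) (+ 9) (- + 8) h₉ hB hC (solve (A ∷ B ∷ C ∷ [])) , hB , hC , lin₃ (- 1ℤ) (+ 4) (- + 3) h₄ hB hC (solve (B ∷ C ∷ D ∷ []))
    go : Dec (∣ X * B * D ∣ ≡ 1) → (A * A ≡ 1ℤ) × (B * B ≡ 1ℤ) × (C * C ≡ 1ℤ) × (D * D ≡ 1ℤ)
    go (no m≢1) = from-rec (rec C B D A (cop , h₄ , h₉) (*≢0ˡ {C} {X * B * D} (λ e → y≢0 (trans y≡ e))) (proper-factor {y} {C} {X * B * D} y≡ y≢0 m≢1))
      where
      from-rec : C * C ≡ B * B → (A * A ≡ 1ℤ) × (B * B ≡ 1ℤ) × (C * C ≡ 1ℤ) × (D * D ≡ 1ℤ)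
      from-rec e = finish (trans (sym e) (coprime-equal-squares {C} {B} cop e)) (coprime-equal-squares {C} {B} cop e)
    go (yes m≡1) = from-units (unit-square {B} {X * D} {X * B * D} (solve (X ∷ B ∷ D ∷ [])) m≡1) (unit-square {D} {X * B} {X * B * D} (solve (X ∷ B ∷ D ∷ [])) m≡1)
      where
      from-units : B * B ≡ 1ℤ → D * D ≡ 1ℤ → (A * A ≡ 1ℤ) × (B * B ≡ 1ℤ) × (C * C ≡ 1ℤ) × (D * D ≡ 1ℤ)
      from-units hB hD = finish hB (*-cancelˡ {+ 3} (λ ()) (lin₃ (- 1ℤ) (+ 4) (- 1ℤ) h₄ hB hD (solve (B ∷ C ∷ D ∷ []))))

  scale-sign : ∀ c {s X} → (s ≡ X) ⊎ (- s ≡ X) → (c * s ≡ c * X) ⊎ (- (c * s) ≡ c * X)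
  scale-sign c (inj₁ h) = inj₁ (cong (c *_) h)
  scale-sign c {s} (inj₂ h) = inj₂ (trans (l c s) (cong (c *_) h))
    where
    l : ∀ c s → - (c * s) ≡ c * - s
    l = solve-∀

  odd-sign : ∀ {s X} → Oddᶻ s → (s ≡ X) ⊎ (- s ≡ X) → Oddᶻ X
  odd-sign {s} {X} (q , e) (inj₁ h) = q , lin₂ (- 1ℤ) 1ℤ h e (solve (s ∷ X ∷ q ∷ []))
  odd-sign {s} {X} (q , e) (inj₂ h) = - 1ℤ - q , lin₂ (- 1ℤ) (- 1ℤ) h e (solve (s ∷ X ∷ q ∷ []))

  odd-if : ∀ {x} → ((∃ λ q → x ≡ + 2 * q) → ⊥) → Oddᶻ x
  odd-if {x} not-even = go (parity x)
    where
    go : Parity x → Oddᶻ x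
    go (inj₁ e) = ⊥-elim (not-even e)
    go (inj₂ o) = o

  odd-case-ring₁ : ∀ b i c y₁ y₀ y₂ →
    + 3 - + 2 * (+ 8 * b * b - + 12 * i - + 2 * c * c) - (- 1ℤ * (+ 4 * (y₁ * y₁) - (+ 3 * (y₀ * y₀) +
      y₂ * y₂)) + + 4 * (y₁ + + 2 * b) * (y₁ - + 2 * b) + - (y₂ + + 2 * c) * (y₂ - + 2 * c))
    ≡ - (+ 3) * (y₀ * y₀ - (1ℤ + + 8 * i))
  odd-case-ring₁ = solve-∀

  odd-case-ring₂ : ∀ b i j y₁ y₀ y₂ →
    + 4 - + 8 * (+ 2 * b * b - + 3 * i - j) - (- 1ℤ * (+ 4 * (y₁ * y₁) - (+ 3 * (y₀ * y₀) + y₂ * y₂))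
      + + 4 * (y₁ + + 2 * b) * (y₁ - + 2 * b) + - 1ℤ * (y₂ * y₂ - (1ℤ + + 8 * j)))
    ≡ - (+ 3) * (y₀ * y₀ - (1ℤ + + 8 * i))
  odd-case-ring₂ = solve-∀

  odd-case-ring₃ : ∀ y₀ c b y₁ y₃ →
    + 9 - + 2 * (+ 4 * (y₀ * y₀) + + 2 * c * c - + 18 * b - + 18 * b * b)
    ≡ 1ℤ * (+ 9 * (y₁ * y₁) - (+ 8 * (y₀ * y₀) + y₃ * y₃)) + - (+ 9 * (y₁ + 1ℤ + + 2 * b)) * (y₁ - (1ℤ
      + + 2 * b)) + (y₃ + + 2 * c) * (y₃ - + 2 * c)
  odd-case-ring₃ = solve-∀

  odd-case-ring₄ : ∀ b d y₀ y₁ y₃ →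
    + 4 * ((1ℤ + + 3 * b - d) * (+ 2 + + 3 * b + d)) - + 4 * (+ 2 * (y₀ * y₀))
    ≡ 1ℤ * (+ 9 * (y₁ * y₁) - (+ 8 * (y₀ * y₀) + y₃ * y₃)) + - (+ 9 * (y₁ + 1ℤ + + 2 * b)) * (y₁ - (1ℤ
      + + 2 * b)) + (y₃ + 1ℤ + + 2 * d) * (y₃ - (1ℤ + + 2 * d))
  odd-case-ring₄ = solve-∀

  odd-case-ring₅ : ∀ y₀ C A B D U V →
    y₀ - C * (A * B * D)
    ≡ 1ℤ * (y₀ - U * V) + V * (U - A * C) + A * C * (V - B * D)
  odd-case-ring₅ = solve-∀

  odd-case-ring₆ : ∀ U A C →
    U * U - 1ℤ
    ≡ (U + A * C) * (U - A * C) + C * C * (A * A - 1ℤ) + 1ℤ * (C * C - 1ℤ)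
  odd-case-ring₆ = solve-∀

  odd-case-ring₇ : ∀ y₁ U V →
    + 4 * (y₁ * y₁) - + 4 * 1ℤ
    ≡ (y₁ + 1ℤ) * (+ 4 * y₁ - (U * U + + 3 * (V * V))) + (y₁ + 1ℤ) * (U * U - 1ℤ) + + 3 * (y₁ + 1ℤ) *
      (V * V - 1ℤ)
  odd-case-ring₇ = solve-∀

  odd-case-ring₈ : ∀ y₁ U V →
    + 4 * (y₁ * y₁) - + 4 * 1ℤ
    ≡ (1ℤ - y₁) * (- (+ 4 * y₁) - (U * U + + 3 * (V * V))) + (1ℤ - y₁) * (U * U - 1ℤ) + + 3 * (1ℤ -
      y₁) * (V * V - 1ℤ)
  odd-case-ring₈ = solve-∀

  odd-case-ring₉ : ∀ y₃ y₁ y₀ z →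
    y₃ * y₃ - + 3 * (+ 3 * (y₁ * y₁) - + 8 * y₀ * z)
    ≡ - 1ℤ * (+ 9 * (y₁ * y₁) - (+ 8 * (y₀ * y₀) + y₃ * y₃)) + - (+ 8 * y₀) * (y₀ - + 3 * z)
  odd-case-ring₉ = solve-∀

  odd-case-ring₁₀ : ∀ z c b y₁ t →
    1ℤ - + 2 * (+ 4 * (z * z) + + 2 * (c * c) - + 2 * b - + 2 * b * b)
    ≡ 1ℤ * (y₁ * y₁ - (+ 8 * (z * z) + t * t)) + - (y₁ + 1ℤ + + 2 * b) * (y₁ - (1ℤ + + 2 * b)) + (t +
      + 2 * c) * (t - + 2 * c)
  odd-case-ring₁₀ = solve-∀

  odd-case-ring₁₁ : ∀ y₁ z t y₀ y₃ →
    + 9 * (y₁ * y₁) - + 9 * (+ 8 * (z * z) + t * t)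
    ≡ 1ℤ * (+ 9 * (y₁ * y₁) - (+ 8 * (y₀ * y₀) + y₃ * y₃)) + + 8 * (y₀ + + 3 * z) * (y₀ - + 3 * z) +
      (y₃ + + 3 * t) * (y₃ - + 3 * t)
  odd-case-ring₁₁ = solve-∀

  odd-case-ring₁₂ : ∀ b d z y₁ t →
    + 4 * ((b - d) * (1ℤ + b + d)) - + 4 * (+ 2 * (z * z))
    ≡ 1ℤ * (y₁ * y₁ - (+ 8 * (z * z) + t * t)) + - (y₁ + 1ℤ + + 2 * b) * (y₁ - (1ℤ + + 2 * b)) + (t
      + 1ℤ + + 2 * d) * (t - (1ℤ + + 2 * d))
  odd-case-ring₁₂ = solve-∀

  odd-case-ring₁₃ : ∀ V′ U P Q z →
    + 9 * V′ * U - + 3 * P * (+ 3 * Q)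
    ≡ + 9 * (z - P * Q) + - (+ 9) * (z - U * V′)
  odd-case-ring₁₃ = solve-∀

  odd-case-ring₁₄ : ∀ V′ U a z y₀ →
    + 9 * V′ * U - (1ℤ + + 2 * (+ 4 + + 9 * (a - z)))
    ≡ - (+ 9) * (z - U * V′) + + 9 * (y₀ - (1ℤ + + 2 * a)) + - (+ 9) * (y₀ - + 3 * z)
  odd-case-ring₁₄ = solve-∀

  odd-case-ring₁₅ : ∀ V′ U P Q V →
    + 3 * (+ 9 * V′ * (+ 9 * V′) + + 3 * (U * U)) - + 4 * (+ 3 * P * (+ 3 * P) + + 2 * (+ 3 * Q * (+ 3
      * Q)))
    ≡ + 9 * (+ 1 * (U * U + + 3 * (V * V)) - + 4 * (P * P + + 2 * (Q * Q))) + - (+ 27 * (V + + 3 *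
      V′)) * (V - + 3 * V′)
  odd-case-ring₁₅ = solve-∀

  odd-case-ring₁₆ : ∀ z U V′ y₀ V →
    + 3 * z - + 3 * (U * V′)
    ≡ - 1ℤ * (y₀ - + 3 * z) + 1ℤ * (y₀ - U * V) + U * (V - + 3 * V′)
  odd-case-ring₁₆ = solve-∀

  odd-case-ring₁₇ : ∀ y₀ C A′ B D z U V′ A →
    + 3 * y₀ - + 3 * (C * (A′ * B * D)) - (+ 3 * (y₀ - + 3 * z) + + 9 * (z - U * V′) + U * (+ 9 * V′ -
      A * C))
    ≡ A * C * (U - B * D) + C * B * D * (A - + 3 * A′)
  odd-case-ring₁₇ = solve-∀

  odd-case-ring₁₈ : ∀ A A′ → 1ℤ - + 3 * (A * A′) ≡ - 1ℤ * (A * A - 1ℤ) + A * (A - + 3 * A′)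
  odd-case-ring₁₈ = solve-∀

  -- From (2y₁ - y₂)(2y₁ + y₂) = 3y₀² one gets 4y₁ = ±(U² + 3V²) with y₀ = UV. If 3 does not divide
  -- y₀, then (3y₁ - y₃)(3y₁ + y₃) = 8y₀², whose factors are both even, gives 3y₁ = ±(P² + 2Q²) with
  -- y₀ = PQ. Now `odd-descent` produces a system whose first entry C divides y₀, and `endgame`
  -- applies.
  odd-case : ∀ {y₀ y₁ y₂ y₃} → System y₀ y₁ y₂ y₃ → y₀ ≢ 0ℤ → Conclusion y₀ → Oddᶻ y₀ → y₀ * y₀ ≡ y₁ * y₁
  odd-case {y₀} {y₁} {y₂} {y₃} (cop , h₄ , h₉) y₀≢0 rec (a , y₀-odd) = with-square (odd-square {y₀} (a , y₀-odd))
    where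
    4-y₀ : Coprime (+ 4) y₀
    4-y₀ = a * a , 1ℤ - + 2 * a , lin₁ (1ℤ - + 2 * a) y₀-odd (solve (y₀ ∷ a ∷ []))
    y₀y₀ : ∀ {s} → Coprime s y₀ → Coprime s (y₀ * y₀)
    y₀y₀ {s} c = coprime-*ʳ {s} {y₀} {y₀} c c
    first : SumForm (+ 3) y₀ (+ 4 * y₁)
    first = sum-form {+ 3} {+ 2 * y₁ - y₂} {+ 2 * y₁ + y₂} {+ 3} {y₀} {+ 4 * y₁} prime-3 (λ c → c) (λ ()) y₀≢0 prod
      (coprime-factors {+ 3} {+ 2 * y₁ - y₂} {+ 2 * y₁ + y₂} {y₀ * y₀} {+ 4 * y₁} prime-3 (λ ()) 3∤1 f≢0 (trans prod (ℤ.*-comm (+ 3) (y₀ * y₀)))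
        (y₀y₀ {+ 4 * y₁} (coprime-* {+ 4} {y₀} {y₁} 4-y₀ (coprime-sym {y₀} {y₁} cop))) (solve (y₁ ∷ y₂ ∷ [])))
      (solve (y₁ ∷ y₂ ∷ []))
      where
      prod : (+ 2 * y₁ - y₂) * (+ 2 * y₁ + y₂) ≡ + 3 * (y₀ * y₀)
      prod = lin₁ 1ℤ h₄ (solve (y₀ ∷ y₁ ∷ y₂ ∷ []))
      f≢0 : + 2 * y₁ - y₂ ≢ 0ℤ
      f≢0 = *≢0ˡ {+ 2 * y₁ - y₂} {+ 2 * y₁ + y₂} (λ z → *-≢0 {+ 3} {y₀ * y₀} (λ ()) (*-≢0 y₀≢0 y₀≢0) (trans (sym prod) z))
    with-square : (∃ λ i → y₀ * y₀ ≡ 1ℤ + + 8 * i) → y₀ * y₀ ≡ y₁ * y₁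
    with-square (i , hi) = with-y₁ y₁-odd
      where
      -- For even y₁ the first equation would give y₂² ≡ -3 modulo 8, which no square satisfies.
      y₁-odd : Oddᶻ y₁
      y₁-odd = odd-if {y₁} λ (b , e) → by-y₂ b e (parity y₂)
        where
        by-y₂ : ∀ b → y₁ ≡ + 2 * b → Parity y₂ → ⊥
        by-y₂ b e (inj₁ (c , e′)) = absurd-∣ (+ 2) (+ 3) (+ 8 * b * b - + 12 * i - + 2 * c * c , lin₃ (- 1ℤ) (+ 4 * (y₁ + + 2 * b)) (- (y₂ + + 2 * c)) h₄ e e′ (lin₁ (- + 3) hi (odd-case-ring₁ b i c y₁ y₀ y₂)))
        by-y₂ b e (inj₂ o) = from (odd-square o)
          where
          from : (∃ λ j → y₂ * y₂ ≡ 1ℤ + + 8 * j) → ⊥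
          from (j , e′) = absurd-∣ (+ 8) (+ 4) (+ 2 * b * b - + 3 * i - j , lin₃ (- 1ℤ) (+ 4 * (y₁ + + 2 * b)) (- 1ℤ) h₄ e e′ (lin₁ (- + 3) hi (odd-case-ring₂ b i j y₁ y₀ y₂)))
      with-y₁ : Oddᶻ y₁ → y₀ * y₀ ≡ y₁ * y₁
      with-y₁ (b , y₁≡) = with-first first (prime-3 y₀)
        where
        y₃-odd : Oddᶻ y₃
        y₃-odd = odd-if {y₃} λ { (c , e) → absurd-∣ (+ 2) (+ 9) (+ 4 * (y₀ * y₀) + + 2 * c * c - + 18 * b - + 18 * b * b , lin₃ 1ℤ (- (+ 9 * (y₁ + 1ℤ + + 2 * b))) (y₃ + + 2 * c) h₉ y₁≡ e (odd-case-ring₃ y₀ c b y₁ y₃)) }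
        with-first : SumForm (+ 3) y₀ (+ 4 * y₁) → + 3 ∣ y₀ ⊎ Coprime (+ 3) y₀ → y₀ * y₀ ≡ y₁ * y₁
        with-first (U , V , y₀≡UV , U-V , U-3 , sign₁) (inj₂ 3-y₀) = with-y₃ y₃-odd
          where
          U≢0 : U ≢ 0ℤ
          U≢0 = *≢0ˡ {U} {V} (λ z → y₀≢0 (trans y₀≡UV z))
          with-y₃ : Oddᶻ y₃ → y₀ * y₀ ≡ y₁ * y₁
          with-y₃ (d , y₃≡) = with-second (sum-form {+ 2} {1ℤ + + 3 * b - d} {+ 2 + + 3 * b + d} {+ 2} {y₀} {+ 3 * y₁} prime-2 (λ c → c) (λ ()) y₀≢0 prod
              (coprime-factors {+ 2} {1ℤ + + 3 * b - d} {+ 2 + + 3 * b + d} {y₀ * y₀} {+ 3 * y₁} prime-2 (λ ()) 2∤1 f≢0 (trans prod (ℤ.*-comm (+ 2) (y₀ * y₀)))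
                (y₀y₀ {+ 3 * y₁} (coprime-* {+ 3} {y₀} {y₁} 3-y₀ (coprime-sym {y₀} {y₁} cop))) s≡)
              s≡)
            where
            s≡ : + 3 * y₁ ≡ 1ℤ + + 3 * b - d + (+ 2 + + 3 * b + d)
            s≡ = lin₁ (+ 3) y₁≡ (solve (y₁ ∷ b ∷ d ∷ []))
            prod : (1ℤ + + 3 * b - d) * (+ 2 + + 3 * b + d) ≡ + 2 * (y₀ * y₀)
            prod = *-cancelˡ {+ 4} (λ ()) (lin₃ 1ℤ (- (+ 9 * (y₁ + 1ℤ + + 2 * b))) (y₃ + 1ℤ + + 2 * d) h₉ y₁≡ y₃≡ (odd-case-ring₄ b d y₀ y₁ y₃))
            f≢0 : 1ℤ + + 3 * b - d ≢ 0ℤ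
            f≢0 = *≢0ˡ {1ℤ + + 3 * b - d} {+ 2 + + 3 * b + d} (λ z → *-≢0 {+ 2} {y₀ * y₀} (λ ()) (*-≢0 y₀≢0 y₀≢0) (trans (sym prod) z))
            with-second : SumForm (+ 2) y₀ (+ 3 * y₁) → y₀ * y₀ ≡ y₁ * y₁
            with-second (P , Q , y₀≡PQ , _ , _ , sign₂) = with-step (odd-descent {U} {V} {P} {Q} {a} (trans (sym y₀≡UV) y₀≡PQ) (trans (sym y₀≡UV) y₀-odd) U-V
                (same-sign 3 2 4 2 {+ 4 * y₁} {U} {V} {P} {Q} sign₁ (swap (scale-sign (+ 4) {+ 3 * y₁} sign₂)) U≢0))
              where
              l : ∀ y → + 3 * (+ 4 * y) ≡ + 4 * (+ 3 * y)
              l = solve-∀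
              swap : (+ 4 * (+ 3 * y₁) ≡ + 4 * (P * P + + 2 * (Q * Q))) ⊎ (- (+ 4 * (+ 3 * y₁)) ≡ + 4 * (P * P + + 2 * (Q * Q))) →
                (+ 3 * (+ 4 * y₁) ≡ + 4 * (P * P + + 2 * (Q * Q))) ⊎ (- (+ 3 * (+ 4 * y₁)) ≡ + 4 * (P * P + + 2 * (Q * Q)))
              swap (inj₁ h) = inj₁ (trans (l y₁) h)
              swap (inj₂ h) = inj₂ (trans (cong -_ (l y₁)) h)
              with-step : OddStep U V P Q → y₀ * y₀ ≡ y₁ * y₁
              with-step (A , B , C , D , hU , hV , _ , _ , C-B , e₄ , e₉) = finish
                  (endgame {y₀} {A} {A} {B} {C} {D} y₀≢0 rec (lin₃ 1ℤ V (A * C) y₀≡UV hU hV (odd-case-ring₅ y₀ C A B D U V)) C-B e₄ e₉)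
                where
                finish : (A * A ≡ 1ℤ) × (B * B ≡ 1ℤ) × (C * C ≡ 1ℤ) × (D * D ≡ 1ℤ) → y₀ * y₀ ≡ y₁ * y₁
                finish (hA , hB , hC , hD) = trans y₀²≡1 (sym (y₁²≡1 sign₁))
                  where
                  UU≡1 : U * U ≡ 1ℤ
                  UU≡1 = lin₃ (U + A * C) (C * C) 1ℤ hU hA hC (odd-case-ring₆ U A C)
                  VV≡1 : V * V ≡ 1ℤ
                  VV≡1 = lin₃ (V + B * D) (D * D) 1ℤ hV hB hD (odd-case-ring₆ V B D)
                  y₀²≡1 : y₀ * y₀ ≡ 1ℤ
                  y₀²≡1 = lin₃ (y₀ + U * V) (V * V) 1ℤ y₀≡UV UU≡1 VV≡1 (odd-case-ring₆ y₀ U V)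
                  y₁²≡1 : (+ 4 * y₁ ≡ U * U + + 3 * (V * V)) ⊎ (- (+ 4 * y₁) ≡ U * U + + 3 * (V * V)) → y₁ * y₁ ≡ 1ℤ
                  y₁²≡1 (inj₁ h) = *-cancelˡ {+ 4} (λ ()) (lin₃ (y₁ + 1ℤ) (y₁ + 1ℤ) (+ 3 * (y₁ + 1ℤ)) h UU≡1 VV≡1 (odd-case-ring₇ y₁ U V))
                  y₁²≡1 (inj₂ h) = *-cancelˡ {+ 4} (λ ()) (lin₃ (1ℤ - y₁) (1ℤ - y₁) (+ 3 * (1ℤ - y₁)) h UU≡1 VV≡1 (odd-case-ring₈ y₁ U V))
        -- For y₀ = 3z also y₃ = 3t, and the second equation becomes y₁² = 8z² + t². Since U is
        -- prime to 3, V = 3V′, and U² + 3V² = 4(P² + 2Q²) takes the form required by `odd-descent`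
        -- for (9V′, U, 3P, 3Q). There 3 divides A, whereas `endgame` gives A² = 1.
        with-first (U , V , y₀≡UV , U-V , U-3 , sign₁) (inj₁ (z , y₀≡3z)) = with-t (3∣sq y₃ (+ 3 * (y₁ * y₁) - + 8 * y₀ * z , lin₂ (- 1ℤ) (- (+ 8 * y₀)) h₉ y₀≡3z (odd-case-ring₉ y₃ y₁ y₀ z)))
          where
          U≢0 : U ≢ 0ℤ
          U≢0 = *≢0ˡ {U} {V} (λ z → y₀≢0 (trans y₀≡UV z))
          z≢0 : z ≢ 0ℤ
          z≢0 = *≢0ʳ {+ 3} {z} (λ e → y₀≢0 (trans y₀≡3z e))
          3∣V : + 3 ∣ V
          3∣V = coprime⇒∣ {+ 3} {U} {V} (coprime-sym {U} {+ 3} U-3) (z , trans (sym y₀≡UV) y₀≡3z)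
          y₁-z : Coprime y₁ z
          y₁-z = coprime-∣ʳ {y₁} {y₀} {z} (coprime-sym {y₀} {y₁} cop) (+ 3 , trans y₀≡3z (ℤ.*-comm (+ 3) z))
          with-t : + 3 ∣ y₃ → y₀ * y₀ ≡ y₁ * y₁
          with-t (t , y₃≡3t) = with-d (odd-if {t} λ { (c , e) → absurd-∣ (+ 2) 1ℤ (+ 4 * (z * z) + + 2 * (c * c) - + 2 * b - + 2 * b * b , lin₃ 1ℤ (- (y₁ + 1ℤ + + 2 * b)) (t + + 2 * c) e₁ y₁≡ e (odd-case-ring₁₀ z c b y₁ t)) })
            where
            e₁ : y₁ * y₁ ≡ + 8 * (z * z) + t * t
            e₁ = *-cancelˡ {+ 9} (λ ()) (lin₃ 1ℤ (+ 8 * (y₀ + + 3 * z)) (y₃ + + 3 * t) h₉ y₀≡3z y₃≡3t (odd-case-ring₁₁ y₁ z t y₀ y₃))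
            with-d : Oddᶻ t → y₀ * y₀ ≡ y₁ * y₁
            with-d (d , t≡) = with-second 3∣V (sum-form {+ 2} {b - d} {1ℤ + b + d} {+ 2} {z} {y₁} prime-2 (λ c → c) (λ ()) z≢0 prod
                (coprime-factors {+ 2} {b - d} {1ℤ + b + d} {z * z} {y₁} prime-2 (λ ()) 2∤1 f≢0 (trans prod (ℤ.*-comm (+ 2) (z * z))) (coprime-*ʳ {y₁} {z} {z} y₁-z y₁-z) s≡) s≡)
              where
              s≡ : y₁ ≡ b - d + (1ℤ + b + d)
              s≡ = lin₁ 1ℤ y₁≡ (solve (y₁ ∷ b ∷ d ∷ []))
              prod : (b - d) * (1ℤ + b + d) ≡ + 2 * (z * z)
              prod = *-cancelˡ {+ 4} (λ ()) (lin₃ 1ℤ (- (y₁ + 1ℤ + + 2 * b)) (t + 1ℤ + + 2 * d) e₁ y₁≡ t≡ (odd-case-ring₁₂ b d z y₁ t))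
              f≢0 : b - d ≢ 0ℤ
              f≢0 = *≢0ˡ {b - d} {1ℤ + b + d} (λ e → *-≢0 {+ 2} {z * z} (λ ()) (*-≢0 z≢0 z≢0) (trans (sym prod) e))
              with-second : + 3 ∣ V → SumForm (+ 2) z y₁ → y₀ * y₀ ≡ y₁ * y₁
              with-second (V′ , V≡) (P , Q , z≡PQ , _ , _ , sign₂) = with-step (odd-descent {+ 9 * V′} {U} {+ 3 * P} {+ 3 * Q} {+ 4 + + 9 * (a - z)}
                  (lin₂ (+ 9) (- + 9) z≡PQ z≡UV′ (odd-case-ring₁₃ V′ U P Q z))
                  (lin₃ (- + 9) (+ 9) (- + 9) z≡UV′ y₀-odd y₀≡3z (odd-case-ring₁₄ V′ U a z y₀))
                  (coprime-* {+ 9} {U} {V′} (coprime-* {+ 3} {U} {+ 3} (coprime-sym {U} {+ 3} U-3) (coprime-sym {U} {+ 3} U-3)) (coprime-sym {U} {V′} (coprime-∣ʳ {U} {V} {V′} U-V (+ 3 , trans V≡ (ℤ.*-comm (+ 3) V′)))))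
                  (lin₂ (+ 9) (- (+ 27 * (V + + 3 * V′))) same V≡ (odd-case-ring₁₅ V′ U P Q V)))
                where
                z≡UV′ : z ≡ U * V′
                z≡UV′ = *-cancelˡ {+ 3} (λ ()) (lin₃ (- 1ℤ) 1ℤ U y₀≡3z y₀≡UV V≡ (odd-case-ring₁₆ z U V′ y₀ V))
                one-times : (+ 4 * y₁ ≡ + 4 * (P * P + + 2 * (Q * Q))) ⊎ (- (+ 4 * y₁) ≡ + 4 * (P * P + + 2 * (Q * Q))) →
                  (+ 1 * (+ 4 * y₁) ≡ + 4 * (P * P + + 2 * (Q * Q))) ⊎ (- (+ 1 * (+ 4 * y₁)) ≡ + 4 * (P * P + + 2 * (Q * Q)))
                one-times (inj₁ h) = inj₁ (trans (ℤ.*-identityˡ (+ 4 * y₁)) h)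
                one-times (inj₂ h) = inj₂ (trans (cong -_ (ℤ.*-identityˡ (+ 4 * y₁))) h)
                same : + 1 * (U * U + + 3 * (V * V)) ≡ + 4 * (P * P + + 2 * (Q * Q))
                same = same-sign 3 2 4 0 {+ 4 * y₁} {U} {V} {P} {Q} sign₁ (one-times (scale-sign (+ 4) {y₁} sign₂)) U≢0
                with-step : OddStep (+ 9 * V′) U (+ 3 * P) (+ 3 * Q) → y₀ * y₀ ≡ y₁ * y₁
                with-step (A , B , C , D , hV′ , hU , hP , _ , C-B , e₄ , e₉) = with-A (coprime⇒∣ {+ 3} {B} {A} 3-B (P , lin₁ (- 1ℤ) hP (solve (A ∷ B ∷ P ∷ []))))
                  where
                  3-B : Coprime (+ 3) B
                  3-B = coprime-∣ʳ {+ 3} {U} {B} (coprime-sym {U} {+ 3} U-3) (D , hU)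
                  with-A : + 3 ∣ A → y₀ * y₀ ≡ y₁ * y₁
                  with-A (A′ , A≡) = impossible (endgame {y₀} {A′} {A} {B} {C} {D} y₀≢0 rec
                      (*-cancelˡ {+ 3} (λ ()) (lin₃ (+ 3) (+ 9) U y₀≡3z z≡UV′ hV′ (lin₂ (A * C) (C * B * D) hU A≡ (odd-case-ring₁₇ y₀ C A′ B D z U V′ A)))) C-B e₄ e₉)
                    where
                    impossible : (A * A ≡ 1ℤ) × (B * B ≡ 1ℤ) × (C * C ≡ 1ℤ) × (D * D ≡ 1ℤ) → y₀ * y₀ ≡ y₁ * y₁
                    impossible (hA , _) = absurd-∣ (+ 3) 1ℤ (A * A′ , lin₂ (- 1ℤ) A hA A≡ (odd-case-ring₁₈ A A′))

  sign-prime-power : ∀ {x} → Coprime (+ 2) x → Coprime (+ 32) x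
  sign-prime-power {x} c = coprime-* {+ 16} {x} {+ 2} (coprime-* {+ 4} {x} {+ 4} c₄ c₄) c
    where
    c₄ : Coprime (+ 4) x
    c₄ = coprime-* {+ 2} {x} {+ 2} c c

  even-case-ring₁ : ∀ p i j y₁ w x →
    + 3 - + 8 * (p - + 3 * i - j) - (- 1ℤ * (y₁ * y₁ - (+ 3 * (w * w) + x * x)) + 1ℤ * (y₁ * y₁ - (1ℤ
      + + 8 * p)))
    ≡ - (+ 3) * (w * w - (1ℤ + + 8 * i)) + - 1ℤ * (x * x - (1ℤ + + 8 * j))
  even-case-ring₁ = solve-∀

  even-case-ring₂ : ∀ p i e y₁ w x →
    + 2 - + 4 * (+ 2 * p - + 6 * i - e * e) - (- 1ℤ * (y₁ * y₁ - (+ 3 * (w * w) + x * x)) + 1ℤ * (y₁ *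
      y₁ - (1ℤ + + 8 * p)))
    ≡ - (+ 3) * (w * w - (1ℤ + + 8 * i)) + - (x + + 2 * e) * (x - + 2 * e)
  even-case-ring₂ = solve-∀

  even-case-ring₃ : ∀ z e p y₁ w x →
    1ℤ - + 2 * (+ 6 * (z * z) + + 2 * (e * e) - + 4 * p) - (1ℤ * (y₁ * y₁ - (+ 3 * (w * w) + x * x)) +
      - 1ℤ * (y₁ * y₁ - (1ℤ + + 8 * p)))
    ≡ + 3 * (w + + 2 * z) * (w - + 2 * z) + (x + + 2 * e) * (x - + 2 * e)
  even-case-ring₃ = solve-∀

  even-case-ring₄ : ∀ b d z y₁ w x →
    + 4 * ((b - d) * (1ℤ + b + d)) - + 4 * (+ 3 * (z * z)) - (1ℤ * (y₁ * y₁ - (+ 3 * (w * w) + x * x))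
      + - (y₁ + 1ℤ + + 2 * b) * (y₁ - (1ℤ + + 2 * b)) + (x + 1ℤ + + 2 * d) * (x - (1ℤ + + 2 * d)))
    ≡ + 3 * (w + + 2 * z) * (w - + 2 * z)
  even-case-ring₄ = solve-∀

  even-case-ring₅ : ∀ B C D →
    + 4 * (B * B) - (+ 3 * (+ 2 * C * (+ 2 * C)) + + 2 * D * (+ 2 * D))
    ≡ + 4 * (B * B - (+ 3 * (C * C) + D * D))
  even-case-ring₅ = solve-∀

  even-case-ring₆ : ∀ B C A →
    + 9 * (B * B) - (+ 8 * (+ 2 * C * (+ 2 * C)) + A * A)
    ≡ 1ℤ * (+ 9 * (B * B) - (+ 32 * (C * C) + A * A))
  even-case-ring₆ = solve-∀

  even-case-ring₇ : ∀ y₀ C m z → y₀ - + 2 * C * (+ 2 * m) ≡ 1ℤ * (y₀ - + 4 * z) + + 4 * (z - C * m)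
  even-case-ring₇ = solve-∀

  even-case-ring₈ : ∀ C q B →
    1ℤ - + 2 * (+ 2 * (C * C) - + 2 * q - + 2 * (q * q))
    ≡ - 1ℤ * (+ 2 * C * (+ 2 * C) - B * B) + - (B + 1ℤ + + 2 * q) * (B - (1ℤ + + 2 * q))
  even-case-ring₈ = solve-∀

  even-case-ring₉ : ∀ b f z →
    (1ℤ + + 3 * b - f) * (+ 2 + + 3 * b + f) - + 16 * (z * z) * + 2
    ≡ 1ℤ * ((1ℤ + + 3 * b - f) * (+ 2 + + 3 * b + f) - + 32 * (z * z))
  even-case-ring₉ = solve-∀

  even-case-ring₁₀ : ∀ y₁ b f →
    + 3 * y₁ - (1ℤ + + 3 * b - f + (+ 2 + + 3 * b + f))
    ≡ + 3 * (y₁ - (1ℤ + + 2 * b))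
  even-case-ring₁₀ = solve-∀

  even-case-ring₁₁ : ∀ b f z y₁ y₀ y₃ →
    + 4 * ((1ℤ + + 3 * b - f) * (+ 2 + + 3 * b + f)) - + 4 * (+ 32 * (z * z)) - (1ℤ * (+ 9 * (y₁ * y₁)
      - (+ 8 * (y₀ * y₀) + y₃ * y₃)) + - (+ 9 * (y₁ + 1ℤ + + 2 * b)) * (y₁ - (1ℤ + + 2 * b)) + (y₃
      + 1ℤ + + 2 * f) * (y₃ - (1ℤ + + 2 * f)))
    ≡ + 8 * (y₀ + + 4 * z) * (y₀ - + 4 * z)
  even-case-ring₁₁ = solve-∀

  even-case-ring₁₂ : ∀ y₁ b → + 3 * y₁ - (1ℤ + + 2 * (1ℤ + + 3 * b)) ≡ + 3 * (y₁ - (1ℤ + + 2 * b))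
  even-case-ring₁₂ = solve-∀

  even-case-ring₁₃ : ∀ z C A B D U V →
    z - C * (A * (B * D))
    ≡ 1ℤ * (z - U * V) + V * (U - A * C) + A * C * (V - B * D)
  even-case-ring₁₃ = solve-∀

  even-case-ring₁₄ : ∀ y₃ y₁ z z′ y₀ →
    y₃ * y₃ - + 3 * (+ 3 * (y₁ * y₁) - + 128 * z * z′)
    ≡ - 1ℤ * (+ 9 * (y₁ * y₁) - (+ 8 * (y₀ * y₀) + y₃ * y₃)) + - (+ 8 * (y₀ + + 4 * z)) * (y₀ - + 4 *
      z) + - (+ 128 * z) * (z - + 3 * z′)
  even-case-ring₁₄ = solve-∀

  even-case-ring₁₅ : ∀ z′ c b y₁ t →
    1ℤ - + 2 * (+ 64 * (z′ * z′) + + 2 * (c * c) - + 2 * b - + 2 * b * b)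
    ≡ 1ℤ * (y₁ * y₁ - (+ 128 * (z′ * z′) + t * t)) + - (y₁ + 1ℤ + + 2 * b) * (y₁ - (1ℤ + + 2 * b)) +
      (t + + 2 * c) * (t - + 2 * c)
  even-case-ring₁₅ = solve-∀

  even-case-ring₁₆ : ∀ y₁ z′ t y₀ y₃ z →
    + 9 * (y₁ * y₁) - + 9 * (+ 128 * (z′ * z′) + t * t) - (1ℤ * (+ 9 * (y₁ * y₁) - (+ 8 * (y₀ * y₀) +
      y₃ * y₃)) + + 8 * (y₀ + + 4 * z) * (y₀ - + 4 * z) + + 128 * (z + + 3 * z′) * (z - + 3 * z′))
    ≡ (y₃ + + 3 * t) * (y₃ - + 3 * t)
  even-case-ring₁₆ = solve-∀

  even-case-ring₁₇ : ∀ b f z′ →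
    (b - f) * (1ℤ + b + f) - + 16 * (z′ * z′) * + 2
    ≡ 1ℤ * ((b - f) * (1ℤ + b + f) - + 32 * (z′ * z′))
  even-case-ring₁₇ = solve-∀

  even-case-ring₁₈ : ∀ b f z′ y₁ t →
    + 4 * ((b - f) * (1ℤ + b + f)) - + 4 * (+ 32 * (z′ * z′))
    ≡ 1ℤ * (y₁ * y₁ - (+ 128 * (z′ * z′) + t * t)) + - (y₁ + 1ℤ + + 2 * b) * (y₁ - (1ℤ + + 2 * b)) +
      (t + 1ℤ + + 2 * f) * (t - (1ℤ + + 2 * f))
  even-case-ring₁₈ = solve-∀

  even-case-ring₁₉ : ∀ y₁ b → + 9 * y₁ - (1ℤ + + 2 * (+ 4 + + 9 * b)) ≡ + 9 * (y₁ - (1ℤ + + 2 * b))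
  even-case-ring₁₉ = solve-∀

  even-case-ring₂₀ : ∀ P Q n →
    + 3 * P * (+ 3 * P) + + 32 * (+ 3 * Q * (+ 3 * Q)) - (1ℤ + + 2 * n)
    ≡ 1ℤ * (+ 9 * (P * P + + 32 * (Q * Q)) - (1ℤ + + 2 * n))
  even-case-ring₂₀ = solve-∀

  even-case-ring₂₁ : ∀ V′ U P Q V →
    + 3 * (+ 9 * V′ * (+ 9 * V′) + + 3 * (U * U)) - (+ 3 * P * (+ 3 * P) + + 32 * (+ 3 * Q * (+ 3 *
      Q)))
    ≡ + 9 * (+ 1 * (U * U + + 3 * (V * V)) - + 1 * (P * P + + 32 * (Q * Q))) + - (+ 27 * (V + + 3 *
      V′)) * (V - + 3 * V′)
  even-case-ring₂₁ = solve-∀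

  even-case-ring₂₂ : ∀ z C A′ B D z′ U V′ A →
    + 3 * z - + 3 * (C * (A′ * (B * D))) - (+ 3 * (z - + 3 * z′) + + 9 * (z′ - U * V′) + U * (+ 9 * V′
      - A * C))
    ≡ A * C * (U - B * D) + C * B * D * (A - + 3 * A′)
  even-case-ring₂₂ = solve-∀

  -- Congruences modulo powers of 2 show y₀ = 4z. The factorizations become y₁ = ±(U² + 3V²) and 3y₁
  -- = ±(P² + 32Q²) with z = UV = PQ, and `even-descent` yields the smaller system (2C, B, 2D, A).
  -- The induction hypothesis would make the odd number B² equal to 4C². If 3 divides z, the
  -- relation is rescaled as in `odd-case`.
  even-case : ∀ {y₀ y₁ y₂ y₃ w} → System y₀ y₁ y₂ y₃ → y₀ ≢ 0ℤ → Conclusion y₀ → y₀ ≡ + 2 * w → ⊥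
  even-case {y₀} {y₁} {y₂} {y₃} {w} (cop , h₄ , h₉) y₀≢0 rec y₀≡2w = with-x (even-of-square y₂ (+ 2 * (y₁ * y₁) - + 3 * (w * y₀)) (lin₂ (- 1ℤ) (- (+ 3 * y₀)) h₄ y₀≡2w (solve (y₀ ∷ y₁ ∷ y₂ ∷ w ∷ []))))
    where
    y₁-odd : Oddᶻ y₁
    y₁-odd = odd-if {y₁} λ e → no-common {y₀} {y₁} (+ 2) cop (w , y₀≡2w) e (absurd-∣ (+ 2) 1ℤ)
    with-x : (∃ λ q → y₂ ≡ + 2 * q) → ⊥
    with-x (x , y₂≡2x) = with-y₁ y₁-odd (odd-square y₁-odd)
      where
      h₃ : y₁ * y₁ ≡ + 3 * (w * w) + x * x
      h₃ = *-cancelˡ {+ 4} (λ ()) (lin₃ 1ℤ (+ 3 * (y₀ + + 2 * w)) (y₂ + + 2 * x) h₄ y₀≡2w y₂≡2x (solve (y₀ ∷ y₁ ∷ y₂ ∷ w ∷ x ∷ [])))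
      with-y₁ : Oddᶻ y₁ → (∃ λ p → y₁ * y₁ ≡ 1ℤ + + 8 * p) → ⊥
      with-y₁ (b , y₁≡) (p , hp) = with-w (parity w) (parity x)
        where
        with-w : Parity w → Parity x → ⊥
        with-w (inj₂ w-odd) (inj₂ x-odd) = from (odd-square w-odd) (odd-square x-odd)
          where
          from : (∃ λ i → w * w ≡ 1ℤ + + 8 * i) → (∃ λ j → x * x ≡ 1ℤ + + 8 * j) → ⊥
          from (i , hi) (j , hj) = absurd-∣ (+ 8) (+ 3) (p - + 3 * i - j , lin₂ (- 1ℤ) 1ℤ h₃ hp (lin₂ (- + 3) (- 1ℤ) hi hj (even-case-ring₁ p i j y₁ w x)))
        with-w (inj₂ w-odd) (inj₁ (e , x≡)) = from (odd-square w-odd)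
          where
          from : (∃ λ i → w * w ≡ 1ℤ + + 8 * i) → ⊥
          from (i , hi) = absurd-∣ (+ 4) (+ 2) (+ 2 * p - + 6 * i - e * e , lin₂ (- 1ℤ) 1ℤ h₃ hp (lin₂ (- + 3) (- (x + + 2 * e)) hi x≡ (even-case-ring₂ p i e y₁ w x)))
        with-w (inj₁ (z , w≡)) (inj₁ (e , x≡)) = absurd-∣ (+ 2) 1ℤ (+ 6 * (z * z) + + 2 * (e * e) - + 4 * p , lin₂ 1ℤ (- 1ℤ) h₃ hp (lin₂ (+ 3 * (w + + 2 * z)) (x + + 2 * e) w≡ x≡ (even-case-ring₃ z e p y₁ w x)))
        with-w (inj₁ (z , w≡)) (inj₂ (d , x≡)) = with-first first (prime-3 z)
          where
          y₀≡4z : y₀ ≡ + 4 * z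
          y₀≡4z = lin₂ 1ℤ (+ 2) y₀≡2w w≡ (solve (y₀ ∷ w ∷ z ∷ []))
          z≢0 : z ≢ 0ℤ
          z≢0 = *≢0ʳ {+ 4} {z} (λ e → y₀≢0 (trans y₀≡4z e))
          y₁-z : Coprime y₁ z
          y₁-z = coprime-∣ʳ {y₁} {y₀} {z} (coprime-sym {y₀} {y₁} cop) (+ 4 , trans y₀≡4z (ℤ.*-comm (+ 4) z))
          y₁-16 : Coprime y₁ (+ 16)
          y₁-16 = coprime-*ʳ {y₁} {+ 4} {+ 4} y₁-4 y₁-4
            where
            y₁-4 : Coprime y₁ (+ 4)
            y₁-4 = 1ℤ - + 2 * b , b * b , lin₁ (1ℤ - + 2 * b) y₁≡ (solve (y₁ ∷ b ∷ []))
          s≡ : y₁ ≡ b - d + (1ℤ + b + d)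
          s≡ = lin₁ 1ℤ y₁≡ (solve (y₁ ∷ b ∷ d ∷ []))
          prod : (b - d) * (1ℤ + b + d) ≡ + 3 * (z * z)
          prod = *-cancelˡ {+ 4} (λ ()) (lin₃ 1ℤ (- (y₁ + 1ℤ + + 2 * b)) (x + 1ℤ + + 2 * d) h₃ y₁≡ x≡ (lin₁ (+ 3 * (w + + 2 * z)) w≡ (even-case-ring₄ b d z y₁ w x)))
          f≢0 : b - d ≢ 0ℤ
          f≢0 = *≢0ˡ {b - d} {1ℤ + b + d} (λ e → *-≢0 {+ 3} {z * z} (λ ()) (*-≢0 z≢0 z≢0) (trans (sym prod) e))
          first : SumForm (+ 3) z y₁
          first = sum-form {+ 3} {b - d} {1ℤ + b + d} {+ 3} {z} {y₁} prime-3 (λ c → c) (λ ()) z≢0 prod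
            (coprime-factors {+ 3} {b - d} {1ℤ + b + d} {z * z} {y₁} prime-3 (λ ()) 3∤1 f≢0 (trans prod (ℤ.*-comm (+ 3) (z * z))) (coprime-*ʳ {y₁} {z} {z} y₁-z y₁-z) s≡) s≡
          y₃-odd : Oddᶻ y₃
          y₃-odd = odd-if {y₃} λ { (c , e) → absurd-∣ (+ 2) (+ 9) (+ 4 * (y₀ * y₀) + + 2 * c * c - + 18 * b - + 18 * b * b , lin₃ 1ℤ (- (+ 9 * (y₁ + 1ℤ + + 2 * b))) (y₃ + + 2 * c) h₉ y₁≡ e (odd-case-ring₃ y₀ c b y₁ y₃)) }
          descend : ∀ {U V P Q} → EvenStep U V P Q → (∀ {A B C D} → U ≡ A * C → V ≡ B * D → P ≡ A * B → ∃ λ m → z ≡ C * m) → ⊥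
          descend (A , B , C , D , hU , hV , hP , _ , C-B , e₄ , e₉ , B-odd) quotient = with-m (quotient {A} {B} {C} {D} hU hV hP)
            where
            with-m : (∃ λ m → z ≡ C * m) → ⊥
            with-m (m , z≡Cm) = impossible B-odd (rec (+ 2 * C) B (+ 2 * D) A (2C-B , lin₁ (+ 4) e₄ (even-case-ring₅ B C D) , lin₁ 1ℤ e₉ (even-case-ring₆ B C A))
                (*≢0ˡ {+ 2 * C} {+ 2 * m} (λ e → y₀≢0 (trans y₀≡ e))) (proper-factor {y₀} {+ 2 * C} {+ 2 * m} y₀≡ y₀≢0 2m≢1))
              where
              y₀≡ : y₀ ≡ + 2 * C * (+ 2 * m)
              y₀≡ = lin₂ 1ℤ (+ 4) y₀≡4z z≡Cm (even-case-ring₇ y₀ C m z)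
              2m≢1 : ∣ + 2 * m ∣ ≢ 1
              2m≢1 e = 2≢1 (ℕ.m*n≡1⇒m≡1 2 ∣ m ∣ (trans (sym (ℤ.abs-* (+ 2) m)) e))
                where
                2≢1 : 2 ≢ 1
                2≢1 ()
              2C-B : Coprime (+ 2 * C) B
              2C-B = coprime-* {+ 2} {B} {C} (from B-odd) C-B
                where
                from : Oddᶻ B → Coprime (+ 2) B
                from (q , e) = - q , 1ℤ , lin₁ 1ℤ e (solve (B ∷ q ∷ []))
              impossible : Oddᶻ B → + 2 * C * (+ 2 * C) ≡ B * B → ⊥
              impossible (q , e) h = absurd-∣ (+ 2) 1ℤ (+ 2 * (C * C) - + 2 * q - + 2 * (q * q) , lin₂ (- 1ℤ) (- (B + 1ℤ + + 2 * q)) h e (even-case-ring₈ C q B))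
          with-first : SumForm (+ 3) z y₁ → + 3 ∣ z ⊎ Coprime (+ 3) z → ⊥
          with-first (U , V , z≡UV , U-V , U-3 , sign₁) three = with-three three
            where
            U≢0 : U ≢ 0ℤ
            U≢0 = *≢0ˡ {U} {V} (λ e → z≢0 (trans z≡UV e))
            V≢0 : V ≢ 0ℤ
            V≢0 = *≢0ʳ {U} {V} (λ e → z≢0 (trans z≡UV e))
            with-three : + 3 ∣ z ⊎ Coprime (+ 3) z → ⊥
            with-three (inj₂ 3-z) = with-f y₃-odd
              where
              with-f : Oddᶻ y₃ → ⊥
              with-f (f , y₃≡) = with-second (sum-form {+ 2} {1ℤ + + 3 * b - f} {+ 2 + + 3 * b + f} {+ 32} {z} {+ 3 * y₁} prime-2 sign-prime-power (λ ()) z≢0 prod₂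
                  (coprime-factors {+ 2} {1ℤ + + 3 * b - f} {+ 2 + + 3 * b + f} {+ 16 * (z * z)} {+ 3 * y₁} prime-2 (λ ()) 2∤1 g≢0 (lin₁ 1ℤ prod₂ (even-case-ring₉ b f z))
                    (coprime-*ʳ {+ 3 * y₁} {+ 16} {z * z} (coprime-* {+ 3} {+ 16} {y₁} (+ 11 , - + 2 , refl) y₁-16) (coprime-*ʳ {+ 3 * y₁} {z} {z} 3y₁-z 3y₁-z)) s≡₂) s≡₂)
                where
                3y₁-z : Coprime (+ 3 * y₁) z
                3y₁-z = coprime-* {+ 3} {z} {y₁} 3-z y₁-z
                s≡₂ : + 3 * y₁ ≡ 1ℤ + + 3 * b - f + (+ 2 + + 3 * b + f)
                s≡₂ = lin₁ (+ 3) y₁≡ (even-case-ring₁₀ y₁ b f)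
                prod₂ : (1ℤ + + 3 * b - f) * (+ 2 + + 3 * b + f) ≡ + 32 * (z * z)
                prod₂ = *-cancelˡ {+ 4} (λ ()) (lin₃ 1ℤ (- (+ 9 * (y₁ + 1ℤ + + 2 * b))) (y₃ + 1ℤ + + 2 * f) h₉ y₁≡ y₃≡ (lin₁ (+ 8 * (y₀ + + 4 * z)) y₀≡4z (even-case-ring₁₁ b f z y₁ y₀ y₃)))
                g≢0 : 1ℤ + + 3 * b - f ≢ 0ℤ
                g≢0 = *≢0ˡ {1ℤ + + 3 * b - f} {+ 2 + + 3 * b + f} (λ e → *-≢0 {+ 32} {z * z} (λ ()) (*-≢0 z≢0 z≢0) (trans (sym prod₂) e))
                with-second : SumForm (+ 32) z (+ 3 * y₁) → ⊥
                with-second (P , Q , z≡PQ , _ , _ , sign₂) = with-odd (odd-sign {+ 3 * y₁} {P * P + + 32 * (Q * Q)} (1ℤ + + 3 * b , lin₁ (+ 3) y₁≡ (even-case-ring₁₂ y₁ b)) sign₂)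
                  where
                  one-times : (+ 3 * y₁ ≡ P * P + + 32 * (Q * Q)) ⊎ (- (+ 3 * y₁) ≡ P * P + + 32 * (Q * Q)) →
                    (+ 3 * y₁ ≡ + 1 * (P * P + + 32 * (Q * Q))) ⊎ (- (+ 3 * y₁) ≡ + 1 * (P * P + + 32 * (Q * Q)))
                  one-times (inj₁ h) = inj₁ (trans h (sym (ℤ.*-identityˡ (P * P + + 32 * (Q * Q)))))
                  one-times (inj₂ h) = inj₂ (trans h (sym (ℤ.*-identityˡ (P * P + + 32 * (Q * Q)))))
                  same : + 3 * (U * U + + 3 * (V * V)) ≡ P * P + + 32 * (Q * Q)
                  same = trans (same-sign 3 32 1 2 {y₁} {U} {V} {P} {Q} sign₁ (one-times sign₂) U≢0) (ℤ.*-identityˡ (P * P + + 32 * (Q * Q)))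
                  with-odd : Oddᶻ (P * P + + 32 * (Q * Q)) → ⊥
                  with-odd (n , odd) = descend {U} {V} {P} {Q} (even-descent {U} {V} {P} {Q} {n} U≢0 V≢0 (trans (sym z≡UV) z≡PQ) odd U-V same)
                    (λ {A} {B} {C} {D} hU hV _ → A * (B * D) , lin₃ 1ℤ V (A * C) z≡UV hU hV (even-case-ring₁₃ z C A B D U V))
            with-three (inj₁ (z′ , z≡3z′)) = with-V (coprime⇒∣ {+ 3} {U} {V} (coprime-sym {U} {+ 3} U-3) (z′ , trans (sym z≡UV) z≡3z′))
              (3∣sq y₃ (+ 3 * (y₁ * y₁) - + 128 * z * z′ , lin₃ (- 1ℤ) (- (+ 8 * (y₀ + + 4 * z))) (- (+ 128 * z)) h₉ y₀≡4z z≡3z′ (even-case-ring₁₄ y₃ y₁ z z′ y₀)))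
              where
              z′≢0 : z′ ≢ 0ℤ
              z′≢0 = *≢0ʳ {+ 3} {z′} (λ e → z≢0 (trans z≡3z′ e))
              y₁-z′ : Coprime y₁ z′
              y₁-z′ = coprime-∣ʳ {y₁} {z} {z′} y₁-z (+ 3 , trans z≡3z′ (ℤ.*-comm (+ 3) z′))
              with-V : + 3 ∣ V → + 3 ∣ y₃ → ⊥
              with-V (V′ , V≡) (t , y₃≡3t) = with-f (odd-if {t} λ { (c , e) → absurd-∣ (+ 2) 1ℤ (+ 64 * (z′ * z′) + + 2 * (c * c) - + 2 * b - + 2 * b * b , lin₃ 1ℤ (- (y₁ + 1ℤ + + 2 * b)) (t + + 2 * c) e₁ y₁≡ e (even-case-ring₁₅ z′ c b y₁ t)) })
                where
                e₁ : y₁ * y₁ ≡ + 128 * (z′ * z′) + t * t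
                e₁ = *-cancelˡ {+ 9} (λ ()) (lin₃ 1ℤ (+ 8 * (y₀ + + 4 * z)) (+ 128 * (z + + 3 * z′)) h₉ y₀≡4z z≡3z′ (lin₁ (y₃ + + 3 * t) y₃≡3t (even-case-ring₁₆ y₁ z′ t y₀ y₃ z)))
                with-f : Oddᶻ t → ⊥
                with-f (f , t≡) = with-second (sum-form {+ 2} {b - f} {1ℤ + b + f} {+ 32} {z′} {y₁} prime-2 sign-prime-power (λ ()) z′≢0 prod₂
                    (coprime-factors {+ 2} {b - f} {1ℤ + b + f} {+ 16 * (z′ * z′)} {y₁} prime-2 (λ ()) 2∤1 g≢0 (lin₁ 1ℤ prod₂ (even-case-ring₁₇ b f z′))
                      (coprime-*ʳ {y₁} {+ 16} {z′ * z′} y₁-16 (coprime-*ʳ {y₁} {z′} {z′} y₁-z′ y₁-z′)) s≡₂) s≡₂)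
                  where
                  s≡₂ : y₁ ≡ b - f + (1ℤ + b + f)
                  s≡₂ = lin₁ 1ℤ y₁≡ (solve (y₁ ∷ b ∷ f ∷ []))
                  prod₂ : (b - f) * (1ℤ + b + f) ≡ + 32 * (z′ * z′)
                  prod₂ = *-cancelˡ {+ 4} (λ ()) (lin₃ 1ℤ (- (y₁ + 1ℤ + + 2 * b)) (t + 1ℤ + + 2 * f) e₁ y₁≡ t≡ (even-case-ring₁₈ b f z′ y₁ t))
                  g≢0 : b - f ≢ 0ℤ
                  g≢0 = *≢0ˡ {b - f} {1ℤ + b + f} (λ e → *-≢0 {+ 32} {z′ * z′} (λ ()) (*-≢0 z′≢0 z′≢0) (trans (sym prod₂) e))
                  with-second : SumForm (+ 32) z′ y₁ → ⊥
                  with-second (P , Q , z′≡PQ , _ , _ , sign₂) = with-odd (odd-sign {+ 9 * y₁} {+ 9 * (P * P + + 32 * (Q * Q))} (+ 4 + + 9 * b , lin₁ (+ 9) y₁≡ (even-case-ring₁₉ y₁ b)) (scale-sign (+ 9) {y₁} sign₂))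
                    where
                    z′≡UV′ : z′ ≡ U * V′
                    z′≡UV′ = *-cancelˡ {+ 3} (λ ()) (lin₃ (- 1ℤ) 1ℤ U z≡3z′ z≡UV V≡ (odd-case-ring₁₆ z′ U V′ z V))
                    one-times : (y₁ ≡ P * P + + 32 * (Q * Q)) ⊎ (- y₁ ≡ P * P + + 32 * (Q * Q)) →
                      (+ 1 * y₁ ≡ + 1 * (P * P + + 32 * (Q * Q))) ⊎ (- (+ 1 * y₁) ≡ + 1 * (P * P + + 32 * (Q * Q)))
                    one-times h = scale-sign (+ 1) {y₁} h
                    same : + 1 * (U * U + + 3 * (V * V)) ≡ + 1 * (P * P + + 32 * (Q * Q))
                    same = same-sign 3 32 1 0 {y₁} {U} {V} {P} {Q} sign₁ (one-times sign₂) U≢0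
                    with-odd : Oddᶻ (+ 9 * (P * P + + 32 * (Q * Q))) → ⊥
                    with-odd (n , odd) = descend {+ 9 * V′} {U} {+ 3 * P} {+ 3 * Q}
                      (even-descent {+ 9 * V′} {U} {+ 3 * P} {+ 3 * Q} {n} (*-≢0 {+ 9} {V′} (λ ()) (*≢0ʳ {U} {V′} (λ e → z′≢0 (trans z′≡UV′ e)))) U≢0
                        (lin₂ (+ 9) (- + 9) z′≡PQ z′≡UV′ (odd-case-ring₁₃ V′ U P Q z′))
                        (lin₁ 1ℤ odd (even-case-ring₂₀ P Q n))
                        (coprime-* {+ 9} {U} {V′} (coprime-* {+ 3} {U} {+ 3} (coprime-sym {U} {+ 3} U-3) (coprime-sym {U} {+ 3} U-3)) (coprime-sym {U} {V′} (coprime-∣ʳ {U} {V} {V′} U-V (+ 3 , trans V≡ (ℤ.*-comm (+ 3) V′)))))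
                        (lin₂ (+ 9) (- (+ 27 * (V + + 3 * V′))) same V≡ (even-case-ring₂₁ V′ U P Q V)))
                      (λ {A} {B} {C} {D} hV′ hU hP → with-A {A} {B} {C} {D} hV′ hU hP (coprime⇒∣ {+ 3} {B} {A} (coprime-∣ʳ {+ 3} {U} {B} (coprime-sym {U} {+ 3} U-3) (D , hU)) (P , lin₁ (- 1ℤ) hP (solve (A ∷ B ∷ P ∷ [])))))
                      where
                      with-A : ∀ {A B C D} → + 9 * V′ ≡ A * C → U ≡ B * D → + 3 * P ≡ A * B → + 3 ∣ A → ∃ λ m → z ≡ C * m
                      with-A {A} {B} {C} {D} hV′ hU _ (A′ , A≡) = A′ * (B * D) , *-cancelˡ {+ 3} (λ ())
                        (lin₃ (+ 3) (+ 9) U z≡3z′ z′≡UV′ hV′ (lin₂ (A * C) (C * B * D) hU A≡ (even-case-ring₂₂ z C A′ B D z′ U V′ A)))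

  system-rec : ∀ {y₀ y₁ y₂ y₃} → System y₀ y₁ y₂ y₃ → y₀ ≢ 0ℤ → Acc ℕ._<_ ∣ y₀ ∣ → y₀ * y₀ ≡ y₁ * y₁
  system-rec {y₀} {y₁} {y₂} {y₃} S y₀≢0 (acc rs) = go (parity y₀)
    where
    rec : Conclusion y₀
    rec x₀ x₁ x₂ x₃ S′ x₀≢0 x₀<y₀ = system-rec {x₀} {x₁} {x₂} {x₃} S′ x₀≢0 (rs x₀<y₀)
    go : Parity y₀ → y₀ * y₀ ≡ y₁ * y₁
    go (inj₁ (w , e)) = ⊥-elim (even-case {y₀} {y₁} {y₂} {y₃} {w} S y₀≢0 rec e)
    go (inj₂ o) = odd-case {y₀} {y₁} {y₂} {y₃} S y₀≢0 rec o

  four-squares-ring₁ : ∀ x₂ g y₁ y₀ c a x₁ x₀ →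
    x₂ * x₂ - g * g * (+ 4 * (y₁ * y₁) - + 3 * (y₀ * y₀)) - (- 1ℤ * (c + + 4 * a - x₂ * x₂) + + 4 * (c
      + a - x₁ * x₁) + - (+ 3) * (c - x₀ * x₀))
    ≡ + 4 * (x₁ + g * y₁) * (x₁ - g * y₁) + - (+ 3 * (x₀ + g * y₀)) * (x₀ - g * y₀)
  four-squares-ring₁ = solve-∀

  four-squares-ring₂ : ∀ x₃ g y₁ y₀ c a x₁ x₀ →
    x₃ * x₃ - g * g * (+ 9 * (y₁ * y₁) - + 8 * (y₀ * y₀)) - (- 1ℤ * (c + + 9 * a - x₃ * x₃) + + 9 * (c
      + a - x₁ * x₁) + - (+ 8) * (c - x₀ * x₀))
    ≡ + 9 * (x₁ + g * y₁) * (x₁ - g * y₁) + - (+ 8 * (x₀ + g * y₀)) * (x₀ - g * y₀)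
  four-squares-ring₂ = solve-∀

  four-squares-ring₃ : ∀ g y₁ y₀ y₂ c a x₂ x₁ x₀ →
    g * g * (+ 4 * (y₁ * y₁)) - g * g * (+ 3 * (y₀ * y₀) + y₂ * y₂) - (1ℤ * (c + + 4 * a - x₂ * x₂) +
      - (+ 4) * (c + a - x₁ * x₁) + + 3 * (c - x₀ * x₀))
    ≡ - (+ 4 * (x₁ + g * y₁)) * (x₁ - g * y₁) + + 3 * (x₀ + g * y₀) * (x₀ - g * y₀) + (x₂ + g * y₂) *
      (x₂ - g * y₂)
  four-squares-ring₃ = solve-∀

  four-squares-ring₄ : ∀ g y₁ y₀ y₃ c a x₃ x₁ x₀ →
    g * g * (+ 9 * (y₁ * y₁)) - g * g * (+ 8 * (y₀ * y₀) + y₃ * y₃) - (1ℤ * (c + + 9 * a - x₃ * x₃) +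
      - (+ 9) * (c + a - x₁ * x₁) + + 8 * (c - x₀ * x₀))
    ≡ - (+ 9 * (x₁ + g * y₁)) * (x₁ - g * y₁) + + 8 * (x₀ + g * y₀) * (x₀ - g * y₀) + (x₃ + g * y₃) *
      (x₃ - g * y₃)
  four-squares-ring₄ = solve-∀

  four-squares-ring₅ : ∀ a c x₁ x₀ g y₀ y₁ →
    a - 0ℤ - (1ℤ * (c + a - x₁ * x₁) + - 1ℤ * (c - x₀ * x₀) + - (g * g) * (y₀ * y₀ - y₁ * y₁))
    ≡ (x₁ + g * y₁) * (x₁ - g * y₁) + - (x₀ + g * y₀) * (x₀ - g * y₀)
  four-squares-ring₅ = solve-∀

  -- If x₀ = 0 then c = 0. Otherwise dividing by g = gcd(x₀, x₁) makes the system primitive: g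
  -- divides x₂ and x₃ because g² divides their squares. Equality of x₀² and x₁² then means a = 0.
  four-squares : ∀ {a c x₀ x₁ x₂ x₃} → c ≡ x₀ * x₀ → c + a ≡ x₁ * x₁ → c + + 4 * a ≡ x₂ * x₂ → c + + 9 * a ≡ x₃ * x₃ → a ≡ 0ℤ ⊎ c ≡ 0ℤ
  four-squares {a} {c} {x₀} {x₁} {x₂} {x₃} h₀ h₁ h₂ h₃ = go (x₀ ℤ.≟ 0ℤ)
    where
    go : Dec (x₀ ≡ 0ℤ) → a ≡ 0ℤ ⊎ c ≡ 0ℤ
    go (yes e) = inj₂ (lin₂ 1ℤ x₀ h₀ e (solve (c ∷ x₀ ∷ [])))
    go (no x₀≢0) = inj₁ (from-gcd (gcd x₀ x₁ x₀≢0))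
      where
      from-gcd : (∃ λ g → ∃ λ y₀ → ∃ λ y₁ → (x₀ ≡ g * y₀) × (x₁ ≡ g * y₁) × (g ≢ 0ℤ) × Coprime y₀ y₁) → a ≡ 0ℤ
      from-gcd (g , y₀ , y₁ , e₀ , e₁ , g≢0 , cop) = with-roots
          (square-∣ {g} {x₂} {+ 4 * (y₁ * y₁) - + 3 * (y₀ * y₀)} g≢0 (lin₃ (- 1ℤ) (+ 4) (- + 3) h₂ h₁ h₀ (lin₂ (+ 4 * (x₁ + g * y₁)) (- (+ 3 * (x₀ + g * y₀))) e₁ e₀ (four-squares-ring₁ x₂ g y₁ y₀ c a x₁ x₀))))
          (square-∣ {g} {x₃} {+ 9 * (y₁ * y₁) - + 8 * (y₀ * y₀)} g≢0 (lin₃ (- 1ℤ) (+ 9) (- + 8) h₃ h₁ h₀ (lin₂ (+ 9 * (x₁ + g * y₁)) (- (+ 8 * (x₀ + g * y₀))) e₁ e₀ (four-squares-ring₂ x₃ g y₁ y₀ c a x₁ x₀))))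
        where
        GG≢0 : g * g ≢ 0ℤ
        GG≢0 = *-≢0 g≢0 g≢0
        with-roots : g ∣ x₂ → g ∣ x₃ → a ≡ 0ℤ
        with-roots (y₂ , e₂) (y₃ , e₃) = conclude (system-rec {y₀} {y₁} {y₂} {y₃} (cop , s₄ , s₉) (*≢0ʳ {g} {y₀} (λ z → x₀≢0 (trans e₀ z))) (<-wellFounded _))
          where
          s₄ : + 4 * (y₁ * y₁) ≡ + 3 * (y₀ * y₀) + y₂ * y₂
          s₄ = *-cancelˡ {g * g} GG≢0 (lin₃ 1ℤ (- + 4) (+ 3) h₂ h₁ h₀ (lin₃ (- (+ 4 * (x₁ + g * y₁))) (+ 3 * (x₀ + g * y₀)) (x₂ + g * y₂) e₁ e₀ e₂ (four-squares-ring₃ g y₁ y₀ y₂ c a x₂ x₁ x₀)))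
          s₉ : + 9 * (y₁ * y₁) ≡ + 8 * (y₀ * y₀) + y₃ * y₃
          s₉ = *-cancelˡ {g * g} GG≢0 (lin₃ 1ℤ (- + 9) (+ 8) h₃ h₁ h₀ (lin₃ (- (+ 9 * (x₁ + g * y₁))) (+ 8 * (x₀ + g * y₀)) (x₃ + g * y₃) e₁ e₀ e₃ (four-squares-ring₄ g y₁ y₀ y₃ c a x₃ x₁ x₀)))
          conclude : y₀ * y₀ ≡ y₁ * y₁ → a ≡ 0ℤ
          conclude e = lin₃ 1ℤ (- 1ℤ) (- (g * g)) h₁ h₀ e (lin₂ (x₁ + g * y₁) (- (x₀ + g * y₀)) e₁ e₀ (four-squares-ring₅ a c x₁ x₀ g y₀ y₁))

-- Infinitely many members for N = 2, 4, 6, 8: duplication of points.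

module Families8 where

  open import Defs using (Quad; quad; evalQ; evalP; IsSquare; IsSquarePoly; InB; BInfinite; _∼_)
  open IntTools
  open Seven using (Oddᶻ; odd-square)
  open TenC using (five-squares)
  open import Data.Integer using (ℤ; +_; -[1+_]; _+_; _*_; -_; _-_; ∣_∣; 0ℤ; 1ℤ)
  import Data.Integer as ℤ
  import Data.Integer.Properties as ℤ
  open import Data.Integer.Tactic.RingSolver using (solve; solve-∀)
  open import Data.Nat as ℕ using (ℕ; zero; suc)
  import Data.Nat.Properties as ℕ
  open import Data.Product using (∃; _×_; _,_; proj₁; proj₂)
  open import Data.Sum using (_⊎_; inj₁; inj₂)
  open import Data.Empty using (⊥; ⊥-elim)
  open import Data.List using (_∷_; [])
  open import Relation.Nullary using (¬_; Dec; yes; no; contradiction)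
  open import Relation.Binary.PropositionalEquality
  open import Relation.Binary.Definitions using (tri<; tri≈; tri>)

  odd-*ᶻ : ∀ {x y} → Oddᶻ x → Oddᶻ y → Oddᶻ (x * y)
  odd-*ᶻ {x} {y} (p , e) (q , e′) = p + q + + 2 * p * q , lin₂ y (1ℤ + + 2 * p) e e′ (solve (x ∷ y ∷ p ∷ q ∷ []))

  odd-+2* : ∀ {x} y → Oddᶻ x → Oddᶻ (x + + 2 * y)
  odd-+2* {x} y (p , e) = p + y , lin₁ 1ℤ e (solve (x ∷ y ∷ p ∷ []))

  odd-≢0 : ∀ {x} → Oddᶻ x → x ≢ 0ℤ
  odd-≢0 {x} (p , e) z = absurd-∣ (+ 2) 1ℤ (- p , lin₂ (- 1ℤ) 1ℤ e z (solve (x ∷ p ∷ [])))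

  One-mod-4 : ℤ → Set
  One-mod-4 x = ∃ λ η → x ≡ 1ℤ + + 4 * η

  product-mod-4-ring₁ : ∀ x y i z w v →
    x * y - (1ℤ + + 4 * (+ 2 * i + z * w + v * z + + 4 * v * w))
    ≡ y * (x - (z + + 4 * v)) + (z + + 4 * v) * (y - (z + + 4 * w)) + 1ℤ * (z * z - (1ℤ + + 8 * i))
  product-mod-4-ring₁ = solve-∀

  -- All factors agree modulo 4 with the odd z, so the product of each pair is z² ≡ 1.
  product-mod-4 : ∀ {z x₁ x₂ x₃ x₄} → Oddᶻ z → ∀ w₁ w₂ w₃ w₄ → x₁ ≡ z + + 4 * w₁ → x₂ ≡ z + + 4 * w₂ → x₃ ≡ z + + 4 * w₃ → x₄ ≡ z + + 4 * w₄ → One-mod-4 (x₁ * x₂ * x₃ * x₄)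
  product-mod-4 {z} {x₁} {x₂} {x₃} {x₄} z-odd w₁ w₂ w₃ w₄ e₁ e₂ e₃ e₄ = combine (pair w₁ w₂ e₁ e₂ (odd-square z-odd)) (pair w₃ w₄ e₃ e₄ (odd-square z-odd))
    where
    pair : ∀ {x y} v w → x ≡ z + + 4 * v → y ≡ z + + 4 * w → (∃ λ i → z * z ≡ 1ℤ + + 8 * i) → One-mod-4 (x * y)
    pair {x} {y} v w e e′ (i , h) = + 2 * i + z * w + v * z + + 4 * v * w , lin₃ y (z + + 4 * v) 1ℤ e e′ h (product-mod-4-ring₁ x y i z w v)
    combine : One-mod-4 (x₁ * x₂) → One-mod-4 (x₃ * x₄) → One-mod-4 (x₁ * x₂ * x₃ * x₄)
    combine (p , e) (q , e′) = p + q + + 4 * p * q , lin₂ (x₃ * x₄) (1ℤ + + 4 * p) e e′ (solve (x₁ ∷ x₂ ∷ x₃ ∷ x₄ ∷ p ∷ q ∷ []))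

  -- Duplication on the curve c + 2nβ = yₙ² (n = n₁, …, n₄), from its origin β = 0. It multiplies β / c
  -- by 2 up to a 2-adic unit, so that the multiples 2ⁱP of a point 2-adically close to the origin are distinct.
  module-ring₁ : ∀ n₁ h e k₁ k₂ n₂ n₃ n₄ →
    n₁ * n₁ * (n₁ * n₁) - (+ 2 * h * (n₁ * n₁ * n₁) - e * (n₁ * n₁) + + 2 * k₁ * n₁ - k₂) - (n₁ * n₁ *
      n₁ * (n₁ + n₂ + n₃ + n₄ - + 2 * h) + - (n₁ * n₁) * (n₁ * n₂ + n₁ * n₃ + n₁ * n₄ + n₂ * n₃ + n₂ *
      n₄ + n₃ * n₄ - e))
    ≡ n₁ * (n₁ * n₂ * n₃ + n₁ * n₂ * n₄ + n₁ * n₃ * n₄ + n₂ * n₃ * n₄ - + 2 * k₁) + - 1ℤ * (n₁ * n₂ *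
      n₃ * n₄ - k₂)
  module-ring₁ = solve-∀

  module-ring₂ : ∀ n₂ h e k₁ k₂ n₁ n₃ n₄ →
    n₂ * n₂ * (n₂ * n₂) - (+ 2 * h * (n₂ * n₂ * n₂) - e * (n₂ * n₂) + + 2 * k₁ * n₂ - k₂) - (n₂ * n₂ *
      n₂ * (n₁ + n₂ + n₃ + n₄ - + 2 * h) + - (n₂ * n₂) * (n₁ * n₂ + n₁ * n₃ + n₁ * n₄ + n₂ * n₃ + n₂ *
      n₄ + n₃ * n₄ - e))
    ≡ n₂ * (n₁ * n₂ * n₃ + n₁ * n₂ * n₄ + n₁ * n₃ * n₄ + n₂ * n₃ * n₄ - + 2 * k₁) + - 1ℤ * (n₁ * n₂ *
      n₃ * n₄ - k₂)
  module-ring₂ = solve-∀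

  module-ring₃ : ∀ n₃ h e k₁ k₂ n₁ n₂ n₄ →
    n₃ * n₃ * (n₃ * n₃) - (+ 2 * h * (n₃ * n₃ * n₃) - e * (n₃ * n₃) + + 2 * k₁ * n₃ - k₂) - (n₃ * n₃ *
      n₃ * (n₁ + n₂ + n₃ + n₄ - + 2 * h) + - (n₃ * n₃) * (n₁ * n₂ + n₁ * n₃ + n₁ * n₄ + n₂ * n₃ + n₂ *
      n₄ + n₃ * n₄ - e))
    ≡ n₃ * (n₁ * n₂ * n₃ + n₁ * n₂ * n₄ + n₁ * n₃ * n₄ + n₂ * n₃ * n₄ - + 2 * k₁) + - 1ℤ * (n₁ * n₂ *
      n₃ * n₄ - k₂)
  module-ring₃ = solve-∀

  module-ring₄ : ∀ n₄ h e k₁ k₂ n₁ n₂ n₃ →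
    n₄ * n₄ * (n₄ * n₄) - (+ 2 * h * (n₄ * n₄ * n₄) - e * (n₄ * n₄) + + 2 * k₁ * n₄ - k₂) - (n₄ * n₄ *
      n₄ * (n₁ + n₂ + n₃ + n₄ - + 2 * h) + - (n₄ * n₄) * (n₁ * n₂ + n₁ * n₃ + n₁ * n₄ + n₂ * n₃ + n₂ *
      n₄ + n₃ * n₄ - e))
    ≡ n₄ * (n₁ * n₂ * n₃ + n₁ * n₂ * n₄ + n₁ * n₃ * n₄ + n₂ * n₃ * n₄ - + 2 * k₁) + - 1ℤ * (n₁ * n₂ *
      n₃ * n₄ - k₂)
  module-ring₄ = solve-∀

  module-ring₅ : ∀ c h β k₁ k₂ n e →
    c * c * (c * c) + + 2 * h * (c * c * c) * β - + 8 * k₁ * c * (β * β * β) - + 16 * k₂ * (β * β * β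
      * β) + n * (+ 2 * (+ 2 * (c * c * c + + 3 * h * (c * c) * β + + 2 * e * c * (β * β) + + 4 * k₁ *
      (β * β * β)) * β)) - ((c + n * (+ 2 * β)) * (c + n * (+ 2 * β)) * (c * c + + 2 * h * β * c) +
      + 2 * (c + n * (+ 2 * β)) * (+ 2 * (h * n - n * n) * (β * β) * c + + 4 * (n * n * n - + 2 * h *
      (n * n) + e * n - k₁) * (β * β * β)))
    ≡ - (+ 16) * β * β * β * β * (n * n * (n * n) - (+ 2 * h * (n * n * n) - e * (n * n) + + 2 * k₁ *
      n - k₂))
  module-ring₅ = solve-∀

  module-ring₆ : ∀ e h c β k₁ k₂ n →
    (e - h * h) * (c * c * (c * c)) * (β * β) + + 4 * k₁ * (c * c * c) * (β * β * β) - + 16 * h * k₂ *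
      c * (β * β * β * β * β) + + 16 * (k₁ * k₁ - e * k₂) * (β * β * β * β * β * β) + n * (+ 2 * (+ 2
      * ((e - h * h) * (c * c * c) * (β * β) + + 6 * k₁ * (c * c) * (β * β * β) + (+ 8 * k₂ + + 4 * h
      * k₁) * c * (β * β * β * β) + + 8 * h * k₂ * (β * β * β * β * β)) * β)) - ((c + n * (+ 2 * β)) *
      (c + n * (+ 2 * β)) * ((e - h * h) * (β * β) * (c * c) + + 4 * k₁ * (β * β * β) * c + + 4 * k₂ *
      (β * β * β * β)) + (+ 2 * (h * n - n * n) * (β * β) * c + + 4 * (n * n * n - + 2 * h * (n * n) +
      e * n - k₁) * (β * β * β)) * (+ 2 * (h * n - n * n) * (β * β) * c + + 4 * (n * n * n - + 2 * h *
      (n * n) + e * n - k₁) * (β * β * β)))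
    ≡ (- (+ 16) * c * h * β * β * β * β * β + + 16 * c * n * β * β * β * β * β - + 4 * c * c * β * β *
      β * β - + 16 * e * β * β * β * β * β * β + + 32 * h * n * β * β * β * β * β * β - + 16 * n * n *
      β * β * β * β * β * β) * (n * n * (n * n) - (+ 2 * h * (n * n * n) - e * (n * n) + + 2 * k₁ * n
      - k₂))
  module-ring₆ = solve-∀

  module-ring₇ : ∀ s c₁ c₀ n f₁ f₀ β L E K D →
    s * c₁ + c₀ + n * (+ 2 * (+ 2 * (s * f₁ + f₀) * β)) - (L * s + E) * (L * s + E)
    ≡ - (L * L) * (s * s - (s * K + D)) + s * (c₁ + n * (+ 2 * (+ 2 * f₁ * β)) - (L * L * K + + 2 * L
      * E)) + 1ℤ * (c₀ + n * (+ 2 * (+ 2 * f₀ * β)) - (L * L * D + E * E))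
  module-ring₇ = solve-∀

  module-ring₈ : ∀ c n β s l m α →
    (c + n * (+ 2 * β)) * s + (+ 2 * l * (β * β) * c + + 4 * m * (β * β * β)) - (c * s + + 4 * (n * α
      * s + + 2 * l * (α * α) * c + + 8 * m * (α * α * α)))
    ≡ (+ 2 * n * s + + 2 * l * c * (β + + 2 * α) + + 4 * m * (β * β + + 2 * α * β + + 4 * (α * α))) *
      (β - + 2 * α)
  module-ring₈ = solve-∀

  module-ring₉ : ∀ c n₁ β n₂ n₃ n₄ h e k₁ k₂ →
    (c + n₁ * (+ 2 * β)) * (c + n₂ * (+ 2 * β)) * (c + n₃ * (+ 2 * β)) * (c + n₄ * (+ 2 * β)) - (c * c
      * (c * c) + + 4 * h * β * (c * c * c) + + 4 * e * (β * β) * (c * c) + + 16 * k₁ * (β * β * β) *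
      c + + 16 * k₂ * (β * β * β * β)) - (+ 2 * β * (c * c * c) * (n₁ + n₂ + n₃ + n₄ - + 2 * h) + + 4
      * (β * β) * (c * c) * (n₁ * n₂ + n₁ * n₃ + n₁ * n₄ + n₂ * n₃ + n₂ * n₄ + n₃ * n₄ - e))
    ≡ + 8 * (β * β * β) * c * (n₁ * n₂ * n₃ + n₁ * n₂ * n₄ + n₁ * n₃ * n₄ + n₂ * n₃ * n₄ - + 2 * k₁) +
      + 16 * (β * β * β * β) * (n₁ * n₂ * n₃ * n₄ - k₂)
  module-ring₉ = solve-∀

  module-ring₁₀ : ∀ γ h α c η β Y →
    + 2 * (1ℤ + + 2 * (γ + γ * γ + h * α * c + η)) - (c * c + + 2 * h * β * c + Y)
    ≡ - (c + 1ℤ + + 2 * γ) * (c - (1ℤ + + 2 * γ)) + - 1ℤ * (Y - (1ℤ + + 4 * η)) + - (+ 2 * h * c) * (β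
      - + 2 * α)
  module-ring₁₀ = solve-∀

  module-ring₁₁ : ∀ s c h β e k₁ k₂ Y →
    + 4 * (s * s) - + 4 * (s * (c * c + + 2 * h * β * c) + ((e - h * h) * (β * β) * (c * c) + + 4 * k₁
      * (β * β * β) * c + + 4 * k₂ * (β * β * β * β)))
    ≡ 1ℤ * (Y * Y - (c * c * (c * c) + + 4 * h * β * (c * c * c) + + 4 * e * (β * β) * (c * c) + + 16
      * k₁ * (β * β * β) * c + + 16 * k₂ * (β * β * β * β))) + (+ 2 * s - c * c - + 2 * h * β * c + Y)
      * (+ 2 * s - (c * c + + 2 * h * β * c + Y))
  module-ring₁₁ = solve-∀

  module-ring₁₂ : ∀ s c h α e β k₁ k₂ →
    s * (c * c * c) + + 2 * (s * (+ 3 * h * (c * c) * α + e * c * (β * β) + + 2 * k₁ * (β * β * β)) +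
      (e - h * h) * (c * c * c) * (α * β) + + 3 * k₁ * (c * c) * (β * β * β) + (+ 4 * k₂ + + 2 * h *
      k₁) * c * (β * β * β * β) + + 4 * h * k₂ * (β * β * β * β * β)) - (s * (c * c * c + + 3 * h * (c
      * c) * β + + 2 * e * c * (β * β) + + 4 * k₁ * (β * β * β)) + ((e - h * h) * (c * c * c) * (β *
      β) + + 6 * k₁ * (c * c) * (β * β * β) + (+ 8 * k₂ + + 4 * h * k₁) * c * (β * β * β * β) + + 8 *
      h * k₂ * (β * β * β * β * β)))
    ≡ - (+ 3 * s * h * (c * c) + (e - h * h) * (c * c * c) * β) * (β - + 2 * α)
  module-ring₁₂ = solve-∀

  module-ring₁₃ : ∀ s c h β k₁ k₂ e α →
    s * (c * c * (c * c)) + + 2 * (s * (h * (c * c * c) * β - + 4 * k₁ * c * (β * β * β) - + 8 * k₂ *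
      (β * β * β * β)) + (e - h * h) * (c * c * (c * c)) * (α * β) + + 2 * k₁ * (c * c * c) * (β * β *
      β) - + 8 * h * k₂ * c * (β * β * β * β * β) + + 8 * (k₁ * k₁ - e * k₂) * (β * β * β * β * β *
      β)) - (s * (c * c * (c * c) + + 2 * h * (c * c * c) * β - + 8 * k₁ * c * (β * β * β) - + 16 * k₂
      * (β * β * β * β)) + ((e - h * h) * (c * c * (c * c)) * (β * β) + + 4 * k₁ * (c * c * c) * (β *
      β * β) - + 16 * h * k₂ * c * (β * β * β * β * β) + + 16 * (k₁ * k₁ - e * k₂) * (β * β * β * β *
      β * β)))
    ≡ - ((e - h * h) * (c * c * (c * c)) * β) * (β - + 2 * α)
  module-ring₁₃ = solve-∀

  module Duplication (n₁ n₂ n₃ n₄ h e k₁ k₂ : ℤ)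
    (e₁ : n₁ + n₂ + n₃ + n₄ ≡ + 2 * h)
    (e₂ : n₁ * n₂ + n₁ * n₃ + n₁ * n₄ + n₂ * n₃ + n₂ * n₄ + n₃ * n₄ ≡ e)
    (e₃ : n₁ * n₂ * n₃ + n₁ * n₂ * n₄ + n₁ * n₃ * n₄ + n₂ * n₃ * n₄ ≡ + 2 * k₁)
    (e₄ : n₁ * n₂ * n₃ * n₄ ≡ k₂)
    where

    -- The congruence conditions put the point 2-adically near the origin and survive duplication.
    -- For even β and odd c all roots are odd, and `product` normalizes their signs so that the
    -- number s in `duplicate` is an odd integer.
    record Point : Set where
      field
        α β c y₁ y₂ y₃ y₄ : ℤ
        h₁ : c + n₁ * (+ 2 * β) ≡ y₁ * y₁
        h₂ : c + n₂ * (+ 2 * β) ≡ y₂ * y₂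
        h₃ : c + n₃ * (+ 2 * β) ≡ y₃ * y₃
        h₄ : c + n₄ * (+ 2 * β) ≡ y₄ * y₄
        β≡2α : β ≡ + 2 * α
        β≢0 : β ≢ 0ℤ
        c-odd : Oddᶻ c
        product : One-mod-4 (y₁ * y₂ * y₃ * y₄)

    -- The nᵢ are the roots of one monic quartic; this relation eliminates n⁴, so that a single
    -- identity serves all four.
    IsRoot : ℤ → Set
    IsRoot n = n * n * (n * n) ≡ + 2 * h * (n * n * n) - e * (n * n) + + 2 * k₁ * n - k₂

    root₁ : IsRoot n₁
    root₁ = lin₂ (n₁ * n₁ * n₁) (- (n₁ * n₁)) e₁ e₂ (lin₂ n₁ (- 1ℤ) e₃ e₄ (module-ring₁ n₁ h e k₁ k₂ n₂ n₃ n₄))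

    root₂ : IsRoot n₂
    root₂ = lin₂ (n₂ * n₂ * n₂) (- (n₂ * n₂)) e₁ e₂ (lin₂ n₂ (- 1ℤ) e₃ e₄ (module-ring₂ n₂ h e k₁ k₂ n₁ n₃ n₄))

    root₃ : IsRoot n₃
    root₃ = lin₂ (n₃ * n₃ * n₃) (- (n₃ * n₃)) e₁ e₂ (lin₂ n₃ (- 1ℤ) e₃ e₄ (module-ring₃ n₃ h e k₁ k₂ n₁ n₂ n₄))

    root₄ : IsRoot n₄
    root₄ = lin₂ (n₄ * n₄ * n₄) (- (n₄ * n₄)) e₁ e₂ (lin₂ n₄ (- 1ℤ) e₃ e₄ (module-ring₄ n₄ h e k₁ k₂ n₁ n₂ n₃))

    module _ {α β c y₁ y₂ y₃ y₄ : ℤ}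
      (h₁ : c + n₁ * (+ 2 * β) ≡ y₁ * y₁) (h₂ : c + n₂ * (+ 2 * β) ≡ y₂ * y₂) (h₃ : c + n₃ * (+ 2 * β) ≡ y₃ * y₃) (h₄ : c + n₄ * (+ 2 * β) ≡ y₄ * y₄)
      (β≡2α : β ≡ + 2 * α) (β≢0 : β ≢ 0ℤ) (c-odd : Oddᶻ c) (product : One-mod-4 (y₁ * y₂ * y₃ * y₄))
      where

      -- The doubled point, free of denominators, has `center s` in place of c and 2 · `factor s` ·
      -- β in place of β, where s = (c² + 2hβc + y₁y₂y₃y₄)/2. The new root belonging to n is
      -- `root s n`.
      center factor : ℤ → ℤ
      center s = s * (c * c * (c * c) + + 2 * h * (c * c * c) * β - + 8 * k₁ * c * (β * β * β) - + 16 * k₂ * (β * β * β * β)) + ((e - h * h) * (c * c * (c * c)) * (β * β) + + 4 * k₁ * (c * c * c) * (β * β * β) - + 16 * h * k₂ * c * (β * β * β * β * β) + + 16 * (k₁ * k₁ - e * k₂) * (β * β * β * β * β * β))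
      factor s = s * (c * c * c + + 3 * h * (c * c) * β + + 2 * e * c * (β * β) + + 4 * k₁ * (β * β * β)) + ((e - h * h) * (c * c * c) * (β * β) + + 6 * k₁ * (c * c) * (β * β * β) + (+ 8 * k₂ + + 4 * h * k₁) * c * (β * β * β * β) + + 8 * h * k₂ * (β * β * β * β * β))

      root : ℤ → ℤ → ℤ
      root s n = (c + n * (+ 2 * β)) * s + (+ 2 * (h * n - n * n) * (β * β) * c + + 4 * (n * n * n - + 2 * h * (n * n) + e * n - k₁) * (β * β * β))

      -- Both sides are linear in s once s² is replaced.
      square : ∀ s n → IsRoot n → s * s ≡ s * (c * c + + 2 * h * β * c) + ((e - h * h) * (β * β) * (c * c) + + 4 * k₁ * (β * β * β) * c + + 4 * k₂ * (β * β * β * β)) → center s + n * (+ 2 * (+ 2 * factor s * β)) ≡ root s n * root s n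
      square s n q s² = linear (c + n * (+ 2 * β)) (c * c + + 2 * h * β * c) ((e - h * h) * (β * β) * (c * c) + + 4 * k₁ * (β * β * β) * c + + 4 * k₂ * (β * β * β * β)) (+ 2 * (h * n - n * n) * (β * β) * c + + 4 * (n * n * n - + 2 * h * (n * n) + e * n - k₁) * (β * β * β)) (c * c * (c * c) + + 2 * h * (c * c * c) * β - + 8 * k₁ * c * (β * β * β) - + 16 * k₂ * (β * β * β * β)) ((e - h * h) * (c * c * (c * c)) * (β * β) + + 4 * k₁ * (c * c * c) * (β * β * β) - + 16 * h * k₂ * c * (β * β * β * β * β) + + 16 * (k₁ * k₁ - e * k₂) * (β * β * β * β * β * β)) (c * c * c + + 3 * h * (c * c) * β + + 2 * e * c * (β * β) + + 4 * k₁ * (β * β * β)) ((e - h * h) * (c * c * c) * (β * β) + + 6 * k₁ * (c * c) * (β * β * β) + (+ 8 * k₂ + + 4 * h * k₁) * c * (β * β * β * β) + + 8 * h * k₂ * (β * β * β * β * β)) s²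
        (lin₁ (- + 16 * β * β * β * β) q (module-ring₅ c h β k₁ k₂ n e))
        (lin₁ (- + 16 * c * h * β * β * β * β * β + + 16 * c * n * β * β * β * β * β - + 4 * c * c * β * β * β * β - + 16 * e * β * β * β * β * β * β + + 32 * h * n * β * β * β * β * β * β - + 16 * n * n * β * β * β * β * β * β) q (module-ring₆ e h c β k₁ k₂ n))
        where
        linear : ∀ L K D E c₁ c₀ f₁ f₀ → s * s ≡ s * K + D → c₁ + n * (+ 2 * (+ 2 * f₁ * β)) ≡ L * L * K + + 2 * L * E → c₀ + n * (+ 2 * (+ 2 * f₀ * β)) ≡ L * L * D + E * E →
          s * c₁ + c₀ + n * (+ 2 * (+ 2 * (s * f₁ + f₀) * β)) ≡ (L * s + E) * (L * s + E)
        linear L K D E c₁ c₀ f₁ f₀ s² h₁ h₀ = lin₃ (- (L * L)) s 1ℤ s² h₁ h₀ (module-ring₇ s c₁ c₀ n f₁ f₀ β L E K D)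

      offset : ℤ → ℤ → ℤ
      offset s n = n * α * s + + 2 * (h * n - n * n) * (α * α) * c + + 8 * (n * n * n - + 2 * h * (n * n) + e * n - k₁) * (α * α * α)

      -- Every term other than cs contains 2β or β², and β is even. With c and s odd,
      -- `product-mod-4` then restores the condition on the product of the roots.
      root-mod-4 : ∀ s n → root s n ≡ c * s + + 4 * offset s n
      root-mod-4 s n = lemma ((h * n - n * n)) ((n * n * n - + 2 * h * (n * n) + e * n - k₁)) β≡2α
        where
        lemma : ∀ l m → β ≡ + 2 * α → (c + n * (+ 2 * β)) * s + (+ 2 * l * (β * β) * c + + 4 * m * (β * β * β)) ≡ c * s + + 4 * (n * α * s + + 2 * l * (α * α) * c + + 8 * m * (α * α * α))
        lemma l m e = lin₁ (+ 2 * n * s + + 2 * l * c * (β + + 2 * α) + + 4 * m * (β * β + + 2 * α * β + + 4 * (α * α))) e (module-ring₈ c n β s l m α)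

      Y² : y₁ * y₂ * y₃ * y₄ * (y₁ * y₂ * y₃ * y₄) ≡ c * c * (c * c) + + 4 * h * β * (c * c * c) + + 4 * e * (β * β) * (c * c) + + 16 * k₁ * (β * β * β) * c + + 16 * k₂ * (β * β * β * β)
      Y² = trans (regroup y₁ y₂ y₃ y₄) (trans (sym (cong₂ _*_ (cong₂ _*_ (cong₂ _*_ h₁ h₂) h₃) h₄))
        (lin₂ (+ 2 * β * (c * c * c)) (+ 4 * (β * β) * (c * c)) e₁ e₂ (lin₂ (+ 8 * (β * β * β) * c) (+ 16 * (β * β * β * β)) e₃ e₄ (module-ring₉ c n₁ β n₂ n₃ n₄ h e k₁ k₂))))
        where
        regroup : ∀ a b c d → a * b * c * d * (a * b * c * d) ≡ a * a * (b * b) * (c * c) * (d * d)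
        regroup = solve-∀

      duplicate : ∃ λ M → ∃ λ (Q : Point) → Point.β Q ≡ + 2 * M * β
      duplicate = build c-odd product
        where
        build : Oddᶻ c → One-mod-4 (y₁ * y₂ * y₃ * y₄) → ∃ λ M → ∃ λ (Q : Point) → Point.β Q ≡ + 2 * M * β
        build (γ , c≡) (η , Y≡) = with-s (1ℤ + + 2 * (γ + γ * γ + h * α * c + η)) (γ + γ * γ + h * α * c + η , refl)
            (half (y₁ * y₂ * y₃ * y₄) Y≡)
          where
          half : ∀ Y → Y ≡ 1ℤ + + 4 * η → + 2 * (1ℤ + + 2 * (γ + γ * γ + h * α * c + η)) ≡ c * c + + 2 * h * β * c + Y
          half Y e = lin₃ (- (c + 1ℤ + + 2 * γ)) (- 1ℤ) (- (+ 2 * h * c)) c≡ e β≡2α (module-ring₁₀ γ h α c η β Y)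
          with-s : ∀ s → Oddᶻ s → + 2 * s ≡ c * c + + 2 * h * β * c + y₁ * y₂ * y₃ * y₄ → ∃ λ M → ∃ λ (Q : Point) → Point.β Q ≡ + 2 * M * β
          with-s s s-odd hs = factor s , record
            { α = factor s * β ; β = + 2 * factor s * β ; c = center s
            ; y₁ = root s n₁ ; y₂ = root s n₂ ; y₃ = root s n₃ ; y₄ = root s n₄
            ; h₁ = square s n₁ root₁ s² ; h₂ = square s n₂ root₂ s² ; h₃ = square s n₃ root₃ s² ; h₄ = square s n₄ root₄ s²
            ; β≡2α = ℤ.*-assoc (+ 2) (factor s) β
            ; β≢0 = *-≢0 {+ 2 * factor s} {β} (*-≢0 {+ 2} {factor s} (λ ()) (odd-≢0 factor-odd)) β≢0
            ; c-odd = center-odd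
            ; product = product-mod-4 {c * s} (odd-*ᶻ c-odd s-odd) (offset s n₁) (offset s n₂) (offset s n₃) (offset s n₄) (root-mod-4 s n₁) (root-mod-4 s n₂) (root-mod-4 s n₃) (root-mod-4 s n₄)
            } , refl
            where
            s² : s * s ≡ s * (c * c + + 2 * h * β * c) + ((e - h * h) * (β * β) * (c * c) + + 4 * k₁ * (β * β * β) * c + + 4 * k₂ * (β * β * β * β))
            s² = *-cancelˡ {+ 4} (λ ()) (from (y₁ * y₂ * y₃ * y₄) Y² hs)
              where
              from : ∀ Y → Y * Y ≡ c * c * (c * c) + + 4 * h * β * (c * c * c) + + 4 * e * (β * β) * (c * c) + + 16 * k₁ * (β * β * β) * c + + 16 * k₂ * (β * β * β * β) →
                + 2 * s ≡ c * c + + 2 * h * β * c + Y → + 4 * (s * s) ≡ + 4 * (s * (c * c + + 2 * h * β * c) + ((e - h * h) * (β * β) * (c * c) + + 4 * k₁ * (β * β * β) * c + + 4 * k₂ * (β * β * β * β)))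
              from Y hY h′ = lin₂ 1ℤ (+ 2 * s - c * c - + 2 * h * β * c + Y) hY h′ (module-ring₁₁ s c h β e k₁ k₂ Y)
            factor-odd : Oddᶻ (factor s)
            factor-odd = subst Oddᶻ (regroup β≡2α) (odd-+2* _ (odd-*ᶻ s-odd (odd-*ᶻ (odd-*ᶻ c-odd c-odd) c-odd)))
              where
              regroup : β ≡ + 2 * α → s * (c * c * c) + + 2 * (s * (+ 3 * h * (c * c) * α + e * c * (β * β) + + 2 * k₁ * (β * β * β))
                + (e - h * h) * (c * c * c) * (α * β) + + 3 * k₁ * (c * c) * (β * β * β) + (+ 4 * k₂ + + 2 * h * k₁) * c * (β * β * β * β) + + 4 * h * k₂ * (β * β * β * β * β)) ≡
                s * (c * c * c + + 3 * h * (c * c) * β + + 2 * e * c * (β * β) + + 4 * k₁ * (β * β * β)) + ((e - h * h) * (c * c * c) * (β * β) + + 6 * k₁ * (c * c) * (β * β * β) + (+ 8 * k₂ + + 4 * h * k₁) * c * (β * β * β * β) + + 8 * h * k₂ * (β * β * β * β * β))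
              regroup e′ = lin₁ (- (+ 3 * s * h * (c * c) + (e - h * h) * (c * c * c) * β)) e′ (module-ring₁₂ s c h α e β k₁ k₂)
            center-odd : Oddᶻ (center s)
            center-odd = subst Oddᶻ (regroup β≡2α) (odd-+2* _ (odd-*ᶻ s-odd (odd-*ᶻ (odd-*ᶻ c-odd c-odd) (odd-*ᶻ c-odd c-odd))))
              where
              regroup : β ≡ + 2 * α → s * (c * c * (c * c)) + + 2 * (s * (h * (c * c * c) * β - + 4 * k₁ * c * (β * β * β) - + 8 * k₂ * (β * β * β * β))
                + (e - h * h) * (c * c * (c * c)) * (α * β) + + 2 * k₁ * (c * c * c) * (β * β * β) - + 8 * h * k₂ * c * (β * β * β * β * β) + + 8 * (k₁ * k₁ - e * k₂) * (β * β * β * β * β * β)) ≡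
                s * (c * c * (c * c) + + 2 * h * (c * c * c) * β - + 8 * k₁ * c * (β * β * β) - + 16 * k₂ * (β * β * β * β)) + ((e - h * h) * (c * c * (c * c)) * (β * β) + + 4 * k₁ * (c * c * c) * (β * β * β) - + 16 * h * k₂ * c * (β * β * β * β * β) + + 16 * (k₁ * k₁ - e * k₂) * (β * β * β * β * β * β))
              regroup e′ = lin₁ (- ((e - h * h) * (c * c * (c * c)) * β)) e′ (module-ring₁₃ s c h β k₁ k₂ e α)

  -- The elementary symmetric functions of 1, 9, 25, 49 are 2 · 42, 1974, 2 · 6458 and 11025.
  open Duplication (+ 1) (+ 9) (+ 25) (+ 49) (+ 42) (+ 1974) (+ 6458) (+ 11025) refl refl refl refl

  -- Opacity keeps the rapidly growing coordinates of the multiples from being evaluated.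
  opaque
    double : ∀ P → ∃ λ M → ∃ λ Q → Point.β Q ≡ + 2 * M * Point.β P
    double P = duplicate {P.α} {P.β} {P.c} {P.y₁} {P.y₂} {P.y₃} {P.y₄} P.h₁ P.h₂ P.h₃ P.h₄ P.β≡2α P.β≢0 P.c-odd P.product
      where module P = Point P

  -- The seed is an explicit point with β even, c odd and the signs of the roots chosen so that
  -- their product is 1 modulo 4; evaluation verifies all its conditions.
  point : ℕ → Point
  point zero = record
    { α = -[1+ 4571640437167803895270035668578 ] ; β = -[1+ 9143280874335607790540071337157 ] ; c = + 2118126773415746011531979024988525
    ; y₁ = -[1+ 45824013482748046 ] ; y₂ = + 44198956069999041 ; y₃ = + 40754910497987425 ; y₄ = -[1+ 34958335883317678 ]
    ; h₁ = refl ; h₂ = refl ; h₃ = refl ; h₄ = refl ; β≡2α = refl ; β≢0 = λ ()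
    ; c-odd = + 1059063386707873005765989512494262 , refl
    ; product = + 721399503664281532256520345404915140690457522187176935957366651256 , refl }
  point (suc i) = proj₁ (proj₂ (double (point i)))

  β c : ℕ → ℤ
  β i = Point.β (point i)
  c i = Point.c (point i)

  β-multiple : ∀ i d → ∃ λ M → β (suc d ℕ.+ i) ≡ + 2 * M * β i
  β-multiple i zero = proj₁ (double (point i)) , proj₂ (proj₂ (double (point i)))
  β-multiple i (suc d) = step (β (suc d ℕ.+ i)) (β-multiple i d) (proj₁ (double (point (suc d ℕ.+ i)))) (proj₂ (proj₂ (double (point (suc d ℕ.+ i)))))
    where
    step : ∀ x → (∃ λ M → x ≡ + 2 * M * β i) → ∀ M′ → β (suc (suc d ℕ.+ i)) ≡ + 2 * M′ * x → ∃ λ M → β (suc (suc d ℕ.+ i)) ≡ + 2 * M * β i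
    step x (M , e) M′ e′ = + 2 * M′ * M , trans e′ (trans (cong (+ 2 * M′ *_) e) (l M M′ (β i)))
      where
      l : ∀ M M′ a → + 2 * M′ * (+ 2 * M * a) ≡ + 2 * (+ 2 * M′ * M) * a
      l = solve-∀

  -- The expansion of c + 2α(2x - 1)², symmetric about x = 1/2: at x = 1, 2, 3, 4 and at their
  -- mirror images the multipliers of 2α are 1, 9, 25, 49.
  symmetric-8 : ℤ → ℤ → Quad
  symmetric-8 α c = quad (+ 4 * (+ 2 * α)) (- (+ 4 * (+ 2 * α))) (c + + 2 * α)

  square-values : ∀ {f} → IsSquarePoly f → ∀ x → IsSquare (evalQ f x)
  square-values (g , h) x = evalP g x , h x

  -- One polynomial serves four lengths, since the interval of length 8 about 1/2 contains those of
  -- length 2, 4 and 6 with the same centre.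
  member-8 : ∀ {α c y₁ y₃ y₅ y₇} → c + + 1 * (+ 2 * α) ≡ y₁ * y₁ → c + + 9 * (+ 2 * α) ≡ y₃ * y₃ → c + + 25 * (+ 2 * α) ≡ y₅ * y₅ → c + + 49 * (+ 2 * α) ≡ y₇ * y₇ →
    α ≢ 0ℤ → c ≢ 0ℤ → (InB 2 (symmetric-8 α c) × InB 4 (symmetric-8 α c)) × (InB 6 (symmetric-8 α c) × InB 8 (symmetric-8 α c))
  member-8 {α} {c} {y₁} {y₃} {y₅} {y₇} h₁ h₃ h₅ h₇ α≢0 c≢0 =
    (member 2 0ℤ (λ { 0 _ → v₋₁ ; 1 _ → v₁ ; (suc (suc _)) (ℕ.s≤s (ℕ.s≤s ())) }) (trans (value 0ℤ 1ℤ refl) (sym (value (+ 1) 1ℤ refl))) ,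
     member 4 (- + 1) (λ { 0 _ → v₋₃ ; 1 _ → v₋₁ ; 2 _ → v₁ ; 3 _ → v₃ ; (suc (suc (suc (suc _)))) (ℕ.s≤s (ℕ.s≤s (ℕ.s≤s (ℕ.s≤s ())))) }) (trans (value (- + 1) (+ 9) refl) (sym (value (+ 2) (+ 9) refl)))) ,
    (member 6 (- + 2) (λ { 0 _ → v₋₅ ; 1 _ → v₋₃ ; 2 _ → v₋₁ ; 3 _ → v₁ ; 4 _ → v₃ ; 5 _ → v₅ ; (suc (suc (suc (suc (suc (suc _)))))) (ℕ.s≤s (ℕ.s≤s (ℕ.s≤s (ℕ.s≤s (ℕ.s≤s (ℕ.s≤s ())))))) }) (trans (value (- + 2) (+ 25) refl) (sym (value (+ 3) (+ 25) refl))) ,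
     member 8 (- + 3) (λ { 0 _ → v₋₇ ; 1 _ → v₋₅ ; 2 _ → v₋₃ ; 3 _ → v₋₁ ; 4 _ → v₁ ; 5 _ → v₃ ; 6 _ → v₅ ; 7 _ → v₇ ; (suc (suc (suc (suc (suc (suc (suc (suc _)))))))) (ℕ.s≤s (ℕ.s≤s (ℕ.s≤s (ℕ.s≤s (ℕ.s≤s (ℕ.s≤s (ℕ.s≤s (ℕ.s≤s ())))))))) }) (trans (value (- + 3) (+ 49) refl) (sym (value (+ 4) (+ 49) refl))))
    where
    f : Quad
    f = symmetric-8 α c
    value : ∀ x k → (+ 2 * x - 1ℤ) * (+ 2 * x - 1ℤ) ≡ k → evalQ f x ≡ c + k * (+ 2 * α)
    value x k e = trans (l α c x) (cong (λ k → c + k * (+ 2 * α)) e)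
      where
      l : ∀ α c x → + 4 * (+ 2 * α) * x * x + - (+ 4 * (+ 2 * α)) * x + (c + + 2 * α) ≡ c + (+ 2 * x - 1ℤ) * (+ 2 * x - 1ℤ) * (+ 2 * α)
      l = solve-∀
    v₋₇ : IsSquare (evalQ f (- + 3))
    v₋₇ = y₇ , trans (value (- + 3) (+ 49) refl) h₇
    v₋₅ : IsSquare (evalQ f (- + 2))
    v₋₅ = y₅ , trans (value (- + 2) (+ 25) refl) h₅
    v₋₃ : IsSquare (evalQ f (- + 1))
    v₋₃ = y₃ , trans (value (- + 1) (+ 9) refl) h₃
    v₋₁ : IsSquare (evalQ f 0ℤ)
    v₋₁ = y₁ , trans (value 0ℤ 1ℤ refl) h₁
    v₁ : IsSquare (evalQ f (+ 1))
    v₁ = y₁ , trans (value (+ 1) 1ℤ refl) h₁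
    v₃ : IsSquare (evalQ f (+ 2))
    v₃ = y₃ , trans (value (+ 2) (+ 9) refl) h₃
    v₅ : IsSquare (evalQ f (+ 3))
    v₅ = y₅ , trans (value (+ 3) (+ 25) refl) h₅
    v₇ : IsSquare (evalQ f (+ 4))
    v₇ = y₇ , trans (value (+ 4) (+ 49) refl) h₇
    -- The square of a polynomial would also take a square value at x = 5.
    not-square : ¬ IsSquarePoly f
    not-square sq = from (square-values {f} sq (+ 5))
      where
      from : IsSquare (evalQ f (+ 5)) → ⊥
      from (y₉ , e) = contra (five-squares {c} {+ 2 * α} {y₁} {y₃} {y₅} {y₇} {y₉} (trans (cong (λ x → c + x) (sym (ℤ.*-identityˡ (+ 2 * α)))) h₁) h₃ h₅ h₇
          (trans (sym (value (+ 5) (+ 81) refl)) e))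
        where
        contra : + 2 * α ≡ 0ℤ ⊎ c ≡ 0ℤ → ⊥
        contra (inj₁ z) = *-≢0 {+ 2} {α} (λ ()) α≢0 z
        contra (inj₂ z) = c≢0 z
    member : ∀ N r → (∀ i → i ℕ.< N → IsSquare (evalQ f (r + + i))) → evalQ f r ≡ evalQ f (r + + (N ℕ.∸ 1)) → InB N f
    member N r squares symmetric = *-≢0 {+ 4} {+ 2 * α} (λ ()) (*-≢0 {+ 2} {α} (λ ()) α≢0) , not-square , r , squares , symmetric

  family-8 : ℕ → Quad
  family-8 i = symmetric-8 (β i) (c i)

  member-of-8 : ∀ i → (InB 2 (family-8 i) × InB 4 (family-8 i)) × (InB 6 (family-8 i) × InB 8 (family-8 i))
  member-of-8 i = member-8 {β i} {c i} {P.y₁} {P.y₂} {P.y₃} {P.y₄} P.h₁ P.h₂ P.h₃ P.h₄ P.β≢0 (odd-≢0 P.c-odd)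
    where module P = Point (point i)

  equivalent⇒proportional-ring₁ : ∀ u v α d β c →
    + 8 * (u * u) * (v * v) * (α * d) - + 8 * (u * u) * (v * v) * (β * c)
    ≡ (v * v * d + + 2 * (v * v) * β) * (u * u * (+ 4 * (+ 2 * α)) - v * v * (+ 4 * (+ 2 * β))) + -
      (+ 8 * (v * v * β)) * (u * u * (c + + 2 * α) - v * v * (d + + 2 * β))
  equivalent⇒proportional-ring₁ = solve-∀

  equivalent⇒proportional : ∀ {α c β d} → symmetric-8 α c ∼ symmetric-8 β d → α * d ≡ β * c
  equivalent⇒proportional {α} {c} {β} {d} (u , v , u≢0 , v≢0 , h₂ , _ , h₀) = cross u v u≢0 v≢0 h₂ h₀
    where
    cross : ∀ u v → u ≢ 0ℤ → v ≢ 0ℤ → u * u * (+ 4 * (+ 2 * α)) ≡ v * v * (+ 4 * (+ 2 * β)) → u * u * (c + + 2 * α) ≡ v * v * (d + + 2 * β) → α * d ≡ β * c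
    cross u v u≢0 v≢0 h₂ h₀ = *-cancelˡ {+ 8 * (u * u) * (v * v)} (*-≢0 {+ 8 * (u * u)} {v * v} (*-≢0 {+ 8} {u * u} (λ ()) (*-≢0 u≢0 u≢0)) (*-≢0 v≢0 v≢0))
      (lin₂ (v * v * d + + 2 * (v * v) * β) (- (+ 8 * (v * v * β))) h₂ h₀ (equivalent⇒proportional-ring₁ u v α d β c))

  distinct-multiple : ∀ {α c β d M} → α ≢ 0ℤ → Oddᶻ d → β ≡ + 2 * M * α → α * d ≢ β * c
  distinct-multiple {α} {c} {β} {d} {M} α≢0 (q , d≡) β≡ h = even≢odd (*-cancelˡ {α} α≢0 (lin₂ 1ℤ c h β≡ (solve (α ∷ c ∷ β ∷ d ∷ M ∷ []))))
    where
    even≢odd : d ≢ + 2 * (M * c)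
    even≢odd e = absurd-∣ (+ 2) 1ℤ (M * c - q , lin₂ (- 1ℤ) 1ℤ d≡ e (solve (d ∷ M ∷ c ∷ q ∷ [])))

  -- Equivalent members have the same ratio of β to c. For i < j, however, `β j` is an even multiple
  -- of `β i`, and equality of the ratios would make `c j` even.
  inequivalent-8 : ∀ i j → i ≢ j → ¬ (family-8 i ∼ family-8 j)
  inequivalent-8 i j i≢j eq = compare (ℕ.<-cmp i j)
    where
    proportional : β i * c j ≡ β j * c i
    proportional = equivalent⇒proportional {β i} {c i} {β j} {c j} eq
    ordered : ∀ i j → i ℕ.< j → β i * c j ≢ β j * c i
    ordered i j i<j = distinct-multiple {β i} {c i} {β j} {c j} {proj₁ multiple} (Point.β≢0 (point i)) (Point.c-odd (point j)) (proj₂ multiple)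
      where
      multiple : ∃ λ M → β j ≡ + 2 * M * β i
      multiple = subst (λ n → ∃ λ M → β n ≡ + 2 * M * β i) (trans (sym (ℕ.+-suc (j ℕ.∸ suc i) i)) (ℕ.m∸n+n≡m i<j)) (β-multiple i (j ℕ.∸ suc i))
    compare : _ → ⊥
    compare (tri< i<j _ _) = ordered i j i<j proportional
    compare (tri≈ _ i≡j _) = i≢j i≡j
    compare (tri> _ _ j<i) = ordered j i j<i (sym proportional)

  infinite-8 : BInfinite 2 × BInfinite 4 × BInfinite 6 × BInfinite 8
  infinite-8 = (family-8 , (λ i → proj₁ (proj₁ (member-of-8 i))) , inequivalent-8)
    , (family-8 , (λ i → proj₂ (proj₁ (member-of-8 i))) , inequivalent-8)
    , (family-8 , (λ i → proj₁ (proj₂ (member-of-8 i))) , inequivalent-8)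
    , (family-8 , (λ i → proj₂ (proj₂ (member-of-8 i))) , inequivalent-8)

-- Infinitely many members for N = 1, 3, 5: a polynomial family.

module Families5 where

  open import Defs using (Quad; quad; evalQ; IsSquare; IsSquarePoly; InB; BInfinite; _∼_)
  open IntTools
  open Seven using (Oddᶻ; odd-square)
  open SevenC using (four-squares)
  open Families8 using (square-values)
  open import Data.Integer using (ℤ; +_; -[1+_]; _+_; _*_; -_; _-_; ∣_∣; 0ℤ; 1ℤ)
  import Data.Integer as ℤ
  import Data.Integer.Properties as ℤ
  open import Data.Integer.Tactic.RingSolver using (solve; solve-∀)
  open import Data.Nat as ℕ using (ℕ; zero; suc)
  import Data.Nat.Properties as ℕ
  open import Data.Product using (∃; _×_; _,_; proj₁; proj₂)
  open import Data.Sum using (_⊎_; inj₁; inj₂)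
  open import Data.Empty using (⊥; ⊥-elim)
  open import Data.List using (_∷_; [])
  open import Relation.Nullary using (¬_; Dec; yes; no; contradiction)
  open import Relation.Binary.PropositionalEquality
  open import Relation.Binary.Definitions using (tri<; tri≈; tri>)

  -- With u = t + 3 the values at 0, 1, 2 are (4u)², (u² + 3)² and (2(u² - 3))².
  symmetric-5 : ℤ → Quad
  symmetric-5 t = quad (t * (t + + 2) * (t + + 4) * (t + + 6)) 0ℤ (+ 16 * ((t + + 3) * (t + + 3)))

  member-5 : ∀ t → t * (t + + 2) * (t + + 4) * (t + + 6) ≢ 0ℤ → + 16 * ((t + + 3) * (t + + 3)) ≢ 0ℤ → InB 1 (symmetric-5 t) × InB 3 (symmetric-5 t) × InB 5 (symmetric-5 t)
  member-5 t a≢0 c≢0 =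
    member 1 0ℤ (λ { 0 _ → v₀ ; (suc _) (ℕ.s≤s ()) }) (trans (value 0ℤ 0ℤ refl) (sym (value 0ℤ 0ℤ refl))) ,
    member 3 (- + 1) (λ { 0 _ → v₋₁ ; 1 _ → v₀ ; 2 _ → v₁ ; (suc (suc (suc _))) (ℕ.s≤s (ℕ.s≤s (ℕ.s≤s ()))) }) (trans (value (- + 1) 1ℤ refl) (sym (value (+ 1) 1ℤ refl))) ,
    member 5 (- + 2) (λ { 0 _ → v₋₂ ; 1 _ → v₋₁ ; 2 _ → v₀ ; 3 _ → v₁ ; 4 _ → v₂ ; (suc (suc (suc (suc (suc _))))) (ℕ.s≤s (ℕ.s≤s (ℕ.s≤s (ℕ.s≤s (ℕ.s≤s ()))))) }) (trans (value (- + 2) (+ 4) refl) (sym (value (+ 2) (+ 4) refl)))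
    where
    f : Quad
    f = symmetric-5 t
    A C : ℤ
    A = t * (t + + 2) * (t + + 4) * (t + + 6)
    C = + 16 * ((t + + 3) * (t + + 3))
    value : ∀ x k → x * x ≡ k → evalQ f x ≡ C + k * A
    value x k e = trans (l A C x) (cong (λ k → C + k * A) e)
      where
      l : ∀ a c x → a * x * x + 0ℤ * x + c ≡ c + x * x * a
      l = solve-∀
    square₀ : C ≡ + 4 * (t + + 3) * (+ 4 * (t + + 3))
    square₀ = l t
      where
      l : ∀ t → + 16 * ((t + + 3) * (t + + 3)) ≡ + 4 * (t + + 3) * (+ 4 * (t + + 3))
      l = solve-∀
    square₁ : C + 1ℤ * A ≡ ((t + + 3) * (t + + 3) + + 3) * ((t + + 3) * (t + + 3) + + 3)
    square₁ = l t
      where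
      l : ∀ t → + 16 * ((t + + 3) * (t + + 3)) + 1ℤ * (t * (t + + 2) * (t + + 4) * (t + + 6)) ≡ ((t + + 3) * (t + + 3) + + 3) * ((t + + 3) * (t + + 3) + + 3)
      l = solve-∀
    square₂ : C + + 4 * A ≡ + 2 * ((t + + 3) * (t + + 3) - + 3) * (+ 2 * ((t + + 3) * (t + + 3) - + 3))
    square₂ = l t
      where
      l : ∀ t → + 16 * ((t + + 3) * (t + + 3)) + + 4 * (t * (t + + 2) * (t + + 4) * (t + + 6)) ≡ + 2 * ((t + + 3) * (t + + 3) - + 3) * (+ 2 * ((t + + 3) * (t + + 3) - + 3))
      l = solve-∀
    v₋₂ : IsSquare (evalQ f (- + 2))
    v₋₂ = + 2 * ((t + + 3) * (t + + 3) - + 3) , trans (value (- + 2) (+ 4) refl) square₂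
    v₋₁ : IsSquare (evalQ f (- + 1))
    v₋₁ = (t + + 3) * (t + + 3) + + 3 , trans (value (- + 1) 1ℤ refl) square₁
    v₀ : IsSquare (evalQ f 0ℤ)
    v₀ = + 4 * (t + + 3) , trans (trans (value 0ℤ 0ℤ refl) (ℤ.+-identityʳ C)) square₀
    v₁ : IsSquare (evalQ f (+ 1))
    v₁ = (t + + 3) * (t + + 3) + + 3 , trans (value (+ 1) 1ℤ refl) square₁
    v₂ : IsSquare (evalQ f (+ 2))
    v₂ = + 2 * ((t + + 3) * (t + + 3) - + 3) , trans (value (+ 2) (+ 4) refl) square₂
    -- The square of a polynomial would also take a square value at x = 3, against `four-squares`.
    not-square : ¬ IsSquarePoly f
    not-square sq = from (square-values {f} sq (+ 3))
      where
      from : IsSquare (evalQ f (+ 3)) → ⊥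
      from (y₃ , e) = contra (four-squares {A} {C} {+ 4 * (t + + 3)} {(t + + 3) * (t + + 3) + + 3} {+ 2 * ((t + + 3) * (t + + 3) - + 3)} {y₃}
        square₀ (trans (cong (λ x → C + x) (sym (ℤ.*-identityˡ A))) square₁) square₂ (trans (sym (value (+ 3) (+ 9) refl)) e))
        where
        contra : A ≡ 0ℤ ⊎ C ≡ 0ℤ → ⊥
        contra (inj₁ z) = a≢0 z
        contra (inj₂ z) = c≢0 z
    member : ∀ N r → (∀ i → i ℕ.< N → IsSquare (evalQ f (r + + i))) → evalQ f r ≡ evalQ f (r + + (N ℕ.∸ 1)) → InB N f
    member N r squares symmetric = a≢0 , not-square , r , squares , symmetric

  family-5 : ℕ → Quad
  family-5 i = symmetric-5 (+ suc i)

  member-of-5 : ∀ i → InB 1 (family-5 i) × InB 3 (family-5 i) × InB 5 (family-5 i)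
  member-of-5 i = member-5 (+ suc i) (*-≢0 {+ suc i * (+ suc i + + 2) * (+ suc i + + 4)} {+ suc i + + 6} (*-≢0 {+ suc i * (+ suc i + + 2)} {+ suc i + + 4} (*-≢0 {+ suc i} {+ suc i + + 2} (λ ()) (λ ())) (λ ())) (λ ()))
    (*-≢0 {+ 16} {(+ suc i + + 3) * (+ suc i + + 3)} (λ ()) (*-≢0 {+ suc i + + 3} {+ suc i + + 3} (λ ()) (λ ())))

  -- With u = t + 3 the ratio of the leading to the constant coefficient is (u² + 9/u² - 10)/16,
  -- which agrees for u and u′ only if u² = u′² or uu′ = ±3. For positive parameters s and t all
  -- factors of the resulting product other than t - s are positive.
  inequivalent-5 : ∀ i j → i ≢ j → ¬ (family-5 i ∼ family-5 j)
  inequivalent-5 i j i≢j (u , v , u≢0 , v≢0 , h₂ , _ , h₀) = nonzero (proportional u v u≢0 v≢0 (+ suc i) (+ suc j) h₂ h₀)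
    where
    proportional : ∀ u v → u ≢ 0ℤ → v ≢ 0ℤ → ∀ s t → u * u * (s * (s + + 2) * (s + + 4) * (s + + 6)) ≡ v * v * (t * (t + + 2) * (t + + 4) * (t + + 6)) →
      u * u * (+ 16 * ((s + + 3) * (s + + 3))) ≡ v * v * (+ 16 * ((t + + 3) * (t + + 3))) →
      (t - s) * (+ 6 + s + t) * (+ 6 + (+ 3 * s + + 3 * t + s * t)) * (+ 12 + (+ 3 * s + + 3 * t + s * t)) ≡ 0ℤ
    proportional u v u≢0 v≢0 s t h₂ h₀ = *-cancelˡ {+ 16 * (u * u) * (v * v)} (*-≢0 {+ 16 * (u * u)} {v * v} (*-≢0 {+ 16} {u * u} (λ ()) (*-≢0 u≢0 u≢0)) (*-≢0 v≢0 v≢0))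
      (lin₂ (- (v * v * (+ 16 * ((t + + 3) * (t + + 3))))) (v * v * (t * (t + + 2) * (t + + 4) * (t + + 6))) h₂ h₀ (solve (u ∷ v ∷ s ∷ t ∷ [])))
    difference≢0 : + suc j - + suc i ≢ 0ℤ
    difference≢0 e = i≢j (sym (ℕ.suc-injective (ℤ.+-injective (ℤ.i-j≡0⇒i≡j (+ suc j) (+ suc i) e))))
    nonzero : (+ suc j - + suc i) * (+ 6 + + suc i + + suc j) * (+ 6 + (+ 3 * + suc i + + 3 * + suc j + + suc i * + suc j)) * (+ 12 + (+ 3 * + suc i + + 3 * + suc j + + suc i * + suc j)) ≢ 0ℤ
    nonzero = *-≢0 {(+ suc j - + suc i) * (+ 6 + + suc i + + suc j) * (+ 6 + (+ 3 * + suc i + + 3 * + suc j + + suc i * + suc j))}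
      (*-≢0 {(+ suc j - + suc i) * (+ 6 + + suc i + + suc j)} (*-≢0 {+ suc j - + suc i} difference≢0 (λ ())) (λ ())) (λ ())

  infinite-5 : BInfinite 1 × BInfinite 3 × BInfinite 5
  infinite-5 = (family-5 , (λ i → proj₁ (member-of-5 i)) , inequivalent-5)
    , (family-5 , (λ i → proj₁ (proj₂ (member-of-5 i))) , inequivalent-5)
    , (family-5 , (λ i → proj₂ (proj₂ (member-of-5 i))) , inequivalent-5)

-- Reduction of the theorem to the results on four and five squares.

open import Defs
open IntTools
open TenC
open SevenC
open Families8
open Families5
open import Data.Integer using (ℤ; +_; _+_; _*_; -_; _-_; 0ℤ; 1ℤ)
import Data.Integer as ℤ
import Data.Integer.Properties as ℤ
open import Data.Integer.Tactic.RingSolver using (solve; solve-∀)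
open import Data.Nat using (ℕ; _≤_; _≥_; _<_; zero; suc; z≤n; s≤s)
import Data.Nat as ℕ
import Data.Nat.Properties as ℕ
open import Data.Sum using (_⊎_; inj₁; inj₂)
open import Data.Product using (∃; _×_; _,_; proj₁; proj₂)
open import Data.Empty using (⊥; ⊥-elim)
open import Data.List using (_∷_; [])
open import Relation.Nullary using (¬_)
open import Relation.Binary.PropositionalEquality using (_≡_; _≢_; refl; sym; trans; cong; subst)

-- Equal values at r and r + n put the axis of symmetry at r + n / 2.
axis : ∀ a b c r n → n ≢ 0ℤ → a * r * r + b * r + c ≡ a * (r + n) * (r + n) + b * (r + n) + c → b ≡ - (a * (+ 2 * r + n))
axis a b c r n n≢0 h = *-cancelˡ {n} n≢0 (lin₁ (- 1ℤ) h (solve (a ∷ b ∷ c ∷ r ∷ n ∷ [])))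

-- The centre r + m is an integer, and f = C + a(x - r - m)²; the values at distances 0, 1, 2, 3
-- from it feed `four-squares`. If C = 0 then a = x₁², and f is the square of x₁(x - r - m).
odd-length : ∀ f r m → + 2 * m ≢ 0ℤ → evalQ f r ≡ evalQ f (r + + 2 * m) → (∀ j → j < 4 → IsSquare (evalQ f (r + (m + + j)))) →
  Quad.a f ≡ 0ℤ ⊎ IsSquarePoly f
odd-length (quad a b c) r m 2m≢0 symmetric square = centered (axis a b c r (+ 2 * m) 2m≢0 symmetric)
    (square 0 (s≤s z≤n)) (square 1 (s≤s (s≤s z≤n))) (square 2 (s≤s (s≤s (s≤s z≤n)))) (square 3 (s≤s (s≤s (s≤s (s≤s z≤n)))))
  where
  value : b ≡ - (a * (+ 2 * r + + 2 * m)) → ∀ x → a * (r + (m + x)) * (r + (m + x)) + b * (r + (m + x)) + c ≡ c - a * ((r + m) * (r + m)) + x * x * a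
  value b≡ x = lin₁ (r + (m + x)) b≡ (solve (a ∷ b ∷ c ∷ r ∷ m ∷ x ∷ []))
  centered : b ≡ - (a * (+ 2 * r + + 2 * m)) →
    IsSquare (evalQ (quad a b c) (r + (m + + 0))) → IsSquare (evalQ (quad a b c) (r + (m + + 1))) → IsSquare (evalQ (quad a b c) (r + (m + + 2))) → IsSquare (evalQ (quad a b c) (r + (m + + 3))) →
    a ≡ 0ℤ ⊎ IsSquarePoly (quad a b c)
  centered b≡ (x₀ , h₀) (x₁ , h₁) (x₂ , h₂) (x₃ , h₃) = cases (four-squares {a} {C} {x₀} {x₁} {x₂} {x₃}
      (trans (sym (ℤ.+-identityʳ C)) (trans (sym (value b≡ (+ 0))) h₀))
      a+C (trans (sym (value b≡ (+ 2))) h₂) (trans (sym (value b≡ (+ 3))) h₃))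
    where
    C : ℤ
    C = c - a * ((r + m) * (r + m))
    a+C : C + a ≡ x₁ * x₁
    a+C = trans (cong (λ x → C + x) (sym (ℤ.*-identityˡ a))) (trans (sym (value b≡ (+ 1))) h₁)
    cases : a ≡ 0ℤ ⊎ C ≡ 0ℤ → a ≡ 0ℤ ⊎ IsSquarePoly (quad a b c)
    cases (inj₁ a≡0) = inj₁ a≡0
    cases (inj₂ C≡0) = inj₂ (- (x₁ * (r + m)) ∷ x₁ ∷ [] , λ x → root x C≡0 a+C)
      where
      root : ∀ x → c - a * ((r + m) * (r + m)) ≡ 0ℤ → c - a * ((r + m) * (r + m)) + a ≡ x₁ * x₁ →
        a * x * x + b * x + c ≡ (- (x₁ * (r + m)) + x * (x₁ + x * 0ℤ)) * (- (x₁ * (r + m)) + x * (x₁ + x * 0ℤ))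
      root x C≡0 a≡ = lin₃ x (1ℤ - (x - (r + m)) * (x - (r + m))) ((x - (r + m)) * (x - (r + m))) b≡ C≡0 a≡ (solve (a ∷ b ∷ c ∷ r ∷ m ∷ x ∷ x₁ ∷ []))

-- The centre r + m + 1/2 is half an odd integer, so 4f = C + a(2x - 2(r + m) - 1)²; the values at r
-- + m + 1, ..., r + m + 5 feed `five-squares`. If C = 0 then a = (2y₁)², and f is the square of
-- y₁(2x - 2(r + m) - 1), with integral coefficients.
even-length : ∀ f r m → 1ℤ + + 2 * m ≢ 0ℤ → evalQ f r ≡ evalQ f (r + (1ℤ + + 2 * m)) → (∀ j → j < 5 → IsSquare (evalQ f (r + (m + + suc j)))) →
  Quad.a f ≡ 0ℤ ⊎ IsSquarePoly f
even-length (quad a b c) r m n≢0 symmetric square = centered (axis a b c r (1ℤ + + 2 * m) n≢0 symmetric)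
    (square 0 (s≤s z≤n)) (square 1 (s≤s (s≤s z≤n))) (square 2 (s≤s (s≤s (s≤s z≤n)))) (square 3 (s≤s (s≤s (s≤s (s≤s z≤n))))) (square 4 (s≤s (s≤s (s≤s (s≤s (s≤s z≤n))))))
  where
  C : ℤ
  C = + 4 * c - a * ((+ 2 * (r + m) + 1ℤ) * (+ 2 * (r + m) + 1ℤ))
  value : b ≡ - (a * (+ 2 * r + (1ℤ + + 2 * m))) → ∀ x y → a * (r + (m + x)) * (r + (m + x)) + b * (r + (m + x)) + c ≡ y * y →
    + 4 * c - a * ((+ 2 * (r + m) + 1ℤ) * (+ 2 * (r + m) + 1ℤ)) + (+ 2 * x - 1ℤ) * (+ 2 * x - 1ℤ) * a ≡ + 2 * y * (+ 2 * y)
  value b≡ x y h = lin₂ (- (+ 4 * (r + (m + x)))) (+ 4) b≡ h (solve (a ∷ b ∷ c ∷ r ∷ m ∷ x ∷ y ∷ []))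
  centered : b ≡ - (a * (+ 2 * r + (1ℤ + + 2 * m))) →
    IsSquare (evalQ (quad a b c) (r + (m + + 1))) → IsSquare (evalQ (quad a b c) (r + (m + + 2))) → IsSquare (evalQ (quad a b c) (r + (m + + 3))) →
    IsSquare (evalQ (quad a b c) (r + (m + + 4))) → IsSquare (evalQ (quad a b c) (r + (m + + 5))) →
    a ≡ 0ℤ ⊎ IsSquarePoly (quad a b c)
  centered b≡ (y₁ , h₁) (y₂ , h₂) (y₃ , h₃) (y₄ , h₄) (y₅ , h₅) = cases (five-squares {C} {a} {+ 2 * y₁} {+ 2 * y₂} {+ 2 * y₃} {+ 2 * y₄} {+ 2 * y₅}
      a+C (value b≡ (+ 2) y₂ h₂) (value b≡ (+ 3) y₃ h₃) (value b≡ (+ 4) y₄ h₄) (value b≡ (+ 5) y₅ h₅))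
    where
    a+C : C + a ≡ + 2 * y₁ * (+ 2 * y₁)
    a+C = trans (cong (λ x → C + x) (sym (ℤ.*-identityˡ a))) (value b≡ (+ 1) y₁ h₁)
    cases : a ≡ 0ℤ ⊎ C ≡ 0ℤ → a ≡ 0ℤ ⊎ IsSquarePoly (quad a b c)
    cases (inj₁ a≡0) = inj₁ a≡0
    cases (inj₂ C≡0) = inj₂ (- (y₁ * (+ 2 * (r + m) + 1ℤ)) ∷ + 2 * y₁ ∷ [] , λ x → *-cancelˡ {+ 4} (λ ()) (root x C≡0 a+C))
      where
      root : ∀ x → + 4 * c - a * ((+ 2 * (r + m) + 1ℤ) * (+ 2 * (r + m) + 1ℤ)) ≡ 0ℤ → + 4 * c - a * ((+ 2 * (r + m) + 1ℤ) * (+ 2 * (r + m) + 1ℤ)) + a ≡ + 2 * y₁ * (+ 2 * y₁) →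
        + 4 * (a * x * x + b * x + c) ≡ + 4 * ((- (y₁ * (+ 2 * (r + m) + 1ℤ)) + x * (+ 2 * y₁ + x * 0ℤ)) * (- (y₁ * (+ 2 * (r + m) + 1ℤ)) + x * (+ 2 * y₁ + x * 0ℤ)))
      root x C≡0 a≡ = lin₃ (+ 4 * x) (1ℤ - (+ 2 * x - (+ 2 * (r + m) + 1ℤ)) * (+ 2 * x - (+ 2 * (r + m) + 1ℤ))) ((+ 2 * x - (+ 2 * (r + m) + 1ℤ)) * (+ 2 * x - (+ 2 * (r + m) + 1ℤ)))
        b≡ C≡0 a≡ (solve (a ∷ b ∷ c ∷ r ∷ m ∷ x ∷ y₁ ∷ []))

ℕ-parity : ∀ n → (∃ λ m → n ≡ 2 ℕ.* m) ⊎ (∃ λ m → n ≡ 1 ℕ.+ 2 ℕ.* m)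
ℕ-parity zero = inj₁ (0 , refl)
ℕ-parity (suc n) = step (ℕ-parity n)
  where
  step : (∃ λ m → n ≡ 2 ℕ.* m) ⊎ (∃ λ m → n ≡ 1 ℕ.+ 2 ℕ.* m) → (∃ λ m → suc n ≡ 2 ℕ.* m) ⊎ (∃ λ m → suc n ≡ 1 ℕ.+ 2 ℕ.* m)
  step (inj₁ (m , e)) = inj₂ (m , cong suc e)
  step (inj₂ (m , e)) = inj₁ (suc m , trans (cong suc e) (sym (ℕ.*-suc 2 m)))

-- The centre and three points beyond it lie in an interval of 2m + 1 points once m ≥ 3, that is,
-- from N = 7 on.
empty-odd : ∀ m → 3 ≤ m → BEmpty (suc (2 ℕ.* m))
empty-odd m 3≤m f (a≢0 , not-square , r , squares , symmetric) = contra (odd-length f r (+ m) 2m≢0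
    (subst (λ n → evalQ f r ≡ evalQ f (r + n)) (ℤ.pos-* 2 m) symmetric)
    (λ j j<4 → squares (m ℕ.+ j) (s≤s (inside j (ℕ.≤-trans (ℕ.≤-pred j<4) 3≤m)))))
  where
  inside : ∀ j → j ≤ m → m ℕ.+ j ≤ 2 ℕ.* m
  inside j j≤m = ℕ.≤-trans (ℕ.+-monoʳ-≤ m j≤m) (ℕ.≤-reflexive (cong (m ℕ.+_) (sym (ℕ.+-identityʳ m))))
  2m≢0 : + 2 * + m ≢ 0ℤ
  2m≢0 = *-≢0 {+ 2} {+ m} (λ ()) (λ z → ℕ.<⇒≢ (ℕ.<-≤-trans (s≤s z≤n) 3≤m) (sym (ℤ.+-injective z)))
  contra : Quad.a f ≡ 0ℤ ⊎ IsSquarePoly f → ⊥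
  contra (inj₁ z) = a≢0 z
  contra (inj₂ sq) = not-square sq

-- Five points beyond the centre lie in an interval of 2m + 2 points once m ≥ 4, that is, from N =
-- 10 on.
empty-even : ∀ m → 4 ≤ m → BEmpty (suc (1 ℕ.+ 2 ℕ.* m))
empty-even m 4≤m f (a≢0 , not-square , r , squares , symmetric) = contra (even-length f r (+ m) n≢0
    (subst (λ n → evalQ f r ≡ evalQ f (r + n)) n≡ symmetric)
    (λ j j<5 → squares (m ℕ.+ suc j) (s≤s (inside j (ℕ.≤-trans (ℕ.≤-pred j<5) 4≤m)))))
  where
  n≡ : + (1 ℕ.+ 2 ℕ.* m) ≡ 1ℤ + + 2 * + m
  n≡ = cong (λ x → 1ℤ + x) (ℤ.pos-* 2 m)
  n≢0 : 1ℤ + + 2 * + m ≢ 0ℤ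
  n≢0 = subst (_≢ 0ℤ) n≡ λ ()
  inside : ∀ j → j ≤ m → m ℕ.+ suc j ≤ 1 ℕ.+ 2 ℕ.* m
  inside j j≤m = ℕ.≤-trans (ℕ.≤-reflexive (ℕ.+-suc m j)) (s≤s (ℕ.≤-trans (ℕ.+-monoʳ-≤ m j≤m) (ℕ.≤-reflexive (cong (m ℕ.+_) (sym (ℕ.+-identityʳ m))))))
  contra : Quad.a f ≡ 0ℤ ⊎ IsSquarePoly f → ⊥
  contra (inj₁ z) = a≢0 z
  contra (inj₂ sq) = not-square sq

empty : ∀ N → N ≥ 9 → BEmpty N
empty zero ()
empty (suc n) (s≤s 8≤n) = by-parity (ℕ-parity n)
  where
  by-parity : (∃ λ m → n ≡ 2 ℕ.* m) ⊎ (∃ λ m → n ≡ 1 ℕ.+ 2 ℕ.* m) → BEmpty (suc n)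
  by-parity (inj₁ (m , refl)) = empty-odd m (ℕ.≤-trans (ℕ.n≤1+n 3) (ℕ.*-cancelˡ-≤ 2 8≤n))
  by-parity (inj₂ (m , refl)) = empty-even m (ℕ.*-cancelˡ-< 2 3 m (ℕ.≤-pred 8≤n))

infinite : ∀ N → 1 ≤ N → N ≤ 6 ⊎ N ≡ 8 → BInfinite N
infinite _ _ (inj₂ refl) = proj₂ (proj₂ (proj₂ infinite-8))
infinite 1 _ _ = proj₁ infinite-5
infinite 2 _ _ = proj₁ infinite-8
infinite 3 _ _ = proj₁ (proj₂ infinite-5)
infinite 4 _ _ = proj₁ (proj₂ infinite-8)
infinite 5 _ _ = proj₂ (proj₂ infinite-5)
infinite 6 _ _ = proj₁ (proj₂ (proj₂ infinite-8))
infinite (suc (suc (suc (suc (suc (suc (suc _))))))) _ (inj₁ (s≤s (s≤s (s≤s (s≤s (s≤s (s≤s ())))))))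

theorem1p1 : ∀ (N : ℕ) → 1 ≤ N →
    ((N ≤ 6 ⊎ N ≡ 8) → BInfinite N) × ((N ≡ 7 ⊎ N ≥ 9) → BEmpty N)
theorem1p1 N 1≤N = infinite N 1≤N , λ { (inj₁ refl) → empty-odd 3 ℕ.≤-refl ; (inj₂ N≥9) → empty N N≥9 }
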